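{- For every genus $g$ and degree $d\ge 1$, the twisted Hurwitz number of an elliptic curve equals its tropical counterpart: $\tilde{h}^{\mathrm{trop}}_{d,g}=\tilde{h}_{d,g}$.
   Context: Let $\tau=(1\ d{+}1)(2\ d{+}2)\cdots(d\ 2d)\in\mathbb{S}_{2d}$. Let $B_d=\{\sigma\in\mathbb{S}_{2d}:\sigma\tau\sigma^{ -1}=\tau\}$ and $C^\sim(\tau)=\{\sigma\in\mathbb{S}_{2d}:\tau\sigma\tau=\sigma^{ -1}\}$. Let $B^\sim_d\subset C^\sim(\tau)$ be the set of those $\sigma\in C^\sim(\tau)$ having no self-symmetric cycle, i.e. no cycle of $\sigma$ whose support is mapped to itself by $\tau$. Write $(2d)!!=2^d d!$. The twisted Hurwitz number $\tilde{h}_{d,g}$ is $\frac{1}{(2d)!!}$ times the number of tuples $(\sigma,\eta_1,\dots,\eta_{g-1},\alpha)\in(\mathbb{S}_{2d})^{g+1}$ such that: each $\eta_s=(i_s\ j_s)$ is a transposition with $j_s\neq\tau(i_s)$; $\sigma\in B^\sim_d$; $\alpha\in B_d$; $\eta_1\cdots\eta_{g-1}\,\sigma\,(\tau\eta_{g-1}\tau)\cdots(\tau\eta_1\tau)=\alpha\sigma\alpha^{ -1}$; and the subgroup generated by $\sigma,\eta_1,\dots,\eta_{g-1},\tau\eta_{g-1}\tau,\dots,\tau\eta_1\tau,\alpha$ acts transitively on $\{1,\dots,2d\}$. Tropical side. A tropical elliptic curve $E$ is an oriented metric circle of positive length with fixed distinct points $p_1,\dots,p_{g-1}\in E$ (branch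 points). A tropical cover $\pi\colon\Gamma\to E$ is a continuous surjective map from a finite connected metric graph $\Gamma$ (loops and multiple edges allowed; vertices map into $\{p_1,\dots,p_{g-1}\}$) such that each edge $e\cong[0,\ell(e)]$ is mapped by $t\mapsto\pi(\text{start of }e)+\omega(e)t$ along the oriented circle (edges may wind around $E$ several times), with positive integer weight $\omega(e)$, and at each vertex the sum of weights of adjacent edges mapping locally to the left equals the sum of weights of adjacent edges mapping locally to the right. The genus of $\Gamma$ is its first Betti number. A twisted tropical cover is such a $\pi$ together with an isometric involution $\iota$ of $\Gamma$ with $\pi\circ\iota=\pi$ such that: the vertices over each $p_i$ are either exactly two $3$-valent vertices or exactly one $4$-valent vertex; all edges adjacent to a $4$-valent vertex have the same weight; the fixed locus of $\iota$ is exactly the set of $4$-valent vertices. Its degree is half the sum of the weights of the edge points over any non-branch point of $E$ (counted with multiplicity). Two twisted covers are equivalent if there is an isometry of sources commuting with the maps to $E$ and with the involutions; $\mathrm{Aut}(\pi)$ is the group of isometries $f$ of $\Gamma$ with $\pi\circ f=\pi$ and $f\circ\iota=\iota\circ f$. The quotient graph $\Gamma/\iota$ has as vertices and edges the $\iota$-orbits of vertices and edges of $\Gamma$, an edge orbit carrying the weight of its members. The tropical twisted Hurwitz number $\tilde{h}^{\mathrm{trop}}_{d,g}$ is the sum over equivalence classes of twisted tropical covers $\pi\colon\Gamma\to E$ of degree $d$ with $\Gamma$ connected of genus $g$ of $$2^{g-1}\cdot\frac{1}{|\mathrm{Aut}(\pi)|}\cdot\prod_V(\omega_V-1)\prod_e\omega(e),$$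 where the first product runs over $4$-valent vertices $V$ of $\Gamma$ with $\omega_V$ the common weight of their adjacent edges, and the second over all edges $e$ of $\Gamma/\iota$.
   Formalization: The genus is restricted to g ≥ 2: for g = 1 there are no branch points, so no tropical cover as defined exists and the tropical number is 0, while the twisted Hurwitz number is positive (1/2 for d = 1); g = 0 is undefined. -}

module Defs where

open import Data.Nat using (ℕ; zero; suc; _+_; _*_; _∸_; _^_; _≤_; _<ᵇ_; _≡ᵇ_; _!)

open import Data.Integer using (+_)
open import Data.Rational using (ℚ; 0ℚ; _/_)
import Data.Rational as Q
open import Data.Fin using (Fin; zero; suc; toℕ; splitAt; join; _≟_)
open import Data.Vec using (Vec; lookup; tabulate)
open import Data.List using (List; []; _∷_; length; map; filter; head; allFin)
open import Data.List.Membership.Propositional using (_∈_)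
open import Data.List.Relation.Unary.Unique.Propositional using (Unique)
open import Data.Maybe using (fromMaybe)
open import Data.Bool using (Bool; true; false; if_then_else_)
open import Data.Sum using (_⊎_; inj₁; inj₂; swap)
open import Data.Product using (Σ; _×_; _,_; proj₁; proj₂; ∃; ∃-syntax; Σ-syntax)
open import Relation.Nullary using (¬_; does)
open import Relation.Nullary.Decidable using (_⊎-dec_)
open import Relation.Binary.PropositionalEquality using (_≡_; _≢_)
open import Function.Bundles using (_↔_; Inverse; _⇔_)

sumFin : ∀ {m} → (Fin m → ℕ) → ℕ
sumFin {zero}  f = 0
sumFin {suc m} f = f zero + sumFin (λ i → f (suc i))

prodFin : ∀ {m} → (Fin m → ℕ) → ℕ
prodFin {zero}  f = 1
prodFin {suc m} f = f zero * prodFin (λ i → f (suc i))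

[_]ᵇ : Bool → ℕ
[ true ]ᵇ  = 1
[ false ]ᵇ = 0

-- the rational number a / b (b is always nonzero where it is used;
-- the value at b = 0 is an irrelevant convention)
frac : ℕ → ℕ → ℚ
frac a zero    = 0ℚ
frac a (suc b) = (+ a) / suc b

sumℚ : List ℚ → ℚ
sumℚ []       = 0ℚ
sumℚ (x ∷ xs) = x Q.+ sumℚ xs

-- "xs lists exactly the elements satisfying P, without repetition";
-- then  length xs  is the cardinality of {x | P x}
IsListing : ∀ {A : Set} → (A → Set) → List A → Set
IsListing {A} P xs = Unique xs × (∀ (x : A) → (x ∈ xs) ⇔ P x)

IsPerm : ∀ {m} → Vec (Fin m) m → Set
IsPerm {m} p = ∀ (i j : Fin m) → lookup p i ≡ lookup p j → i ≡ j

-- Classical side.  The set {1,…,2d} is  Fin (d + d);  point i ∈ {1..d}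
-- is  i ↑ˡ d  and point d+i is  d ↑ʳ i.  Permutations are vectors,
-- and composition is function composition: (στ)(x) = σ(τ(x)).

Perm : ℕ → Set
Perm d = Vec (Fin (d + d)) (d + d)

-- τ = (1 d+1)(2 d+2)⋯(d 2d)
τ : ∀ d → Fin (d + d) → Fin (d + d)
τ d i = join d d (swap (splitAt d i))

transp : ∀ {m} → Fin m → Fin m → Fin m → Fin m
transp i j k = if does (k ≟ i) then j else (if does (k ≟ j) then i else k)

IsAdmTransp : ∀ d → Perm d → Set
IsAdmTransp d η = ∃[ i ] ∃[ j ] (i ≢ j × j ≢ τ d i × η ≡ tabulate (transp i j))

iter : ∀ {m} → Vec (Fin m) m → ℕ → Fin m → Fin m
iter p zero    x = x
iter p (suc k) x = lookup p (iter p k x)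

SameCycle : ∀ {m} → Vec (Fin m) m → Fin m → Fin m → Set
SameCycle p i j = ∃[ k ] iter p k i ≡ j

InB : ∀ d → Perm d → Set
InB d α = IsPerm α × (∀ i → lookup α (τ d i) ≡ τ d (lookup α i))

-- C~(τ) : τστ = σ⁻¹, i.e. (τστ)∘σ = id
InC~ : ∀ d → Perm d → Set
InC~ d σ = IsPerm σ × (∀ i → τ d (lookup σ (τ d (lookup σ i))) ≡ i)

InB~ : ∀ d → Perm d → Set
InB~ d σ = InC~ d σ ×
  (∀ i → ¬ (∀ j → SameCycle σ i j → SameCycle σ i (τ d j)))

applyL : ∀ d {k} → Vec (Perm d) k → Fin (d + d) → Fin (d + d)
applyL d Data.Vec.[] x = x
applyL d (η Data.Vec.∷ ηs) x = lookup η (applyL d ηs x)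

applyR : ∀ d {k} → Vec (Perm d) k → Fin (d + d) → Fin (d + d)
applyR d Data.Vec.[] x = x
applyR d (η Data.Vec.∷ ηs) x = applyR d ηs (τ d (lookup η (τ d x)))

data Orbit {m : ℕ} (gs : List (Fin m → Fin m)) (i : Fin m) : Fin m → Set where
  here : Orbit gs i i
  fwd  : ∀ {j} (h : Fin m → Fin m) → h ∈ gs → Orbit gs i j → Orbit gs i (h j)
  bwd  : ∀ {j} (h : Fin m → Fin m) → h ∈ gs → Orbit gs i (h j) → Orbit gs i j

Transitive : ∀ {m} → List (Fin m → Fin m) → Set
Transitive {m} gs = ∀ (i j : Fin m) → Orbit gs i j

vecToList : ∀ {A : Set} {k} → Vec A k → List A
vecToList Data.Vec.[] = []
vecToList (x Data.Vec.∷ xs) = x ∷ vecToList xs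

HurTuple : ℕ → ℕ → Set
HurTuple d g = Perm d × Vec (Perm d) (g ∸ 1) × Perm d

HurCond : ∀ d g → HurTuple d g → Set
HurCond d g (σ , ηs , α) =
  (∀ s → IsAdmTransp d (lookup ηs s)) ×
  InB~ d σ ×
  InB d α ×
  -- η₁⋯η_{g-1} σ (τη_{g-1}τ)⋯(τη₁τ) = ασα⁻¹, written as  LHS ∘ α = α ∘ σ
  (∀ i → applyL d ηs (lookup σ (applyR d ηs (lookup α i))) ≡ lookup α (lookup σ i)) ×
  Transitive (lookup σ ∷ lookup α
               ∷ (map lookup (vecToList ηs)
                  Data.List.++ map (λ η x → τ d (lookup η (τ d x))) (vecToList ηs)))

-- (2d)!! = 2^d d!
dfact : ℕ → ℕ
dfact d = 2 ^ d * d !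

-- h~_{d,g} = (number of admissible tuples) / (2d)!!, the number of
-- tuples being the length of any repetition-free listing of them
twistedHurwitz : ∀ d g → (H : List (HurTuple d g)) → ℚ
twistedHurwitz d g H = frac (length H) (dfact d)

-- Tropical side.  E has branch points p_0,…,p_{n-1} (n = g-1), indexed
-- by Fin n in their cyclic order along the oriented circle.  A (twisted)
-- tropical cover is encoded combinatorially: vertices Fin nV lying over
-- p_(pos v); edges Fin nE, edge e starts at src e, runs in the positive
-- direction of E with weight wt e, and ends at tgt e after winding
-- wind e full extra times around E (its image has length
-- dist⁺(p_(pos src), p_(pos tgt)) + wind·|E|, its length is that divided
-- by wt e).  ιV, ιE is the involution on vertices/edges.

record TCover (n : ℕ) : Set where
  field
    nV nE : ℕ
    pos   : Fin nV → Fin n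
    src   : Fin nE → Fin nV
    tgt   : Fin nE → Fin nV
    wt    : Fin nE → ℕ
    wind  : Fin nE → ℕ
    ιV    : Fin nV → Fin nV
    ιE    : Fin nE → Fin nE

module _ {n : ℕ} (c : TCover n) where
  open TCover c

  inW : Fin nV → ℕ
  inW v = sumFin (λ e → if does (tgt e ≟ v) then wt e else 0)

  outW : Fin nV → ℕ
  outW v = sumFin (λ e → if does (src e ≟ v) then wt e else 0)

  val : Fin nV → ℕ
  val v = sumFin (λ e → [ does (src e ≟ v) ]ᵇ) + sumFin (λ e → [ does (tgt e ≟ v) ]ᵇ)

  Adj : Fin nV → Fin nE → Set
  Adj v e = (src e ≡ v) ⊎ (tgt e ≡ v)

  ωV : Fin nV → ℕ
  ωV v = fromMaybe 0 (head (map wt (filter (λ e → (src e ≟ v) ⊎-dec (tgt e ≟ v)) (allFin nE))))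

  -- 2·degree: weighted number of preimages of a point of the arc
  -- (p_{n-1}, p_0) of E
  twiceDeg : ℕ
  twiceDeg = sumFin (λ e → wt e * (wind e + [ toℕ (pos (tgt e)) <ᵇ toℕ (pos (src e)) ]ᵇ))

  IsTropCover : Set
  IsTropCover =
    (∀ e → 1 ≤ wt e) ×
    (∀ e → pos (src e) ≡ pos (tgt e) → 1 ≤ wind e) ×   -- positive edge length
    (∀ v → inW v ≡ outW v)

  IsTwistedStructure : Set
  IsTwistedStructure =
    (∀ (i : Fin n) →
       (∃[ v ] (pos v ≡ i × val v ≡ 4 × (∀ w → pos w ≡ i → w ≡ v)))
     ⊎ (∃[ v ] ∃[ w ] (v ≢ w × pos v ≡ i × pos w ≡ i × val v ≡ 3 × val w ≡ 3
                        × (∀ u → pos u ≡ i → (u ≡ v) ⊎ (u ≡ w))))) ×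
    (∀ v → val v ≡ 4 → ∀ e e' → Adj v e → Adj v e' → wt e ≡ wt e') ×
    -- ι is an involutive isometry with π ∘ ι = π
    (∀ v → ιV (ιV v) ≡ v) ×
    (∀ e → ιE (ιE e) ≡ e) ×
    (∀ v → pos (ιV v) ≡ pos v) ×
    (∀ e → src (ιE e) ≡ ιV (src e)) ×
    (∀ e → tgt (ιE e) ≡ ιV (tgt e)) ×
    (∀ e → wt (ιE e) ≡ wt e) ×
    (∀ e → wind (ιE e) ≡ wind e) ×
    (∀ e → ιE e ≢ e) ×
    (∀ v → (ιV v ≡ v) ⇔ (val v ≡ 4))

  Connected : Set
  Connected = ∀ (S : Fin nV → Bool) → (∀ e → S (src e) ≡ S (tgt e)) → ∀ v w → S v ≡ S w

  -- first Betti number of the connected graph equals g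
  HasGenus : ℕ → Set
  HasGenus g = nE + 1 ≡ nV + g

  IsTwistedTropCover : ℕ → ℕ → Set
  IsTwistedTropCover d g =
    IsTropCover × IsTwistedStructure × twiceDeg ≡ 2 * d × Connected × HasGenus g

  AutData : Set
  AutData = Vec (Fin nV) nV × Vec (Fin nE) nE

  IsAut : AutData → Set
  IsAut (fV , fE) =
    IsPerm fV × IsPerm fE ×
    (∀ v → pos (lookup fV v) ≡ pos v) ×
    (∀ e → src (lookup fE e) ≡ lookup fV (src e)) ×
    (∀ e → tgt (lookup fE e) ≡ lookup fV (tgt e)) ×
    (∀ e → wt (lookup fE e) ≡ wt e) ×
    (∀ e → wind (lookup fE e) ≡ wind e) ×
    (∀ v → lookup fV (ιV v) ≡ ιV (lookup fV v)) ×
    (∀ e → lookup fE (ιE e) ≡ ιE (lookup fE e))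

  vertexFactor : ℕ
  vertexFactor = prodFin (λ v → if does (val v Data.Nat.≟ 4) then ωV v ∸ 1 else 1)

  -- Π ω(e) over the edges of Γ/ι (each orbit {e, ιe} represented by
  -- its member of smaller index)
  edgeFactor : ℕ
  edgeFactor = prodFin (λ e → if toℕ e <ᵇ toℕ (ιE e) then wt e else 1)

Equiv : ∀ {n} → TCover n → TCover n → Set
Equiv c c' =
  Σ[ fV ∈ Fin (TCover.nV c) ↔ Fin (TCover.nV c') ]
  Σ[ fE ∈ Fin (TCover.nE c) ↔ Fin (TCover.nE c') ]
  let φ = Inverse.to fV ; ψ = Inverse.to fE in
    (∀ v → TCover.pos c' (φ v) ≡ TCover.pos c v) ×
    (∀ e → TCover.src c' (ψ e) ≡ φ (TCover.src c e)) ×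
    (∀ e → TCover.tgt c' (ψ e) ≡ φ (TCover.tgt c e)) ×
    (∀ e → TCover.wt c' (ψ e) ≡ TCover.wt c e) ×
    (∀ e → TCover.wind c' (ψ e) ≡ TCover.wind c e) ×
    (∀ v → φ (TCover.ιV c v) ≡ TCover.ιV c' (φ v)) ×
    (∀ e → ψ (TCover.ιE c e) ≡ TCover.ιE c' (ψ e))

TropEntry : ℕ → Set
TropEntry n = Σ[ c ∈ TCover n ] List (AutData c)

IsRepSystem : ∀ d g → List (TropEntry (g ∸ 1)) → Set
IsRepSystem d g L =
  (∀ (k : Fin (length L)) → IsTwistedTropCover (proj₁ (Data.List.lookup L k)) d g) ×
  (∀ (k : Fin (length L)) →
     IsListing (IsAut (proj₁ (Data.List.lookup L k))) (proj₂ (Data.List.lookup L k))) ×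
  (∀ (k l : Fin (length L)) → k ≢ l →
     ¬ Equiv (proj₁ (Data.List.lookup L k)) (proj₁ (Data.List.lookup L l))) ×
  (∀ (c : TCover (g ∸ 1)) → IsTwistedTropCover c d g →
     ∃[ k ] Equiv c (proj₁ (Data.List.lookup L k)))

entryWeight : ∀ g → TropEntry (g ∸ 1) → ℚ
entryWeight g (c , auts) =
  frac (2 ^ (g ∸ 1) * vertexFactor c * edgeFactor c) (length auts)

tropTwistedHurwitz : ∀ g → List (TropEntry (g ∸ 1)) → ℚ
tropTwistedHurwitz g L = sumℚ (map (entryWeight g) L)

-- A twisted permutation σ without self-symmetric cycle is one for which σ τ is an involution without fixed
-- points, and its cycles come in mirror pairs.  Follow σ around the circle: crossing the branch
-- point p_i replaces T by η_i T (τ η_i τ), and the cycles of T between two branch points are the arcs of a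
-- cover.  A transposition either joins or cuts a cycle together with its mirror image (two 3-valent vertices)
-- or recombines a cycle with its own mirror image (a 4-valent vertex).  Fix a cover and count the tuples whose
-- cycles are labelled by its arcs: there are 2^d d! starting data including the final gluing α, and a branch
-- point contributes 2 times the product of the weights of the edges which start there, one edge from each
-- mirror pair, times ω - 1 at a 4-valent vertex of weight ω.
-- The automorphisms of the cover permute the labellings of a fixed tuple simply transitively, and every tuple
-- is labelled by a cover, unique up to equivalence; so each class contributes its weight.

module Submission where

open import Defs
open import Data.Bool using (Bool; true; false; if_then_else_)
open import Data.Empty using (⊥; ⊥-elim)
open import Data.Unit using (⊤; tt)
open import Data.Nat using (ℕ; zero; suc; _+_; _*_; _∸_; _^_; _≤_; _<_; _<ᵇ_; z≤n; s≤s; _!; _≤?_; _<?_; NonZero)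
open import Data.Nat renaming (_≟_ to _≟ℕ_) using ()
open import Data.Nat.Properties hiding (_≟_; _≤?_; _<?_; <-cmp)
open import Data.Nat.Properties using () renaming (<-cmp to <-cmpℕ)
open import Data.Nat.ListAction using (sum; product)
open import Data.Nat.ListAction.Properties using (sum-↭; product-↭)
open import Data.Fin using (Fin; zero; suc; toℕ; fromℕ; fromℕ<; inject₁; splitAt; join; _↑ˡ_; _↑ʳ_; _≟_)
import Data.Fin.Properties as F
open import Data.Vec using (Vec; []; _∷_) renaming (lookup to _!!_)
import Data.Vec as V
import Data.Vec.Properties as VP
open import Data.List using (List; []; _∷_; length; map; filter; head; allFin; _++_; concat; upTo)
import Data.List as L
import Data.List.Properties as LP
open import Data.List.Membership.Propositional using (_∈_)
open import Data.List.Membership.Propositional.Properties using (∈-map⁺; ∈-map⁻; ∈-++⁺ˡ; ∈-++⁺ʳ; ∈-++⁻; ∈-filter⁺; ∈-filter⁻; ∈-allFin; ∈-lookup; ∈-concat⁺′; ∈-concat⁻′; ∈-applyUpTo⁺; ∈-applyUpTo⁻)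
open import Data.List.Membership.Propositional.Properties.WithK using (unique∧set⇒bag)
open import Data.List.Relation.Binary.BagAndSetEquality using (∼bag⇒↭)
open import Data.List.Relation.Binary.Permutation.Propositional using (_↭_)
open import Data.List.Relation.Binary.Permutation.Propositional.Properties using (↭-length) renaming (map⁺ to ↭-map)
open import Data.List.Relation.Unary.All as All using (All; []; _∷_)
open import Data.List.Relation.Unary.Any as Any using (here; there)
open import Data.List.Relation.Unary.AllPairs using ([]; _∷_)
open import Data.List.Relation.Unary.Unique.Propositional using (Unique)
import Data.List.Relation.Unary.Unique.Propositional.Properties as U
open import Data.Maybe using (Maybe; just; nothing; fromMaybe)
import Data.Maybe
open import Data.Maybe.Properties using (just-injective)
open import Data.Sum using (_⊎_; inj₁; inj₂; [_,_]′; swap)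
open import Data.Product using (Σ; _×_; _,_; proj₁; proj₂; ∃; ∃-syntax; Σ-syntax)
open import Data.Product.Properties using () renaming (≡-dec to ×-≡-dec)
open import Function using (_∘_; id; case_of_; _⇔_; Equivalence; Inverse; mk⇔; mk↔ₛ′)
open import Relation.Nullary using (¬_; Dec; yes; no; does; contradiction)
open import Relation.Nullary.Decidable using (_⊎-dec_; _×-dec_; ¬?; dec-true; dec-false)
open import Relation.Binary.PropositionalEquality using (_≡_; _≢_; refl; sym; trans; cong; cong₂; subst; module ≡-Reasoning)
open import Relation.Binary.Definitions using (DecidableEquality; tri<; tri≈; tri>)
open import Data.Nat.Tactic.RingSolver using (solve-∀)

-- Listings and cardinalities

private variable
  𝔸 𝔹 : Set

Card : (𝔸 → Set) → ℕ → Set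
Card P n = ∃ λ xs → IsListing P xs × length xs ≡ n

∈⇒ : ∀ {P : 𝔸 → Set} {xs} → IsListing P xs → ∀ {x} → x ∈ xs → P x
∈⇒ (_ , e) {x} = Equivalence.to (e x)

⇒∈ : ∀ {P : 𝔸 → Set} {xs} → IsListing P xs → ∀ {x} → P x → x ∈ xs
⇒∈ (_ , e) {x} = Equivalence.from (e x)

listing-↭ : ∀ {P : 𝔸 → Set} {xs ys} → IsListing P xs → IsListing P ys → xs ↭ ys
listing-↭ lx ly = ∼bag⇒↭ (unique∧set⇒bag (proj₁ lx) (proj₁ ly)
  λ {_} → mk⇔ (⇒∈ ly ∘ ∈⇒ lx) (⇒∈ lx ∘ ∈⇒ ly))

card-unique : ∀ {P : 𝔸 → Set} {xs n} → IsListing P xs → Card P n → length xs ≡ n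
card-unique lx (ys , ly , refl) = ↭-length (listing-↭ lx ly)

card-≡ : ∀ {P : 𝔸 → Set} {m n} → Card P m → Card P n → m ≡ n
card-≡ (xs , lx , refl) c = card-unique lx c

card-subst : ∀ {P : 𝔸 → Set} {m n} → m ≡ n → Card P m → Card P n
card-subst refl c = c

card-⇔ : ∀ {P Q : 𝔸 → Set} {n} → (∀ {x} → P x → Q x) → (∀ {x} → Q x → P x) → Card P n → Card Q n
card-⇔ f g (xs , l , e) = xs , (proj₁ l , λ x → mk⇔ (f ∘ ∈⇒ l) (⇒∈ l ∘ g)) , e

unique-map : ∀ {f : 𝔸 → 𝔹} {xs} → (∀ {x y} → x ∈ xs → y ∈ xs → f x ≡ f y → x ≡ y) →
  Unique xs → Unique (map f xs)
unique-map {xs = []} _ [] = []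
unique-map {f = f} {xs = x ∷ xs} inj (x∉ ∷ u) =
  All.tabulate (λ y∈ eq → let (z , z∈ , y≡) = ∈-map⁻ f y∈ in
    All.lookup x∉ z∈ (inj (here refl) (there z∈) (trans eq y≡)))
  ∷ unique-map (λ a b → inj (there a) (there b)) u

listing-map : ∀ {P : 𝔸 → Set} {Q : 𝔹 → Set} {xs} (f : 𝔸 → 𝔹) → (∀ {x} → P x → Q (f x)) →
  (∀ {x y} → P x → P y → f x ≡ f y → x ≡ y) → (∀ {y} → Q y → ∃ λ x → P x × f x ≡ y) →
  IsListing P xs → IsListing Q (map f xs)
listing-map {Q = Q} f P⇒Q inj surj l =
  unique-map (λ a b → inj (∈⇒ l a) (∈⇒ l b)) (proj₁ l) ,
  λ y → mk⇔ (λ y∈ → let (x , x∈ , e) = ∈-map⁻ f y∈ in subst Q (sym e) (P⇒Q (∈⇒ l x∈)))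
            (λ q → let (x , p , e) = surj q in subst (_∈ _) e (∈-map⁺ f (⇒∈ l p)))

card-map : ∀ {P : 𝔸 → Set} {Q : 𝔹 → Set} {n} (f : 𝔸 → 𝔹) → (∀ {x} → P x → Q (f x)) →
  (∀ {x y} → P x → P y → f x ≡ f y → x ≡ y) → (∀ {y} → Q y → ∃ λ x → P x × f x ≡ y) →
  Card P n → Card Q n
card-map f a b c (xs , l , e) = map f xs , listing-map f a b c l , trans (LP.length-map f xs) e

card-⊎ : ∀ {P Q : 𝔸 → Set} {m n} → (∀ {x} → P x → Q x → ⊥) → Card P m → Card Q n →
  Card (λ x → P x ⊎ Q x) (m + n)
card-⊎ disj (xs , lx , refl) (ys , ly , refl) = xs ++ ys ,
  (U.++⁺ (proj₁ lx) (proj₁ ly) (λ (a , b) → disj (∈⇒ lx a) (∈⇒ ly b)) ,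
   λ z → mk⇔ (λ z∈ → case ∈-++⁻ xs z∈ of λ { (inj₁ a) → inj₁ (∈⇒ lx a) ; (inj₂ b) → inj₂ (∈⇒ ly b) })
             (λ { (inj₁ p) → ∈-++⁺ˡ (⇒∈ lx p) ; (inj₂ q) → ∈-++⁺ʳ xs (⇒∈ ly q) })) ,
  LP.length-++ xs

card-[] : ∀ {P : 𝔸 → Set} → (∀ {x} → ¬ P x) → Card P 0
card-[] n = [] , ([] , λ x → mk⇔ (λ ()) (λ p → ⊥-elim (n p))) , refl

card-1 : (a : 𝔸) → Card (_≡ a) 1
card-1 a = a ∷ [] , ([] ∷ [] , λ x → mk⇔ (λ { (here e) → e }) here) , refl

Σ-list : ∀ {P : 𝔸 → Set} {Q : 𝔸 → 𝔹 → Set} (w : 𝔸 → ℕ) (xs : List 𝔸) → IsListing P xs →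
  (∀ {a} → P a → Card (Q a) (w a)) →
  Card (λ (ab : 𝔸 × 𝔹) → P (proj₁ ab) × Q (proj₁ ab) (proj₂ ab)) (sum (map w xs))
Σ-list {P = P} {Q} w xs l h = card-⇔ (λ (a , b) → ∈⇒ l a , b) (λ (a , b) → ⇒∈ l a , b) (go xs (proj₁ l) (∈⇒ l))
  where
  go : ∀ ys → Unique ys → (∀ {y} → y ∈ ys → P y) →
    Card (λ ab → proj₁ ab ∈ ys × Q (proj₁ ab) (proj₂ ab)) (sum (map w ys))
  go [] _ _ = card-[] λ ()
  go (y ∷ ys) (y∉ ∷ u) p = card-⇔
    (λ { (inj₁ (refl , q)) → here refl , q ; (inj₂ (i , q)) → there i , q })
    (λ { (here refl , q) → inj₁ (refl , q) ; (there i , q) → inj₂ (i , q) })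
    (card-⊎ {P = λ ab → proj₁ ab ≡ y × Q (proj₁ ab) (proj₂ ab)} (λ { (refl , _) (i , _) → All.lookup y∉ i refl })
      (card-map (y ,_) (λ q → refl , q) (λ _ _ → λ { refl → refl })
        (λ { {_ , b} (refl , q) → b , q , refl }) (h (p (here refl))))
      (go ys u (p ∘ there)))

sum-const : ∀ (xs : List 𝔸) m → sum (map (λ _ → m) xs) ≡ length xs * m
sum-const [] m = refl
sum-const (x ∷ xs) m = cong (m +_) (sum-const xs m)

card-Σ : ∀ {P : 𝔸 → Set} {Q : 𝔸 → 𝔹 → Set} {n m} → Card P n → (∀ {a} → P a → Card (Q a) m) →
  Card (λ (ab : 𝔸 × 𝔹) → P (proj₁ ab) × Q (proj₁ ab) (proj₂ ab)) (n * m)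
card-Σ {m = m} (xs , l , refl) h = card-subst (sum-const xs m) (Σ-list (λ _ → m) xs l h)

card-Fin : ∀ n → Card {Fin n} (λ _ → ⊤) n
card-Fin n = allFin n , (U.allFin⁺ n , λ x → mk⇔ _ (λ _ → ∈-allFin x)) , LP.length-tabulate id

card-< : ∀ n → Card (_< n) n
card-< n = upTo n , (U.upTo⁺ n , λ x → mk⇔ (λ i → let (j , j< , e) = ∈-applyUpTo⁻ id i in subst (_< n) (sym e) j<)
  (∈-applyUpTo⁺ id)) , LP.length-applyUpTo id n

filter-listing : ∀ {P Q : 𝔸 → Set} {xs} (Q? : ∀ x → Dec (Q x)) → IsListing P xs →
  IsListing (λ x → P x × Q x) (filter Q? xs)
filter-listing Q? l = U.filter⁺ Q? (proj₁ l) , λ x → mk⇔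
  (λ i → let (a , b) = ∈-filter⁻ Q? i in ∈⇒ l a , b)
  (λ (p , q) → ∈-filter⁺ Q? (⇒∈ l p) q)

card-complement : ∀ {P : 𝔸 → Set} {Q : 𝔸 → Set} {n m} (Q? : ∀ x → Dec (Q x)) → Card P n → Card Q m →
  (∀ {x} → Q x → P x) → Card (λ x → P x × ¬ Q x) (n ∸ m)
card-complement {Q = Q} {m = m} Q? cP@(xs , l , refl) cQ Q⇒P = let r = filter (λ x → ¬? (Q? x)) xs in
  r , filter-listing (λ x → ¬? (Q? x)) l ,
  sym (trans (cong (_∸ m) (card-≡ cP (card-⇔ (λ { (inj₁ q) → Q⇒P q ; (inj₂ (p , _)) → p })
    (λ {x} p → case Q? x of λ { (yes q) → inj₁ q ; (no ¬q) → inj₂ (p , ¬q) })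
    (card-⊎ {P = Q} (λ q (_ , ¬q) → ¬q q) cQ (r , filter-listing (λ x → ¬? (Q? x)) l , refl))))) (m+n∸m≡n m _))

list₁ : ∀ {B : Set} {P : B → Set} {a : B} → P a → (∀ {x} → P x → x ≡ a) → IsListing P (a ∷ [])
list₁ pa all = [] ∷ [] , λ x → mk⇔ (λ { (here refl) → pa ; (there ()) }) (λ p → here (all p))

list₂ : ∀ {B : Set} {P : B → Set} {a b : B} → a ≢ b → P a → P b → (∀ {x} → P x → x ≡ a ⊎ x ≡ b) → IsListing P (a ∷ b ∷ [])
list₂ ne pa pb all = (ne ∷ []) ∷ [] ∷ [] , λ x → mk⇔ (λ { (here refl) → pa ; (there (here refl)) → pb })
  (λ p → [ here , there ∘ here ]′ (all p))

-- Sums and products over Fin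

fin-listing : ∀ {n} {P : Fin n → Set} (P? : ∀ x → Dec (P x)) → IsListing P (filter P? (allFin n))
fin-listing {n} P? = let (u , h) = filter-listing P? (proj₁ (proj₂ (card-Fin n))) in
  u , λ x → mk⇔ (proj₂ ∘ Equivalence.to (h x)) (λ p → Equivalence.from (h x) (tt , p))

private
  sum-tabulate : ∀ {n} {P : Fin n → Set} (P? : ∀ x → Dec (P x)) (w : Fin n → ℕ) m (g : Fin m → Fin n) →
    sumFin (λ e → if does (P? (g e)) then w (g e) else 0) ≡ sum (map w (filter P? (L.tabulate g)))
  sum-tabulate P? w zero g = refl
  sum-tabulate P? w (suc m) g with does (P? (g zero))
  ... | true  = cong (w (g zero) +_) (sum-tabulate P? w m (g ∘ suc))
  ... | false = sum-tabulate P? w m (g ∘ suc)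

  prod-tabulate : ∀ {n} {P : Fin n → Set} (P? : ∀ x → Dec (P x)) (w : Fin n → ℕ) m (g : Fin m → Fin n) →
    prodFin (λ e → if does (P? (g e)) then w (g e) else 1) ≡ product (map w (filter P? (L.tabulate g)))
  prod-tabulate P? w zero g = refl
  prod-tabulate P? w (suc m) g with does (P? (g zero))
  ... | true  = cong (w (g zero) *_) (prod-tabulate P? w m (g ∘ suc))
  ... | false = trans (+-identityʳ _) (prod-tabulate P? w m (g ∘ suc))

sumFin-list : ∀ {n} {P : Fin n → Set} (P? : ∀ x → Dec (P x)) (w : Fin n → ℕ) {xs} → IsListing P xs →
  sumFin (λ e → if does (P? e) then w e else 0) ≡ sum (map w xs)
sumFin-list P? w l = trans (sum-tabulate P? w _ id) (sum-↭ (↭-map w (listing-↭ (fin-listing P?) l)))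

prodFin-list : ∀ {n} {P : Fin n → Set} (P? : ∀ x → Dec (P x)) (w : Fin n → ℕ) {xs} → IsListing P xs →
  prodFin (λ e → if does (P? e) then w e else 1) ≡ product (map w xs)
prodFin-list P? w l = trans (prod-tabulate P? w _ id) (product-↭ (↭-map w (listing-↭ (fin-listing P?) l)))

sumFin-cong : ∀ {n} {f g : Fin n → ℕ} → (∀ i → f i ≡ g i) → sumFin f ≡ sumFin g
sumFin-cong {zero} h = refl
sumFin-cong {suc n} h = cong₂ _+_ (h zero) (sumFin-cong (h ∘ suc))

prodFin-cong : ∀ {n} {f g : Fin n → ℕ} → (∀ i → f i ≡ g i) → prodFin f ≡ prodFin g
prodFin-cong {zero} h = refl
prodFin-cong {suc n} h = cong₂ _*_ (h zero) (prodFin-cong (h ∘ suc))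

sumFin-count : ∀ {n} {P : Fin n → Set} (P? : ∀ x → Dec (P x)) {xs} → IsListing P xs →
  sumFin (λ e → [ does (P? e) ]ᵇ) ≡ length xs
sumFin-count P? {xs} l = trans (sumFin-cong λ e → lem (does (P? e)))
  (trans (sumFin-list P? (λ _ → 1) l) (trans (sum-const xs 1) (*-identityʳ _)))
  where
  lem : ∀ b → [ b ]ᵇ ≡ (if b then 1 else 0)
  lem true  = refl
  lem false = refl

-- Iteration of an injection of a finite set

least : ∀ {P : ℕ → Set} → (∀ k → Dec (P k)) → ∀ m → P m → ∃ λ k → P k × (∀ j → j < k → ¬ P j)
least {P} P? m pm = case go (suc m) of λ { (inj₁ r) → r ; (inj₂ n) → ⊥-elim (n m ≤-refl pm) }
  where
  go : ∀ b → (∃ λ k → P k × (∀ j → j < k → ¬ P j)) ⊎ (∀ j → j < b → ¬ P j)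
  go zero = inj₂ λ _ ()
  go (suc b) with go b
  ... | inj₁ r = inj₁ r
  ... | inj₂ n with P? b
  ... | yes p = inj₁ (b , p , n)
  ... | no ¬p = inj₂ λ j j<sb pj → case m≤n⇒m<n∨m≡n (≤-pred j<sb) of λ
    { (inj₁ j<b) → n j j<b pj ; (inj₂ refl) → ¬p pj }

module _ {N : ℕ} where

  it : (Fin N → Fin N) → ℕ → Fin N → Fin N
  it f zero x = x
  it f (suc k) x = f (it f k x)

  Inj : (Fin N → Fin N) → Set
  Inj f = ∀ {x y} → f x ≡ f y → x ≡ y

  Cyc : (Fin N → Fin N) → Fin N → Fin N → Set
  Cyc f x y = ∃ λ k → it f k x ≡ y

  Per : (Fin N → Fin N) → Fin N → ℕ → Set
  Per f x m = 1 ≤ m × it f m x ≡ x × (∀ k → 1 ≤ k → k < m → it f k x ≢ x)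

  opaque
    it-+ : ∀ f a b x → it f (a + b) x ≡ it f a (it f b x)
    it-+ f zero b x = refl
    it-+ f (suc a) b x = cong f (it-+ f a b x)

    it-∸ : ∀ f {a b} x → a ≤ b → it f (b ∸ a) (it f a x) ≡ it f b x
    it-∸ f {a} {b} x a≤b = trans (sym (it-+ f (b ∸ a) a x)) (cong (λ k → it f k x) (m∸n+n≡m a≤b))

    it-∸′ : ∀ f {a b} x → a ≤ b → it f a (it f (b ∸ a) x) ≡ it f b x
    it-∸′ f {a} {b} x a≤b = trans (sym (it-+ f a (b ∸ a) x)) (cong (λ k → it f k x) (m+[n∸m]≡n a≤b))

    it-suc′ : ∀ f k x → it f k (f x) ≡ it f (suc k) x
    it-suc′ f zero x = refl
    it-suc′ f (suc k) x = cong f (it-suc′ f k x)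

    it-inj : ∀ {f} → Inj f → ∀ k → Inj (it f k)
    it-inj i zero e = e
    it-inj i (suc k) e = it-inj i k (i e)

    it-cong : ∀ {f g} → (∀ x → f x ≡ g x) → ∀ k x → it f k x ≡ it g k x
    it-cong h zero x = refl
    it-cong {f} h (suc k) x = trans (cong f (it-cong h k x)) (h _)

    cyc-refl : ∀ {f x} → Cyc f x x
    cyc-refl = 0 , refl

    cyc-step : ∀ {f x} → Cyc f x (f x)
    cyc-step = 1 , refl

    cyc-trans : ∀ {f x y z} → Cyc f x y → Cyc f y z → Cyc f x z
    cyc-trans {f} {x} (k , refl) (l , e) = l + k , trans (it-+ f l k x) e

    cyc-cong : ∀ {f g} → (∀ x → f x ≡ g x) → ∀ {x y} → Cyc f x y → Cyc g x y
    cyc-cong h (k , e) = k , trans (sym (it-cong h k _)) e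

    per-cong : ∀ {f g} → (∀ x → f x ≡ g x) → ∀ {x m} → Per f x m → Per g x m
    per-cong h {x} {m} (a , b , c) = a , trans (sym (it-cong h m x)) b , λ k p q e → c k p q (trans (it-cong h k x) e)

    cyc-closed : ∀ {f x z} {D : Fin N → Set} → (∀ {w} → D w → D (f w)) → D x → Cyc f x z → D z
    cyc-closed {D = D} h d (zero , e) = subst D e d
    cyc-closed {D = D} h d (suc k , refl) = h (cyc-closed {D = D} h d (k , refl))

    per-inj : ∀ {f x m i j} → Inj f → Per f x m → i < m → j < m → it f i x ≡ it f j x → i ≡ j
    per-inj {f} {x} {m} {i} {j} inj (_ , _ , min) i<m j<m e with <-cmpℕ i j
    ... | tri≈ _ eq _ = eq
    ... | tri< i<j _ _ = ⊥-elim (min (j ∸ i) (m<n⇒0<n∸m i<j) (<-≤-trans (s≤s (m∸n≤m j i)) j<m)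
            (sym (it-inj inj i (trans e (sym (it-∸′ f x (<⇒≤ i<j)))))))
    ... | tri> _ _ j<i = ⊥-elim (min (i ∸ j) (m<n⇒0<n∸m j<i) (<-≤-trans (s≤s (m∸n≤m i j)) i<m)
            (sym (it-inj inj j (trans (sym e) (sym (it-∸′ f x (<⇒≤ j<i)))))))

    period : ∀ {f} → Inj f → ∀ x → ∃ (Per f x)
    period {f} inj x with F.pigeonhole (n<1+n N) (λ i → it f (toℕ i) x)
    ... | i , j , i<j , e with least {λ k → 1 ≤ k × it f k x ≡ x} (λ k → (1 ≤? k) ×-dec (it f k x ≟ x)) (toℕ j ∸ toℕ i)
          (m<n⇒0<n∸m i<j , sym (it-inj inj (toℕ i) (trans e (sym (it-∸′ f x (<⇒≤ i<j))))))
    ... | k , (1≤k , ek) , min = k , 1≤k , ek , λ l p q r → min l q (p , r)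

    reduce : ∀ {f x m} → Per f x m → ∀ k → ∃ λ r → r < m × it f k x ≡ it f r x
    reduce (1≤m , _) zero = 0 , 1≤m , refl
    reduce {f} {x} {m} p@(1≤m , em , _) (suc k) with reduce p k
    ... | r , r<m , e with m≤n⇒m<n∨m≡n r<m
    ... | inj₁ sr<m = suc r , sr<m , cong f e
    ... | inj₂ refl = 0 , 1≤m , trans (cong f e) em

    cyc-reduce : ∀ {f x m y} → Per f x m → Cyc f x y → ∃ λ r → r < m × it f r x ≡ y
    cyc-reduce p (k , e) = let (r , r< , e′) = reduce p k in r , r< , trans (sym e′) e

    cyc-dec : ∀ {f} → Inj f → ∀ x y → Dec (Cyc f x y)
    cyc-dec {f} inj x y with period inj x
    ... | m , p with F.any? {m} (λ r → it f (toℕ r) x ≟ y)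
    ... | yes (r , e) = yes (toℕ r , e)
    ... | no n = no λ c → let (r , r< , e) = cyc-reduce p c in
            n (fromℕ< r< , trans (cong (λ k → it f k x) (F.toℕ-fromℕ< r<)) e)

    cyc-sym : ∀ {f} → Inj f → ∀ {x y} → Cyc f x y → Cyc f y x
    cyc-sym {f} inj {x} c with period inj x
    ... | m , p@(_ , em , _) with cyc-reduce p c
    ... | r , r<m , refl = m ∸ r , trans (it-∸ f x (<⇒≤ r<m)) em

    per-step : ∀ {f x m} → Inj f → Per f x m → Per f (f x) m
    per-step {f} {x} {m} inj (a , b , c) = a , trans (it-suc′ f m x) (cong f b) ,
      λ k p q e → c k p q (inj (trans (sym (it-suc′ f k x)) e))

    per-cyc : ∀ {f x y m} → Inj f → Cyc f x y → Per f x m → Per f y m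
    per-cyc inj c p = cyc-closed {D = λ z → Per _ z _} (per-step inj) p c

    per-unique : ∀ {f x m n} → Per f x m → Per f x n → m ≡ n
    per-unique {m = m} {n} (a , b , c) (a′ , b′ , c′) with <-cmpℕ m n
    ... | tri≈ _ e _ = e
    ... | tri< l _ _ = ⊥-elim (c′ m a l b)
    ... | tri> _ _ l = ⊥-elim (c n a′ l b′)

    card-cyc : ∀ {f x m} → Inj f → Per f x m → Card (Cyc f x) m
    card-cyc {f} {x} inj p = card-map (λ k → it f k x) (λ {k} _ → k , refl) (λ a b → per-inj inj p a b)
      (cyc-reduce p) (card-< _)

  opaque

    sw : Fin N → Fin N → Fin N → Fin N
    sw = transp

    sw-≡ : ∀ x y z → sw x y z ≡ transp x y z
    sw-≡ x y z = refl

    transp-l : ∀ x y → sw x y x ≡ y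
    transp-l x y rewrite dec-true (x ≟ x) refl = refl

    transp-r : ∀ x y → sw x y y ≡ x
    transp-r x y with y ≟ x
    ... | yes e = e
    ... | no _ rewrite dec-true (y ≟ y) refl = refl

    transp-n : ∀ {x y z} → z ≢ x → z ≢ y → sw x y z ≡ z
    transp-n {x} {y} {z} a b rewrite dec-false (z ≟ x) a | dec-false (z ≟ y) b = refl

    transp-elim : (P : Fin N → Fin N → Set) → ∀ {x y} → P x y → P y x →
      (∀ {z} → z ≢ x → z ≢ y → P z z) → ∀ z → P z (sw x y z)
    transp-elim P {x} {y} a b c z with z ≟ x
    ... | yes refl = a
    ... | no p with z ≟ y
    ... | yes refl = b
    ... | no q = c p q

    transp-inv : ∀ x y z → sw x y (sw x y z) ≡ z
    transp-inv x y = transp-elim (λ z w → sw x y w ≡ z) (transp-r x y) (transp-l x y) transp-n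

    transp-sym : ∀ x y z → sw x y z ≡ sw y x z
    transp-sym x y = transp-elim (λ z w → w ≡ sw y x z) (sym (transp-r y x)) (sym (transp-l y x))
      (λ a b → sym (transp-n b a))

    inv⇒inj : ∀ {f : Fin N → Fin N} → (∀ z → f (f z) ≡ z) → Inj f
    inv⇒inj {f} h e = trans (sym (h _)) (trans (cong f e) (h _))

    transp-closed : ∀ {D : Fin N → Set} {x y z} → D x → D y → D z → D (sw x y z)
    transp-closed {D} a b = transp-elim (λ z w → D z → D w) (λ _ → b) (λ _ → a) (λ _ _ c → c) _

    transp-injective : ∀ {x y z w} → sw x y z ≡ sw x y w → z ≡ w
    transp-injective = inv⇒inj (transp-inv _ _)

  -- Multiplying a permutation by a transposition joins or cuts the cycles through the two points.

  module Surgery {f f′ : Fin N → Fin N} (inj : Inj f) {x y : Fin N} (x≢y : x ≢ y)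
    (h : ∀ {z} → Cyc f x z ⊎ Cyc f y z → f′ z ≡ sw x y (f z)) where

    D : Fin N → Set
    D z = Cyc f x z ⊎ Cyc f y z

    D-step : ∀ {z} → D z → D (f z)
    D-step (inj₁ c) = inj₁ (cyc-trans c cyc-step)
    D-step (inj₂ c) = inj₂ (cyc-trans c cyc-step)

    D-it : ∀ {z} → D z → ∀ k → D (it f k z)
    D-it d zero = d
    D-it d (suc k) = D-step (D-it d k)

    seg : ∀ {u} → D u → ∀ a → (∀ k → 1 ≤ k → k < a → it f k u ≢ x × it f k u ≢ y) →
      ∀ k → k < a → it f′ k u ≡ it f k u
    seg d a av zero _ = refl
    seg d a av (suc k) k<a = trans (cong f′ (seg d a av k (<-trans (n<1+n k) k<a)))
      (trans (h (D-it d k)) (let (p , q) = av (suc k) (s≤s z≤n) k<a in transp-n p q))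

    hop : ∀ {u} → D u → ∀ a → 1 ≤ a → (∀ k → 1 ≤ k → k < a → it f k u ≢ x × it f k u ≢ y) →
      it f′ a u ≡ sw x y (it f a u)
    hop d (suc a) _ av = trans (cong f′ (seg d (suc a) av a ≤-refl)) (h (D-it d a))

    module Join {m m′} (px : Per f x m) (py : Per f y m′) (ncyc : ¬ Cyc f x y) where

      private
        avx : ∀ k → 1 ≤ k → k < m → it f k x ≢ x × it f k x ≢ y
        avx k p q = proj₂ (proj₂ px) k p q , λ e → ncyc (k , e)
        avy : ∀ k → 1 ≤ k → k < m′ → it f k y ≢ x × it f k y ≢ y
        avy k p q = (λ e → ncyc (cyc-sym inj (k , e))) , proj₂ (proj₂ py) k p q
        hopx : it f′ m x ≡ y
        hopx = trans (hop (inj₁ cyc-refl) m (proj₁ px) avx) (trans (cong (sw x y) (proj₁ (proj₂ px))) (transp-l x y))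
        hopy : it f′ m′ y ≡ x
        hopy = trans (hop (inj₂ cyc-refl) m′ (proj₁ py) avy) (trans (cong (sw x y) (proj₁ (proj₂ py))) (transp-r x y))

      join-cyc : Cyc f′ x y
      join-cyc = m , hopx

      join-cover : ∀ {z} → D z → Cyc f′ x z
      join-cover (inj₁ c) = let (r , r< , e) = cyc-reduce px c in r , trans (seg (inj₁ cyc-refl) m avx r r<) e
      join-cover (inj₂ c) = let (r , r< , e) = cyc-reduce py c in
        cyc-trans join-cyc (r , trans (seg (inj₂ cyc-refl) m′ avy r r<) e)

      join-per : Per f′ x (m′ + m)
      join-per = ≤-trans (proj₁ px) (m≤n+m m m′) ,
        trans (it-+ f′ m′ m x) (trans (cong (it f′ m′) hopx) hopy) , min
        where
        min : ∀ k → 1 ≤ k → k < m′ + m → it f′ k x ≢ x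
        min k 1≤k k< e with k <? m
        ... | yes k<m = proj₂ (proj₂ px) k 1≤k k<m (trans (sym (seg (inj₁ cyc-refl) m avx k k<m)) e)
        ... | no k≮m = go (k ∸ m) (+-cancelʳ-< m (k ∸ m) m′ (subst (_< m′ + m) (sym (m∸n+n≡m m≤k)) k<))
              (trans (cong (it f′ (k ∸ m)) (sym hopx)) (trans (it-∸ f′ x m≤k) e))
          where
          m≤k = ≮⇒≥ k≮m
          go : ∀ j → j < m′ → it f′ j y ≢ x
          go j j< e = ncyc (cyc-sym inj (j , trans (sym (seg (inj₂ cyc-refl) m′ avy j j<)) e))

    module Cut {m a} (px : Per f x m) (1≤a : 1 ≤ a) (a<m : a < m) (ea : it f a x ≡ y) where

      private
        av : ∀ k → 1 ≤ k → k < a → it f k x ≢ x × it f k x ≢ y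
        av k p q = proj₂ (proj₂ px) k p (<-trans q a<m) ,
          λ e → <⇒≢ q (per-inj inj px (<-trans q a<m) a<m (trans e (sym ea)))

      cut-seg : ∀ k → k < a → it f′ k x ≡ it f k x
      cut-seg = seg (inj₁ cyc-refl) a av

      cut-perˡ : Per f′ x a
      cut-perˡ = 1≤a , trans (hop (inj₁ cyc-refl) a 1≤a av) (trans (cong (sw x y) ea) (transp-r x y)) ,
        λ k p q e → proj₁ (av k p q) (trans (sym (cut-seg k q)) e)

      cut-ncyc : ¬ Cyc f′ x y
      cut-ncyc c = let (r , r< , e) = cyc-reduce cut-perˡ c in
        <⇒≢ r< (per-inj inj px (<-trans r< a<m) a<m (trans (sym (cut-seg r r<)) (trans e (sym ea))))

  module FullCut {f f′ : Fin N → Fin N} (inj : Inj f) {x y : Fin N} (x≢y : x ≢ y)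
    (h : ∀ {z} → Cyc f x z ⊎ Cyc f y z → f′ z ≡ sw x y (f z))
    {m a} (px : Per f x m) (1≤a : 1 ≤ a) (a<m : a < m) (ea : it f a x ≡ y) where

    open Surgery inj x≢y h public
    open Cut px 1≤a a<m ea public

    private
      ey : it f (m ∸ a) y ≡ x
      ey = trans (cong (it f (m ∸ a)) (sym ea)) (trans (it-∸ f x (<⇒≤ a<m)) (proj₁ (proj₂ px)))
      h′ : ∀ {z} → Cyc f y z ⊎ Cyc f x z → f′ z ≡ sw y x (f z)
      h′ {z} c = trans (h (swap c)) (transp-sym x y (f z))
      module S = Surgery inj (x≢y ∘ sym) h′
      module C = S.Cut (per-cyc inj (a , ea) px) (m<n⇒0<n∸m a<m) (∸-monoʳ-< 1≤a (<⇒≤ a<m)) ey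

    cut-perʳ : Per f′ y (m ∸ a)
    cut-perʳ = C.cut-perˡ

    cut-cover : ∀ {z} → Cyc f x z → Cyc f′ x z ⊎ Cyc f′ y z
    cut-cover c with cyc-reduce px c
    ... | k , k<m , refl with k <? a
    ... | yes k<a = inj₁ (k , cut-seg k k<a)
    ... | no k≮a = inj₂ (k ∸ a , trans (C.cut-seg (k ∸ a) (∸-monoˡ-< k<m a≤k))
            (trans (cong (it f (k ∸ a)) (sym ea)) (it-∸ f x a≤k)))
      where a≤k = ≮⇒≥ k≮a

-- Orbits of finitely many functions

module _ {N : ℕ} where

  orbit-trans : ∀ {gs : List (Fin N → Fin N)} {p q r} → Orbit gs p q → Orbit gs q r → Orbit gs p r
  orbit-trans a here = a
  orbit-trans a (fwd h i b) = fwd h i (orbit-trans a b)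
  orbit-trans a (bwd h i b) = bwd h i (orbit-trans a b)

  cyc⇒orbit : ∀ {gs : List (Fin N → Fin N)} {f p q} → f ∈ gs → Cyc f p q → Orbit gs p q
  cyc⇒orbit {gs} {p = p} i = cyc-closed {D = Orbit gs p} (fwd _ i) here

  orbit-sym : ∀ {gs : List (Fin N → Fin N)} {p q} → Orbit gs p q → Orbit gs q p
  orbit-sym here = here
  orbit-sym (fwd h i o) = orbit-trans (bwd h i here) (orbit-sym o)
  orbit-sym (bwd h i o) = orbit-trans (fwd h i here) (orbit-sym o)

  orbit-inv : ∀ {gs : List (Fin N → Fin N)} {C : Set} (f : Fin N → C) → (∀ {h} → h ∈ gs → ∀ x → f (h x) ≡ f x) →
    ∀ {p q} → Orbit gs p q → f p ≡ f q
  orbit-inv f inv here = refl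
  orbit-inv f inv (fwd h i o) = trans (orbit-inv f inv o) (sym (inv i _))
  orbit-inv f inv (bwd h i o) = trans (orbit-inv f inv o) (inv i _)

  private
    Pairs = List (Fin N × Fin N)

    merge : ∀ (gs : List (Fin N → Fin N)) (ps : Pairs) → (∀ {xy} → xy ∈ ps → Orbit gs (proj₁ xy) (proj₂ xy)) →
      ∃ λ (f : Fin N → Fin N) → (∀ {xy} → xy ∈ ps → f (proj₁ xy) ≡ f (proj₂ xy)) × (∀ {z w} → f z ≡ f w → Orbit gs z w)
    merge gs [] _ = id , (λ ()) , λ { refl → here }
    merge gs ((x , y) ∷ ps) os with merge gs ps (os ∘ there)
    ... | f , inv , snd = f′ , (λ { (here refl) → trans (hit refl) (sym fy) ; (there i) → cong f″ (inv i) }) , snd′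
      where
      f″ : Fin N → Fin N
      f″ a = if does (a ≟ f x) then f y else a
      f′ : Fin N → Fin N
      f′ z = f″ (f z)
      hit : ∀ {z} → f z ≡ f x → f′ z ≡ f y
      hit {z} e rewrite dec-true (f z ≟ f x) e = refl
      miss : ∀ {z} → f z ≢ f x → f′ z ≡ f z
      miss {z} n rewrite dec-false (f z ≟ f x) n = refl
      fy : f′ y ≡ f y
      fy with f y ≟ f x
      ... | yes e = refl
      ... | no n = refl
      xy = os (here refl)
      snd′ : ∀ {z w} → f′ z ≡ f′ w → Orbit gs z w
      snd′ {z} {w} e = go (f z ≟ f x) (f w ≟ f x)
        where
        go : Dec (f z ≡ f x) → Dec (f w ≡ f x) → Orbit gs z w
        go (yes a) (yes b) = snd (trans a (sym b))
        go (yes a) (no b) = orbit-trans (snd a) (orbit-trans xy (snd (trans (sym (hit a)) (trans e (miss b)))))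
        go (no a) (yes b) = orbit-sym (orbit-trans (snd b) (orbit-trans xy (snd (trans (sym (hit b)) (trans (sym e) (miss a))))))
        go (no a) (no b) = snd (trans (sym (miss a)) (trans e (miss b)))

  colouring : ∀ (gs : List (Fin N → Fin N)) →
    ∃ λ (f : Fin N → Fin N) → (∀ {h} → h ∈ gs → ∀ x → f (h x) ≡ f x) × (∀ {z w} → f z ≡ f w → Orbit gs z w)
  colouring gs with merge gs (concat (map graph gs)) os
    where
    graph : (Fin N → Fin N) → Pairs
    graph h = map (λ x → x , h x) (allFin N)
    os : ∀ {xy} → xy ∈ concat (map graph gs) → Orbit gs (proj₁ xy) (proj₂ xy)
    os i with ∈-concat⁻′ (map graph gs) i
    ... | _ , i₁ , i₂ with ∈-map⁻ graph i₂
    ... | h , h∈ , refl with ∈-map⁻ (λ x → x , h x) i₁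
    ... | x , _ , refl = fwd h h∈ here
  ... | f , inv , snd = f , (λ {h} h∈ x → sym (inv (∈-concat⁺′ (∈-map⁺ (λ x → x , h x) (∈-allFin x)) (∈-map⁺ _ h∈)))) , snd

m+m-injective : ∀ {m n} → m + m ≡ n + n → m ≡ n
m+m-injective {m} {n} e with <-cmpℕ m n
... | tri≈ _ e _ = e
... | tri< l _ _ = ⊥-elim (<⇒≢ (+-mono-< l l) e)
... | tri> _ _ l = ⊥-elim (<⇒≢ (+-mono-< l l) (sym e))

-- Permutations inverted by the involution τ, and their conjugates η T (τ η τ)

module Twisted {N : ℕ} (τ : Fin N → Fin N) (ττ : ∀ z → τ (τ z) ≡ z) (τ≢ : ∀ z → τ z ≢ z) where

  -- Given the first two fields, the last one says that no cycle is self-symmetric: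
  -- T τ is an involution, and a self-symmetric cycle would produce a fixed point of τ or of T τ.
  record TwPerm (T : Fin N → Fin N) : Set where
    field
      inj : Inj T
      tw  : ∀ z → τ (T (τ (T z))) ≡ z
      nf  : ∀ z → T z ≢ τ z

    tw₁ : ∀ z → T (τ (T z)) ≡ τ z
    tw₁ z = trans (sym (ττ _)) (cong τ (tw z))

    it-τ : ∀ k z → it T k (τ (it T k z)) ≡ τ z
    it-τ zero z = refl
    it-τ (suc k) z = trans (sym (it-suc′ T k _)) (trans (cong (it T k) (tw₁ _)) (it-τ k z))

    cyc-τ : ∀ {z w} → Cyc T z w → Cyc T (τ z) (τ w)
    cyc-τ {z} (k , refl) = cyc-sym inj (k , it-τ k z)

    cyc-τ₁ : ∀ {z w} → Cyc T z (τ w) → Cyc T (τ z) w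
    cyc-τ₁ {z} {w} c = subst (Cyc T (τ z)) (ττ w) (cyc-τ c)

    per-τ : ∀ {z m} → Per T z m → Per T (τ z) m
    per-τ {z} {m} (a , b , c) = a , fix z m b , λ k p q e → c k p q
      (subst (λ w → it T k w ≡ w) (ττ z) (fix (τ z) k e))
      where
      fix : ∀ z m → it T m z ≡ z → it T m (τ z) ≡ τ z
      fix z m e = trans (cong (λ w → it T m (τ w)) (sym e)) (it-τ m z)

    no-self : ∀ {z} → ¬ Cyc T z (τ z)
    no-self {z} (k , e) = go k z e
      where
      go : ∀ k z → it T k z ≢ τ z
      go zero z e = τ≢ z (sym e)
      go (suc zero) z e = nf z e
      go (suc (suc k)) z e = go k (T z) (inj (trans (cong T (it-suc′ T k z)) (trans e (sym (tw₁ z)))))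

  conj : (Fin N → Fin N) → (Fin N → Fin N) → Fin N → Fin N
  conj η T z = η (T (τ (η (τ z))))

  conj-η : ∀ {η η′ T} → (∀ z → η z ≡ η′ z) → ∀ z → conj η T z ≡ conj η′ T z
  conj-η {η} {η′} {T} h z = trans (h (T (τ (η (τ z))))) (cong (η′ ∘ T ∘ τ) (h (τ z)))

  twPerm-conj : ∀ {η T} → (∀ z → η (η z) ≡ z) → TwPerm T → TwPerm (conj η T)
  twPerm-conj {η} {T} inv t = record
    { inj = λ e → inv⇒inj {f = τ} ττ (inv⇒inj {f = η} inv (inv⇒inj {f = τ} ττ (TwPerm.inj t (inv⇒inj {f = η} inv e))))
    ; tw = λ z → let w = τ (η (τ z)) in
        trans (cong (λ u → τ (η (T (τ (η u))))) (ττ _))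
        (trans (cong (λ u → τ (η (T (τ u)))) (inv _))
        (trans (cong (τ ∘ η) (TwPerm.tw₁ t w))
        (trans (cong (τ ∘ η) (ττ _)) (trans (cong τ (inv _)) (ττ z)))))
    ; nf = λ z e → TwPerm.nf t (τ (η (τ z))) (trans (sym (inv _)) (trans (cong η e) (sym (ττ _)))) }

  twPerm-cong : ∀ {T T′} → (∀ z → T z ≡ T′ z) → TwPerm T → TwPerm T′
  twPerm-cong {T} {T′} h t = record
    { inj = λ e → TwPerm.inj t (trans (h _) (trans e (sym (h _))))
    ; tw = λ z → trans (cong τ (trans (sym (h _)) (cong (T ∘ τ) (sym (h z))))) (TwPerm.tw t z)
    ; nf = λ z e → TwPerm.nf t z (trans (h z) e) }

module Surgeries {N : ℕ} (τ : Fin N → Fin N) (ττ : ∀ z → τ (τ z) ≡ z) (τ≢ : ∀ z → τ z ≢ z) where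

  open Twisted τ ττ τ≢

  module Local {T : Fin N → Fin N} (t : TwPerm T) {x y : Fin N} (x≢y : x ≢ y) (y≢τx : y ≢ τ x) where

    open TwPerm t

    η : Fin N → Fin N
    η = sw x y

    T⁺ : Fin N → Fin N
    T⁺ = conj η T

    t⁺ : TwPerm T⁺
    t⁺ = twPerm-conj {η} (transp-inv x y) t

    ητ-n : ∀ {z} → z ≢ τ x → z ≢ τ y → τ (η (τ z)) ≡ z
    ητ-n {z} a b = trans (cong τ (transp-n (λ e → a (trans (sym (ττ z)) (cong τ e)))
      (λ e → b (trans (sym (ττ z)) (cong τ e))))) (ττ z)

    far-eq : ∀ {z} → z ≢ τ x → z ≢ τ y → T⁺ z ≡ η (T z)
    far-eq a b = cong (η ∘ T) (ητ-n a b)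

    pass-eq : ∀ {z} → z ≢ τ x → z ≢ τ y → T z ≢ x → T z ≢ y → T⁺ z ≡ T z
    pass-eq a b c d = trans (far-eq a b) (transp-n c d)

    private
      h : ¬ Cyc T x (τ y) → ∀ {z} → Cyc T x z ⊎ Cyc T y z → T⁺ z ≡ sw x y (T z)
      h n c = far-eq (λ { refl → [ no-self , (λ d → n (cyc-sym inj (cyc-τ₁ d))) ]′ c })
                     (λ { refl → [ n , no-self ]′ c })

    module NearOne (c : Cyc T x y) where

      ncyc-τ : ¬ Cyc T x (τ y)
      ncyc-τ d = no-self (cyc-trans (cyc-sym inj c) d)

      m : ℕ
      m = proj₁ (period inj x)

      px : Per T x m
      px = proj₂ (period inj x)

      private r = cyc-reduce px c

      a : ℕ
      a = proj₁ r

      a<m : a < m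
      a<m = proj₁ (proj₂ r)

      ea : it T a x ≡ y
      ea = proj₂ (proj₂ r)

      1≤a : 1 ≤ a
      1≤a = n≢0⇒n>0 (λ e → x≢y (trans (cong (λ k → it T k x) (sym e)) ea))

      open FullCut inj x≢y (h ncyc-τ) px 1≤a a<m ea public

    module NearTwo (n : ¬ Cyc T x y) (nτ : ¬ Cyc T x (τ y)) where

      open Surgery inj x≢y (h nτ) public
      open Join (proj₂ (period inj x)) (proj₂ (period inj y)) n public

    -- T⁺ = (x y) T (τx τy): the first factor joins the cycle of x and its mirror image, the second cuts
    -- the result; the two halves are exchanged by τ, so they have equal length.
    module NearMirror (c : Cyc T x (τ y)) where

      n : ¬ Cyc T x y
      n d = no-self (cyc-trans (cyc-sym inj d) c)

      private
        m = proj₁ (period inj x)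
        px : Per T x m
        px = proj₂ (period inj x)
        py : Per T y m
        py = subst (λ z → Per T z m) (ττ y) (per-τ (per-cyc inj c px))
        f : Fin N → Fin N
        f z = η (T z)
        f-inj : Inj f
        f-inj e = inj (transp-injective e)
        module S = Surgery {f′ = f} inj x≢y (λ _ → refl)
        module J = S.Join px py n
        cx : ∀ {z} → S.D z → Cyc f x z
        cx = J.join-cover
        u = f (τ x)
        v = f (τ y)
        yτx : Cyc T y (τ x)
        yτx = cyc-sym inj (cyc-τ₁ c)
        u≢v : u ≢ v
        u≢v e = x≢y (inv⇒inj {f = τ} ττ (f-inj e))
        xu : Cyc f x u
        xu = cyc-trans (cx (inj₂ yτx)) cyc-step
        xv : Cyc f x v
        xv = cyc-trans (cx (inj₁ c)) cyc-step
        pu : Per f u (m + m)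
        pu = per-cyc f-inj xu J.join-per
        red = cyc-reduce pu (cyc-trans (cyc-sym f-inj xu) xv)
        a = proj₁ red
        h′ : ∀ {z} → Cyc f u z ⊎ Cyc f v z → T⁺ z ≡ sw u v (f z)
        h′ {z} _ = go z
          where
          go : ∀ z → f (τ (η (τ z))) ≡ sw u v (f z)
          go z with z ≟ τ x
          ... | yes refl = trans (cong f (trans (cong (τ ∘ η) (ττ x)) (cong τ (transp-l x y)))) (sym (transp-l u v))
          ... | no p with z ≟ τ y
          ... | yes refl = trans (cong f (trans (cong (τ ∘ η) (ττ y)) (cong τ (transp-r x y)))) (sym (transp-r u v))
          ... | no q = trans (cong f (ητ-n p q)) (sym (transp-n (p ∘ f-inj) (q ∘ f-inj)))
        1≤a : 1 ≤ a
        1≤a = n≢0⇒n>0 (λ e → u≢v (trans (cong (λ k → it f k u) (sym e)) (proj₂ (proj₂ red))))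
        module C = FullCut {f′ = T⁺} f-inj u≢v h′ pu 1≤a (proj₁ (proj₂ red)) (proj₂ (proj₂ red))
        cover : ∀ {z} → S.D z → Cyc T⁺ u z ⊎ Cyc T⁺ v z
        cover d = C.cut-cover (cyc-trans (cyc-sym f-inj xu) (cx d))
        inj⁺ = TwPerm.inj t⁺
        pair : ∀ {p q r} → Cyc T⁺ p q → Cyc T⁺ p r → Cyc T⁺ q r
        pair c d = cyc-trans (cyc-sym inj⁺ c) d
        half : ∀ {b c} → Per T⁺ x b → Per T⁺ (τ x) c → b + c ≡ m + m → b ≡ m
        half p q e with per-unique (TwPerm.per-τ t⁺ p) q
        ... | refl = m+m-injective e
        sum-a : a + (m + m ∸ a) ≡ m + m
        sum-a = m+[n∸m]≡n (<⇒≤ (proj₁ (proj₂ red)))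

      D : Fin N → Set
      D z = Cyc T x z ⊎ Cyc T (τ x) z

      private
        toS : ∀ {z} → D z → S.D z
        toS (inj₁ c) = inj₁ c
        toS (inj₂ d) = inj₂ (cyc-trans yτx d)
        ux = cover (inj₁ cyc-refl)
        uτx = cover (inj₂ yτx)

      mirror-cover : ∀ {z} → D z → Cyc T⁺ x z ⊎ Cyc T⁺ (τ x) z
      mirror-cover d = go ux uτx (cover (toS d))
        where
        go : ∀ {z} → Cyc T⁺ u x ⊎ Cyc T⁺ v x → Cyc T⁺ u (τ x) ⊎ Cyc T⁺ v (τ x) → Cyc T⁺ u z ⊎ Cyc T⁺ v z →
          Cyc T⁺ x z ⊎ Cyc T⁺ (τ x) z
        go (inj₁ p) (inj₁ q) _ = ⊥-elim (TwPerm.no-self t⁺ (pair p q))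
        go (inj₂ p) (inj₂ q) _ = ⊥-elim (TwPerm.no-self t⁺ (pair p q))
        go (inj₁ p) (inj₂ q) (inj₁ r) = inj₁ (pair p r)
        go (inj₁ p) (inj₂ q) (inj₂ r) = inj₂ (pair q r)
        go (inj₂ p) (inj₁ q) (inj₁ r) = inj₂ (pair q r)
        go (inj₂ p) (inj₁ q) (inj₂ r) = inj₁ (pair p r)

      mirror-per : ∀ {k} → Per T x k → Per T⁺ x k
      mirror-per {k} pk = subst (Per T⁺ x) (per-unique px pk) (go ux uτx)
        where
        go : Cyc T⁺ u x ⊎ Cyc T⁺ v x → Cyc T⁺ u (τ x) ⊎ Cyc T⁺ v (τ x) → Per T⁺ x m
        go (inj₁ p) (inj₁ q) = ⊥-elim (TwPerm.no-self t⁺ (pair p q))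
        go (inj₂ p) (inj₂ q) = ⊥-elim (TwPerm.no-self t⁺ (pair p q))
        go (inj₁ p) (inj₂ q) = let r = per-cyc inj⁺ p C.cut-perˡ in
          subst (Per T⁺ x) (half r (per-cyc inj⁺ q C.cut-perʳ) sum-a) r
        go (inj₂ p) (inj₁ q) = let r = per-cyc inj⁺ p C.cut-perʳ in
          subst (Per T⁺ x) (half r (per-cyc inj⁺ q C.cut-perˡ) (trans (+-comm _ a) sum-a)) r

record CutResult {N : ℕ} (T T⁺ : Fin N → Fin N) (x y : Fin N) : Set where
  field
    {m a} : ℕ
    px : Per T x m
    a<m : a < m
    ea : it T a x ≡ y
    cut-perˡ : Per T⁺ x a
    cut-perʳ : Per T⁺ y (m ∸ a)
    cut-cover : ∀ {z} → Cyc T x z → Cyc T⁺ x z ⊎ Cyc T⁺ y z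
    cut-ncyc : ¬ Cyc T⁺ x y

record JoinResult {N : ℕ} (T T⁺ : Fin N → Fin N) (x y : Fin N) : Set where
  field
    join-cover : ∀ {z} → Cyc T x z ⊎ Cyc T y z → Cyc T⁺ x z
    join-per : ∀ {m m′} → Per T x m → Per T y m′ → Per T⁺ x (m′ + m)

record MirrorResult {N : ℕ} (τ T T⁺ : Fin N → Fin N) (x : Fin N) : Set where
  field
    mirror-cover : ∀ {z} → Cyc T x z ⊎ Cyc T (τ x) z → Cyc T⁺ x z ⊎ Cyc T⁺ (τ x) z
    mirror-per : ∀ {k} → Per T x k → Per T⁺ x k

opaque
  near-one : ∀ {N τ ττ τ≢ T} {x y : Fin N} → Twisted.TwPerm τ ττ τ≢ T → x ≢ y → y ≢ τ x → Cyc T x y →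
    CutResult T (Twisted.conj τ ττ τ≢ (sw x y) T) x y
  near-one {τ = τ} {ττ} {τ≢} t x≢y y≢τx c = record { O }
    where module O = Surgeries.Local.NearOne τ ττ τ≢ t x≢y y≢τx c

  near-two : ∀ {N τ ττ τ≢ T} {x y : Fin N} → Twisted.TwPerm τ ττ τ≢ T → x ≢ y → y ≢ τ x → ¬ Cyc T x y → ¬ Cyc T x (τ y) →
    JoinResult T (Twisted.conj τ ττ τ≢ (sw x y) T) x y
  near-two {τ = τ} {ττ} {τ≢} {T} {x} {y} t x≢y y≢τx n nτ = record
    { join-cover = O.join-cover
    ; join-per = λ p q → subst (Per _ x) (cong₂ _+_ (per-unique (proj₂ (period inj y)) q) (per-unique (proj₂ (period inj x)) p)) O.join-per }
    where
    inj : Inj T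
    inj = Twisted.TwPerm.inj t
    module O = Surgeries.Local.NearTwo τ ττ τ≢ t x≢y y≢τx n nτ

  near-mirror : ∀ {N τ ττ τ≢ T} {x y : Fin N} → Twisted.TwPerm τ ττ τ≢ T → x ≢ y → y ≢ τ x → Cyc T x (τ y) →
    MirrorResult τ T (Twisted.conj τ ττ τ≢ (sw x y) T) x
  near-mirror {τ = τ} {ττ} {τ≢} t x≢y y≢τx c = record { mirror-cover = O.mirror-cover ; mirror-per = O.mirror-per }
    where module O = Surgeries.Local.NearMirror τ ττ τ≢ t x≢y y≢τx c

  pass-eq : ∀ {N τ ττ τ≢ T} {x y z : Fin N} → Twisted.TwPerm τ ττ τ≢ T → x ≢ y → y ≢ τ x →
    z ≢ τ x → z ≢ τ y → T z ≢ x → T z ≢ y → Twisted.conj τ ττ τ≢ (sw x y) T z ≡ T z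
  pass-eq {τ = τ} {ττ} {τ≢} t x≢y y≢τx = Surgeries.Local.pass-eq τ ττ τ≢ t x≢y y≢τx

-- Labelled permutations and branch points

module Labelled {N : ℕ} (τ : Fin N → Fin N) (ττ : ∀ z → τ (τ z) ≡ z) (τ≢ : ∀ z → τ z ≢ z)
  {A V : Set} (ι : A → A) (w : A → ℕ) where

  open Twisted τ ττ τ≢ public

  -- The labels in X are in bijection with the cycles of T.
  record State (X : A → Set) (T : Fin N → Fin N) (l : Fin N → A) : Set where
    field
      twp : TwPerm T
      l∈ : ∀ p → X (l p)
      l-T : ∀ p → l (T p) ≡ l p
      l-τ : ∀ p → l (τ p) ≡ ι (l p)
      l-cyc : ∀ {p q} → l p ≡ l q → Cyc T p q
      l-per : ∀ p → Per T p (w (l p))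
      l-onto : ∀ {a} → X a → ∃ λ p → l p ≡ a

    open TwPerm twp public

    cyc-l : ∀ {p q} → Cyc T p q → l p ≡ l q
    cyc-l {p} c = sym (cyc-closed {D = λ z → l z ≡ l p} (λ e → trans (l-T _) e) refl c)

    ι-≢ : ∀ p → ι (l p) ≢ l p
    ι-≢ p e = no-self (l-cyc (trans (sym e) (sym (l-τ p))))

    X-ι : ∀ {a} → X a → X (ι a)
    X-ι xa with l-onto xa
    ... | p , refl = subst X (l-τ p) (l∈ (τ p))

  state-cong : ∀ {X T T′ l l′} → (∀ p → T p ≡ T′ p) → (∀ p → l p ≡ l′ p) → State X T l → State X T′ l′
  state-cong {X} {T} {T′} {l} {l′} eT el s = record
    { twp = twPerm-cong eT S.twp
    ; l∈ = λ p → subst X (el p) (S.l∈ p)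
    ; l-T = λ p → trans (sym (trans (S.l-T′ p) (el (T′ p)))) (trans (S.l-T p) (el p))
    ; l-τ = λ p → trans (sym (el _)) (trans (S.l-τ p) (cong ι (el p)))
    ; l-cyc = λ {p} {q} e → cyc-cong eT (S.l-cyc (trans (el p) (trans e (sym (el q)))))
    ; l-per = λ p → per-cong eT (subst (λ a → Per T p (w a)) (el p) (S.l-per p))
    ; l-onto = λ xa → let (p , e) = S.l-onto xa in p , trans (sym (el p)) e }
    where
    module S where
      open State s public
      l-T′ : ∀ p → l (T p) ≡ l (T′ p)
      l-T′ p = cong l (eT p)

  -- A label crosses the branch point unchanged, or both labels are adjacent to the same vertex.
  Agree : (A → Maybe V) → A → (A → Maybe V) → A → Set
  Agree s a s′ a′ = (∃ λ u → s a ≡ just u × s′ a′ ≡ just u) ⊎ (s a ≡ nothing × s′ a′ ≡ nothing × a ≡ a′)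

  Adm : Vec (Fin N) N → Set
  Adm η = ∃[ i ] ∃[ j ] (i ≢ j × j ≢ τ i × η ≡ V.tabulate (sw i j))

  mirror : (Fin N → Fin N) → Fin N → Fin N
  mirror η z = τ (η (τ z))

  Link : (Fin N → Fin N) → (Fin N → Fin N) → Fin N → Fin N → Set
  Link T η = Orbit (T ∷ η ∷ mirror η ∷ [])

  -- Crossing a branch point from the state (T , l) on one side to the conjugate by η on the other side
  record Crossing (Nr Fr : A → Set) (sN sF : A → Maybe V) (T : Fin N → Fin N) (l : Fin N → A)
    (η : Vec (Fin N) N) (l⁺ : Vec A N) : Set where
    field
      adm : Adm η
      far : State Fr (conj (η !!_) T) (l⁺ !!_)
      step : ∀ p → Agree sF (l⁺ !! p) sN (l p)
      pres : ∀ p → Agree sN (l (η !! p)) sN (l p)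
      moved : ∀ {p u} → sN (l p) ≡ just u → ∃ λ q → Cyc T p q × (η !! q ≢ q ⊎ η !! τ q ≢ τ q)
      linked : ∀ {p q u} → sN (l p) ≡ just u → sN (l q) ≡ just u → Link T (η !!_) p q

-- One side (near) and the other side (far) of a branch point
record Setting : Set₁ where
  field
    {A V} : Set
    ι : A → A
    w : A → ℕ
    _≟V_ : DecidableEquality V
    ιι : ∀ a → ι (ι a) ≡ a
    ιV : V → V
    ιVιV : ∀ v → ιV (ιV v) ≡ v
    Nr Fr : A → Set
    sN sF : A → Maybe V
    pass→ : ∀ {a} → Nr a → sN a ≡ nothing → Fr a × sF a ≡ nothing
    pass← : ∀ {a} → Fr a → sF a ≡ nothing → Nr a × sN a ≡ nothing
    sN-ι : ∀ a → sN (ι a) ≡ Data.Maybe.map ιV (sN a)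
    sF-ι : ∀ a → sF (ι a) ≡ Data.Maybe.map ιV (sF a)
    Fr-ι : ∀ {a} → Fr a → Fr (ι a)
    w-ι : ∀ a → w (ι a) ≡ w a
    1≤w : ∀ {a} → Nr a → 1 ≤ w a
    1≤wF : ∀ {a} → Fr a → 1 ≤ w a

module Branch {N : ℕ} (τ : Fin N → Fin N) (ττ : ∀ z → τ (τ z) ≡ z) (τ≢ : ∀ z → τ z ≢ z) (Z : Setting)
    {T : Fin N → Fin N} {l : Fin N → Setting.A Z}
    (st : Labelled.State τ ττ τ≢ {Setting.A Z} {Setting.V Z} (Setting.ι Z) (Setting.w Z) (Setting.Nr Z) T l) where

    open Setting Z
    open Labelled τ ττ τ≢ {A} {V} ι w

    open State st

    Valid : Vec (Fin N) N × Vec A N → Set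
    Valid (η , l⁺) = Crossing Nr Fr sN sF T l η l⁺

    vx : Fin N → Maybe V
    vx p = sN (l p)

    vx-T : ∀ p → vx (T p) ≡ vx p
    vx-T p = cong sN (l-T p)

    vx-τ : ∀ p → vx (τ p) ≡ Data.Maybe.map ιV (vx p)
    vx-τ p = trans (cong sN (l-τ p)) (sN-ι (l p))

    vx-τj : ∀ {p u} → vx p ≡ just u → vx (τ p) ≡ just (ιV u)
    vx-τj {p} e = trans (vx-τ p) (cong (Data.Maybe.map ιV) e)

    vx-τn : ∀ {p} → vx p ≡ nothing → vx (τ p) ≡ nothing
    vx-τn {p} e = trans (vx-τ p) (cong (Data.Maybe.map ιV) e)

    just≢nothing : ∀ {m : Maybe V} {u} → m ≡ just u → m ≡ nothing → ⊥
    just≢nothing refl ()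

    record Pair (u : V) : Set where
      field
        {x y} : Fin N
        x≢y : x ≢ y
        y≢τx : y ≢ τ x
        ux : vx x ≡ just u
        uy : vx y ≡ just u

    module Assemble {u : V} (D : Pair u) where

      open Pair D

      η : Fin N → Fin N
      η = sw x y

      T⁺ : Fin N → Fin N
      T⁺ = conj η T

      t⁺ : TwPerm T⁺
      t⁺ = twPerm-conj {η} (transp-inv x y) twp

      vx-η : ∀ p → vx (η p) ≡ vx p
      vx-η = transp-elim (λ z z′ → vx z′ ≡ vx z) (trans uy (sym ux)) (trans ux (sym uy)) (λ _ _ → refl)

      vx-mirror : ∀ p → vx (τ (η (τ p))) ≡ vx p
      vx-mirror p = trans (vx-τ _) (trans (cong (Data.Maybe.map ιV) (vx-η (τ p))) (trans (sym (vx-τ (τ p))) (cong vx (ττ p))))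

      vx-T⁺ : ∀ p → vx (T⁺ p) ≡ vx p
      vx-T⁺ p = trans (vx-η _) (trans (vx-T _) (vx-mirror p))

      T⁺-pass : ∀ {p} → vx p ≡ nothing → T⁺ p ≡ T p
      T⁺-pass {p} e = pass-eq twp x≢y y≢τx (λ { refl → just≢nothing (vx-τj ux) e }) (λ { refl → just≢nothing (vx-τj uy) e })
        (λ e′ → just≢nothing ux (trans (cong vx (sym e′)) (trans (vx-T p) e)))
        (λ e′ → just≢nothing uy (trans (cong vx (sym e′)) (trans (vx-T p) e)))

      it-pass : ∀ {p} → vx p ≡ nothing → ∀ k → it T⁺ k p ≡ it T k p × vx (it T k p) ≡ nothing
      it-pass e zero = refl , e
      it-pass e (suc k) = let (a , b) = it-pass e k in
        trans (cong T⁺ a) (T⁺-pass b) , trans (vx-T _) b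

      η-pres : ∀ p → Agree sN (l (η p)) sN (l p)
      η-pres = transp-elim (λ z z′ → Agree sN (l z′) sN (l z)) (inj₁ (u , uy , ux)) (inj₁ (u , ux , uy)) λ {z} _ _ → go z
        where
        go : ∀ z → Agree sN (l z) sN (l z)
        go z with sN (l z)
        ... | just u = inj₁ (u , refl , refl)
        ... | nothing = inj₂ (refl , refl , refl)

      record Relabelling (l⁺ : Fin N → A) : Set where
        field
          onPass : ∀ {p} → vx p ≡ nothing → l⁺ p ≡ l p
          onV : ∀ {p v} → vx p ≡ just v → Fr (l⁺ p) × sF (l⁺ p) ≡ just v × l⁺ (T⁺ p) ≡ l⁺ p × l⁺ (τ p) ≡ ι (l⁺ p) × Per T⁺ p (w (l⁺ p))
          inV : ∀ {p q v} → vx p ≡ just v → vx q ≡ just v → l⁺ p ≡ l⁺ q → Cyc T⁺ p q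
          ontoV : ∀ {a v} → Fr a → sF a ≡ just v → ∃ λ p → l⁺ p ≡ a
          movedV : ∀ {p v} → vx p ≡ just v → ∃ λ q → Cyc T p q × (η q ≢ q ⊎ η (τ q) ≢ τ q)
          linkedV : ∀ {p q v} → vx p ≡ just v → vx q ≡ just v → Link T η p q

      module _ {l⁺ : Fin N → A} (R : Relabelling l⁺) where
        open Relabelling R

        private
          agree : ∀ p → Agree sF (l⁺ p) sN (l p)
          agree p with sN (l p) in e
          ... | just v = inj₁ (v , proj₁ (proj₂ (onV e)) , refl)
          ... | nothing = inj₂ (subst (λ a → sF a ≡ nothing) (sym (onPass e)) (proj₂ (pass→ (l∈ p) e)) , refl , onPass e)

        relabel-state : State Fr T⁺ l⁺
        relabel-state = record
          { twp = t⁺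
          ; l∈ = λ p → by p (λ e → subst Fr (sym (onPass e)) (proj₁ (pass→ (l∈ p) e))) (λ _ e → proj₁ (onV e))
          ; l-T = λ p → by p (λ e → trans (onPass (trans (vx-T⁺ p) e)) (trans (cong l (T⁺-pass e)) (trans (l-T p) (sym (onPass e)))))
                             (λ _ e → proj₁ (proj₂ (proj₂ (onV e))))
          ; l-τ = λ p → by p (λ e → trans (onPass (vx-τn e)) (trans (l-τ p) (cong ι (sym (onPass e)))))
                             (λ _ e → proj₁ (proj₂ (proj₂ (proj₂ (onV e)))))
          ; l-cyc = cyc
          ; l-per = λ p → by p per (λ _ e → proj₂ (proj₂ (proj₂ (proj₂ (onV e)))))
          ; l-onto = onto }
          where
          by : ∀ p {C : Set} → (vx p ≡ nothing → C) → (∀ v → vx p ≡ just v → C) → C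
          by p a b with vx p in e
          ... | nothing = a refl
          ... | just v = b v refl
          cyc : ∀ {p q} → l⁺ p ≡ l⁺ q → Cyc T⁺ p q
          cyc {p} {q} e with agree p | agree q
          ... | inj₁ (u , a , b) | inj₁ (u′ , a′ , b′) =
            inV b (trans b′ (trans (sym a′) (trans (cong sF (sym e)) a))) e
          ... | inj₁ (u , a , b) | inj₂ (a′ , b′ , c′) = ⊥-elim (just≢nothing a (trans (cong sF e) a′))
          ... | inj₂ (a , b , c) | inj₁ (u , a′ , b′) = ⊥-elim (just≢nothing a′ (trans (cong sF (sym e)) a))
          ... | inj₂ (a , b , c) | inj₂ (a′ , b′ , c′) =
            let (k , ek) = l-cyc (trans (sym c) (trans e c′)) in k , trans (proj₁ (it-pass b k)) ek
          per : ∀ {p} → vx p ≡ nothing → Per T⁺ p (w (l⁺ p))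
          per {p} e with l-per p
          ... | a , b , c rewrite onPass e = a , trans (proj₁ (it-pass e (w (l p)))) b , λ k i j e′ → c k i j (trans (sym (proj₁ (it-pass e k))) e′)
          onto : ∀ {a} → Fr a → ∃ λ p → l⁺ p ≡ a
          onto {a} fa with sF a in e
          ... | just v = ontoV fa e
          ... | nothing with l-onto (proj₁ (pass← fa e)) | proj₂ (pass← fa e)
          ... | p , refl | n = p , onPass n

        relabel-valid : Valid (V.tabulate η , V.tabulate l⁺)
        relabel-valid = record
          { adm = x , y , x≢y , y≢τx , refl
          ; far = state-cong (λ p → sym (trans (ηη _) (cong (η ∘ T ∘ τ) (ηη _)))) (λ p → sym (ll p)) relabel-state
          ; step = λ p → subst (λ a → Agree sF a sN (l p)) (sym (ll p)) (agree p)
          ; pres = λ p → subst (λ q → Agree sN (l q) sN (l p)) (sym (ηη p)) (η-pres p)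
          ; moved = λ e → let (q , c , m) = movedV e in q , c ,
              [ (λ n → inj₁ (n ∘ trans (sym (ηη q)))) , (λ n → inj₂ (n ∘ trans (sym (ηη (τ q))))) ]′ m
          ; linked = λ e e′ → relink (linkedV e e′) }
          where
          ηη = VP.lookup∘tabulate η
          ll = VP.lookup∘tabulate l⁺
          relink : ∀ {p q} → Link T η p q → Link T (V.tabulate η !!_) p q
          relink here = here
          relink (fwd _ (here refl) o) = fwd _ (here refl) (relink o)
          relink (fwd _ (there (here refl)) o) = subst (Orbit _ _) (ηη _) (fwd _ (there (here refl)) (relink o))
          relink (fwd _ (there (there (here refl))) o) = subst (Orbit _ _) (cong τ (ηη _)) (fwd _ (there (there (here refl))) (relink o))
          relink (bwd _ (here refl) o) = bwd _ (here refl) (relink o)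
          relink (bwd _ (there (here refl)) o) = bwd _ (there (here refl)) (subst (Orbit _ _) (sym (ηη _)) (relink o))
          relink (bwd _ (there (there (here refl))) o) = bwd _ (there (there (here refl))) (subst (Orbit _ _) (cong τ (sym (ηη _))) (relink o))

    card-label : ∀ {a} → Nr a → Card (λ z → l z ≡ a) (w a)
    card-label na with l-onto na
    ... | p , refl = card-⇔ (λ c → sym (cyc-l c)) (λ e → l-cyc (sym e)) (card-cyc inj (l-per p))

    conj-inj : ∀ x y → Inj (conj (sw x y) T)
    conj-inj x y = TwPerm.inj (twPerm-conj {sw x y} (transp-inv x y) twp)

    choose : Fin N → Fin N → A → A → Fin N → A
    choose x y a b p = if does (cyc-dec (conj-inj x y) x p) then a else b

    choose-yes : ∀ {x y a b p} → Cyc (conj (sw x y) T) x p → choose x y a b p ≡ a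
    choose-yes {x} {y} {p = p} c rewrite dec-true (cyc-dec (conj-inj x y) x p) c = refl

    choose-no : ∀ {x y a b p} → ¬ Cyc (conj (sw x y) T) x p → choose x y a b p ≡ b
    choose-no {x} {y} {p = p} c rewrite dec-false (cyc-dec (conj-inj x y) x p) c = refl

    pure-step : ∀ {p} (l⁺ : Vec A N) → Agree sF (l⁺ !! p) sN (l p) → vx p ≡ nothing → l⁺ !! p ≡ l p
    pure-step l⁺ (inj₁ (_ , _ , a)) e = ⊥-elim (just≢nothing a e)
    pure-step l⁺ (inj₂ (_ , _ , a)) e = a

    -- A transposition inside a cycle that crosses unchanged would cut it.
    module Inspect {η : Vec (Fin N) N} {l⁺ : Vec A N} (V : Valid (η , l⁺)) where
      module C = Crossing V

      X Y : Fin N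
      X = proj₁ C.adm
      Y = proj₁ (proj₂ C.adm)

      X≢Y : X ≢ Y
      X≢Y = proj₁ (proj₂ (proj₂ C.adm))

      Y≢τX : Y ≢ τ X
      Y≢τX = proj₁ (proj₂ (proj₂ (proj₂ C.adm)))

      η≡ : η ≡ V.tabulate (sw X Y)
      η≡ = proj₂ (proj₂ (proj₂ (proj₂ C.adm)))

      ηf : ∀ z → η !! z ≡ sw X Y z
      ηf z = trans (cong (_!! z) η≡) (VP.lookup∘tabulate (sw X Y) z)

      far′ : State Fr (conj (sw X Y) T) (l⁺ !!_)
      far′ = state-cong (conj-η {T = T} ηf) (λ _ → refl) C.far

      cut : Cyc T X Y → ¬ Cyc (conj (sw X Y) T) X Y
      cut c = CutResult.cut-ncyc (near-one twp X≢Y Y≢τX c)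

      vertex : ∃ λ u → vx X ≡ just u × vx Y ≡ just u
      vertex with subst (λ q → Agree sN (l q) sN (l X)) (trans (ηf X) (transp-l X Y)) (C.pres X)
      ... | inj₁ (u , a , b) = u , b , a
      ... | inj₂ (a , b , c) = ⊥-elim (cut (l-cyc (sym c)) (State.l-cyc far′
              (trans (pure-step l⁺ (C.step X) b) (trans (sym c) (sym (pure-step l⁺ (C.step Y) a))))))

      only-moved : ∀ {z} → η !! z ≢ z → z ≡ X ⊎ z ≡ Y
      only-moved {z} n with z ≟ X
      ... | yes e = inj₁ e
      ... | no p with z ≟ Y
      ... | yes e = inj₂ e
      ... | no q = ⊥-elim (n (trans (ηf z) (transp-n p q)))

      step-v : ∀ {p u} → vx p ≡ just u → Fr (l⁺ !! p) × sF (l⁺ !! p) ≡ just u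
      step-v {p} e with C.step p
      ... | inj₁ (u , a , b) = State.l∈ far′ p , trans a (trans (sym b) e)
      ... | inj₂ (a , b , c) = ⊥-elim (just≢nothing e b)

    moved-vertex : ∀ {η l⁺} → Valid (η , l⁺) → ∀ {q} → η !! q ≢ q → ∃ λ u → vx q ≡ just u
    moved-vertex V n with Inspect.only-moved V n | Inspect.vertex V
    ... | inj₁ refl | u , a , b = u , a
    ... | inj₂ refl | u , a , b = u , b

    MovesAt : V → Vec (Fin N) N → Set
    MovesAt v η = ∃ λ x → vx x ≡ just v × η !! x ≢ x

    tabulate-≡ : ∀ {B : Set} (xs : Vec B N) (f : Fin N → B) → (∀ i → xs !! i ≡ f i) → xs ≡ V.tabulate f
    tabulate-≡ xs f h = trans (sym (VP.tabulate∘lookup xs)) (VP.tabulate-cong h)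

    transp-moved : ∀ {x y x′ y′ : Fin N} → x′ ≢ y′ → V.tabulate (sw x y) ≡ V.tabulate (sw x′ y′) → x′ ≡ x ⊎ x′ ≡ y
    transp-moved {x} {y} {x′} {y′} n e with x′ ≟ x
    ... | yes q = inj₁ q
    ... | no p with x′ ≟ y
    ... | yes q = inj₂ q
    ... | no q = ⊥-elim (n (sym (trans (sym (transp-l x′ y′)) (trans (sym (VP.lookup∘tabulate (sw x′ y′) x′))
            (trans (cong (_!! x′) (sym e)) (trans (VP.lookup∘tabulate (sw x y) x′) (transp-n p q)))))))

    transp-τ-link : ∀ {η : Fin N → Fin N} {p q} → Link T η p q → Link T η (τ p) (τ q)
    transp-τ-link here = here
    transp-τ-link (fwd _ (here refl) o) = bwd _ (here refl) (subst (Orbit _ _) (sym (tw₁ _)) (transp-τ-link o))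
    transp-τ-link {η} (fwd _ (there (here refl)) o) = subst (Orbit _ _) (cong (τ ∘ η) (ττ _)) (fwd _ (there (there (here refl))) (transp-τ-link o))
    transp-τ-link {η} (fwd _ (there (there (here refl))) o) = subst (Orbit _ _) (sym (ττ _)) (fwd _ (there (here refl)) (transp-τ-link o))
    transp-τ-link (bwd _ (here refl) o) = subst (Orbit _ _) (tw₁ _) (fwd _ (here refl) (transp-τ-link o))
    transp-τ-link {η} (bwd _ (there (here refl)) o) = bwd _ (there (there (here refl))) (subst (Orbit _ _) (sym (cong (τ ∘ η) (ττ _))) (transp-τ-link o))
    transp-τ-link {η} (bwd _ (there (there (here refl))) o) = bwd _ (there (here refl)) (subst (Orbit _ _) (ττ _) (transp-τ-link o))

    -- At a pair of vertices v ≠ ι v, a relabelling is determined by its values at v.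
    record Twin (v : V) : Set where
      field
        v≢ : ιV v ≢ v
        only : ∀ {a u} → Nr a → sN a ≡ just u → u ≡ v ⊎ u ≡ ιV v
        onlyF : ∀ {a u} → Fr a → sF a ≡ just u → u ≡ v ⊎ u ≡ ιV v

    module Sided {v : V} (W : Twin v) where

      open Twin W

      ext : (Fin N → A) → Fin N → A
      ext μ p with vx p
      ... | nothing = l p
      ... | just u = if does (u ≟V v) then μ p else ι (μ (τ p))

      ext-n : ∀ {μ p} → vx p ≡ nothing → ext μ p ≡ l p
      ext-n {μ} {p} e with vx p
      ext-n {μ} {p} refl | .nothing = refl

      ext-v : ∀ {μ p} → vx p ≡ just v → ext μ p ≡ μ p
      ext-v {μ} {p} e with vx p
      ext-v {μ} {p} refl | .(just v) rewrite dec-true (v ≟V v) refl = refl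

      ext-ιv : ∀ {μ p} → vx p ≡ just (ιV v) → ext μ p ≡ ι (μ (τ p))
      ext-ιv {μ} {p} e with vx p
      ext-ιv {μ} {p} refl | .(just (ιV v)) rewrite dec-false (ιV v ≟V v) v≢ = refl

      side : ∀ {p u} → vx p ≡ just u → vx p ≡ just v ⊎ vx p ≡ just (ιV v)
      side {p} e with only (l∈ p) e
      ... | inj₁ refl = inj₁ e
      ... | inj₂ refl = inj₂ e

      flip : ∀ {p} → vx p ≡ just (ιV v) → vx (τ p) ≡ just v
      flip e = trans (vx-τj e) (cong just (ιVιV v))

      module Halves (D : Pair v) where

        open Pair D
        open Assemble D public

        record Half (μ : Fin N → A) : Set where
          field
            onH : ∀ {p} → vx p ≡ just v → Fr (μ p) × sF (μ p) ≡ just v × μ (T⁺ p) ≡ μ p × Per T⁺ p (w (μ p))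
            inH : ∀ {p q} → vx p ≡ just v → vx q ≡ just v → μ p ≡ μ q → Cyc T⁺ p q
            ontoH : ∀ {a} → Fr a → sF a ≡ just v → ∃ λ p → vx p ≡ just v × μ p ≡ a
            movedH : ∀ {p} → vx p ≡ just v → ∃ λ q → Cyc T p q × η q ≢ q
            linkedH : ∀ {p q} → vx p ≡ just v → vx q ≡ just v → Link T η p q

        private
          ι-inj : ∀ {a b} → ι a ≡ ι b → a ≡ b
          ι-inj e = trans (sym (ιι _)) (trans (cong ι e) (ιι _))
          same : ∀ {p u u′} → vx p ≡ just u → vx p ≡ just u′ → u ≡ u′
          same e e′ = just-injective (trans (sym e) e′)

        half-valid : ∀ {μ} → Half μ → Valid (V.tabulate η , V.tabulate (ext μ))
        half-valid {μ} H = relabel-valid record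
          { onPass = ext-n
          ; onV = λ e → [ onv e , onιv e ]′ (side e)
          ; inV = λ {p} {q} e e′ eq → case side e of λ
              { (inj₁ s) → let s′ = trans e′ (trans (sym e) s) in
                  inH s s′ (trans (sym (ext-v s)) (trans eq (ext-v s′)))
              ; (inj₂ s) → let s′ = trans e′ (trans (sym e) s) in
                  subst (λ z → Cyc T⁺ z q) (ττ p) (TwPerm.cyc-τ₁ t⁺ (subst (Cyc T⁺ (τ p)) refl
                    (inH (flip s) (flip s′) (ι-inj (trans (sym (ext-ιv s)) (trans eq (ext-ιv s′))))))) }
          ; ontoV = ontov
          ; movedV = λ {p} e → case side e of λ
              { (inj₁ s) → let (q , c , n) = movedH s in q , c , inj₁ n
              ; (inj₂ s) → let (q , c , n) = movedH (flip s) in τ q ,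
                  subst (λ z → Cyc T z (τ q)) (ττ p) (cyc-τ c) ,
                  inj₂ (λ e → n (trans (sym (cong η (ττ q))) (trans e (ττ q)))) }
          ; linkedV = λ {p} {q} e e′ → case side e of λ
              { (inj₁ s) → linkedH s (trans e′ (trans (sym e) s))
              ; (inj₂ s) → subst (λ z → Link T η z q) (ττ p) (subst (Link T η _) (ττ q)
                  (transp-τ-link (linkedH (flip s) (flip (trans e′ (trans (sym e) s)))))) } }
          where
          open Half H
          Goal : Fin N → V → Set
          Goal p u = Fr (ext μ p) × sF (ext μ p) ≡ just u × ext μ (T⁺ p) ≡ ext μ p × ext μ (τ p) ≡ ι (ext μ p) × Per T⁺ p (w (ext μ p))
          onv : ∀ {p u} → vx p ≡ just u → vx p ≡ just v → Goal p u
          onv {p} e s with same e s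
          ... | refl with onH s
          ... | a , b , c , d rewrite ext-v {μ} s = a , b , trans (ext-v (trans (vx-T⁺ p) s)) c ,
                trans (ext-ιv (vx-τj s)) (cong (ι ∘ μ) (ττ p)) , d
          onιv : ∀ {p u} → vx p ≡ just u → vx p ≡ just (ιV v) → Goal p u
          onιv {p} e s with same e s
          ... | refl with onH (flip s) | onH (flip (trans (vx-T⁺ p) s))
          ... | a , b , c , d | _ , _ , c′ , _ rewrite ext-ιv {μ} s = Fr-ι a , trans (sF-ι _) (cong (Data.Maybe.map ιV) b) ,
                trans (ext-ιv (trans (vx-T⁺ p) s)) (cong ι (trans (sym c′) (cong μ (TwPerm.tw₁ t⁺ p)))) ,
                trans (ext-v (flip s)) (sym (ιι _)) ,
                subst (λ k → Per T⁺ p k) (sym (w-ι _)) (subst (λ z → Per T⁺ z (w (μ (τ p)))) (ττ p) (TwPerm.per-τ t⁺ d))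
          ontov : ∀ {a u} → Fr a → sF a ≡ just u → ∃ λ p → ext μ p ≡ a
          ontov {a} fa e with onlyF fa e
          ... | inj₁ refl = let (p , s , m) = ontoH fa e in p , trans (ext-v s) m
          ... | inj₂ refl = let (p , s , m) = ontoH (Fr-ι fa) (trans (sF-ι a) (trans (cong (Data.Maybe.map ιV) e) (cong just (ιVιV v)))) in
                τ p , trans (ext-ιv (vx-τj s)) (trans (cong ι (trans (cong μ (ττ p)) m)) (ιι a))

        half-moves : MovesAt v (V.tabulate η)
        half-moves = x , ux , λ e → x≢y (trans (sym e) (trans (VP.lookup∘tabulate η x) (transp-l x y)))

      half-unique : ∀ {η : Vec (Fin N) N} {l⁺ : Vec A N} (V : Valid (η , l⁺)) {μ} →
        (∀ {p} → vx p ≡ just v → l⁺ !! p ≡ μ p) → l⁺ ≡ V.tabulate (ext μ)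
      half-unique {η} {l⁺} V {μ} h = tabulate-≡ l⁺ _ go
        where
        open Inspect V
        go : ∀ p → l⁺ !! p ≡ ext μ p
        go p with vx p in e
        ... | nothing = pure-step l⁺ (C.step p) e
        ... | just u with only (l∈ p) e
        ... | inj₁ refl rewrite dec-true (v ≟V v) refl = h e
        ... | inj₂ refl rewrite dec-false (ιV v ≟V v) v≢ = trans (cong (l⁺ !!_) (sym (ττ p)))
              (trans (State.l-τ far′ (τ p)) (cong ι (h (flip e))))

      MovingAt : Vec (Fin N) N × Vec A N → Set
      MovingAt ηl = Valid ηl × MovesAt v (proj₁ ηl)

      moving-X : ∀ {η l⁺} (V : Valid (η , l⁺)) → MovesAt v η → vx (Inspect.X V) ≡ just v × vx (Inspect.Y V) ≡ just v
      moving-X V (z , vz , n) with Inspect.only-moved V n | Inspect.vertex V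
      ... | inj₁ refl | u , a , b = vz , trans b (trans (sym a) vz)
      ... | inj₂ refl | u , a , b = trans a (trans (sym b) vz) , vz

      -- One near label e, two far labels f₁ and f₂: η = (z T^(w f₁) z), where z lies in the cycle e and its far cycle is f₁.
      record OneTwoLabels : Set where
        field
          {e f₁ f₂} : A
          eN : Nr e
          ev : sN e ≡ just v
          e! : ∀ {a} → Nr a → sN a ≡ just v → a ≡ e
          F₁ : Fr f₁
          f₁v : sF f₁ ≡ just v
          F₂ : Fr f₂
          f₂v : sF f₂ ≡ just v
          f₁≢f₂ : f₁ ≢ f₂
          f! : ∀ {a} → Fr a → sF a ≡ just v → a ≡ f₁ ⊎ a ≡ f₂
          we : w e ≡ w f₁ + w f₂

      module OneTwo (B : OneTwoLabels) where

        open OneTwoLabels B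

        private
          a : ℕ
          a = w f₁

          pt : Fin N → Fin N
          pt z = it T a z

          μ : Fin N → Fin N → A
          μ z = choose z (pt z) f₁ f₂

          Φ : Fin N → Vec (Fin N) N × Vec A N
          Φ z = V.tabulate (sw z (pt z)) , V.tabulate (ext (μ z))

          e-at : ∀ {z} → l z ≡ e → vx z ≡ just v
          e-at refl = ev

          at-e : ∀ {z} → vx z ≡ just v → l z ≡ e
          at-e {z} = e! (l∈ z)

          module At {z : Fin N} (lz : l z ≡ e) where
            y = pt z
            pz : Per T z (w e)
            pz = subst (λ b → Per T z (w b)) lz (l-per z)
            a<we : a < w e
            a<we = subst (a <_) (sym we) (m<m+n a (1≤wF F₂))
            c : Cyc T z y
            c = a , refl
            z≢y : z ≢ y
            z≢y eq = proj₂ (proj₂ pz) a (1≤wF F₁) a<we (sym eq)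
            y≢τz : y ≢ τ z
            y≢τz eq = no-self (a , eq)
            uy : vx y ≡ just v
            uy = trans (cong sN (sym (cyc-l c))) (e-at lz)
            pair : Pair v
            pair = record { x≢y = z≢y ; y≢τx = y≢τz ; ux = e-at lz ; uy = uy }
            open Halves pair public
            module O = CutResult (near-one twp z≢y y≢τz c)
            m≡ : O.m ≡ w e
            m≡ = per-unique O.px pz
            a≡ : O.a ≡ a
            a≡ = per-inj inj pz (subst (O.a <_) m≡ O.a<m) a<we O.ea
            p₁ : Per T⁺ z (w f₁)
            p₁ = subst (Per T⁺ z) a≡ O.cut-perˡ
            p₂ : Per T⁺ y (w f₂)
            p₂ = subst (Per T⁺ y) (trans (cong₂ _∸_ (trans m≡ we) a≡) (m+n∸m≡n (w f₁) (w f₂))) O.cut-perʳ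
            inj⁺ = TwPerm.inj t⁺
            data Which (p : Fin N) : Set where
              first  : Cyc T⁺ z p → μ z p ≡ f₁ → Which p
              second : Cyc T⁺ y p → μ z p ≡ f₂ → Which p
            μ-y : μ z y ≡ f₂
            μ-y = choose-no O.cut-ncyc
            μ-z : μ z z ≡ f₁
            μ-z = choose-yes cyc-refl
            which : ∀ {p} → vx p ≡ just v → Which p
            which s with O.cut-cover (l-cyc (trans lz (sym (at-e s))))
            ... | inj₁ d = first d (choose-yes d)
            ... | inj₂ d = second d (choose-no (λ d′ → O.cut-ncyc (cyc-trans d′ (cyc-sym inj⁺ d))))
            half : Half (μ z)
            half = record
              { onH = onH
              ; inH = inH
              ; ontoH = λ fa s → case f! fa s of λ { (inj₁ refl) → z , e-at lz , μ-z ; (inj₂ refl) → y , uy , μ-y }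
              ; movedH = λ s → z , l-cyc (trans (at-e s) (sym lz)) , λ q → z≢y (trans (sym q) (transp-l z y))
              ; linkedH = λ s s′ → cyc⇒orbit (here refl) (l-cyc (trans (at-e s) (sym (at-e s′)))) }
              where
              onH : ∀ {p} → vx p ≡ just v → Fr (μ z p) × sF (μ z p) ≡ just v × μ z (T⁺ p) ≡ μ z p × Per T⁺ p (w (μ z p))
              onH s with which s
              ... | first d m rewrite m = F₁ , f₁v , choose-yes (cyc-trans d cyc-step) , per-cyc inj⁺ d p₁
              ... | second d m rewrite m = F₂ , f₂v , choose-no (λ d′ → O.cut-ncyc (cyc-trans d′ (cyc-sym inj⁺ (cyc-trans d cyc-step)))) , per-cyc inj⁺ d p₂
              inH : ∀ {p q} → vx p ≡ just v → vx q ≡ just v → μ z p ≡ μ z q → Cyc T⁺ p q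
              inH s s′ eq with which s | which s′
              ... | first d m | first d′ m′ = cyc-trans (cyc-sym inj⁺ d) d′
              ... | second d m | second d′ m′ = cyc-trans (cyc-sym inj⁺ d) d′
              ... | first d m | second d′ m′ = ⊥-elim (f₁≢f₂ (trans (sym m) (trans eq m′)))
              ... | second d m | first d′ m′ = ⊥-elim (f₁≢f₂ (trans (sym m′) (trans (sym eq) m)))

          Φ-inj : ∀ {z z′} → l z ≡ e → l z′ ≡ e → Φ z ≡ Φ z′ → z ≡ z′
          Φ-inj {z} {z′} h h′ eq with transp-moved (At.z≢y h′) (cong proj₁ eq)
          ... | inj₁ q = sym q
          ... | inj₂ q = ⊥-elim (f₁≢f₂ (begin
                f₁ ≡⟨ At.μ-z h′ ⟨
                μ z′ z′ ≡⟨ ext-v (e-at h′) ⟨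
                ext (μ z′) z′ ≡⟨ VP.lookup∘tabulate (ext (μ z′)) z′ ⟨
                proj₂ (Φ z′) !! z′ ≡⟨ cong (λ k → proj₂ k !! z′) eq ⟨
                proj₂ (Φ z) !! z′ ≡⟨ VP.lookup∘tabulate (ext (μ z)) z′ ⟩
                ext (μ z) z′ ≡⟨ cong (ext (μ z)) q ⟩
                ext (μ z) (pt z) ≡⟨ ext-v (At.uy h) ⟩
                μ z (pt z) ≡⟨ At.μ-y h ⟩
                f₂ ∎))
            where open ≡-Reasoning

          Φ-onto : ∀ {ηl} → MovingAt ηl → ∃ λ z → l z ≡ e × Φ z ≡ ηl
          Φ-onto {η , l⁺} (V , mv) = go (f! (proj₁ sx) (proj₂ sx)) (f! (proj₁ sy) (proj₂ sy))
            where
            open Inspect V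
            XY = moving-X V mv
            sx = step-v (proj₁ XY)
            sy = step-v (proj₂ XY)
            c : Cyc T X Y
            c = l-cyc (trans (at-e (proj₁ XY)) (sym (at-e (proj₂ XY))))
            build : ∀ {z y} → z ≢ y → y ≢ τ z → l z ≡ e → Cyc T z y → η ≡ V.tabulate (sw z y) →
              State Fr (conj (sw z y) T) (l⁺ !!_) → l⁺ !! z ≡ f₁ → l⁺ !! y ≡ f₂ → ∃ λ z → l z ≡ e × Φ z ≡ (η , l⁺)
            build {z} {y} n nτ lz c ηe S m₁ m₂ = z , lz , cong₂ _,_ (trans (cong (λ q → V.tabulate (sw z q)) y≡) (sym ηe))
                (sym (half-unique V agree))
              where
              module O = CutResult (near-one twp n nτ c)
              a≡ : O.a ≡ a
              a≡ = per-unique O.cut-perˡ (subst (λ b → Per _ z (w b)) m₁ (State.l-per S z))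
              y≡ : pt z ≡ y
              y≡ = trans (cong (λ k → it T k z) (sym a≡)) O.ea
              agree : ∀ {p} → vx p ≡ just v → l⁺ !! p ≡ μ z p
              agree {p} s with O.cut-cover (l-cyc (trans lz (sym (at-e s))))
              ... | inj₁ d = trans (sym (State.cyc-l S d)) (trans m₁ (sym (choose-yes (subst (λ q → Cyc (conj (sw z q) T) z p) (sym y≡) d))))
              ... | inj₂ d = trans (sym (State.cyc-l S d)) (trans m₂ (sym (choose-no (λ d′ →
                    O.cut-ncyc (cyc-trans (subst (λ q → Cyc (conj (sw z q) T) z p) y≡ d′) (cyc-sym (State.inj S) d))))))
            go : l⁺ !! X ≡ f₁ ⊎ l⁺ !! X ≡ f₂ → l⁺ !! Y ≡ f₁ ⊎ l⁺ !! Y ≡ f₂ → ∃ λ z → l z ≡ e × Φ z ≡ (η , l⁺)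
            go (inj₁ m) (inj₂ m′) = build X≢Y Y≢τX (at-e (proj₁ XY)) c η≡ far′ m m′
            go (inj₂ m) (inj₁ m′) = build (X≢Y ∘ sym) (λ q → Y≢τX (trans (sym (ττ Y)) (cong τ (sym q)))) (at-e (proj₂ XY)) (cyc-sym inj c)
              (trans η≡ (VP.tabulate-cong (transp-sym X Y)))
              (state-cong (conj-η {T = T} (transp-sym X Y)) (λ _ → refl) far′) m′ m
            go (inj₁ m) (inj₁ m′) = ⊥-elim (cut c (State.l-cyc far′ (trans m (sym m′))))
            go (inj₂ m) (inj₂ m′) = ⊥-elim (cut c (State.l-cyc far′ (trans m (sym m′))))

        card-oneTwo : Card MovingAt (w e)
        card-oneTwo = card-map Φ (λ h → At.half-valid h (At.half h) , At.half-moves h) Φ-inj Φ-onto (card-label eN)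

      -- Two near labels e₁ and e₂, one far label f: η = (x y) with x in the cycle e₁ and y in the cycle e₂.
      record TwoOneLabels : Set where
        field
          {e₁ e₂ f} : A
          E₁ : Nr e₁
          e₁v : sN e₁ ≡ just v
          E₂ : Nr e₂
          e₂v : sN e₂ ≡ just v
          e₁≢e₂ : e₁ ≢ e₂
          e! : ∀ {a} → Nr a → sN a ≡ just v → a ≡ e₁ ⊎ a ≡ e₂
          F₁ : Fr f
          fv : sF f ≡ just v
          f! : ∀ {a} → Fr a → sF a ≡ just v → a ≡ f
          wf : w f ≡ w e₁ + w e₂

      module TwoOne (B : TwoOneLabels) where

        open TwoOneLabels B

        private
          μ : Fin N → A
          μ _ = f

          Φ : Fin N × Fin N → Vec (Fin N) N × Vec A N
          Φ (x , y) = V.tabulate (sw x y) , V.tabulate (ext μ)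

          at-e : ∀ {z} → vx z ≡ just v → l z ≡ e₁ ⊎ l z ≡ e₂
          at-e {z} = e! (l∈ z)

          vx-of : ∀ {z e} → l z ≡ e → sN e ≡ just v → vx z ≡ just v
          vx-of refl s = s

          apart : ∀ {z z′} → vx z ≡ just v → vx z′ ≡ just v → z′ ≢ τ z
          apart s s′ refl = v≢ (just-injective (trans (sym (vx-τj s)) s′))

          module At {x y : Fin N} (lx : l x ≡ e₁) (ly : l y ≡ e₂) where
            ux = vx-of lx e₁v
            uy = vx-of ly e₂v
            x≢y : x ≢ y
            x≢y q = e₁≢e₂ (trans (sym lx) (trans (cong l q) ly))
            y≢τx : y ≢ τ x
            y≢τx = apart ux uy
            pair : Pair v
            pair = record { x≢y = x≢y ; y≢τx = y≢τx ; ux = ux ; uy = uy }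
            open Halves pair public
            n : ¬ Cyc T x y
            n c = e₁≢e₂ (trans (sym lx) (trans (cyc-l c) ly))
            nτ : ¬ Cyc T x (τ y)
            nτ c = v≢ (just-injective (trans (sym (vx-τj uy)) (trans (cong sN (sym (cyc-l c))) ux)))
            module O = JoinResult (near-two twp x≢y y≢τx n nτ)
            inj⁺ = TwPerm.inj t⁺
            d-of : ∀ {p} → vx p ≡ just v → Cyc T x p ⊎ Cyc T y p
            d-of s with at-e s
            ... | inj₁ q = inj₁ (l-cyc (trans lx (sym q)))
            ... | inj₂ q = inj₂ (l-cyc (trans ly (sym q)))
            all : ∀ {p} → vx p ≡ just v → Cyc T⁺ x p
            all s = O.join-cover (d-of s)
            px : Per T⁺ x (w f)
            px = subst (Per T⁺ x) (trans (+-comm (w e₂) (w e₁)) (sym wf))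
              (O.join-per (subst (λ b → Per T x (w b)) lx (l-per x)) (subst (λ b → Per T y (w b)) ly (l-per y)))
            to-x : ∀ {p} → vx p ≡ just v → Link T η p x
            to-x s with d-of s
            ... | inj₁ c = cyc⇒orbit (here refl) (cyc-sym inj c)
            ... | inj₂ c = subst (Link T η _) (transp-r x y) (fwd _ (there (here refl)) (cyc⇒orbit (here refl) (cyc-sym inj c)))
            from-x : ∀ {p} → vx p ≡ just v → Link T η x p
            from-x s with d-of s
            ... | inj₁ c = cyc⇒orbit (here refl) c
            ... | inj₂ c = orbit-trans (subst (Link T η x) (transp-l x y) (fwd _ (there (here refl)) here)) (cyc⇒orbit (here refl) c)
            half : Half μ
            half = record
              { onH = λ s → F₁ , fv , refl , per-cyc inj⁺ (all s) px
              ; inH = λ s s′ _ → cyc-trans (cyc-sym inj⁺ (all s)) (all s′)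
              ; ontoH = λ fa s → x , ux , sym (f! fa s)
              ; movedH = λ s → case d-of s of λ
                  { (inj₁ c) → x , cyc-sym inj c , λ q → x≢y (trans (sym q) (transp-l x y))
                  ; (inj₂ c) → y , cyc-sym inj c , λ q → x≢y (trans (sym (transp-r x y)) q) }
              ; linkedH = λ s s′ → orbit-trans (to-x s) (from-x s′) }

          Φ-inj : ∀ {xy xy′} → l (proj₁ xy) ≡ e₁ × l (proj₂ xy) ≡ e₂ → l (proj₁ xy′) ≡ e₁ × l (proj₂ xy′) ≡ e₂ → Φ xy ≡ Φ xy′ → xy ≡ xy′
          Φ-inj {x , y} {x′ , y′} (a , b) (a′ , b′) eq = go (transp-moved (At.x≢y a′ b′) (cong proj₁ eq))
              (transp-moved (At.x≢y a′ b′ ∘ sym) (trans (cong proj₁ eq) (VP.tabulate-cong (transp-sym x′ y′))))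
            where
            go : x′ ≡ x ⊎ x′ ≡ y → y′ ≡ x ⊎ y′ ≡ y → (x , y) ≡ (x′ , y′)
            go (inj₁ refl) (inj₂ refl) = refl
            go (inj₂ refl) _ = ⊥-elim (e₁≢e₂ (trans (sym a′) b))
            go _ (inj₁ refl) = ⊥-elim (e₁≢e₂ (trans (sym a) b′))

          Φ-onto : ∀ {ηl} → MovingAt ηl → ∃ λ xy → (l (proj₁ xy) ≡ e₁ × l (proj₂ xy) ≡ e₂) × Φ xy ≡ ηl
          Φ-onto {η , l⁺} (V , mv) = go (at-e (proj₁ XY)) (at-e (proj₂ XY))
            where
            open Inspect V
            XY = moving-X V mv
            lX : l⁺ !! X ≡ l⁺ !! Y
            lX = let (a , b) = step-v (proj₁ XY) ; (c , d) = step-v (proj₂ XY) in trans (f! a b) (sym (f! c d))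
            ncyc : ¬ Cyc T X Y
            ncyc c = cut c (State.l-cyc far′ lX)
            l≡ : l⁺ ≡ V.tabulate (ext μ)
            l≡ = half-unique V (λ s → let (a , b) = step-v s in f! a b)
            go : l X ≡ e₁ ⊎ l X ≡ e₂ → l Y ≡ e₁ ⊎ l Y ≡ e₂ → ∃ λ xy → (l (proj₁ xy) ≡ e₁ × l (proj₂ xy) ≡ e₂) × Φ xy ≡ (η , l⁺)
            go (inj₁ a) (inj₂ b) = (X , Y) , (a , b) , cong₂ _,_ (sym η≡) (sym l≡)
            go (inj₂ a) (inj₁ b) = (Y , X) , (b , a) , cong₂ _,_ (trans (VP.tabulate-cong (transp-sym Y X)) (sym η≡)) (sym l≡)
            go (inj₁ a) (inj₁ b) = ⊥-elim (ncyc (l-cyc (trans a (sym b))))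
            go (inj₂ a) (inj₂ b) = ⊥-elim (ncyc (l-cyc (trans a (sym b))))

        card-twoOne : Card MovingAt (w e₁ * w e₂)
        card-twoOne = card-map Φ (λ (h , h′) → At.half-valid h h′ (At.half h h′) , At.half-moves h h′) Φ-inj Φ-onto
          (card-Σ (card-label E₁) (λ _ → card-label E₂))

    -- A single vertex with near labels e, ι e and far labels f, ι f: η = (x y) with x in e and y in ι e,
    -- and there are two ways of labelling the two far cycles.
    record TwoTwoLabels : Set where
      field
        {v} : V
        only : ∀ {a u} → Nr a → sN a ≡ just u → u ≡ v
        onlyF : ∀ {a u} → Fr a → sF a ≡ just u → u ≡ v
        {e f} : A
        E : Nr e
        e! : ∀ {a} → Nr a → sN a ≡ just v → a ≡ e ⊎ a ≡ ι e
        ev : sN e ≡ just v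
        ιev : sN (ι e) ≡ just v
        F₁ : Fr f
        fv : sF f ≡ just v
        ιfv : sF (ι f) ≡ just v
        f! : ∀ {a} → Fr a → sF a ≡ just v → a ≡ f ⊎ a ≡ ι f
        f≢ : ι f ≢ f
        we : w e ≡ w f

    module TwoTwo (B : TwoTwoLabels) where

      open TwoTwoLabels B

      private
        ext : (Fin N → A) → Fin N → A
        ext μ p with vx p
        ... | nothing = l p
        ... | just _ = μ p

        ext-n : ∀ {μ p} → vx p ≡ nothing → ext μ p ≡ l p
        ext-n {μ} {p} e with vx p
        ext-n {μ} {p} refl | .nothing = refl

        ext-v : ∀ {μ p u} → vx p ≡ just u → ext μ p ≡ μ p
        ext-v {μ} {p} e with vx p
        ext-v {μ} {p} refl | .(just _) = refl

        at-v : ∀ {p u} → vx p ≡ just u → vx p ≡ just v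
        at-v {p} s with only (l∈ p) s
        ... | refl = s

        Param : (Fin N × Fin N) × A → Set
        Param ((x , y) , g) = (l x ≡ e × (l y ≡ ι e × ¬ y ≡ τ x)) × (g ≡ f ⊎ g ≡ ι f)

        μ : Fin N → Fin N → A → Fin N → A
        μ x y g = choose x y g (ι g)

        Φ : (Fin N × Fin N) × A → Vec (Fin N) N × Vec A N
        Φ ((x , y) , g) = V.tabulate (sw x y) , V.tabulate (ext (μ x y g))

        f!′ : ∀ {g} → g ≡ f ⊎ g ≡ ι f → ∀ {a} → Fr a → sF a ≡ just v → a ≡ g ⊎ a ≡ ι g
        f!′ (inj₁ refl) = f!
        f!′ (inj₂ refl) fa s with f! fa s
        ... | inj₁ refl = inj₂ (sym (ιι _))
        ... | inj₂ q = inj₁ q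

        module At {x y : Fin N} {g : A} (lx : l x ≡ e) (ly : l y ≡ ι e) (y≢τx : y ≢ τ x) (gf : g ≡ f ⊎ g ≡ ι f) where
          ux : vx x ≡ just v
          ux = trans (cong sN lx) ev
          uy : vx y ≡ just v
          uy = trans (cong sN ly) ιev
          x≢y : x ≢ y
          x≢y q = ι-≢ x (trans (cong ι lx) (trans (sym ly) (trans (cong l (sym q)) refl)))
          pair : Pair v
          pair = record { x≢y = x≢y ; y≢τx = y≢τx ; ux = ux ; uy = uy }
          open Assemble pair public
          c : Cyc T x (τ y)
          c = l-cyc (trans lx (sym (trans (l-τ y) (trans (cong ι ly) (ιι e)))))
          module O = MirrorResult (near-mirror twp x≢y y≢τx c)
          inj⁺ = TwPerm.inj t⁺
          G : Fr g × sF g ≡ just v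
          G = [ (λ { refl → F₁ , fv }) , (λ { refl → Fr-ι F₁ , ιfv }) ]′ gf
          ιG : Fr (ι g) × sF (ι g) ≡ just v
          ιG = [ (λ { refl → Fr-ι F₁ , ιfv }) , (λ { refl → subst Fr (sym (ιι f)) F₁ , trans (cong sF (ιι f)) fv }) ]′ gf
          ιg≢g : ι g ≢ g
          ιg≢g = [ (λ { refl → f≢ }) , (λ { refl q → f≢ (trans (sym q) (ιι f)) }) ]′ gf
          wg : w g ≡ w e
          wg = [ (λ { refl → sym we }) , (λ { refl → trans (w-ι f) (sym we) }) ]′ gf
          ly′ : l (τ x) ≡ ι e
          ly′ = trans (l-τ x) (cong ι lx)
          d-of : ∀ {p} → vx p ≡ just v → Cyc T x p ⊎ Cyc T (τ x) p
          d-of {p} s with e! (l∈ p) s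
          ... | inj₁ q = inj₁ (l-cyc (trans lx (sym q)))
          ... | inj₂ q = inj₂ (l-cyc (trans ly′ (sym q)))
          data Which (p : Fin N) : Set where
            first  : Cyc T⁺ x p → μ x y g p ≡ g → Which p
            second : Cyc T⁺ (τ x) p → μ x y g p ≡ ι g → Which p
          apart : ∀ {p} → Cyc T⁺ x p → Cyc T⁺ (τ x) p → ⊥
          apart d d′ = TwPerm.no-self t⁺ (cyc-trans d (cyc-sym inj⁺ d′))
          mk₁ : ∀ {p} → Cyc T⁺ x p → Which p
          mk₁ d = first d (choose-yes d)
          mk₂ : ∀ {p} → Cyc T⁺ (τ x) p → Which p
          mk₂ d = second d (choose-no (λ d′ → apart d′ d))
          val₁ : ∀ {p} → Cyc T⁺ x p → μ x y g p ≡ g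
          val₁ = choose-yes
          val₂ : ∀ {p} → Cyc T⁺ (τ x) p → μ x y g p ≡ ι g
          val₂ d = choose-no (λ d′ → apart d′ d)
          which : ∀ {p} → vx p ≡ just v → Which p
          which s = [ mk₁ , mk₂ ]′ (O.mirror-cover (d-of s))
          px : Per T⁺ x (w g)
          px = subst (Per T⁺ x) (sym wg) (O.mirror-per (subst (λ b → Per T x (w b)) lx (l-per x)))
          toy : Link T η x y
          toy = subst (Link T η x) (transp-l x y) (fwd _ (there (here refl)) here)
          tox : Link T η y x
          tox = subst (Link T η y) (transp-r x y) (fwd _ (there (here refl)) here)
          y∼τx : Cyc T y (τ x)
          y∼τx = l-cyc (trans ly (sym ly′))
          relabelling : Relabelling (ext (μ x y g))
          relabelling = record
            { onPass = ext-n
            ; onV = onV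
            ; inV = λ s s′ eq → inV (at-v s) (at-v s′) (trans (sym (ext-v s)) (trans eq (ext-v s′)))
            ; ontoV = ontoV
            ; movedV = λ s → case d-of (at-v s) of λ
                { (inj₁ d) → x , cyc-sym inj d , inj₁ (λ q → x≢y (trans (sym q) (transp-l x y)))
                ; (inj₂ d) → τ x , cyc-sym inj d , inj₂ (λ q → x≢y (trans (sym (trans (sym (cong η (ττ x))) (trans q (ττ x)))) (transp-l x y))) }
            ; linkedV = λ s s′ → orbit-trans (to (at-v s)) (from (at-v s′)) }
            where
            onV : ∀ {p u} → vx p ≡ just u → Fr (ext (μ x y g) p) × sF (ext (μ x y g) p) ≡ just u ×
              ext (μ x y g) (T⁺ p) ≡ ext (μ x y g) p × ext (μ x y g) (τ p) ≡ ι (ext (μ x y g) p) × Per T⁺ p (w (ext (μ x y g) p))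
            onV {p} s with only (l∈ p) s
            ... | refl = go (which s)
              where
              go : Which p → _
              go (first d m) = let E = trans (ext-v s) m in
                subst Fr (sym E) (proj₁ G) , trans (cong sF E) (proj₂ G) ,
                trans (ext-v (trans (vx-T⁺ p) s)) (trans (val₁ (cyc-trans d cyc-step)) (sym E)) ,
                trans (ext-v (vx-τj s)) (trans (val₂ (TwPerm.cyc-τ t⁺ d)) (cong ι (sym E))) ,
                subst (λ a → Per T⁺ p (w a)) (sym E) (per-cyc inj⁺ d px)
              go (second d m) = let E = trans (ext-v s) m in
                subst Fr (sym E) (proj₁ ιG) , trans (cong sF E) (proj₂ ιG) ,
                trans (ext-v (trans (vx-T⁺ p) s)) (trans (val₂ (cyc-trans d cyc-step)) (sym E)) ,
                trans (ext-v (vx-τj s)) (trans (val₁ (subst (λ z → Cyc T⁺ z (τ p)) (ττ x) (TwPerm.cyc-τ t⁺ d)))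
                  (trans (sym (ιι g)) (cong ι (sym E)))) ,
                subst (λ a → Per T⁺ p (w a)) (sym E) (subst (Per T⁺ p) (sym (w-ι g)) (per-cyc inj⁺ d (TwPerm.per-τ t⁺ px)))
            inV : ∀ {p q} → vx p ≡ just v → vx q ≡ just v → μ x y g p ≡ μ x y g q → Cyc T⁺ p q
            inV {p} {q} s s′ eq = go (which s) (which s′)
              where
              go : Which p → Which q → Cyc T⁺ p q
              go (first d m) (first d′ m′) = cyc-trans (cyc-sym inj⁺ d) d′
              go (second d m) (second d′ m′) = cyc-trans (cyc-sym inj⁺ d) d′
              go (first d m) (second d′ m′) = ⊥-elim (ιg≢g (trans (sym m′) (trans (sym eq) m)))
              go (second d m) (first d′ m′) = ⊥-elim (ιg≢g (trans (sym m) (trans eq m′)))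
            ontoV : ∀ {a u} → Fr a → sF a ≡ just u → ∃ λ p → ext (μ x y g) p ≡ a
            ontoV fa s with onlyF fa s
            ... | refl with f!′ gf fa s
            ... | inj₁ refl = x , trans (ext-v ux) (val₁ cyc-refl)
            ... | inj₂ refl = τ x , trans (ext-v (vx-τj ux)) (val₂ cyc-refl)
            to : ∀ {p} → vx p ≡ just v → Link T η p x
            to s with d-of s
            ... | inj₁ d = cyc⇒orbit (here refl) (cyc-sym inj d)
            ... | inj₂ d = orbit-trans (cyc⇒orbit (here refl) (cyc-sym inj (cyc-trans y∼τx d))) tox
            from : ∀ {p} → vx p ≡ just v → Link T η x p
            from s with d-of s
            ... | inj₁ d = cyc⇒orbit (here refl) d
            ... | inj₂ d = orbit-trans toy (cyc⇒orbit (here refl) (cyc-trans y∼τx d))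

        Φ-inj : ∀ {q q′} → Param q → Param q′ → Φ q ≡ Φ q′ → q ≡ q′
        Φ-inj {(x , y) , g} {(x′ , y′) , g′} ((a , b , n) , gf) ((a′ , b′ , n′) , gf′) eq =
            go (transp-moved (M′.x≢y) (cong proj₁ eq)) (transp-moved (M′.x≢y ∘ sym) (trans (cong proj₁ eq) (VP.tabulate-cong (transp-sym x′ y′))))
          where
          module M = At a b n gf
          module M′ = At a′ b′ n′ gf′
          ne : ∀ {z z′} → l z ≡ e → l z′ ≡ ι e → z ≢ z′
          ne p q refl = ι-≢ x (trans (cong ι a) (trans (sym q) (trans p (sym a))))
          go : x′ ≡ x ⊎ x′ ≡ y → y′ ≡ x ⊎ y′ ≡ y → ((x , y) , g) ≡ ((x′ , y′) , g′)
          go (inj₁ refl) (inj₂ refl) = cong ((x , y) ,_) (trans (sym (M.val₁ cyc-refl)) (trans (sym (ext-v M.ux))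
            (trans (sym (VP.lookup∘tabulate (ext (μ x y g)) x)) (trans (cong (λ k → proj₂ k !! x) eq)
            (trans (VP.lookup∘tabulate (ext (μ x y g′)) x) (trans (ext-v M.ux) (M′.val₁ cyc-refl)))))))
          go (inj₂ q) _ = ⊥-elim (ne a′ b q)
          go _ (inj₁ q) = ⊥-elim (ne a b′ (sym q))

        Φ-onto : ∀ {ηl} → Valid ηl → ∃ λ q → Param q × Φ q ≡ ηl
        Φ-onto {η , l⁺} V = go (e! (l∈ X) vX) (e! (l∈ Y) vY)
          where
          open Inspect V
          vX = at-v (proj₁ (proj₂ vertex))
          vY = at-v (proj₂ (proj₂ vertex))
          far-two : ∀ {p q} → vx p ≡ just v → vx q ≡ just v → l⁺ !! p ≡ l⁺ !! q ⊎ l⁺ !! q ≡ ι (l⁺ !! p)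
          far-two {p} {q} s s′ with f! (proj₁ (step-v s)) (proj₂ (step-v s)) | f! (proj₁ (step-v s′)) (proj₂ (step-v s′))
          ... | inj₁ a | inj₁ b = inj₁ (trans a (sym b))
          ... | inj₁ a | inj₂ b = inj₂ (trans b (cong ι (sym a)))
          ... | inj₂ a | inj₁ b = inj₂ (trans b (trans (sym (ιι f)) (cong ι (sym a))))
          ... | inj₂ a | inj₂ b = inj₁ (trans a (sym b))
          w-l⁺ : ∀ {p} → vx p ≡ just v → w (l⁺ !! p) ≡ w e
          w-l⁺ s with f! (proj₁ (step-v s)) (proj₂ (step-v s))
          ... | inj₁ a = trans (cong w a) (sym we)
          ... | inj₂ a = trans (cong w a) (trans (w-ι f) (sym we))
          w-l : ∀ {p} → vx p ≡ just v → w (l p) ≡ w e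
          w-l {p} s with e! (l∈ p) s
          ... | inj₁ a = cong w a
          ... | inj₂ a = trans (cong w a) (w-ι e)
          ncyc : ¬ Cyc T X Y
          ncyc c = <⇒≢ (subst (O.a <_) (trans (per-unique O.px (l-per X)) (w-l vX)) O.a<m)
              (trans (per-unique O.cut-perˡ (State.l-per far′ X)) (w-l⁺ vX))
            where module O = CutResult (near-one twp X≢Y Y≢τX c)
          build : ∀ {x y} → x ≢ y → (n : y ≢ τ x) → (a : l x ≡ e) (b : l y ≡ ι e) → vx x ≡ just v → η ≡ V.tabulate (sw x y) →
            State Fr (conj (sw x y) T) (l⁺ !!_) → ∃ λ q → Param q × Φ q ≡ (η , l⁺)
          build {x} {y} n nτ a b s ηe S = ((x , y) , l⁺ !! x) , ((a , b , nτ) , gf) ,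
              cong₂ _,_ (sym ηe) (sym (tabulate-≡ l⁺ _ go))
            where
            gf = f! (proj₁ (step-v s)) (proj₂ (step-v s))
            module M = At a b nτ gf
            go : ∀ p → l⁺ !! p ≡ ext (μ x y (l⁺ !! x)) p
            go p with vx p in eq
            ... | nothing = pure-step l⁺ (C.step p) eq
            ... | just u with far-two s (at-v eq)
            ... | inj₁ q = trans (sym q) (sym (M.val₁ (State.l-cyc S q)))
            ... | inj₂ q = trans q (sym (M.val₂ (State.l-cyc S (trans (State.l-τ S x) (sym q)))))
          go : l X ≡ e ⊎ l X ≡ ι e → l Y ≡ e ⊎ l Y ≡ ι e → ∃ λ q → Param q × Φ q ≡ (η , l⁺)
          go (inj₁ a) (inj₂ b) = build X≢Y Y≢τX a b vX η≡ far′
          go (inj₂ a) (inj₁ b) = build (X≢Y ∘ sym) (λ q → Y≢τX (trans (sym (ττ Y)) (cong τ (sym q)))) b a vY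
              (trans η≡ (VP.tabulate-cong (transp-sym X Y))) (state-cong (conj-η {T = T} (transp-sym X Y)) (λ _ → refl) far′)
          go (inj₁ a) (inj₁ b) = ⊥-elim (ncyc (l-cyc (trans a (sym b))))
          go (inj₂ a) (inj₂ b) = ⊥-elim (ncyc (l-cyc (trans a (sym b))))

        card-params : Card Param ((w e * (w e ∸ 1)) * 2)
        card-params = card-Σ (card-Σ (card-label E) (λ {x} lx → card-subst (cong (_∸ 1) (w-ι e))
            (card-complement (λ y → y ≟ τ x) (card-label (X-ι E)) (card-1 (τ x)) (λ { refl → trans (l-τ x) (cong ι lx) }))))
          (λ _ → card-⊎ (λ a b → f≢ (trans (sym b) a)) (card-1 f) (card-1 (ι f)))

      card-twoTwo : Card Valid ((w e * (w e ∸ 1)) * 2)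
      card-twoTwo = card-map Φ (λ ((a , b , n) , gf) → At.relabel-valid a b n gf (At.relabelling a b n gf)) Φ-inj Φ-onto card-params

    card-sides : ∀ {v k} → ιV v ≢ v → (only : ∀ {a u} → Nr a → sN a ≡ just u → u ≡ v ⊎ u ≡ ιV v) →
      Card (λ ηl → Valid ηl × MovesAt v (proj₁ ηl)) k → Card (λ ηl → Valid ηl × MovesAt (ιV v) (proj₁ ηl)) k → Card Valid (k + k)
    card-sides {v} v≢ only c c′ = card-⇔ [ proj₁ , proj₁ ]′ split (card-⊎ disj c c′)
      where
      at : ∀ {η l⁺ u} (V : Valid (η , l⁺)) → MovesAt u η → vx (Inspect.X V) ≡ just u
      at V (z , vz , n) with Inspect.only-moved V n | Inspect.vertex V
      ... | inj₁ refl | _ = vz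
      ... | inj₂ refl | u , a , b = trans a (trans (sym b) vz)
      disj : ∀ {ηl} → Valid ηl × MovesAt v (proj₁ ηl) → Valid ηl × MovesAt (ιV v) (proj₁ ηl) → ⊥
      disj (V , m) (_ , m′) = v≢ (just-injective (trans (sym (at V m′)) (at V m)))
      split : ∀ {ηl} → Valid ηl → (Valid ηl × MovesAt v (proj₁ ηl)) ⊎ (Valid ηl × MovesAt (ιV v) (proj₁ ηl))
      split {η , l⁺} V with Inspect.vertex V
      ... | u , a , b = go (only (l∈ _) a)
        where
        mv : MovesAt u η
        mv = Inspect.X V , a , λ e → Inspect.X≢Y V (trans (sym e) (trans (Inspect.ηf V _) (transp-l _ _)))
        go : u ≡ v ⊎ u ≡ ιV v → (Valid (η , l⁺) × MovesAt v η) ⊎ (Valid (η , l⁺) × MovesAt (ιV v) η)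
        go (inj₁ refl) = inj₁ (V , mv)
        go (inj₂ refl) = inj₂ (V , mv)

module Chain {St D : Set} (next : D → St → St) where

  run : ∀ {m} → Vec D m → St → Fin (suc m) → St
  run [] s _ = s
  run (δ ∷ δs) s zero = next δ (run δs s zero)
  run (δ ∷ δs) s (suc i) = run δs s i

  run-step : ∀ {m} (δs : Vec D m) s i → run δs s (inject₁ i) ≡ next (δs !! i) (run δs s (suc i))
  run-step (δ ∷ δs) s zero = refl
  run-step (δ ∷ δs) s (suc i) = run-step δs s i

  run-last : ∀ {m} (δs : Vec D m) s → run δs s (fromℕ m) ≡ s
  run-last [] s = refl
  run-last (δ ∷ δs) s = run-last δs s

  run-good : ∀ {m} (G : Fin (suc m) → St → Set) (δs : Vec D m) s → G (fromℕ m) s →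
    (∀ i → G (suc i) (run δs s (suc i)) → G (inject₁ i) (next (δs !! i) (run δs s (suc i)))) → ∀ i → G i (run δs s i)
  run-good G [] s g h zero = g
  run-good G (δ ∷ δs) s g h (suc i) = run-good (G ∘ suc) δs s g (h ∘ suc) i
  run-good G (δ ∷ δs) s g h zero = h zero (run-good (G ∘ suc) δs s g (h ∘ suc) zero)

  card-chain : ∀ {m} (G : Fin (suc m) → St → Set) (Val : Fin m → St → D → Set) (K : Fin m → ℕ) →
    (∀ {i s δ} → G (suc i) s → Val i s δ → G (inject₁ i) (next δ s)) →
    (∀ {i s} → G (suc i) s → Card (Val i s) (K i)) → ∀ {s} → G (fromℕ m) s →
    Card (λ (δs : Vec D m) → ∀ i → Val i (run δs s (suc i)) (δs !! i)) (prodFin K)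
  card-chain {zero} G Val K pres cnt g = card-⇔ {P = _≡ []} (λ _ ()) (λ { {[]} _ → refl }) (card-1 [])
  card-chain {suc m} G Val K pres cnt {s} g = card-subst (*-comm (prodFin (K ∘ suc)) (K zero))
    (card-map (λ (δs , δ) → δ ∷ δs)
      (λ { (hs , h) zero → h ; (hs , h) (suc i) → hs i })
      (λ { _ _ refl → refl })
      (λ { {δ ∷ δs} h → (δs , δ) , (h ∘ suc , h zero) , refl })
      (card-Σ (card-chain (G ∘ suc) (Val ∘ suc) (K ∘ suc) pres cnt g)
        (λ {δs} hs → cnt (run-good (G ∘ suc) δs s g (λ i g′ → pres g′ (hs i)) zero))))

-- Counting equivariant permutations

module _ {N : ℕ} where

  private
    inv-aux : (f : Fin N → Fin N) (y : Fin N) → Dec (∃ λ x → f x ≡ y) → Fin N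
    inv-aux f y (yes (x , _)) = x
    inv-aux f y (no _) = y

  opaque
    inverse : (Fin N → Fin N) → Fin N → Fin N
    inverse f y = inv-aux f y (F.any? (λ x → f x ≟ y))

    inj⇒onto : ∀ {f : Fin N → Fin N} → Inj f → ∀ y → ∃ λ x → f x ≡ y
    inj⇒onto {f} inj y with period inj y
    ... | suc m , _ , e , _ = it f m y , e

    inverse-r : ∀ {f} → Inj f → ∀ y → f (inverse f y) ≡ y
    inverse-r {f} inj y with F.any? (λ x → f x ≟ y)
    ... | yes (x , e) = e
    ... | no n = ⊥-elim (n (inj⇒onto inj y))

    inverse-l : ∀ {f} → Inj f → ∀ x → inverse f (f x) ≡ x
    inverse-l inj x = inj (inverse-r inj _)

    inverse-inj : ∀ {f} → Inj f → Inj (inverse f)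
    inverse-inj {f} inj e = trans (sym (inverse-r inj _)) (trans (cong f e) (inverse-r inj _))

vec-ext : ∀ {A : Set} {n} {xs ys : Vec A n} → (∀ i → xs !! i ≡ ys !! i) → xs ≡ ys
vec-ext {xs = xs} {ys} h = trans (sym (VP.tabulate∘lookup xs)) (trans (VP.tabulate-cong h) (VP.tabulate∘lookup ys))

module Tau (d : ℕ) where

  τi : ∀ i → τ d (i ↑ˡ d) ≡ d ↑ʳ i
  τi i = cong (join d d ∘ swap) (F.splitAt-↑ˡ d i d)

  τj : ∀ i → τ d (d ↑ʳ i) ≡ i ↑ˡ d
  τj i = cong (join d d ∘ swap) (F.splitAt-↑ʳ d d i)

  data Half (z : Fin (d + d)) : Set where
    lo : ∀ i → i ↑ˡ d ≡ z → Half z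
    hi : ∀ i → d ↑ʳ i ≡ z → Half z

  half : ∀ z → Half z
  half z with splitAt d z in e
  ... | inj₁ i = lo i (F.splitAt⁻¹-↑ˡ e)
  ... | inj₂ i = hi i (F.splitAt⁻¹-↑ʳ e)

  ττ : ∀ z → τ d (τ d z) ≡ z
  ττ z with half z
  ... | lo i refl = trans (cong (τ d) (τi i)) (τj i)
  ... | hi i refl = trans (cong (τ d) (τj i)) (τi i)

  lo≢hi : ∀ {i j} → i ↑ˡ d ≢ d ↑ʳ j
  lo≢hi {i} {j} e = case trans (sym (F.splitAt-↑ˡ d i d)) (trans (cong (splitAt d) e) (F.splitAt-↑ʳ d d j)) of λ ()

  τ≢ : ∀ z → τ d z ≢ z
  τ≢ z e with half z
  ... | lo i refl = lo≢hi (trans (sym e) (τi i))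
  ... | hi i refl = lo≢hi (trans (sym (τj i)) e)

  open import Data.List.Membership.DecPropositional (_≟_ {d + d}) using () renaming (_∈?_ to _∈?P_)

  private
    P = Fin (d + d)

    Free : List P → Set
    Free [] = ⊤
    Free (x ∷ xs) = (¬ (x ∈ xs ⊎ τ d x ∈ xs)) × Free xs

    free-listing : ∀ xs → Free xs → Card (λ z → z ∈ xs ⊎ τ d z ∈ xs) (length xs + length xs)
    free-listing [] _ = card-[] λ { (inj₁ ()) ; (inj₂ ()) }
    free-listing (x ∷ xs) (n , f) = card-subst (cong suc (sym (+-suc (length xs) (length xs))))
      (card-⇔ {P = λ z → (z ≡ x ⊎ z ≡ τ d x) ⊎ (z ∈ xs ⊎ τ d z ∈ xs)}
        (λ { (inj₁ (inj₁ e)) → inj₁ (here e) ; (inj₁ (inj₂ refl)) → inj₂ (here (ττ x))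
           ; (inj₂ (inj₁ i)) → inj₁ (there i) ; (inj₂ (inj₂ i)) → inj₂ (there i) })
        (λ { (inj₁ (here e)) → inj₁ (inj₁ e) ; (inj₁ (there i)) → inj₂ (inj₁ i)
           ; {z} (inj₂ (here e)) → inj₁ (inj₂ (trans (sym (ττ z)) (cong (τ d) e))) ; (inj₂ (there i)) → inj₂ (inj₂ i) })
        (card-⊎ {P = λ z → z ≡ x ⊎ z ≡ τ d x} {Q = λ z → z ∈ xs ⊎ τ d z ∈ xs} (λ { (inj₁ refl) p → n p ; (inj₂ refl) (inj₁ i) → n (inj₂ i)
                   ; (inj₂ refl) (inj₂ i) → n (inj₁ (subst (_∈ xs) (ττ x) i)) })
          (card-⊎ (λ { refl e → τ≢ _ (sym e) }) (card-1 x) (card-1 (τ d x)))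
          (free-listing xs f)))

    count : ℕ → ℕ
    count zero = 1
    count (suc k) = count k * (d + d ∸ (k + k))

    count-fact : ∀ k m → k + m ≡ d → count k * dfact m ≡ dfact d
    count-fact zero m refl = +-identityʳ _
    count-fact (suc k) m e = trans (trans (cong (_* dfact m) (cong (count k *_) lem)) arith) (count-fact k (suc m) (trans (+-suc k m) e))
      where
      lem : d + d ∸ (k + k) ≡ 2 * suc m
      lem = trans (cong (_∸ (k + k)) (sum-eq (trans (+-suc k m) e))) (m+n∸m≡n (k + k) _)
        where
        r : ∀ k m → (k + suc m) + (k + suc m) ≡ k + k + 2 * suc m
        r = solve-∀
        sum-eq : k + suc m ≡ d → d + d ≡ k + k + 2 * suc m
        sum-eq refl = r k m
      arith : count k * (2 * suc m) * dfact m ≡ count k * dfact (suc m)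
      arith = s (count k) (suc m) (2 ^ m) (m !)
        where
        s : ∀ a b p q → a * (2 * b) * (p * q) ≡ a * (2 * p * (b * q))
        s = solve-∀

    count-d : count d ≡ dfact d
    count-d = trans (sym (*-identityʳ (count d))) (count-fact d 0 (+-identityʳ d))

  fromHalf : (Fin d → P) → Fin (d + d) → P
  fromHalf f z = [ f , τ d ∘ f ]′ (splitAt d z)

  fromHalf-lo : ∀ f i → fromHalf f (i ↑ˡ d) ≡ f i
  fromHalf-lo f i = cong [ f , τ d ∘ f ]′ (F.splitAt-↑ˡ d i d)

  fromHalf-hi : ∀ f i → fromHalf f (d ↑ʳ i) ≡ τ d (f i)
  fromHalf-hi f i = cong [ f , τ d ∘ f ]′ (F.splitAt-↑ʳ d d i)

  fromHalf-τ : ∀ f z → fromHalf f (τ d z) ≡ τ d (fromHalf f z)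
  fromHalf-τ f z with half z
  ... | lo i refl = trans (cong (fromHalf f) (τi i)) (trans (fromHalf-hi f i) (cong (τ d) (sym (fromHalf-lo f i))))
  ... | hi i refl = trans (cong (fromHalf f) (τj i)) (trans (fromHalf-lo f i) (trans (sym (ττ _)) (cong (τ d) (sym (fromHalf-hi f i)))))

  fromHalf-inj : ∀ {f} → (∀ {i j} → f i ≡ f j → i ≡ j) → (∀ {i j} → f i ≢ τ d (f j)) → Inj (fromHalf f)
  fromHalf-inj {f} inj ne {x} {y} e with half x | half y
  ... | lo i refl | lo j refl = cong (_↑ˡ d) (inj (trans (sym (fromHalf-lo f i)) (trans e (fromHalf-lo f j))))
  ... | hi i refl | hi j refl = cong (d ↑ʳ_) (inj (inv⇒inj {f = τ d} ττ (trans (sym (fromHalf-hi f i)) (trans e (fromHalf-hi f j)))))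
  ... | lo i refl | hi j refl = ⊥-elim (ne (trans (sym (fromHalf-lo f i)) (trans e (fromHalf-hi f j))))
  ... | hi i refl | lo j refl = ⊥-elim (ne (trans (sym (fromHalf-lo f j)) (trans (sym e) (fromHalf-hi f i))))

  private
    FreeV : ∀ {k} → Vec P k → Set
    FreeV v = Free (V.toList v)

    card-freeV : ∀ k → Card (λ (v : Vec P k) → FreeV v) (count k)
    card-freeV zero = card-⇔ {P = _≡ []} (λ { refl → tt }) (λ { {[]} _ → refl }) (card-1 [])
    card-freeV (suc k) = card-map (λ (xs , x) → x ∷ xs)
      (λ (f , _ , n) → n , f)
      (λ { _ _ refl → refl })
      (λ { {x ∷ xs} (n , f) → (xs , x) , (f , tt , n) , refl })
      (card-Σ (card-freeV k) (λ {xs} f → card-subst (cong (λ j → d + d ∸ (j + j)) (VP.length-toList xs))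
        (card-complement (λ x → (x ∈?P V.toList xs) ⊎-dec (τ d x ∈?P V.toList xs)) (card-Fin (d + d)) (free-listing _ f) _)))

    ∈-toList : ∀ {k} {x : P} (v : Vec P k) → x ∈ V.toList v → ∃ λ i → v !! i ≡ x
    ∈-toList (y ∷ v) (here e) = zero , sym e
    ∈-toList (y ∷ v) (there i) = let (j , e) = ∈-toList v i in suc j , e

    toList-∈ : ∀ {k} (v : Vec P k) i → v !! i ∈ V.toList v
    toList-∈ (y ∷ v) zero = here refl
    toList-∈ (y ∷ v) (suc i) = there (toList-∈ v i)

    free-inj : ∀ {k} (v : Vec P k) → FreeV v → ∀ {i j} → v !! i ≡ v !! j → i ≡ j
    free-inj (x ∷ v) (n , f) {zero} {zero} e = refl
    free-inj (x ∷ v) (n , f) {zero} {suc j} e = ⊥-elim (n (inj₁ (subst (_∈ V.toList v) (sym e) (toList-∈ v j))))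
    free-inj (x ∷ v) (n , f) {suc i} {zero} e = ⊥-elim (n (inj₁ (subst (_∈ V.toList v) e (toList-∈ v i))))
    free-inj (x ∷ v) (n , f) {suc i} {suc j} e = cong suc (free-inj v f e)

    free-ne : ∀ {k} (v : Vec P k) → FreeV v → ∀ {i j} → v !! i ≢ τ d (v !! j)
    free-ne (x ∷ v) (n , f) {zero} {zero} e = τ≢ x (sym e)
    free-ne (x ∷ v) (n , f) {zero} {suc j} e = n (inj₂ (subst (_∈ V.toList v) (trans (sym (ττ _)) (cong (τ d) (sym e))) (toList-∈ v j)))
    free-ne (x ∷ v) (n , f) {suc i} {zero} e = n (inj₂ (subst (_∈ V.toList v) e (toList-∈ v i)))
    free-ne (x ∷ v) (n , f) {suc i} {suc j} e = free-ne v f e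

    free-make : ∀ {k} (v : Vec P k) → (∀ {i j} → v !! i ≡ v !! j → i ≡ j) → (∀ {i j} → v !! i ≢ τ d (v !! j)) → FreeV v
    free-make [] _ _ = tt
    free-make (x ∷ v) inj ne =
      (λ { (inj₁ i) → let (j , e) = ∈-toList v i in case inj {suc j} {zero} e of λ ()
         ; (inj₂ i) → let (j , e) = ∈-toList v i in ne {suc j} {zero} e }) ,
      free-make v (λ {i} {j} e → F.suc-injective (inj {suc i} {suc j} e)) (λ {i} {j} → ne {suc i} {suc j})

  card-InB : Card (InB d) (dfact d)
  card-InB = card-subst count-d (card-map (λ v → V.tabulate (fromHalf (v !!_))) to inj onto (card-freeV d))
    where
    lt : ∀ v z → V.tabulate (fromHalf (v !!_)) !! z ≡ fromHalf (v !!_) z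
    lt v = VP.lookup∘tabulate (fromHalf (v !!_))
    to : ∀ {v} → FreeV v → InB d (V.tabulate (fromHalf (v !!_)))
    to {v} f = (λ i j e → fromHalf-inj (free-inj v f) (free-ne v f) (trans (sym (lt v i)) (trans e (lt v j)))) ,
      λ i → trans (lt v _) (trans (fromHalf-τ (v !!_) i) (cong (τ d) (sym (lt v i))))
    inj : ∀ {v v′ : Vec P d} → FreeV v → FreeV v′ → V.tabulate (fromHalf (v !!_)) ≡ V.tabulate (fromHalf (v′ !!_)) → v ≡ v′
    inj {v} {v′} _ _ e = vec-ext λ i → trans (sym (fromHalf-lo (v !!_) i)) (trans (sym (lt v _)) (trans (cong (_!! (i ↑ˡ d)) e)
      (trans (lt v′ _) (fromHalf-lo (v′ !!_) i))))
    onto : ∀ {α} → InB d α → ∃ λ v → FreeV v × V.tabulate (fromHalf (v !!_)) ≡ α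
    onto {α} (p , q) = v , free-make v
        (λ {i} {j} e → F.↑ˡ-injective d i j (p _ _ (trans (sym (lv i)) (trans e (lv j)))))
        (λ {i} {j} e → lo≢hi (p _ _ (trans (sym (lv i)) (trans e (trans (cong (τ d) (lv j)) (trans (sym (q _)) (cong (α !!_) (τi j)))))))) ,
      vec-ext (λ z → trans (lt v z) (go z))
      where
      v = V.tabulate (λ i → α !! (i ↑ˡ d))
      lv : ∀ i → v !! i ≡ α !! (i ↑ˡ d)
      lv = VP.lookup∘tabulate _
      go : ∀ z → fromHalf (v !!_) z ≡ α !! z
      go z with half z
      ... | lo i refl = trans (fromHalf-lo (v !!_) i) (lv i)
      ... | hi i refl = trans (fromHalf-hi (v !!_) i) (trans (cong (τ d) (lv i)) (trans (sym (q _)) (cong (α !!_) (τi i))))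

enumerate : ∀ {B : Set} {P : B → Set} {d} → Card P d → Σ[ at ∈ (Fin d → B) ]
  (∀ i → P (at i)) × (∀ {b} → P b → ∃ λ i → at i ≡ b) × (∀ {i j} → at i ≡ at j → i ≡ j)
enumerate (xs , l , refl) = L.lookup xs , (λ i → ∈⇒ l (∈-lookup {xs = xs} i)) ,
  (λ p → Any.index (⇒∈ l p) , sym (lookup-index (⇒∈ l p))) , λ {i} {j} → go xs (proj₁ l) i j
  where
  open import Data.List.Relation.Unary.Any.Properties using (lookup-index)
  go : ∀ xs → Unique xs → ∀ i j → L.lookup xs i ≡ L.lookup xs j → i ≡ j
  go (x ∷ xs) (x∉ ∷ u) zero zero e = refl
  go (x ∷ xs) (x∉ ∷ u) zero (suc j) e = ⊥-elim (All.lookup x∉ (∈-lookup {xs = xs} j) e)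
  go (x ∷ xs) (x∉ ∷ u) (suc i) zero e = ⊥-elim (All.lookup x∉ (∈-lookup {xs = xs} i) (sym e))
  go (x ∷ xs) (x∉ ∷ u) (suc i) (suc j) e = cong suc (go xs u i j e)

-- The state at level 0 is glued to the state at the last level by an equivariant permutation α.

module Loops (d : ℕ) {A V : Set} (ι : A → A) (w : A → ℕ) {n : ℕ} (Xs : Fin (suc n) → A → Set) (glue : A → A)
  (sN sF : Fin n → A → Maybe V) where

  open Tau d public
  open Labelled (τ d) ττ τ≢ {A} {V} ι w public

  private
    P = Fin (d + d)

  St = (P → P) × (P → A)
  D = Vec P (d + d) × Vec A (d + d)

  next : D → St → St
  next (η , l) (T , _) = conj (η !!_) T , (l !!_)

  open Chain next public

  Good : Fin (suc n) → St → Set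
  Good i (T , l) = State (Xs i) T l

  Val : Fin n → St → D → Set
  Val i (T , l) (η , l⁺) = Crossing (Xs (suc i)) (Xs (inject₁ i)) (sN i) (sF i) T l η l⁺

  Start = Vec P (d + d) × Vec A (d + d)

  start : Start → St
  start (σ , l) = (σ !!_) , (l !!_)

  record Loop (z : (Start × Vec D n) × Vec P (d + d)) : Set where
    s = proj₁ (proj₁ z)
    δs = proj₂ (proj₁ z)
    α = proj₂ z
    field
      initial : Good (fromℕ n) (start s)
      steps : ∀ i → Val i (run δs (start s) (suc i)) (δs !! i)
      α-B : InB d α
      α-T : ∀ p → proj₁ (run δs (start s) zero) (α !! p) ≡ α !! (proj₁ s !! p)
      α-l : ∀ p → proj₂ (run δs (start s) zero) (α !! p) ≡ glue (proj₂ s !! p)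

    good : ∀ i → Good i (run δs (start s) i)
    good = run-good Good δs (start s) initial (λ i _ → Crossing.far (steps i))

record Frame (d : ℕ) : Set₁ where
  field
    p₀ : Fin (d + d)
    {A V} : Set
    _≟A_ : DecidableEquality A
    ι : A → A
    ιι : ∀ a → ι (ι a) ≡ a
    w : A → ℕ
    w-ι : ∀ a → w (ι a) ≡ w a
    X Pos : A → Set
    X-ι : ∀ {a} → X a → X (ι a)
    pos? : ∀ {a} → X a → Pos a ⊎ Pos (ι a)
    pos! : ∀ {a} → Pos a → ¬ Pos (ι a)
    1≤w : ∀ {a} → X a → 1 ≤ w a
    base-points : Card (λ ar → (X (proj₁ ar) × Pos (proj₁ ar)) × proj₂ ar < w (proj₁ ar)) d

module Framing {d : ℕ} (Z : Frame d) where

  open Frame Z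
  open Tau d
  open Labelled (τ d) ττ τ≢ {A} {V} ι w

  private
    P = Fin (d + d)

    at : Fin d → A × ℕ
    at = proj₁ (enumerate base-points)

    at∈ : ∀ i → (X (proj₁ (at i)) × Pos (proj₁ (at i))) × proj₂ (at i) < w (proj₁ (at i))
    at∈ = proj₁ (proj₂ (enumerate base-points))

    idx : ∀ {ar} → (X (proj₁ ar) × Pos (proj₁ ar)) × proj₂ ar < w (proj₁ ar) → ∃ λ i → at i ≡ ar
    idx = proj₁ (proj₂ (proj₂ (enumerate base-points)))

    at-inj : ∀ {i j} → at i ≡ at j → i ≡ j
    at-inj = proj₂ (proj₂ (proj₂ (enumerate base-points)))

    lab : Fin d → A
    lab i = proj₁ (at i)

    res : Fin d → ℕ
    res i = proj₂ (at i)

    up : ∀ i → ∃ λ j → lab j ≡ lab i × ((suc (res i) < w (lab i) × res j ≡ suc (res i)) ⊎ (suc (res i) ≡ w (lab i) × res j ≡ 0))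
    up i with m≤n⇒m<n∨m≡n (proj₂ (at∈ i))
    ... | inj₁ lt = let (j , e) = idx (proj₁ (at∈ i) , lt) in j , cong proj₁ e , inj₁ (lt , cong proj₂ e)
    ... | inj₂ eq = let (j , e) = idx (proj₁ (at∈ i) , 1≤w (proj₁ (proj₁ (at∈ i)))) in j , cong proj₁ e , inj₂ (eq , cong proj₂ e)

    ↑ : Fin d → Fin d
    ↑ i = proj₁ (up i)

    at-≡ : ∀ {i j} → lab i ≡ lab j → res i ≡ res j → i ≡ j
    at-≡ e e′ = at-inj (cong₂ _,_ e e′)

    ↑-inj : ∀ {i j} → ↑ i ≡ ↑ j → i ≡ j
    ↑-inj {i} {j} e = go (proj₂ (up i)) (proj₂ (up j))
      where
      go : lab (↑ i) ≡ lab i × ((suc (res i) < w (lab i) × res (↑ i) ≡ suc (res i)) ⊎ (suc (res i) ≡ w (lab i) × res (↑ i) ≡ 0)) →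
           lab (↑ j) ≡ lab j × ((suc (res j) < w (lab j) × res (↑ j) ≡ suc (res j)) ⊎ (suc (res j) ≡ w (lab j) × res (↑ j) ≡ 0)) → i ≡ j
      go (a , r) (b , s) with trans (sym a) (trans (cong lab e) b)
      ... | le with r | s
      ... | inj₁ (_ , p) | inj₁ (_ , q) = at-≡ le (suc-injective (trans (sym p) (trans (cong res e) q)))
      ... | inj₂ (p , _) | inj₂ (q , _) = at-≡ le (suc-injective (trans p (trans (cong w le) (sym q))))
      ... | inj₁ (_ , p) | inj₂ (_ , q) = case trans (sym p) (trans (cong res e) q) of λ ()
      ... | inj₂ (_ , p) | inj₁ (_ , q) = case trans (sym q) (trans (cong res (sym e)) p) of λ ()

    ↓ : Fin d → Fin d
    ↓ = inverse ↑

    ↑↓ : ∀ i → ↑ (↓ i) ≡ i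
    ↑↓ = inverse-r ↑-inj

    ↓↑ : ∀ i → ↓ (↑ i) ≡ i
    ↓↑ = inverse-l ↑-inj

  T₀ : P → P
  T₀ z = [ (λ i → ↑ i ↑ˡ d) , (λ i → d ↑ʳ ↓ i) ]′ (splitAt d z)

  l₀ : P → A
  l₀ z = [ lab , ι ∘ lab ]′ (splitAt d z)

  private
    T-lo : ∀ i → T₀ (i ↑ˡ d) ≡ ↑ i ↑ˡ d
    T-lo i = cong [ (λ i → ↑ i ↑ˡ d) , (λ i → d ↑ʳ ↓ i) ]′ (F.splitAt-↑ˡ d i d)

    T-hi : ∀ i → T₀ (d ↑ʳ i) ≡ d ↑ʳ ↓ i
    T-hi i = cong [ (λ i → ↑ i ↑ˡ d) , (λ i → d ↑ʳ ↓ i) ]′ (F.splitAt-↑ʳ d d i)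

    l-lo : ∀ i → l₀ (i ↑ˡ d) ≡ lab i
    l-lo i = cong [ lab , ι ∘ lab ]′ (F.splitAt-↑ˡ d i d)

    l-hi : ∀ i → l₀ (d ↑ʳ i) ≡ ι (lab i)
    l-hi i = cong [ lab , ι ∘ lab ]′ (F.splitAt-↑ʳ d d i)

    t₀ : TwPerm T₀
    t₀ = record { inj = inj ; tw = tw ; nf = nf }
      where
      inj : Inj T₀
      inj {x} {y} e with half x | half y
      ... | lo i refl | lo j refl = cong (_↑ˡ d) (↑-inj (F.↑ˡ-injective d _ _ (trans (sym (T-lo i)) (trans e (T-lo j)))))
      ... | hi i refl | hi j refl = cong (d ↑ʳ_) (inverse-inj ↑-inj (F.↑ʳ-injective d _ _ (trans (sym (T-hi i)) (trans e (T-hi j)))))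
      ... | lo i refl | hi j refl = ⊥-elim (lo≢hi (trans (sym (T-lo i)) (trans e (T-hi j))))
      ... | hi i refl | lo j refl = ⊥-elim (lo≢hi (trans (sym (T-lo j)) (trans (sym e) (T-hi i))))
      tw : ∀ z → τ d (T₀ (τ d (T₀ z))) ≡ z
      tw z with half z
      ... | lo i refl = trans (cong (τ d ∘ T₀ ∘ τ d) (T-lo i)) (trans (cong (τ d ∘ T₀) (τi _)) (trans (cong (τ d) (T-hi _)) (trans (τj _) (cong (_↑ˡ d) (↓↑ i)))))
      ... | hi i refl = trans (cong (τ d ∘ T₀ ∘ τ d) (T-hi i)) (trans (cong (τ d ∘ T₀) (τj _)) (trans (cong (τ d) (T-lo _)) (trans (τi _) (cong (d ↑ʳ_) (↑↓ i)))))
      nf : ∀ z → T₀ z ≢ τ d z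
      nf z e with half z
      ... | lo i refl = lo≢hi (trans (sym (T-lo i)) (trans e (τi i)))
      ... | hi i refl = lo≢hi (sym (trans (sym (T-hi i)) (trans e (τj i))))

    climb : ∀ b → res b ≡ 0 → ∀ k → k < w (lab b) → ∃ λ j → lab j ≡ lab b × res j ≡ k × it T₀ k (b ↑ˡ d) ≡ j ↑ˡ d
    climb b r0 zero _ = b , refl , r0 , refl
    climb b r0 (suc k) lt with climb b r0 k (<-trans (n<1+n k) lt)
    ... | j , lj , rj , e with up j | T-lo j
    ... | u , lu , inj₁ (_ , ru) | T≡ = u , trans lu lj , trans ru (cong suc rj) , trans (cong T₀ e) T≡
    ... | u , lu , inj₂ (eq , ru) | T≡ = ⊥-elim (<⇒≢ lt (trans (cong suc (sym rj)) (trans eq (cong w lj))))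

    base-per : ∀ b → res b ≡ 0 → Per T₀ (b ↑ˡ d) (w (lab b))
    base-per b r0 = 1≤w (proj₁ (proj₁ (at∈ b))) , cyc (w (lab b)) refl , min
      where
      cyc : ∀ m → m ≡ w (lab b) → it T₀ m (b ↑ˡ d) ≡ b ↑ˡ d
      cyc zero _ = refl
      cyc (suc m) eq with climb b r0 m (≤-reflexive eq)
      ... | j , lj , rj , e with up j | T-lo j
      ... | u , lu , inj₁ (lt , ru) | T≡ = ⊥-elim (<⇒≢ lt (trans (cong suc rj) (trans eq (cong w (sym lj)))))
      ... | u , lu , inj₂ (_ , ru) | T≡ = trans (cong T₀ e) (trans T≡ (cong (_↑ˡ d) (at-≡ (trans lu lj) (trans ru (sym r0)))))
      min : ∀ k → 1 ≤ k → k < w (lab b) → it T₀ k (b ↑ˡ d) ≢ b ↑ˡ d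
      min k 1≤k k< e with climb b r0 k k<
      ... | j , lj , rj , e′ with F.↑ˡ-injective d _ _ (trans (sym e′) e)
      ... | refl = <⇒≢ 1≤k (trans (sym r0) rj)

    from-base : ∀ i → ∃ λ b → res b ≡ 0 × lab b ≡ lab i × Cyc T₀ (b ↑ˡ d) (i ↑ˡ d)
    from-base i with idx {lab i , 0} (proj₁ (at∈ i) , 1≤w (proj₁ (proj₁ (at∈ i))))
    ... | b , e with climb b (cong proj₂ e) (res i) (subst (λ a → res i < w a) (sym (cong proj₁ e)) (proj₂ (at∈ i)))
    ... | j , lj , rj , ej = b , cong proj₂ e , cong proj₁ e , res i , trans ej (cong (_↑ˡ d) (at-≡ (trans lj (cong proj₁ e)) rj))

  standard : State X T₀ l₀
  standard = record
    { twp = t₀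
    ; l∈ = λ z → case half z of λ { (lo i refl) → subst X (sym (l-lo i)) (x i) ; (hi i refl) → subst X (sym (l-hi i)) (X-ι (x i)) }
    ; l-T = lT ; l-τ = lτ ; l-cyc = lcyc ; l-per = lper
    ; l-onto = onto }
    where
    open TwPerm t₀
    x : ∀ i → X (lab i)
    x i = proj₁ (proj₁ (at∈ i))
    lT : ∀ z → l₀ (T₀ z) ≡ l₀ z
    lT z with half z
    ... | lo i refl = trans (cong l₀ (T-lo i)) (trans (l-lo _) (trans (proj₁ (proj₂ (up i))) (sym (l-lo i))))
    ... | hi i refl = trans (cong l₀ (T-hi i)) (trans (l-hi _) (trans (cong ι (trans (sym (proj₁ (proj₂ (up (↓ i))))) (cong lab (↑↓ i)))) (sym (l-hi i))))
    lτ : ∀ z → l₀ (τ d z) ≡ ι (l₀ z)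
    lτ z with half z
    ... | lo i refl = trans (cong l₀ (τi i)) (trans (l-hi i) (cong ι (sym (l-lo i))))
    ... | hi i refl = trans (cong l₀ (τj i)) (trans (l-lo i) (trans (sym (ιι _)) (cong ι (sym (l-hi i)))))
    cyc-lo : ∀ {i j} → lab i ≡ lab j → Cyc T₀ (i ↑ˡ d) (j ↑ˡ d)
    cyc-lo {i} {j} e with from-base i | from-base j
    ... | b , rb , lb , c | b′ , rb′ , lb′ , c′ with at-≡ (trans lb (trans e (sym lb′))) (trans rb (sym rb′))
    ... | refl = cyc-trans (cyc-sym inj c) c′
    ι-inj : ∀ {a b} → ι a ≡ ι b → a ≡ b
    ι-inj e = trans (sym (ιι _)) (trans (cong ι e) (ιι _))
    mixed : ∀ {i j} → lab i ≢ ι (lab j)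
    mixed {i} {j} e = pos! (proj₂ (proj₁ (at∈ j))) (subst Pos e (proj₂ (proj₁ (at∈ i))))
    lcyc : ∀ {p q} → l₀ p ≡ l₀ q → Cyc T₀ p q
    lcyc {p} {q} e with half p | half q
    ... | lo i refl | lo j refl = cyc-lo (trans (sym (l-lo i)) (trans e (l-lo j)))
    ... | hi i refl | hi j refl = subst (λ z → Cyc T₀ z (d ↑ʳ j)) (τi i) (subst (Cyc T₀ _) (τi j)
          (cyc-τ (cyc-lo (ι-inj (trans (sym (l-hi i)) (trans e (l-hi j)))))))
    ... | lo i refl | hi j refl = ⊥-elim (mixed (trans (sym (l-lo i)) (trans e (l-hi j))))
    ... | hi i refl | lo j refl = ⊥-elim (mixed (trans (sym (l-lo j)) (trans (sym e) (l-hi i))))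
    per-lo : ∀ i → Per T₀ (i ↑ˡ d) (w (lab i))
    per-lo i with from-base i
    ... | b , rb , lb , c = subst (λ a → Per T₀ (i ↑ˡ d) (w a)) lb (per-cyc inj c (base-per b rb))
    lper : ∀ z → Per T₀ z (w (l₀ z))
    lper z with half z
    ... | lo i refl = subst (λ a → Per T₀ (i ↑ˡ d) (w a)) (sym (l-lo i)) (per-lo i)
    ... | hi i refl = subst (Per T₀ (d ↑ʳ i)) (trans (sym (w-ι _)) (cong w (sym (l-hi i)))) (subst (λ y → Per T₀ y (w (lab i))) (τi i) (per-τ (per-lo i)))
    onto : ∀ {a} → X a → ∃ λ p → l₀ p ≡ a
    onto xa with pos? xa
    ... | inj₁ pa = let (i , e) = idx ((xa , pa) , 1≤w xa) in i ↑ˡ d , trans (l-lo i) (cong proj₁ e)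
    ... | inj₂ pa = let (i , e) = idx ((X-ι xa , pa) , 1≤w (X-ι xa)) in d ↑ʳ i , trans (l-hi i) (trans (cong (ι ∘ proj₁) e) (ιι _))

  private
    base-aux : ∀ {l : P → A} {a} → Dec (∃ λ p → l p ≡ a) → P
    base-aux (yes (p , _)) = p
    base-aux (no _) = p₀

    base : (P → A) → A → P
    base l a = base-aux (F.any? (λ p → l p ≟A a))

    g : (P → P) → (P → A) → Fin d → P
    g T l i = it T (res i) (base l (lab i))

  -- It depends on the data T and l only, not on the proof that they form a state.
  frame : (P → P) → (P → A) → P → P
  frame T l = fromHalf (g T l)

  frame-τ : ∀ {T l} z → frame T l (τ d z) ≡ τ d (frame T l z)
  frame-τ {T} {l} = fromHalf-τ (g T l)

  module _ {T : P → P} {l : P → A} (st : State X T l) where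
    open State st

    private
      l-base : ∀ {a} → X a → l (base l a) ≡ a
      l-base {a} xa with F.any? (λ p → l p ≟A a)
      ... | yes (p , e) = e
      ... | no n = ⊥-elim (n (l-onto xa))

      l-g : ∀ i → l (g T l i) ≡ lab i
      l-g i = trans (sym (cyc-l (res i , refl))) (l-base (proj₁ (proj₁ (at∈ i))))

      g-up : ∀ i → g T l (↑ i) ≡ T (g T l i)
      g-up i with up i
      ... | u , lu , inj₁ (_ , ru) = cong₂ (λ k a → it T k (base l a)) ru lu
      ... | u , lu , inj₂ (eq , ru) = trans (cong₂ (λ k a → it T k (base l a)) ru lu)
              (sym (subst (λ k → it T k (base l (lab i)) ≡ base l (lab i)) (sym eq)
                (proj₁ (proj₂ (subst (λ a → Per T (base l (lab i)) (w a)) (l-base (proj₁ (proj₁ (at∈ i)))) (l-per (base l (lab i))))))))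

    frame-inj : Inj (frame T l)
    frame-inj = fromHalf-inj
      (λ {i} {j} e → g-inj (trans (sym (l-g i)) (trans (cong l e) (l-g j))) e)
      (λ {i} {j} e → pos! (proj₂ (proj₁ (at∈ j))) (subst Pos (trans (sym (l-g i)) (trans (cong l e) (trans (l-τ _) (cong ι (l-g j))))) (proj₂ (proj₁ (at∈ i)))))
      where
      g-inj : ∀ {i j} → lab i ≡ lab j → g T l i ≡ g T l j → i ≡ j
      g-inj {i} {j} le e = at-≡ le (per-inj inj pb (proj₂ (at∈ i)) (subst (λ a → res j < w a) (sym le) (proj₂ (at∈ j)))
          (trans e (cong (λ a → it T (res j) (base l a)) (sym le))))
        where
        pb : Per T (base l (lab i)) (w (lab i))
        pb = subst (λ a → Per T (base l (lab i)) (w a)) (l-base (proj₁ (proj₁ (at∈ i)))) (l-per (base l (lab i)))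

    frame-T : ∀ z → frame T l (T₀ z) ≡ T (frame T l z)
    frame-T z with half z
    ... | lo i refl = trans (cong (frame T l) (T-lo i)) (trans (fromHalf-lo _ _) (trans (g-up i) (cong T (sym (fromHalf-lo _ i)))))
    ... | hi i refl = trans (cong (frame T l) (T-hi i)) (trans (fromHalf-hi _ _)
          (trans (sym (tw₁ _)) (cong T (trans (cong (τ d) (trans (sym (g-up (↓ i))) (cong (g T l) (↑↓ i)))) (sym (fromHalf-hi _ i))))))

    frame-l : ∀ z → l (frame T l z) ≡ l₀ z
    frame-l z with half z
    ... | lo i refl = trans (cong l (fromHalf-lo _ i)) (trans (l-g i) (sym (l-lo i)))
    ... | hi i refl = trans (cong l (fromHalf-hi _ i)) (trans (l-τ _) (trans (cong ι (l-g i)) (sym (l-hi i))))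

  module _ {β : P → P} (βinj : Inj β) (βτ : ∀ z → β (τ d z) ≡ τ d (β z)) where

    private
      β⁻ = inverse β
      r = inverse-r βinj
      li = inverse-l βinj

    transport-T : P → P
    transport-T z = β (T₀ (β⁻ z))

    transport-l : P → A
    transport-l z = l₀ (β⁻ z)

    private
      it-tr : ∀ k z → it transport-T k z ≡ β (it T₀ k (β⁻ z))
      it-tr zero z = sym (r z)
      it-tr (suc k) z = cong (β ∘ T₀) (trans (cong β⁻ (it-tr k z)) (li _))

      β⁻τ : ∀ z → β⁻ (τ d z) ≡ τ d (β⁻ z)
      β⁻τ z = βinj (trans (r _) (sym (trans (βτ _) (cong (τ d) (r z)))))

    transport : State X transport-T transport-l
    transport = record
      { twp = record
        { inj = λ e → inverse-inj βinj (inj (βinj e))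
        ; tw = λ z → trans (cong (λ u → τ d (β (T₀ u))) (trans (β⁻τ _) (cong (τ d) (li _))))
            (trans (sym (βτ _)) (trans (cong β (tw (β⁻ z))) (r z)))
        ; nf = λ z e → nf (β⁻ z) (βinj (trans e (trans (cong (τ d) (sym (r z))) (sym (βτ _))))) }
      ; l∈ = λ z → l∈ (β⁻ z)
      ; l-T = λ z → trans (cong l₀ (li _)) (l-T (β⁻ z))
      ; l-τ = λ z → trans (cong l₀ (β⁻τ z)) (l-τ (β⁻ z))
      ; l-cyc = λ {p} {q} e → let (k , ek) = l-cyc e in k , trans (it-tr k p) (trans (cong β ek) (r q))
      ; l-per = λ z → let (a , b , c) = l-per (β⁻ z) in a , trans (it-tr (w (l₀ (β⁻ z))) z) (trans (cong β b) (r z)) ,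
          λ k p q e → c k p q (βinj (trans (sym (it-tr k z)) (trans e (sym (r z)))))
      ; l-onto = λ xa → let (p , e) = l-onto xa in β p , trans (cong l₀ (li p)) e }
      where open State standard

  -- Replacing α by the equivariant permutation which carries the standard state to the last one makes all choices independent.
  record Gluing : Set₁ where
    field
      {n} : ℕ
      Xs : Fin (suc n) → A → Set
      last≡ : ∀ {a} → Xs (fromℕ n) a → X a
      ≡last : ∀ {a} → X a → Xs (fromℕ n) a
      glue unglue : A → A
      unglue-X : ∀ {a} → Xs zero a → X (unglue a)
      glue-X : ∀ {a} → X a → Xs zero (glue a)
      glue-unglue : ∀ {a} → Xs zero a → glue (unglue a) ≡ a
      unglue-glue : ∀ {a} → X a → unglue (glue a) ≡ a
      unglue-ι : ∀ {a} → Xs zero a → unglue (ι a) ≡ ι (unglue a)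
      w-unglue : ∀ {a} → Xs zero a → w (unglue a) ≡ w a
      sN sF : Fin n → A → Maybe V
      K : Fin n → ℕ
      local : ∀ i {T l} → State (Xs (suc i)) T l →
        Card (λ ηl → Crossing (Xs (suc i)) (Xs (inject₁ i)) (sN i) (sF i) T l (proj₁ ηl) (proj₂ ηl)) (K i)

  module Closed (Y : Gluing) where

    open Gluing Y

    open Loops d {A} {V} ι w Xs glue sN sF using (St; D; next; Good; Val; Start; start; Loop; module Loop; run; run-good; card-chain)

    private
      state-X : ∀ {X X′ : A → Set} {T l} → (∀ {a} → X a → X′ a) → (∀ {a} → X′ a → X a) → State X T l → State X′ T l
      state-X f g s = record { State s ; l∈ = λ p → f (State.l∈ s p) ; l-onto = λ xa → State.l-onto s (g xa) }

      unglued : ∀ {T l} → Good zero (T , l) → State X T (unglue ∘ l)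
      unglued {T} {l} s = record
        { twp = twp
        ; l∈ = λ p → unglue-X (l∈ p)
        ; l-T = λ p → cong unglue (l-T p)
        ; l-τ = λ p → trans (cong unglue (l-τ p)) (unglue-ι (l∈ p))
        ; l-cyc = λ e → l-cyc (trans (sym (glue-unglue (l∈ _))) (trans (cong glue e) (glue-unglue (l∈ _))))
        ; l-per = λ p → subst (Per T p) (sym (w-unglue (l∈ p))) (l-per p)
        ; l-onto = λ xa → let (p , e) = l-onto (glue-X xa) in p , trans (cong unglue e) (unglue-glue xa) }
        where open State s

      module B (β : Vec P (d + d)) (b : InB d β) where
        inj : Inj (β !!_)
        inj = proj₁ b _ _
        eqv : ∀ z → β !! τ d z ≡ τ d (β !! z)
        eqv = proj₂ b

      st : Vec P (d + d) → Start
      st β = V.tabulate (λ z → β !! T₀ (inverse (β !!_) z)) , V.tabulate (λ z → l₀ (inverse (β !!_) z))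

      st₁ : ∀ β z → proj₁ (st β) !! z ≡ β !! T₀ (inverse (β !!_) z)
      st₁ β = VP.lookup∘tabulate _

      st₂ : ∀ β z → proj₂ (st β) !! z ≡ l₀ (inverse (β !!_) z)
      st₂ β = VP.lookup∘tabulate _

      st-good : ∀ {β} → InB d β → Good (fromℕ n) (start (st β))
      st-good {β} b = state-X ≡last last≡ (state-cong (sym ∘ st₁ β) (sym ∘ st₂ β) (transport (B.inj β b) (B.eqv β b)))

      Γ : St → P → P
      Γ (T , l) = frame T (unglue ∘ l)

      Φ : Vec P (d + d) × Vec D n → (Start × Vec D n) × Vec P (d + d)
      Φ (β , δs) = (st β , δs) , V.tabulate (λ z → Γ (run δs (start (st β)) zero) (inverse (β !!_) z))

      Dom : Vec P (d + d) × Vec D n → Set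
      Dom (β , δs) = InB d β × (∀ i → Val i (run δs (start (st β)) (suc i)) (δs !! i))

      Φ-loop : ∀ {q} → Dom q → Loop (Φ q)
      Φ-loop {β , δs} (b , vs) = record
        { initial = st-good {β} b
        ; steps = vs
        ; α-B = (λ i j e → inverse-inj (B.inj β b) (frame-inj S (trans (sym (αz i)) (trans e (αz j))))) ,
            λ z → trans (αz _) (trans (cong γ (β⁻τ z)) (trans (frame-τ _) (cong (τ d) (sym (αz z)))))
        ; α-T = λ p → trans (cong T (αz p)) (trans (sym (frame-T S _))
            (sym (trans (cong (proj₂ (Φ (β , δs)) !!_) (st₁ β p)) (trans (αz _) (cong γ (inverse-l (B.inj β b) _))))))
        ; α-l = λ p → trans (cong l (αz p)) (trans (sym (glue-unglue (State.l∈ G _)))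
            (cong glue (trans (frame-l S _) (sym (st₂ β p))))) }
        where
        G : Good zero (run δs (start (st β)) zero)
        G = run-good Good δs (start (st β)) (st-good {β} b) (λ i _ → Crossing.far (vs i)) zero
        T = proj₁ (run δs (start (st β)) zero)
        l = proj₂ (run δs (start (st β)) zero)
        S : State X T (unglue ∘ l)
        S = unglued G
        γ = Γ (T , l)
        αz : ∀ z → proj₂ (Φ (β , δs)) !! z ≡ γ (inverse (β !!_) z)
        αz = VP.lookup∘tabulate _
        β⁻τ : ∀ z → inverse (β !!_) (τ d z) ≡ τ d (inverse (β !!_) z)
        β⁻τ z = B.inj β b (trans (inverse-r (B.inj β b) _) (sym (trans (B.eqv β b _) (cong (τ d) (inverse-r (B.inj β b) z)))))

      Φ-inj : ∀ {q q′} → Dom q → Dom q′ → Φ q ≡ Φ q′ → q ≡ q′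
      Φ-inj {β , δs} {β′ , δs′} (b , vs) (b′ , vs′) e with cong (proj₂ ∘ proj₁) e
      ... | refl = cong (_, δs) (vec-ext λ z → sym (trans (cong (β′ !!_) (h z)) (inverse-r (B.inj β′ b′) _)))
        where
        G : ∀ {β} → InB d β → (∀ i → Val i (run δs (start (st β)) (suc i)) (δs !! i)) → Good zero (run δs (start (st β)) zero)
        G {β} b vs = run-good Good δs (start (st β)) (st-good {β} b) (λ i _ → Crossing.far (vs i)) zero
        γ = Γ (run δs (start (st β)) zero)
        γ≡ : ∀ z → γ z ≡ Γ (run δs (start (st β′)) zero) z
        γ≡ z = cong (λ q → Γ (run δs (start q) zero) z) (cong (proj₁ ∘ proj₁) e)
        same : ∀ z → γ (inverse (β !!_) z) ≡ γ (inverse (β′ !!_) z)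
        same z = trans (sym (VP.lookup∘tabulate _ z)) (trans (cong (λ q → proj₂ q !! z) e) (trans (VP.lookup∘tabulate _ z) (sym (γ≡ _))))
        h : ∀ z → z ≡ inverse (β′ !!_) (β !! z)
        h z = trans (sym (inverse-l (B.inj β b) z)) (frame-inj (unglued (G {β} b vs)) (same (β !! z)))

      Φ-onto : ∀ {z} → Loop z → ∃ λ q → Dom q × Φ q ≡ z
      Φ-onto {((σ , l) , δs) , α} L = (β , δs) , (bB , vs) , cong₂ _,_ (cong (_, δs) st≡) α≡
        where
        open Loop L using (initial; steps; α-B; α-T; α-l; good)
        t = run δs (start (σ , l)) zero
        γ = Γ t
        S : State X (proj₁ t) (unglue ∘ proj₂ t)
        S = unglued (good zero)
        α⁻ = inverse (α !!_)
        αr : ∀ z → α !! α⁻ z ≡ z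
        αr = inverse-r (B.inj α α-B)
        β = V.tabulate (λ z → α⁻ (γ z))
        βz : ∀ z → β !! z ≡ α⁻ (γ z)
        βz = VP.lookup∘tabulate _
        αβ : ∀ z → α !! (β !! z) ≡ γ z
        αβ z = trans (cong (α !!_) (βz z)) (αr _)
        bB : InB d β
        bB = (λ i j e → frame-inj S (trans (sym (αβ i)) (trans (cong (α !!_) e) (αβ j)))) ,
          λ z → B.inj α α-B (trans (αβ _) (trans (frame-τ z) (trans (cong (τ d) (sym (αβ z))) (sym (B.eqv α α-B _)))))
        β⁻ = inverse (β !!_)
        α-γ : ∀ z → α !! z ≡ γ (β⁻ z)
        α-γ z = trans (cong (α !!_) (sym (inverse-r (B.inj β bB) z))) (αβ _)
        st≡ : st β ≡ (σ , l)
        st≡ = cong₂ _,_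
          (vec-ext λ z → trans (st₁ β z) (B.inj α α-B (trans (αβ _) (trans (frame-T S _) (trans (cong (proj₁ t) (sym (α-γ z))) (α-T z))))))
          (vec-ext λ z → trans (st₂ β z) (trans (sym (frame-l S _)) (trans (cong (unglue ∘ proj₂ t) (sym (α-γ z)))
            (trans (cong unglue (α-l z)) (unglue-glue (last≡ (State.l∈ initial z)))))))
        vs : ∀ i → Val i (run δs (start (st β)) (suc i)) (δs !! i)
        vs i = subst (λ q → Val i (run δs (start q) (suc i)) (δs !! i)) (sym st≡) (steps i)
        α≡ : V.tabulate (λ z → Γ (run δs (start (st β)) zero) (β⁻ z)) ≡ α
        α≡ = vec-ext λ z → trans (VP.lookup∘tabulate _ z) (trans (cong (λ q → Γ (run δs (start q) zero) (β⁻ z)) st≡) (sym (α-γ z)))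

    card-loops : Card Loop (dfact d * prodFin K)
    card-loops = card-map {P = Dom} {Q = Loop} Φ (λ {q} → Φ-loop {q}) (λ {q} {q′} → Φ-inj {q} {q′}) Φ-onto
      (card-Σ {P = InB d} {Q = λ β δs → ∀ i → Val i (run δs (start (st β)) (suc i)) (δs !! i)} card-InB
        (λ {β} b → card-chain Good Val K (λ _ → Crossing.far) (λ {i} → local i) (st-good {β} b)))

-- The arcs of a cover

<ᵇ-1 : ∀ {m n} → m < n → [ m <ᵇ n ]ᵇ ≡ 1
<ᵇ-1 {m} {n} l with m <ᵇ n | <⇒<ᵇ l
... | true | _ = refl

<ᵇ-0 : ∀ {m n} → ¬ m < n → [ m <ᵇ n ]ᵇ ≡ 0
<ᵇ-0 {m} {n} l with m <ᵇ n in eq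
... | true = ⊥-elim (l (<ᵇ⇒< m n (subst Data.Bool.T (sym eq) tt)))
... | false = refl

pick : ∀ {P A : Set} → Dec P → A → Maybe A
pick (yes _) a = just a
pick (no _) a = nothing

pick-yes : ∀ {P A : Set} (D : Dec P) {a : A} → P → pick D a ≡ just a
pick-yes (yes _) p = refl
pick-yes (no n) p = ⊥-elim (n p)

pick-no : ∀ {P A : Set} (D : Dec P) {a : A} → ¬ P → pick D a ≡ nothing
pick-no (yes p) n = ⊥-elim (n p)
pick-no (no _) n = refl

pick-just : ∀ {P A : Set} (D : Dec P) {a b : A} → pick D a ≡ just b → P × a ≡ b
pick-just (yes p) refl = p , refl

pick-nothing : ∀ {P A : Set} (D : Dec P) {a : A} → pick D a ≡ nothing → ¬ P
pick-nothing (no n) _ = n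

-- The circle E is cut in the arc between the last and the first branch point, and an edge is followed from its source:
-- (e , j) is the part of e which lies on the circle after e has crossed the cut j times.
-- Level inject₁ i is just before the branch point i, and level suc i is just after it.
module Arcs {n : ℕ} (c : TCover n) where

  open TCover c public

  Arc : Set
  Arc = Fin nE × ℕ

  _≟A_ : DecidableEquality Arc
  _≟A_ = ×-≡-dec _≟_ _≟ℕ_

  ιA : Arc → Arc
  ιA (e , j) = ιE e , j

  wA : Arc → ℕ
  wA (e , _) = wt e

  ps pt : Fin nE → ℕ
  ps e = toℕ (pos (src e))
  pt e = toℕ (pos (tgt e))

  cross : Fin nE → ℕ
  cross e = wind e + [ pt e <ᵇ ps e ]ᵇ

  Xs : Fin (suc n) → Arc → Set
  Xs i (e , j) = (1 ≤ j ⊎ ps e < toℕ i) × (j < cross e ⊎ (j ≡ cross e × toℕ i ≤ pt e))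

  endV startV : Fin n → Arc → Maybe (Fin nV)
  endV i (e , j) = pick ((j ≟ℕ cross e) ×-dec (pos (tgt e) ≟ i)) (tgt e)
  startV i (e , j) = pick ((j ≟ℕ 0) ×-dec (pos (src e) ≟ i)) (src e)

  glue unglue : Arc → Arc
  glue (e , j) = e , suc j
  unglue (e , j) = e , j ∸ 1

  startV-yes : ∀ {i e} → pos (src e) ≡ i → startV i (e , 0) ≡ just (src e)
  startV-yes p = pick-yes _ (refl , p)

  startV-just : ∀ {i a v} → startV i a ≡ just v → proj₂ a ≡ 0 × src (proj₁ a) ≡ v × pos v ≡ i
  startV-just {i} {e , j} eq with pick-just ((j ≟ℕ 0) ×-dec (pos (src e) ≟ i)) eq
  ... | (p , q) , refl = p , refl , q

  startV-no : ∀ {i a} → startV i a ≡ nothing → proj₂ a ≡ 0 → pos (src (proj₁ a)) ≢ i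
  startV-no {i} {e , j} eq p q = pick-nothing ((j ≟ℕ 0) ×-dec (pos (src e) ≟ i)) eq (p , q)

  startV-nothing : ∀ {i a} → ¬ (proj₂ a ≡ 0 × pos (src (proj₁ a)) ≡ i) → startV i a ≡ nothing
  startV-nothing {i} {e , j} n = pick-no ((j ≟ℕ 0) ×-dec (pos (src e) ≟ i)) n

  endV-yes : ∀ {i e} → pos (tgt e) ≡ i → endV i (e , cross e) ≡ just (tgt e)
  endV-yes p = pick-yes _ (refl , p)

  endV-just : ∀ {i a v} → endV i a ≡ just v → proj₂ a ≡ cross (proj₁ a) × tgt (proj₁ a) ≡ v × pos v ≡ i
  endV-just {i} {e , j} eq with pick-just ((j ≟ℕ cross e) ×-dec (pos (tgt e) ≟ i)) eq
  ... | (p , q) , refl = p , refl , q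

  endV-no : ∀ {i a} → endV i a ≡ nothing → proj₂ a ≡ cross (proj₁ a) → pos (tgt (proj₁ a)) ≢ i
  endV-no {i} {e , j} eq p q = pick-nothing ((j ≟ℕ cross e) ×-dec (pos (tgt e) ≟ i)) eq (p , q)

  endV-nothing : ∀ {i a} → ¬ (proj₂ a ≡ cross (proj₁ a) × pos (tgt (proj₁ a)) ≡ i) → endV i a ≡ nothing
  endV-nothing {i} {e , j} n = pick-no ((j ≟ℕ cross e) ×-dec (pos (tgt e) ≟ i)) n

  pass→ : ∀ {i a} → Xs (suc i) a → startV i a ≡ nothing → Xs (inject₁ i) a × endV i a ≡ nothing
  pass→ {i} {e , j} (x , y) s = (x′ x , y′ y) , endV-nothing {a = e , j} (λ (p , q) → no-end p q y)
    where
    ti = F.toℕ-inject₁ i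
    x′ : 1 ≤ j ⊎ ps e < suc (toℕ i) → 1 ≤ j ⊎ ps e < toℕ (inject₁ i)
    x′ (inj₁ p) = inj₁ p
    x′ (inj₂ p) = case j ≟ℕ 0 of λ where
      (no q) → inj₁ (n≢0⇒n>0 q)
      (yes q) → inj₂ (subst (ps e <_) (sym ti) (≤∧≢⇒< (≤-pred p) (λ r → startV-no {a = e , j} s q (F.toℕ-injective r))))
    y′ : _ → _
    y′ (inj₁ p) = inj₁ p
    y′ (inj₂ (p , q)) = inj₂ (p , subst (_≤ pt e) (sym ti) (<⇒≤ q))
    no-end : j ≡ cross e → pos (tgt e) ≡ i → ¬ (j < cross e ⊎ (j ≡ cross e × suc (toℕ i) ≤ pt e))
    no-end refl q (inj₁ p) = <-irrefl refl p
    no-end refl refl (inj₂ (_ , p)) = <-irrefl refl p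

  pass← : ∀ {i a} → Xs (inject₁ i) a → endV i a ≡ nothing → Xs (suc i) a × startV i a ≡ nothing
  pass← {i} {e , j} (x , y) s = (x′ x , y′ y) , startV-nothing {a = e , j} (λ (p , q) → no-start p q x)
    where
    ti = F.toℕ-inject₁ i
    x′ : 1 ≤ j ⊎ ps e < toℕ (inject₁ i) → _
    x′ (inj₁ p) = inj₁ p
    x′ (inj₂ p) = inj₂ (m<n⇒m<1+n (subst (ps e <_) ti p))
    y′ : j < cross e ⊎ (j ≡ cross e × toℕ (inject₁ i) ≤ pt e) → j < cross e ⊎ (j ≡ cross e × suc (toℕ i) ≤ pt e)
    y′ (inj₁ p) = inj₁ p
    y′ (inj₂ (p , q)) = inj₂ (p , ≤∧≢⇒< (subst (_≤ pt e) ti q) (λ r → endV-no {a = e , j} s p (sym (F.toℕ-injective r))))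
    no-start : j ≡ 0 → pos (src e) ≡ i → ¬ (1 ≤ j ⊎ ps e < toℕ (inject₁ i))
    no-start refl q (inj₁ ())
    no-start refl refl (inj₂ p) = <-irrefl (sym ti) p

  last→ : ∀ {a} → Xs (fromℕ n) a → proj₂ a < cross (proj₁ a)
  last→ (_ , inj₁ p) = p
  last→ {e , j} (_ , inj₂ (_ , q)) = ⊥-elim (<⇒≱ (F.toℕ<n (pos (tgt e))) (subst (_≤ pt e) (F.toℕ-fromℕ n) q))

  →last : ∀ {a} → proj₂ a < cross (proj₁ a) → Xs (fromℕ n) a
  →last {e , j} p = inj₂ (subst (ps e <_) (sym (F.toℕ-fromℕ n)) (F.toℕ<n (pos (src e)))) , inj₁ p

  zero→ : ∀ {a} → Xs zero a → 1 ≤ proj₂ a × proj₂ a ≤ cross (proj₁ a)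
  zero→ (inj₁ p , inj₁ q) = p , <⇒≤ q
  zero→ (inj₁ p , inj₂ (q , _)) = p , ≤-reflexive q

  →zero : ∀ {a} → 1 ≤ proj₂ a → proj₂ a ≤ cross (proj₁ a) → Xs zero a
  →zero p q with m≤n⇒m<n∨m≡n q
  ... | inj₁ r = inj₁ p , inj₁ r
  ... | inj₂ r = inj₁ p , inj₂ (r , z≤n)

  glue-unglue : ∀ {a} → Xs zero a → glue (unglue a) ≡ a
  glue-unglue {e , zero} x = case proj₁ (zero→ x) of λ ()
  glue-unglue {e , suc j} x = refl

  module Positive (pl : ∀ e → pos (src e) ≡ pos (tgt e) → 1 ≤ wind e) where

    short : ∀ e → cross e ≡ 0 → ps e < pt e
    short e z with <-cmpℕ (ps e) (pt e)
    ... | tri< l _ _ = l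
    ... | tri≈ _ q _ = ⊥-elim (<⇒≢ (≤-trans (pl e (F.toℕ-injective q)) (m≤m+n _ _)) (sym z))
    ... | tri> _ _ l = case trans (sym (m+n≡0⇒n≡0 (wind e) z)) (<ᵇ-1 l) of λ ()

    start-arc : ∀ {i e} → pos (src e) ≡ i → Xs (suc i) (e , 0)
    start-arc {i} {e} refl = inj₂ ≤-refl , (case 0 ≟ℕ cross e of λ
      { (yes q) → inj₂ (q , short e (sym q)) ; (no q) → inj₁ (n≢0⇒n>0 (q ∘ sym)) })

    end-arc : ∀ {i e} → pos (tgt e) ≡ i → Xs (inject₁ i) (e , cross e)
    end-arc {i} {e} refl = (case cross e ≟ℕ 0 of λ
      { (yes q) → inj₂ (subst (ps e <_) (sym (F.toℕ-inject₁ i)) (short e q)) ; (no q) → inj₁ (n≢0⇒n>0 q) }) ,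
      inj₂ (refl , ≤-reflexive (F.toℕ-inject₁ i))

module Marking {n : ℕ} (c : TCover n) (d : ℕ) = Loops d {Arcs.Arc c} {Fin (TCover.nV c)} (Arcs.ιA c) (Arcs.wA c) {n} (Arcs.Xs c) (Arcs.glue c) (Arcs.startV c) (Arcs.endV c)

prodFin-* : ∀ {n} (f g : Fin n → ℕ) → prodFin (λ i → f i * g i) ≡ prodFin f * prodFin g
prodFin-* {zero} f g = refl
prodFin-* {suc n} f g = trans (cong (f zero * g zero *_) (prodFin-* (f ∘ suc) (g ∘ suc))) (r (f zero) (g zero) _ _)
  where
  r : ∀ a b c d → a * b * (c * d) ≡ a * c * (b * d)
  r = solve-∀

prodFin-const : ∀ n k → prodFin {n} (λ _ → k) ≡ k ^ n
prodFin-const zero k = refl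
prodFin-const (suc n) k = cong (k *_) (prodFin-const n k)

prodFin-single : ∀ {n} (j : Fin n) k → prodFin (λ i → if does (j ≟ i) then k else 1) ≡ k
prodFin-single j k = trans (prodFin-list (λ i → j ≟ i) (λ _ → k) {j ∷ []} ([] ∷ [] , λ x → mk⇔ (λ { (here e) → sym e ; (there ()) }) (λ e → here (sym e)))) (*-identityʳ k)

prodFin-group : ∀ {m n} (p : Fin m → Fin n) (f : Fin m → ℕ) →
  prodFin (λ i → prodFin (λ x → if does (p x ≟ i) then f x else 1)) ≡ prodFin f
prodFin-group {zero} {n} p f = trans (prodFin-const n 1) (^-zeroˡ n)
prodFin-group {suc m} p f = trans (prodFin-* (λ i → if does (p zero ≟ i) then f zero else 1) _)
  (cong₂ _*_ (prodFin-single (p zero) (f zero)) (prodFin-group (p ∘ suc) (f ∘ suc)))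

One Two : ∀ {m n} → (Fin m → Fin n) → Fin n → _
One {m} h v = Σ[ e ∈ Fin m ] h e ≡ v × (∀ {e′} → h e′ ≡ v → e′ ≡ e)
Two {m} h v = Σ[ e₁ ∈ Fin m ] Σ[ e₂ ∈ Fin m ] h e₁ ≡ v × h e₂ ≡ v × e₁ ≢ e₂ × (∀ {e′} → h e′ ≡ v → e′ ≡ e₁ ⊎ e′ ≡ e₂)

module _ {m n : ℕ} (h : Fin m → Fin n) (v : Fin n) where

  fibre : List (Fin m)
  fibre = filter (λ e → h e ≟ v) (allFin m)

  fibre-listing : IsListing (λ e → h e ≡ v) fibre
  fibre-listing = fin-listing (λ e → h e ≟ v)

  fibre-one : ∀ {e} → fibre ≡ e ∷ [] → h e ≡ v × (∀ {e′} → h e′ ≡ v → e′ ≡ e)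
  fibre-one {e} q = ∈⇒ fibre-listing (subst (e ∈_) (sym q) (here refl)) ,
    λ p → case subst (_ ∈_) q (⇒∈ fibre-listing p) of λ { (here r) → r }

  fibre-two : ∀ {e₁ e₂} → fibre ≡ e₁ ∷ e₂ ∷ [] → h e₁ ≡ v × h e₂ ≡ v × e₁ ≢ e₂ × (∀ {e′} → h e′ ≡ v → e′ ≡ e₁ ⊎ e′ ≡ e₂)
  fibre-two {e₁} {e₂} q = ∈⇒ fibre-listing (subst (e₁ ∈_) (sym q) (here refl)) , ∈⇒ fibre-listing (subst (e₂ ∈_) (sym q) (there (here refl))) ,
    ne (subst Unique q (proj₁ fibre-listing)) , λ p → case subst (_ ∈_) q (⇒∈ fibre-listing p) of λ { (here r) → inj₁ r ; (there (here r)) → inj₂ r }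
    where
    ne : Unique (e₁ ∷ e₂ ∷ []) → e₁ ≢ e₂
    ne ((n ∷ _) ∷ _) = n

module Symmetric {n : ℕ} (c : TCover n) (tc : IsTropCover c) (ts : IsTwistedStructure c) where

  open Arcs c public

  wt≥1 : ∀ e → 1 ≤ wt e
  wt≥1 = proj₁ tc

  wind≥1 = proj₁ (proj₂ tc)
  balanced = proj₂ (proj₂ tc)

  fibres = proj₁ ts
  four-wt = proj₁ (proj₂ ts)
  ιVιV = proj₁ (proj₂ (proj₂ ts))
  ιEιE = proj₁ (proj₂ (proj₂ (proj₂ ts)))
  pos-ι = proj₁ (proj₂ (proj₂ (proj₂ (proj₂ ts))))
  src-ι = proj₁ (proj₂ (proj₂ (proj₂ (proj₂ (proj₂ ts)))))
  tgt-ι = proj₁ (proj₂ (proj₂ (proj₂ (proj₂ (proj₂ (proj₂ ts))))))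
  wt-ι = proj₁ (proj₂ (proj₂ (proj₂ (proj₂ (proj₂ (proj₂ (proj₂ ts)))))))
  wind-ι = proj₁ (proj₂ (proj₂ (proj₂ (proj₂ (proj₂ (proj₂ (proj₂ (proj₂ ts))))))))
  ιE≢ = proj₁ (proj₂ (proj₂ (proj₂ (proj₂ (proj₂ (proj₂ (proj₂ (proj₂ (proj₂ ts)))))))))
  fixed⇔ = proj₂ (proj₂ (proj₂ (proj₂ (proj₂ (proj₂ (proj₂ (proj₂ (proj₂ (proj₂ ts)))))))))

  open Positive wind≥1 public

  pos-src-ι : ∀ e → pos (src (ιE e)) ≡ pos (src e)
  pos-src-ι e = trans (cong pos (src-ι e)) (pos-ι _)

  pos-tgt-ι : ∀ e → pos (tgt (ιE e)) ≡ pos (tgt e)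
  pos-tgt-ι e = trans (cong pos (tgt-ι e)) (pos-ι _)

  cross-ι : ∀ e → cross (ιE e) ≡ cross e
  cross-ι e = cong₂ _+_ (wind-ι e) (cong₂ (λ a b → [ toℕ a <ᵇ toℕ b ]ᵇ) (pos-tgt-ι e) (pos-src-ι e))

  ιιA : ∀ a → ιA (ιA a) ≡ a
  ιιA (e , j) = cong (_, j) (ιEιE e)

  wA-ι : ∀ a → wA (ιA a) ≡ wA a
  wA-ι (e , _) = wt-ι e

  Xs-ι : ∀ {i a} → Xs i a → Xs i (ιA a)
  Xs-ι {i} {e , j} (x , y) = [ inj₁ , (λ p → inj₂ (subst (_< toℕ i) (cong toℕ (sym (pos-src-ι e))) p)) ]′ x ,
    [ (λ p → inj₁ (subst (j <_) (sym (cross-ι e)) p)) ,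
      (λ (p , q) → inj₂ (trans p (sym (cross-ι e)) , subst (toℕ i ≤_) (cong toℕ (sym (pos-tgt-ι e))) q)) ]′ y

  startV-ι : ∀ {i} a → startV i (ιA a) ≡ Data.Maybe.map ιV (startV i a)
  startV-ι {i} (e , j) with (j ≟ℕ 0) ×-dec (pos (src e) ≟ i)
  ... | yes (refl , q) = trans (startV-yes (trans (pos-src-ι e) q)) (cong just (src-ι e))
  ... | no m = startV-nothing {a = ιE e , j} (λ (p , q) → m (p , trans (sym (pos-src-ι e)) q))

  endV-ι : ∀ {i} a → endV i (ιA a) ≡ Data.Maybe.map ιV (endV i a)
  endV-ι {i} (e , j) with (j ≟ℕ cross e) ×-dec (pos (tgt e) ≟ i)
  ... | yes (refl , q) = trans (cong (λ k → endV i (ιE e , k)) (sym (cross-ι e))) (trans (endV-yes (trans (pos-tgt-ι e) q)) (cong just (tgt-ι e)))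
  ... | no m = endV-nothing {a = ιE e , j} (λ (p , q) → m (trans p (cross-ι e) , trans (sym (pos-tgt-ι e)) q))

  private
    ys zs : Fin nV → List (Fin nE)
    ys = fibre src
    zs = fibre tgt

    val-≡ : ∀ v → val c v ≡ length (ys v) + length (zs v)
    val-≡ v = cong₂ _+_ (sumFin-count (λ e → src e ≟ v) (fibre-listing src v)) (sumFin-count (λ e → tgt e ≟ v) (fibre-listing tgt v))

    bal : ∀ v → sum (map wt (ys v)) ≡ sum (map wt (zs v))
    bal v = trans (sym (sumFin-list (λ e → src e ≟ v) wt (fibre-listing src v)))
      (trans (sym (balanced v)) (sumFin-list (λ e → tgt e ≟ v) wt (fibre-listing tgt v)))

    pos-sum : ∀ e es → 0 ≢ sum (map wt (e ∷ es))
    pos-sum e es = <⇒≢ (≤-trans (wt≥1 e) (m≤m+n _ _))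

    split₃ : ∀ (as bs : List (Fin nE)) → length as + length bs ≡ 3 → sum (map wt as) ≡ sum (map wt bs) →
      (∃ λ e → ∃ λ f₁ → ∃ λ f₂ → as ≡ e ∷ [] × bs ≡ f₁ ∷ f₂ ∷ []) ⊎ (∃ λ e₁ → ∃ λ e₂ → ∃ λ f → as ≡ e₁ ∷ e₂ ∷ [] × bs ≡ f ∷ [])
    split₃ [] (b ∷ bs) _ s = ⊥-elim (pos-sum b bs s)
    split₃ (a ∷ []) (b ∷ b′ ∷ []) _ _ = inj₁ (a , b , b′ , refl , refl)
    split₃ (a ∷ a′ ∷ []) (b ∷ []) _ _ = inj₂ (a , a′ , b , refl , refl)
    split₃ (a ∷ a′ ∷ a″ ∷ []) [] _ s = ⊥-elim (pos-sum a (a′ ∷ a″ ∷ []) (sym s))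

    split₄ : ∀ (as bs : List (Fin nE)) → length as + length bs ≡ 4 → length as ≡ length bs →
      (∃ λ e → ∃ λ e′ → ∃ λ f → ∃ λ f′ → as ≡ e ∷ e′ ∷ [] × bs ≡ f ∷ f′ ∷ [])
    split₄ (a ∷ a′ ∷ []) (b ∷ b′ ∷ []) _ _ = a , a′ , b , b′ , refl , refl
    split₄ (_ ∷ _ ∷ _ ∷ as) (_ ∷ _ ∷ bs) h _ = case trans (+-comm (2 + length bs) (length as)) (suc-injective (suc-injective (suc-injective h))) of λ ()
    split₄ (a ∷ []) (b ∷ b′ ∷ b″ ∷ []) _ ()
    split₄ (a ∷ a′ ∷ a″ ∷ []) (b ∷ []) _ ()
    split₄ (a ∷ a′ ∷ a″ ∷ a‴ ∷ []) [] _ ()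

    sum-same : ∀ ω es → (∀ {e} → e ∈ es → wt e ≡ ω) → sum (map wt es) ≡ length es * ω
    sum-same ω [] _ = refl
    sum-same ω (e ∷ es) h = cong₂ _+_ (h (here refl)) (sum-same ω es (h ∘ there))

    adj-ωV : ∀ {v e} → val c v ≡ 4 → Adj c v e → ωV c v ≡ wt e
    adj-ωV {v} {e} v4 a = go _ (proj₂ (fin-listing (λ e → (src e ≟ v) ⊎-dec (tgt e ≟ v))))
      where
      go : ∀ es → (∀ x → x ∈ es ⇔ Adj c v x) → fromMaybe 0 (head (map wt es)) ≡ wt e
      go [] h = case Equivalence.from (h e) a of λ ()
      go (x ∷ es) h = four-wt v v4 x e (Equivalence.to (h x) (here refl)) a

  data Shape (i : Fin n) : Set where
    twoTwo : ∀ v (pv : pos v ≡ i) (only : ∀ u → pos u ≡ i → u ≡ v) → ιV v ≡ v → val c v ≡ 4 →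
      ∀ e f → src e ≡ v → (∀ {e′} → src e′ ≡ v → e′ ≡ e ⊎ e′ ≡ ιE e) → tgt f ≡ v → (∀ {f′} → tgt f′ ≡ v → f′ ≡ f ⊎ f′ ≡ ιE f) →
      wt e ≡ wt f → ωV c v ≡ wt e → Shape i
    oneTwo : ∀ v (pv : pos v ≡ i) (only : ∀ u → pos u ≡ i → u ≡ v ⊎ u ≡ ιV v) → ιV v ≢ v → val c v ≡ 3 →
      (o : One src v) (t : Two tgt v) → wt (proj₁ o) ≡ wt (proj₁ t) + wt (proj₁ (proj₂ t)) → Shape i
    twoOne : ∀ v (pv : pos v ≡ i) (only : ∀ u → pos u ≡ i → u ≡ v ⊎ u ≡ ιV v) → ιV v ≢ v → val c v ≡ 3 →
      (o : Two src v) (t : One tgt v) → wt (proj₁ t) ≡ wt (proj₁ o) + wt (proj₁ (proj₂ o)) → Shape i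

  private
    shape′ : ∀ i → Shape i
    shape′ i with fibres i
    ... | inj₁ (v , pv , v4 , only) = go (split₄ (ys v) (zs v) lens (*-cancelʳ-≡ _ _ ω eq-len))
      where
      fx : ιV v ≡ v
      fx = Equivalence.from (fixed⇔ v) v4
      lens = trans (sym (val-≡ v)) v4
      wy : ∀ {e} → e ∈ ys v → wt e ≡ ωV c v
      wy e∈ = sym (adj-ωV v4 (inj₁ (∈⇒ (fibre-listing src v) e∈)))
      wz : ∀ {e} → e ∈ zs v → wt e ≡ ωV c v
      wz e∈ = sym (adj-ωV v4 (inj₂ (∈⇒ (fibre-listing tgt v) e∈)))
      ω = ωV c v
      some : ∀ as bs → length as + length bs ≡ 4 → (∀ {e} → e ∈ as → wt e ≡ ω) → (∀ {e} → e ∈ bs → wt e ≡ ω) → 1 ≤ ω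
      some (a ∷ as) bs _ h _ = subst (1 ≤_) (h (here refl)) (wt≥1 a)
      some [] (b ∷ bs) _ _ h = subst (1 ≤_) (h (here refl)) (wt≥1 b)
      instance
        nz : NonZero ω
        nz = Data.Nat.>-nonZero (some (ys v) (zs v) lens wy wz)
      eq-len : length (ys v) * ω ≡ length (zs v) * ω
      eq-len = trans (sym (sum-same ω (ys v) wy)) (trans (bal v) (sum-same ω (zs v) wz))
      go : (∃ λ e → ∃ λ e′ → ∃ λ f → ∃ λ f′ → ys v ≡ e ∷ e′ ∷ [] × zs v ≡ f ∷ f′ ∷ []) → Shape i
      go (e , e′ , f , f′ , p , q) with fibre-two src v p | fibre-two tgt v q
      ... | se , se′ , _ , e! | tf , tf′ , _ , f! = twoTwo v pv only fx v4 e f se (λ s → mate src src-ι e! se s) tf (λ s → mate tgt tgt-ι f! tf s)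
          (trans (sym (adj-ωV v4 (inj₁ se))) (adj-ωV v4 (inj₂ tf))) (adj-ωV v4 (inj₁ se))
        where
        mate : ∀ (h : Fin nE → Fin nV) → (∀ e → h (ιE e) ≡ ιV (h e)) → ∀ {a b x} → (∀ {y} → h y ≡ v → y ≡ a ⊎ y ≡ b) → h a ≡ v → h x ≡ v → x ≡ a ⊎ x ≡ ιE a
        mate h h-ι {a} {b} {x} all ha hx with all hx
        ... | inj₁ r = inj₁ r
        ... | inj₂ r with all (trans (h-ι a) (trans (cong ιV ha) fx))
        ... | inj₁ s = ⊥-elim (ιE≢ a s)
        ... | inj₂ s = inj₂ (trans r (sym s))
    ... | inj₂ (v , w , v≢w , pv , pw , v3 , w3 , only) = go (split₃ (ys v) (zs v) (trans (sym (val-≡ v)) v3) (bal v))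
      where
      nfx : ιV v ≢ v
      nfx q = case trans (sym v3) (Equivalence.to (fixed⇔ v) q) of λ ()
      w≡ : ιV v ≡ w
      w≡ with only (ιV v) (trans (pos-ι v) pv)
      ... | inj₁ q = ⊥-elim (nfx q)
      ... | inj₂ q = q
      only′ : ∀ u → pos u ≡ i → u ≡ v ⊎ u ≡ ιV v
      only′ u p = [ inj₁ , (λ q → inj₂ (trans q (sym w≡))) ]′ (only u p)
      go : _ → Shape i
      go (inj₁ (e , f₁ , f₂ , p , q)) = oneTwo v pv only′ nfx v3 (e , fibre-one src v p) (f₁ , f₂ , fibre-two tgt v q)
        (trans (sym (+-identityʳ _)) (trans (cong (sum ∘ map wt) (sym p)) (trans (bal v) (trans (cong (sum ∘ map wt) q) (cong (wt f₁ +_) (+-identityʳ _))))))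
      go (inj₂ (e₁ , e₂ , f , p , q)) = twoOne v pv only′ nfx v3 (e₁ , e₂ , fibre-two src v p) (f , fibre-one tgt v q)
        (trans (sym (+-identityʳ _)) (trans (cong (sum ∘ map wt) (sym q)) (trans (sym (bal v)) (trans (cong (sum ∘ map wt) p) (cong (wt e₁ +_) (+-identityʳ _))))))

  opaque
    shape : ∀ i → Shape i
    shape = shape′

    out-edge : ∀ v → ∃ λ e → src e ≡ v
    out-edge v with shape (pos v)
    ... | twoTwo u pu only _ _ e _ s _ _ _ _ _ = e , trans s (sym (only v refl))
    ... | oneTwo u pu only _ _ (e , s , _) _ _ = [ (λ q → e , trans s (sym q)) , (λ q → ιE e , trans (src-ι e) (trans (cong ιV s) (sym q))) ]′ (only v refl)
    ... | twoOne u pu only _ _ (e , _ , s , _) _ _ = [ (λ q → e , trans s (sym q)) , (λ q → ιE e , trans (src-ι e) (trans (cong ιV s) (sym q))) ]′ (only v refl)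

-- Counting the marked tuples of a cover

module LocalCount {n : ℕ} (d : ℕ) (c : TCover n) (tc : IsTropCover c) (ts : IsTwistedStructure c) where

  open Symmetric c tc ts public
  open Marking c d using (State; Crossing; ττ; τ≢) public

  vf : Fin nV → ℕ
  vf v = if does (val c v ≟ℕ 4) then ωV c v ∸ 1 else 1

  ef : Fin nE → ℕ
  ef e = if toℕ e <ᵇ toℕ (ιE e) then wt e else 1

  vfi efi K : Fin n → ℕ
  vfi i = prodFin (λ v → if does (pos v ≟ i) then vf v else 1)
  efi i = prodFin (λ e → if does (pos (src e) ≟ i) then ef e else 1)
  K i = 2 * (vfi i * efi i)

  prod-K : prodFin K ≡ 2 ^ n * (vertexFactor c * edgeFactor c)
  prod-K = trans (prodFin-* (λ _ → 2) (λ i → vfi i * efi i)) (cong₂ _*_ (prodFin-const n 2)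
    (trans (prodFin-* vfi efi) (cong₂ _*_ (prodFin-group pos vf) (prodFin-group (pos ∘ src) ef))))

  private
    ef-< : ∀ {e} → toℕ e < toℕ (ιE e) → ef e ≡ wt e
    ef-< {e} p with toℕ e <ᵇ toℕ (ιE e) | <⇒<ᵇ p
    ... | true | _ = refl

    ef-≮ : ∀ {e} → ¬ toℕ e < toℕ (ιE e) → ef e ≡ 1
    ef-≮ {e} p with toℕ e <ᵇ toℕ (ιE e) in q
    ... | true = ⊥-elim (p (<ᵇ⇒< _ _ (subst Data.Bool.T (sym q) tt)))
    ... | false = refl

    ef-pair : ∀ e → ef e * ef (ιE e) ≡ wt e
    ef-pair e with <-cmpℕ (toℕ e) (toℕ (ιE e))
    ... | tri< l _ ¬g = trans (cong₂ _*_ (ef-< l) (ef-≮ (subst (λ x → ¬ toℕ (ιE e) < toℕ x) (sym (ιEιE e)) ¬g))) (*-identityʳ _)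
    ... | tri≈ _ q _ = ⊥-elim (ιE≢ e (sym (F.toℕ-injective q)))
    ... | tri> ¬l _ g = trans (cong₂ _*_ (ef-≮ ¬l) (ef-< (subst (λ x → toℕ (ιE e) < toℕ x) (sym (ιEιE e)) g))) (trans (+-identityʳ _) (wt-ι e))

    vf-4 : ∀ {v} → val c v ≡ 4 → vf v ≡ ωV c v ∸ 1
    vf-4 {v} p rewrite dec-true (val c v ≟ℕ 4) p = refl

    vf-3 : ∀ {v} → val c v ≡ 3 → vf v ≡ 1
    vf-3 {v} p rewrite p = refl

    list₄ : ∀ {B : Set} {P : B → Set} {a b a′ b′ : B} → a ≢ b → a ≢ a′ → a ≢ b′ → b ≢ a′ → b ≢ b′ → a′ ≢ b′ → P a → P b → P a′ → P b′ →
      (∀ {x} → P x → (x ≡ a ⊎ x ≡ b) ⊎ (x ≡ a′ ⊎ x ≡ b′)) → IsListing P (a ∷ b ∷ a′ ∷ b′ ∷ [])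
    list₄ n₁ n₂ n₃ n₄ n₅ n₆ pa pb pa′ pb′ all = (n₁ ∷ n₂ ∷ n₃ ∷ []) ∷ (n₄ ∷ n₅ ∷ []) ∷ (n₆ ∷ []) ∷ [] ∷ [] , λ x → mk⇔
      (λ { (here refl) → pa ; (there (here refl)) → pb ; (there (there (here refl))) → pa′ ; (there (there (there (here refl)))) → pb′ })
      (λ p → [ [ here , there ∘ here ]′ , [ there ∘ there ∘ here , there ∘ there ∘ there ∘ here ]′ ]′ (all p))

    ιV-inj : ∀ {u v} → ιV u ≡ ιV v → u ≡ v
    ιV-inj p = trans (sym (ιVιV _)) (trans (cong ιV p) (ιVιV _))

    ιE-inj : ∀ {u v} → ιE u ≡ ιE v → u ≡ v
    ιE-inj p = trans (sym (ιEιE _)) (trans (cong ιE p) (ιEιE _))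

    module Mirror (h : Fin nE → Fin nV) (h-ι : ∀ e → h (ιE e) ≡ ιV (h e)) {v : Fin nV} where

      flip : ∀ {e} → h e ≡ ιV v → h (ιE e) ≡ v
      flip p = trans (h-ι _) (trans (cong ιV p) (ιVιV v))

      one : One h v → One h (ιV v)
      one (e , p , all) = ιE e , trans (h-ι e) (cong ιV p) , λ q → trans (sym (ιEιE _)) (cong ιE (all (flip q)))

      two : Two h v → Two h (ιV v)
      two (e₁ , e₂ , p₁ , p₂ , ne , all) = ιE e₁ , ιE e₂ , trans (h-ι e₁) (cong ιV p₁) , trans (h-ι e₂) (cong ιV p₂) , ne ∘ ιE-inj ,
        λ q → [ (λ r → inj₁ (trans (sym (ιEιE _)) (cong ιE r))) , (λ r → inj₂ (trans (sym (ιEιE _)) (cong ιE r))) ]′ (all (flip q))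

  module At (i : Fin n) {T : Fin (d + d) → Fin (d + d)} {l : Fin (d + d) → Arc} (st : State (Xs (suc i)) T l) where

    private
      setting : Setting
      setting = record
        { A = Arc ; V = Fin nV ; ι = ιA ; w = wA ; _≟V_ = _≟_ ; ιι = ιιA ; ιV = ιV ; ιVιV = ιVιV
        ; Nr = Xs (suc i) ; Fr = Xs (inject₁ i) ; sN = startV i ; sF = endV i
        ; pass→ = λ {a} → pass→ {i} {a} ; pass← = λ {a} → pass← {i} {a} ; sN-ι = startV-ι ; sF-ι = endV-ι
        ; Fr-ι = λ {a} → Xs-ι {_} {a} ; w-ι = wA-ι ; 1≤w = λ {a} _ → wt≥1 (proj₁ a) ; 1≤wF = λ {a} _ → wt≥1 (proj₁ a) }

    module Br = Branch (τ d) ττ τ≢ setting st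

    moved-start : ∀ {η l⁺} → Br.Valid (η , l⁺) → ∀ {q} → η !! q ≢ q → ∃ λ u → startV i (l q) ≡ just u
    moved-start = Br.moved-vertex

    near-v : ∀ {a u} → startV i a ≡ just u → pos u ≡ i
    near-v {a} p = proj₂ (proj₂ (startV-just {i} {a} p))

    far-v : ∀ {a u} → endV i a ≡ just u → pos u ≡ i
    far-v {a} p = proj₂ (proj₂ (endV-just {i} {a} p))

    module _ {v : Fin nV} (pv : pos v ≡ i) where

      start-at : ∀ {e} → src e ≡ v → Xs (suc i) (e , 0) × startV i (e , 0) ≡ just v
      start-at refl = start-arc pv , startV-yes pv

      end-at : ∀ {e} → tgt e ≡ v → Xs (inject₁ i) (e , cross e) × endV i (e , cross e) ≡ just v
      end-at refl = end-arc pv , endV-yes pv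

    start-of : ∀ {a v} → startV i a ≡ just v → a ≡ (proj₁ a , 0) × src (proj₁ a) ≡ v
    start-of {e , j} p with startV-just {i} {e , j} p
    ... | refl , q , _ = refl , q

    end-of : ∀ {a v} → endV i a ≡ just v → a ≡ (proj₁ a , cross (proj₁ a)) × tgt (proj₁ a) ≡ v
    end-of {e , j} p with endV-just {i} {e , j} p
    ... | refl , q , _ = refl , q

    module Pair {v : Fin nV} (pv : pos v ≡ i) (only : ∀ u → pos u ≡ i → u ≡ v ⊎ u ≡ ιV v) (v≢ : ιV v ≢ v) where

      twin : Br.Twin v
      twin = record { v≢ = v≢ ; only = λ {a} _ p → only _ (near-v {a} p) ; onlyF = λ {a} _ p → only _ (far-v {a} p) }

      one-two : (o : One src v) (t : Two tgt v) → wt (proj₁ o) ≡ wt (proj₁ t) + wt (proj₁ (proj₂ t)) →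
        Card (λ ηl → Br.Valid ηl × Br.MovesAt v (proj₁ ηl)) (wt (proj₁ o))
      one-two (e , se , e!) (f₁ , f₂ , t₁ , t₂ , ne , f!) we = Br.Sided.OneTwo.card-oneTwo twin (record
        { eN = proj₁ (start-at pv se) ; ev = proj₂ (start-at pv se)
        ; e! = λ {a} _ p → let (r , s) = start-of {a} p in trans r (cong (_, 0) (e! s))
        ; F₁ = proj₁ (end-at pv t₁) ; f₁v = proj₂ (end-at pv t₁) ; F₂ = proj₁ (end-at pv t₂) ; f₂v = proj₂ (end-at pv t₂) ; f₁≢f₂ = ne ∘ cong proj₁
        ; f! = λ {a} _ p → let (r , s) = end-of {a} p in [ (λ q → inj₁ (trans r (cong (λ x → x , cross x) q))) , (λ q → inj₂ (trans r (cong (λ x → x , cross x) q))) ]′ (f! s)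
        ; we = we })

      two-one : (o : Two src v) (t : One tgt v) → wt (proj₁ t) ≡ wt (proj₁ o) + wt (proj₁ (proj₂ o)) →
        Card (λ ηl → Br.Valid ηl × Br.MovesAt v (proj₁ ηl)) (wt (proj₁ o) * wt (proj₁ (proj₂ o)))
      two-one (e₁ , e₂ , s₁ , s₂ , ne , e!) (f , tf , f!) wf = Br.Sided.TwoOne.card-twoOne twin (record
        { E₁ = proj₁ (start-at pv s₁) ; e₁v = proj₂ (start-at pv s₁) ; E₂ = proj₁ (start-at pv s₂) ; e₂v = proj₂ (start-at pv s₂) ; e₁≢e₂ = ne ∘ cong proj₁
        ; e! = λ {a} _ p → let (r , s) = start-of {a} p in [ (λ q → inj₁ (trans r (cong (_, 0) q))) , (λ q → inj₂ (trans r (cong (_, 0) q))) ]′ (e! s)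
        ; F₁ = proj₁ (end-at pv tf) ; fv = proj₂ (end-at pv tf)
        ; f! = λ {a} _ p → let (r , s) = end-of {a} p in trans r (cong (λ x → x , cross x) (f! s))
        ; wf = wf })

    pair-vfi : ∀ {v} → pos v ≡ i → (∀ u → pos u ≡ i → u ≡ v ⊎ u ≡ ιV v) → ιV v ≢ v → val c v ≡ 3 → vfi i ≡ 1
    pair-vfi {v} pv only v≢ v3 = trans (prodFin-list (λ u → pos u ≟ i) vf
        (list₂ (v≢ ∘ sym) pv (trans (pos-ι v) pv) (λ {u} → only u)))
      (cong₂ _*_ (vf-3 v3) (trans (*-identityʳ _) (vf-3 ιv3)))
      where
      ιv3 : val c (ιV v) ≡ 3
      ιv3 with fibres i
      ... | inj₁ (u , pu , _ , all) = ⊥-elim (v≢ (trans (all _ (trans (pos-ι v) pv)) (sym (all v pv))))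
      ... | inj₂ (u , u′ , _ , _ , _ , a , b , all) = [ (λ q → trans (cong (val c) q) a) , (λ q → trans (cong (val c) q) b) ]′ (all _ (trans (pos-ι v) pv))

    K-of : ∀ {a b} → vfi i ≡ a → efi i ≡ b → 2 * (a * b) ≡ K i
    K-of p q = cong₂ (λ x y → 2 * (x * y)) (sym p) (sym q)

    local : Card Br.Valid (K i)
    local with shape i
    ... | twoTwo v pv only fx v4 e f se e! tf f! we ωe = card-subst (trans (arith (wt e)) (K-of vfi≡ efi≡))
        (Br.TwoTwo.card-twoTwo (record
          { only = λ {a} _ p → only _ (near-v {a} p) ; onlyF = λ {a} _ p → only _ (far-v {a} p)
          ; E = proj₁ (start-at pv se)
          ; e! = λ {a} _ p → let (r , s) = start-of {a} p in [ (λ q → inj₁ (trans r (cong (_, 0) q))) , (λ q → inj₂ (trans r (cong (_, 0) q))) ]′ (e! s)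
          ; ev = proj₂ (start-at pv se) ; ιev = proj₂ (start-at pv ιse) ; F₁ = proj₁ (end-at pv tf) ; fv = proj₂ (end-at pv tf)
          ; ιfv = trans (cong (λ k → endV i (ιE f , k)) (sym (cross-ι f))) (proj₂ (end-at pv ιtf))
          ; f! = λ {a} _ p → let (r , s) = end-of {a} p in [ (λ q → inj₁ (trans r (cong (λ x → x , cross x) q))) ,
              (λ q → inj₂ (trans r (trans (cong (λ x → x , cross x) q) (cong (ιE f ,_) (cross-ι f))))) ]′ (f! s)
          ; f≢ = ιE≢ f ∘ cong proj₁ ; we = we }))
      where
      ιse : src (ιE e) ≡ v
      ιse = trans (src-ι e) (trans (cong ιV se) fx)
      ιtf : tgt (ιE f) ≡ v
      ιtf = trans (tgt-ι f) (trans (cong ιV tf) fx)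
      vfi≡ : vfi i ≡ wt e ∸ 1
      vfi≡ = trans (prodFin-list (λ u → pos u ≟ i) vf {v ∷ []} ([] ∷ [] , λ x → mk⇔ (λ { (here refl) → pv ; (there ()) }) (λ p → here (only x p))))
        (trans (*-identityʳ _) (trans (vf-4 v4) (cong (_∸ 1) ωe)))
      efi≡ : efi i ≡ wt e
      efi≡ = trans (prodFin-list (λ x → pos (src x) ≟ i) ef (list₂ (ιE≢ e ∘ sym) (trans (cong pos se) pv) (trans (cong pos ιse) pv) (λ p → e! (only _ p))))
        (trans (cong (ef e *_) (*-identityʳ _)) (ef-pair e))
      arith : ∀ a → a * (a ∸ 1) * 2 ≡ 2 * ((a ∸ 1) * a)
      arith a = r a (a ∸ 1)
        where
        r : ∀ a b → a * b * 2 ≡ 2 * (b * a)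
        r = solve-∀
    ... | oneTwo v pv only v≢ v3 o@(e , se , e!) t we = card-subst (trans (arith (wt e)) (K-of {1} (pair-vfi pv only v≢ v3) efi≡))
        (Br.card-sides v≢ (λ {a} _ p → only _ (near-v {a} p)) (Pair.one-two pv only v≢ o t we)
          (card-subst (wt-ι e) (Pair.one-two pιv only′ (v≢ ∘ ιV-inj) (Mirror.one src src-ι o) (Mirror.two tgt tgt-ι t)
            (trans (wt-ι e) (trans we (sym (cong₂ _+_ (wt-ι _) (wt-ι _))))))))
      where
      pιv = trans (pos-ι v) pv
      only′ : ∀ u → pos u ≡ i → u ≡ ιV v ⊎ u ≡ ιV (ιV v)
      only′ u p = [ (λ q → inj₂ (trans q (sym (ιVιV v)))) , inj₁ ]′ (only u p)
      ιo = Mirror.one src src-ι o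
      efi≡ : efi i ≡ wt e
      efi≡ = trans (prodFin-list (λ x → pos (src x) ≟ i) ef (list₂ (ιE≢ e ∘ sym) (trans (cong pos se) pv) (trans (cong pos (proj₁ (proj₂ ιo))) pιv)
          (λ p → [ (λ q → inj₁ (e! q)) , (λ q → inj₂ (proj₂ (proj₂ ιo) q)) ]′ (only _ p))))
        (trans (cong (ef e *_) (*-identityʳ _)) (ef-pair e))
      arith : ∀ a → a + a ≡ 2 * (1 * a)
      arith = solve-∀
    ... | twoOne v pv only v≢ v3 o@(e₁ , e₂ , s₁ , s₂ , ne , e!) t wf = card-subst (trans (arith (wt e₁) (wt e₂)) (K-of {1} (pair-vfi pv only v≢ v3) efi≡))
        (Br.card-sides v≢ (λ {a} _ p → only _ (near-v {a} p)) (Pair.two-one pv only v≢ o t wf)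
          (card-subst (cong₂ _*_ (wt-ι e₁) (wt-ι e₂)) (Pair.two-one pιv only′ (v≢ ∘ ιV-inj) ιo (Mirror.one tgt tgt-ι t)
            (trans (wt-ι _) (trans wf (sym (cong₂ _+_ (wt-ι _) (wt-ι _))))))))
      where
      pιv = trans (pos-ι v) pv
      only′ : ∀ u → pos u ≡ i → u ≡ ιV v ⊎ u ≡ ιV (ιV v)
      only′ u p = [ (λ q → inj₂ (trans q (sym (ιVιV v)))) , inj₁ ]′ (only u p)
      ιo = Mirror.two src src-ι o
      s₁′ = proj₁ (proj₂ (proj₂ ιo))
      s₂′ = proj₁ (proj₂ (proj₂ (proj₂ ιo)))
      apart : ∀ {x y} → src x ≡ v → src y ≡ ιV v → x ≢ y
      apart p q refl = v≢ (trans (sym q) p)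
      efi≡ : efi i ≡ wt e₁ * wt e₂
      efi≡ = trans (prodFin-list (λ x → pos (src x) ≟ i) ef (list₄ ne (apart s₁ s₁′) (apart s₁ s₂′) (apart s₂ s₁′) (apart s₂ s₂′) (ne ∘ ιE-inj)
          (trans (cong pos s₁) pv) (trans (cong pos s₂) pv) (trans (cong pos s₁′) pιv) (trans (cong pos s₂′) pιv)
          (λ p → [ (λ q → inj₁ (e! q)) , (λ q → inj₂ (proj₂ (proj₂ (proj₂ (proj₂ (proj₂ ιo)))) q)) ]′ (only _ p))))
        (trans (regroup (ef e₁) (ef e₂) _ _) (cong₂ _*_ (ef-pair e₁) (ef-pair e₂)))
        where
        regroup : ∀ a b c d → a * (b * (c * (d * 1))) ≡ (a * c) * (b * d)
        regroup = solve-∀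
      arith : ∀ a b → a * b + a * b ≡ 2 * (1 * (a * b))
      arith = solve-∀

module MarkedCount {n d g : ℕ} (c : TCover n) (ok : IsTwistedTropCover c d g) (1≤d : 1 ≤ d) where

  open LocalCount d c (proj₁ ok) (proj₁ (proj₂ ok))

  X : Arc → Set
  X a = proj₂ a < cross (proj₁ a)

  Pos : Arc → Set
  Pos a = toℕ (proj₁ a) < toℕ (ιE (proj₁ a))

  private
    Pos-e : Fin nE → Set
    Pos-e e = toℕ e < toℕ (ιE e)

    Pts : (Fin nE → Set) → Arc × ℕ → Set
    Pts Q ((e , j) , r) = (j < cross e × Q e) × r < wt e

    weight : Fin nE → ℕ
    weight e = cross e * wt e

    card-pts : ∀ {Q : Fin nE → Set} (es : List (Fin nE)) → IsListing Q es → Card (Pts Q) (sum (map weight es))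
    card-pts es le = card-map (λ (e , j , r) → (e , j) , r) (λ (q , j , r) → (j , q) , r) (λ { _ _ refl → refl })
      (λ { {(e , j) , r} ((j< , q) , r<) → (e , j , r) , (q , j< , r<) , refl })
      (Σ-list {Q = λ e jr → proj₁ jr < cross e × proj₂ jr < wt e} weight es le (λ {e} _ → card-Σ (card-< (cross e)) (λ _ → card-< (wt e))))

    es₊ : List (Fin nE)
    es₊ = filter (λ e → toℕ e <? toℕ (ιE e)) (allFin nE)

    card₊ : Card (Pts Pos-e) (sum (map weight es₊))
    card₊ = card-pts es₊ (fin-listing (λ e → toℕ e <? toℕ (ιE e)))

    flip : ∀ {e} → Pos-e (ιE e) → toℕ (ιE e) < toℕ e
    flip {e} p = subst (λ x → toℕ (ιE e) < toℕ x) (ιEιE e) p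

    card₋ : Card (Pts (Pos-e ∘ ιE)) (sum (map weight es₊))
    card₋ = card-map (λ (a , r) → ιA a , r)
      (λ { {(e , j) , r} ((p , q) , s) → (subst (j <_) (sym (cross-ι e)) p , subst Pos-e (sym (ιEιE e)) q) , subst (r <_) (sym (wt-ι e)) s })
      (λ { {(e , j) , r} {(e′ , j′) , r′} _ _ q → cong₂ _,_ (trans (sym (ιιA (e , j))) (trans (cong (ιA ∘ proj₁) q) (ιιA (e′ , j′)))) (cong proj₂ q) })
      (λ { {(e , j) , r} ((p , q) , s) → ((ιE e , j) , r) , ((subst (j <_) (sym (cross-ι e)) p , q) , subst (r <_) (sym (wt-ι e)) s) , cong (_, r) (ιιA (e , j)) })
      card₊

    all-pts : Card (Pts (λ _ → ⊤)) (2 * d)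
    all-pts = card-subst (trans (sym (sumFin-list (λ _ → yes tt) weight (proj₁ (proj₂ (card-Fin nE)))))
      (trans (sumFin-cong (λ e → *-comm (cross e) (wt e))) (proj₁ (proj₂ (proj₂ ok))))) (card-pts (allFin nE) (proj₁ (proj₂ (card-Fin nE))))

    pos? : ∀ e → Pos-e e ⊎ Pos-e (ιE e)
    pos? e with <-cmpℕ (toℕ e) (toℕ (ιE e))
    ... | tri< l _ _ = inj₁ l
    ... | tri≈ _ q _ = ⊥-elim (ιE≢ e (sym (F.toℕ-injective q)))
    ... | tri> _ _ l = inj₂ (subst (λ x → toℕ (ιE e) < toℕ x) (sym (ιEιE e)) l)

    half-degree : sum (map weight es₊) ≡ d
    half-degree = m+m-injective (trans (card-≡ (card-⇔
        (λ { (inj₁ ((p , _) , r)) → (p , tt) , r ; (inj₂ ((p , _) , r)) → (p , tt) , r })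
        (λ { {(e , j) , r} ((p , _) , s) → sign e p s })
        (card-⊎ {P = Pts Pos-e} {Q = Pts (Pos-e ∘ ιE)} (λ { ((_ , p) , _) ((_ , q) , _) → <-asym p (flip q) }) card₊ card₋)) all-pts)
      (cong (d +_) (+-identityʳ d)))
      where
      sign : ∀ e {j r} → j < cross e → r < wt e → Pts Pos-e ((e , j) , r) ⊎ Pts (Pos-e ∘ ιE) ((e , j) , r)
      sign e p s = [ (λ l → inj₁ ((p , l) , s)) , (λ l → inj₂ ((p , l) , s)) ]′ (pos? e)

    ungl : ∀ {a} → Xs zero a → X (unglue a)
    ungl {e , j} x = let (p , q) = zero→ {e , j} x in ≤-trans (≤-reflexive (m+[n∸m]≡n p)) q

    p₀ : Fin (d + d)
    p₀ = fromℕ< {0} (≤-trans 1≤d (m≤m+n d d))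

  card-marked : Card (Marking.Loop c d) (dfact d * (2 ^ n * (vertexFactor c * edgeFactor c)))
  card-marked = card-subst (cong (dfact d *_) prod-K) (Framing.Closed.card-loops frame gluing)
    where
    frame : Frame d
    frame = record
      { p₀ = p₀ ; A = Arc ; V = Fin nV ; _≟A_ = _≟A_ ; ι = ιA ; ιι = ιιA ; w = wA ; w-ι = wA-ι ; X = X ; Pos = Pos
      ; X-ι = λ {a} x → subst (proj₂ a <_) (sym (cross-ι (proj₁ a))) x
      ; pos? = λ {a} _ → pos? (proj₁ a) ; pos! = λ p q → <-asym p (flip q)
      ; 1≤w = λ {a} _ → wt≥1 (proj₁ a) ; base-points = card-subst half-degree card₊ }
    gluing : Framing.Gluing frame
    gluing = record
      { n = n ; Xs = Xs ; last≡ = λ {a} → last→ {a} ; ≡last = λ {a} → →last {a} ; glue = glue ; unglue = unglue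
      ; unglue-X = λ {a} → ungl {a} ; glue-X = λ {a} x → →zero {glue a} (s≤s z≤n) x ; glue-unglue = λ {a} → glue-unglue {a}
      ; unglue-glue = λ _ → refl ; unglue-ι = λ _ → refl ; w-unglue = λ _ → refl
      ; sN = startV ; sF = endV ; K = K ; local = λ i st → At.local i st }

-- Marked tuples and the Hurwitz conditions

iter-it : ∀ {m} (p : Vec (Fin m) m) k x → iter p k x ≡ it (p !!_) k x
iter-it p zero x = refl
iter-it p (suc k) x = cong (p !!_) (iter-it p k x)

cyc⇒same : ∀ {m} {p : Vec (Fin m) m} {x y} → Cyc (p !!_) x y → SameCycle p x y
cyc⇒same {p = p} (k , e) = k , trans (iter-it p k _) e

same⇒cyc : ∀ {m} {p : Vec (Fin m) m} {x y} → SameCycle p x y → Cyc (p !!_) x y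
same⇒cyc {p = p} (k , e) = k , trans (sym (iter-it p k _)) e

∈-vecToList : ∀ {A : Set} {k} (v : Vec A k) i → v !! i ∈ vecToList v
∈-vecToList (x ∷ v) zero = here refl
∈-vecToList (x ∷ v) (suc i) = there (∈-vecToList v i)

vecToList-∈ : ∀ {A : Set} {k x} (v : Vec A k) → x ∈ vecToList v → ∃ λ i → x ≡ v !! i
vecToList-∈ (x ∷ v) (here e) = zero , e
vecToList-∈ (x ∷ v) (there i) = let (j , e) = vecToList-∈ v i in suc j , e

module Generators (d : ℕ) {n : ℕ} (σ : Perm d) (ηs : Vec (Perm d) n) (α : Perm d) where

  gens : List (Fin (d + d) → Fin (d + d))
  gens = (σ !!_) ∷ (α !!_) ∷ (map _!!_ (vecToList ηs) ++ map (λ η x → τ d (η !! τ d x)) (vecToList ηs))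

  σ∈ : (σ !!_) ∈ gens
  σ∈ = here refl

  α∈ : (α !!_) ∈ gens
  α∈ = there (here refl)

  η∈ : ∀ i → ((ηs !! i) !!_) ∈ gens
  η∈ i = there (there (∈-++⁺ˡ (∈-map⁺ _!!_ (∈-vecToList ηs i))))

  mirror∈ : ∀ i → (λ x → τ d ((ηs !! i) !! τ d x)) ∈ gens
  mirror∈ i = there (there (∈-++⁺ʳ (map _!!_ (vecToList ηs)) (∈-map⁺ (λ η x → τ d (η !! τ d x)) (∈-vecToList ηs i))))

  gens-elim : ∀ (Q : (Fin (d + d) → Fin (d + d)) → Set) → Q (σ !!_) → Q (α !!_) → (∀ i → Q ((ηs !! i) !!_)) →
    (∀ i → Q (λ x → τ d ((ηs !! i) !! τ d x))) → ∀ {h} → h ∈ gens → Q h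
  gens-elim Q a b f g (here refl) = a
  gens-elim Q a b f g (there (here refl)) = b
  gens-elim Q a b f g (there (there i)) with ∈-++⁻ (map _!!_ (vecToList ηs)) i
  ... | inj₁ j with ∈-map⁻ _!!_ j
  ... | η , η∈ , refl with vecToList-∈ ηs η∈
  ... | k , refl = f k
  gens-elim Q a b f g (there (there i)) | inj₂ j with ∈-map⁻ (λ η x → τ d (η !! τ d x)) j
  ... | η , η∈ , refl with vecToList-∈ ηs η∈
  ... | k , refl = g k

module LoopFacts {n : ℕ} (d : ℕ) (c : TCover n) (tc : IsTropCover c) (ts : IsTwistedStructure c)
  {z : (Vec (Fin (d + d)) (d + d) × Vec (Arcs.Arc c) (d + d)) × Vec (Vec (Fin (d + d)) (d + d) × Vec (Arcs.Arc c) (d + d)) n}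
  {α : Vec (Fin (d + d)) (d + d)} (L : Marking.Loop c d (z , α)) where

  open Symmetric c tc ts public
  module M = Marking c d
  open M using (run; start; conj; Agree; Link; State; module State; Crossing; module Crossing; ττ; τ≢) public

  private
    P = Fin (d + d)

  σ = proj₁ (proj₁ z)
  δs = proj₂ z

  η : Fin n → Vec P (d + d)
  η i = proj₁ (δs !! i)

  S : Fin (suc n) → P → P
  S i = proj₁ (run δs (start (proj₁ z)) i)

  lb : Fin (suc n) → P → Arc
  lb i = proj₂ (run δs (start (proj₁ z)) i)

  opaque
    state : ∀ i → State (Xs i) (S i) (lb i)
    state = M.Loop.good L

    crossing : ∀ i → Crossing (Xs (suc i)) (Xs (inject₁ i)) (startV i) (endV i) (S (suc i)) (lb (suc i)) (η i) (proj₂ (δs !! i))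
    crossing = M.Loop.steps L

  lb-far : ∀ i p → proj₂ (δs !! i) !! p ≡ lb (inject₁ i) p
  lb-far i p = sym (cong (λ s → proj₂ s p) (M.run-step δs (start (proj₁ z)) i))

  S-far : ∀ i p → S (inject₁ i) p ≡ conj (η i !!_) (S (suc i)) p
  S-far i p = cong (λ s → proj₁ s p) (M.run-step δs (start (proj₁ z)) i)

  lb-last : ∀ p → lb (fromℕ n) p ≡ proj₂ (proj₁ z) !! p
  lb-last p = cong (λ s → proj₂ s p) (M.run-last δs (start (proj₁ z)))

  S-last : ∀ p → S (fromℕ n) p ≡ σ !! p
  S-last p = cong (λ s → proj₁ s p) (M.run-last δs (start (proj₁ z)))

  step : ∀ i p → Agree (endV i) (lb (inject₁ i) p) (startV i) (lb (suc i) p)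
  step i p = subst (λ a → Agree (endV i) a (startV i) (lb (suc i) p)) (lb-far i p) (Crossing.step (crossing i) p)

  lb-glue : ∀ p → lb zero (α !! p) ≡ glue (lb (fromℕ n) p)
  lb-glue p = trans (M.Loop.α-l L p) (cong glue (sym (lb-last p)))

  α-inj : Inj (α !!_)
  α-inj = proj₁ (M.Loop.α-B L) _ _

  vx : ∀ i → P → Maybe (Fin nV)
  vx i p = startV i (lb (suc i) p)

  vx-τ : ∀ i p → vx i (τ d p) ≡ Data.Maybe.map ιV (vx i p)
  vx-τ i p = trans (cong (startV i) (State.l-τ (state (suc i)) p)) (startV-ι _)

  vx-η : ∀ i p → vx i (η i !! p) ≡ vx i p
  vx-η i p with Crossing.pres (crossing i) p
  ... | inj₁ (u , a , b) = trans a (sym b)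
  ... | inj₂ (a , b , _) = trans a (sym b)

  vx-mirror : ∀ i p → vx i (τ d (η i !! τ d p)) ≡ vx i p
  vx-mirror i p = trans (vx-τ i _) (trans (cong (Data.Maybe.map ιV) (vx-η i (τ d p))) (trans (sym (vx-τ i (τ d p))) (cong (vx i) (ττ p))))

  vx-S : ∀ i p → vx i (S (suc i) p) ≡ vx i p
  vx-S i p = cong (startV i) (State.l-T (state (suc i)) p)

  moved-vx : ∀ i {q} → η i !! q ≢ q ⊎ η i !! τ d q ≢ τ d q → ∃ λ u → vx i q ≡ just u
  moved-vx i {q} m = [ direct , (λ k → let (u , e) = direct k in ιV u , trans (cong (vx i) (sym (ττ q))) (trans (vx-τ i (τ d q)) (cong (Data.Maybe.map ιV) e))) ]′ m
    where
    direct : ∀ {q} → η i !! q ≢ q → ∃ λ u → vx i q ≡ just u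
    direct = LocalCount.At.moved-start d c tc ts i (state (suc i)) (crossing i)

  -- Following the labels backwards along the edges, every point comes from the start of an edge.
  trace : ∀ (Q : Fin (suc n) → P → Set) → (∀ i p e → lb (suc i) p ≡ (e , 0) → pos (src e) ≡ i → Q (suc i) p) →
    (∀ i p → vx i p ≡ nothing → Q (inject₁ i) p → Q (suc i) p) → (∀ p → Q (fromℕ n) p → Q zero (α !! p)) → ∀ i p → Q i p
  trace Q st ps gl i p = level (ground _) _ i p ≤-refl refl
    where
    level : ∀ {j} → (∀ p → proj₂ (lb zero p) ≡ j → Q zero p) → ∀ k i p → toℕ i ≤ k → proj₂ (lb i p) ≡ j → Q i p
    level g k zero p _ e = g p e
    level g (suc k) (suc i) p (s≤s l) e = go (vx i p) refl (step i p)
      where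
      go : ∀ m → vx i p ≡ m → Agree (endV i) (lb (inject₁ i) p) (startV i) (lb (suc i) p) → Q (suc i) p
      go nothing q (inj₁ (u , _ , b)) = case trans (sym b) q of λ ()
      go nothing q (inj₂ (_ , _ , same)) = ps i p q (level g k (inject₁ i) p (≤-trans (≤-reflexive (F.toℕ-inject₁ i)) l) (trans (cong proj₂ same) e))
      go (just u) q _ = let (a , b , r) = startV-just {i} {lb (suc i) p} q in st i p _ (cong (proj₁ (lb (suc i) p) ,_) a) (trans (cong pos b) r)
    ground : ∀ j p → proj₂ (lb zero p) ≡ j → Q zero p
    ground j p e = subst (Q zero) (proj₂ pre) (down j (trans (cong proj₂ (sym (lb-glue (proj₁ pre)))) (trans (cong (proj₂ ∘ lb zero) (proj₂ pre)) e)))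
      where
      pre = inj⇒onto α-inj p
      down : ∀ j → suc (proj₂ (lb (fromℕ n) (proj₁ pre))) ≡ j → Q zero (α !! proj₁ pre)
      down zero ()
      down (suc j) e = gl _ (level (ground j) n (fromℕ n) _ (≤-reflexive (F.toℕ-fromℕ n)) (suc-injective e))

  opaque
    pnt : Fin nE → P
    pnt e = proj₁ (State.l-onto (state (suc (pos (src e)))) (start-arc refl))

    lb-pnt : ∀ e → lb (suc (pos (src e))) (pnt e) ≡ (e , 0)
    lb-pnt e = proj₂ (State.l-onto (state (suc (pos (src e)))) (start-arc refl))

    vx-pnt : ∀ e → vx (pos (src e)) (pnt e) ≡ just (src e)
    vx-pnt e = trans (cong (startV _) (lb-pnt e)) (startV-yes refl)

    end-pnt : ∀ e → ∃ λ p → lb (inject₁ (pos (tgt e))) p ≡ (e , cross e) × vx (pos (tgt e)) p ≡ just (tgt e)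
    end-pnt e with State.l-onto (state (inject₁ (pos (tgt e)))) (end-arc refl)
    ... | p , q with step (pos (tgt e)) p | trans (cong (endV (pos (tgt e))) q) (endV-yes refl)
    ... | inj₁ (u , a , b) | r = p , q , trans b (trans (sym a) r)
    ... | inj₂ (a , _ , _) | r = case trans (sym a) r of λ ()

  ηs : Vec (Perm d) n
  ηs = V.map proj₁ δs

  η-lookup : ∀ i → ηs !! i ≡ η i
  η-lookup i = VP.lookup-map i proj₁ δs

  open Generators d σ ηs α public

  colour-S : ∀ {C : Set} (f : P → C) → (∀ {h} → h ∈ gens → ∀ x → f (h x) ≡ f x) → ∀ i p → f (S i p) ≡ f p
  colour-S f inv = M.run-good (λ i s → ∀ p → f (proj₁ s p) ≡ f p) δs (start (proj₁ z)) (inv σ∈)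
    (λ i h p → trans (ηi i _) (trans (h _) (mi i p)))
    where
    ηi : ∀ i p → f (η i !! p) ≡ f p
    ηi i p = subst (λ v → f (v !! p) ≡ f p) (η-lookup i) (inv (η∈ i) p)
    mi : ∀ i p → f (τ d (η i !! τ d p)) ≡ f p
    mi i p = subst (λ v → f (τ d (v !! τ d p)) ≡ f p) (η-lookup i) (inv (mirror∈ i) p)

  connected⇒transitive : Connected c → Transitive gens
  connected⇒transitive conn x y with colouring gens
  ... | f , inv , snd = snd (trans (at x) (sym (at y)))
    where
    cyc-f : ∀ {i p q} → lb i p ≡ lb i q → f p ≡ f q
    cyc-f {i} {p} e = sym (cyc-closed {D = λ w → f w ≡ f p} (λ h → trans (colour-S f inv i _) h) refl (State.l-cyc (state i) e))
    link-f : ∀ {i p q u} → vx i p ≡ just u → vx i q ≡ just u → f p ≡ f q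
    link-f {i} a b = orbit-inv f
      (λ { (here refl) → colour-S f inv (suc i)
         ; (there (here refl)) p → subst (λ v → f (v !! p) ≡ f p) (η-lookup i) (inv (η∈ i) p)
         ; (there (there (here refl))) p → subst (λ v → f (τ d (v !! τ d p)) ≡ f p) (η-lookup i) (inv (mirror∈ i) p) })
      (Crossing.linked (crossing i) a b)
    origin : ∀ i p → f p ≡ f (pnt (proj₁ (lb i p)))
    origin = trace (λ i p → f p ≡ f (pnt (proj₁ (lb i p))))
      (λ { i p e q refl → trans (cyc-f {suc i} (trans q (sym (lb-pnt e)))) (cong (f ∘ pnt ∘ proj₁) (sym q)) })
      (λ i p n h → trans h (cong (f ∘ pnt ∘ proj₁) (same i p n)))
      (λ p h → trans (inv α∈ p) (trans h (cong (f ∘ pnt ∘ proj₁) (sym (lb-glue p)))))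
      where
      same : ∀ i p → vx i p ≡ nothing → lb (inject₁ i) p ≡ lb (suc i) p
      same i p n with step i p
      ... | inj₁ (_ , _ , b) = case trans (sym b) n of λ ()
      ... | inj₂ (_ , _ , e) = e
    vp : Fin nV → P
    vp v = pnt (proj₁ (out-edge v))
    vp-f : ∀ {i p v} → vx i p ≡ just v → f p ≡ f (vp v)
    vp-f {i} {p} {v} h with out-edge v | startV-just {i} {lb (suc i) p} h
    ... | e , refl | _ , _ , refl = link-f {i} h (vx-pnt e)
    edge : ∀ e → f (vp (src e)) ≡ f (vp (tgt e))
    edge e = let (p , q , r) = end-pnt e in trans (sym (vp-f (vx-pnt e))) (trans (sym (trans (origin _ p) (cong (f ∘ pnt ∘ proj₁) q))) (vp-f r))
    v₀ = src (proj₁ (lb (fromℕ n) x))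
    Sv : Fin nV → Bool
    Sv v = does (f (vp v) ≟ f (vp v₀))
    all : ∀ v → f (vp v) ≡ f (vp v₀)
    all v with f (vp v) ≟ f (vp v₀) | conn Sv (λ e → cong (λ a → does (a ≟ f (vp v₀))) (edge e)) v v₀
    ... | yes p | _ = p
    ... | no _ | q = case trans q (dec-true (f (vp v₀) ≟ f (vp v₀)) refl) of λ ()
    at : ∀ p → f p ≡ f (vp v₀)
    at p = trans (origin (fromℕ n) p) (trans (vp-f (vx-pnt _)) (all _))

  transitive⇒connected : Transitive gens → Connected c
  transitive⇒connected tr Sv inv v w = trans (sym (at v)) (trans (orbit-inv χ ginv (tr _ _)) (at w))
    where
    χ : P → Bool
    χ p = Sv (src (proj₁ (lb (fromℕ n) p)))
    χi : ∀ i → P → Bool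
    χi i p = Sv (src (proj₁ (lb i p)))
    agree : ∀ {i a b} → Agree (startV i) a (startV i) b → Sv (src (proj₁ a)) ≡ Sv (src (proj₁ b))
    agree {i} {a} {b} (inj₁ (u , p , q)) = cong Sv (trans (proj₁ (proj₂ (startV-just {i} {a} p))) (sym (proj₁ (proj₂ (startV-just {i} {b} q)))))
    agree (inj₂ (_ , _ , refl)) = refl
    χ-step : ∀ i p → χi (inject₁ i) p ≡ χi (suc i) p
    χ-step i p with step i p
    ... | inj₁ (u , a , b) = trans (inv _) (cong Sv (trans (proj₁ (proj₂ (endV-just {i} {lb (inject₁ i) p} a))) (sym (proj₁ (proj₂ (startV-just {i} {lb (suc i) p} b))))))
    ... | inj₂ (_ , _ , e) = cong (Sv ∘ src ∘ proj₁) e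
    const : ∀ {m} (h : Fin (suc m) → Bool) → (∀ i → h (inject₁ i) ≡ h (suc i)) → ∀ i → h zero ≡ h i
    const h s zero = refl
    const {suc m} h s (suc i) = trans (s zero) (const (h ∘ suc) (s ∘ suc) i)
    χ-all : ∀ i p → χi i p ≡ χ p
    χ-all i p = trans (sym (const (λ i → χi i p) (λ i → χ-step i p) i)) (const (λ i → χi i p) (λ i → χ-step i p) (fromℕ n))
    ηinv : ∀ i p → χ (η i !! p) ≡ χ p
    ηinv i p = trans (sym (χ-all (suc i) _)) (trans (agree {i} (Crossing.pres (crossing i) p)) (χ-all (suc i) p))
    τagree : ∀ {i p q} → Agree (startV i) (lb (suc i) p) (startV i) (lb (suc i) q) → χi (suc i) (τ d p) ≡ χi (suc i) (τ d q)
    τagree {i} {p} {q} a = agree {i} (help a)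
      where
      help : Agree (startV i) (lb (suc i) p) (startV i) (lb (suc i) q) → Agree (startV i) (lb (suc i) (τ d p)) (startV i) (lb (suc i) (τ d q))
      help (inj₁ (u , x , y)) = inj₁ (ιV u , trans (vx-τ i p) (cong (Data.Maybe.map ιV) x) , trans (vx-τ i q) (cong (Data.Maybe.map ιV) y))
      help (inj₂ (x , y , e)) = inj₂ (trans (vx-τ i p) (cong (Data.Maybe.map ιV) x) , trans (vx-τ i q) (cong (Data.Maybe.map ιV) y) ,
        trans (State.l-τ (state (suc i)) p) (trans (cong ιA e) (sym (State.l-τ (state (suc i)) q))))
    minv : ∀ i p → χ (τ d (η i !! τ d p)) ≡ χ p
    minv i p = trans (sym (χ-all (suc i) _)) (trans (τagree {i} (Crossing.pres (crossing i) (τ d p))) (trans (cong (χi (suc i)) (ττ p)) (χ-all (suc i) p)))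
    ginv : ∀ {h} → h ∈ gens → ∀ p → χ (h p) ≡ χ p
    ginv = gens-elim (λ h → ∀ p → χ (h p) ≡ χ p)
      (λ p → trans (cong (Sv ∘ src ∘ proj₁ ∘ lb (fromℕ n)) (sym (S-last p))) (cong (Sv ∘ src ∘ proj₁) (State.l-T (state (fromℕ n)) p)))
      (λ p → trans (sym (χ-all zero _)) (cong (Sv ∘ src ∘ proj₁) (lb-glue p)))
      (λ i p → subst (λ v → χ (v !! p) ≡ χ p) (sym (η-lookup i)) (ηinv i p))
      (λ i p → subst (λ v → χ (τ d (v !! τ d p)) ≡ χ p) (sym (η-lookup i)) (minv i p))
    at : ∀ v → χ (pnt (proj₁ (out-edge v))) ≡ Sv v
    at v with out-edge v
    ... | e , refl = trans (sym (χ-all (suc (pos (src e))) (pnt e))) (cong (Sv ∘ src ∘ proj₁) (lb-pnt e))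

  S-zero : ∀ p → S zero p ≡ applyL d ηs (σ !! applyR d ηs p)
  S-zero = go δs
    where
    go : ∀ {m} (δs : Vec M.D m) p → proj₁ (run δs (start (proj₁ z)) zero) p ≡ applyL d (V.map proj₁ δs) (σ !! applyR d (V.map proj₁ δs) p)
    go [] p = refl
    go (δ ∷ δs) p = cong (proj₁ δ !!_) (go δs _)

  hurwitz : Connected c → HurCond d (suc n) (σ , ηs , α)
  hurwitz conn = (λ i → let (x , y , a , b , e) = Crossing.adm (crossing i) in
      x , y , a , b , trans (η-lookup i) (trans e (VP.tabulate-cong (sw-≡ x y)))) ,
    (((λ i j e → inj e) , tw) , λ i h → no-self (same⇒cyc (h i (0 , refl)))) ,
    M.Loop.α-B L ,
    (λ p → trans (sym (S-zero _)) (M.Loop.α-T L p)) ,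
    connected⇒transitive conn
    where
    open M.TwPerm (M.State.twp (M.Loop.initial L))

-- Two marked tuples with the same underlying tuple

record Iso {n} (c c′ : TCover n) : Set where
  private
    module C = TCover c
    module C′ = TCover c′
  field
    fV : Fin C.nV → Fin C′.nV
    fE : Fin C.nE → Fin C′.nE
    f-pos : ∀ v → C′.pos (fV v) ≡ C.pos v
    f-src : ∀ e → C′.src (fE e) ≡ fV (C.src e)
    f-tgt : ∀ e → C′.tgt (fE e) ≡ fV (C.tgt e)
    f-wt : ∀ e → C′.wt (fE e) ≡ C.wt e
    f-wind : ∀ e → C′.wind (fE e) ≡ C.wind e
    f-ιV : ∀ v → fV (C.ιV v) ≡ C′.ιV (fV v)
    f-ιE : ∀ e → fE (C.ιE e) ≡ C′.ιE (fE e)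
    gV : Fin C′.nV → Fin C.nV
    gE : Fin C′.nE → Fin C.nE
    fgV : ∀ v → fV (gV v) ≡ v
    gfV : ∀ v → gV (fV v) ≡ v
    fgE : ∀ e → fE (gE e) ≡ e
    gfE : ∀ e → gE (fE e) ≡ e

module Compare {n : ℕ} (d : ℕ)
  (c : TCover n) (tc : IsTropCover c) (ts : IsTwistedStructure c)
  (c′ : TCover n) (tc′ : IsTropCover c′) (ts′ : IsTwistedStructure c′)
  {σ : Vec (Fin (d + d)) (d + d)} {l : Vec (Arcs.Arc c) (d + d)} {δs : Vec (Vec (Fin (d + d)) (d + d) × Vec (Arcs.Arc c) (d + d)) n}
  {l′ : Vec (Arcs.Arc c′) (d + d)} {δs′ : Vec (Vec (Fin (d + d)) (d + d) × Vec (Arcs.Arc c′) (d + d)) n} {α : Vec (Fin (d + d)) (d + d)}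
  (L : Marking.Loop c d (((σ , l) , δs) , α)) (L′ : Marking.Loop c′ d (((σ , l′) , δs′) , α))
  (η≡ : ∀ i → proj₁ (δs !! i) ≡ proj₁ (δs′ !! i)) where

  private
    module A = LoopFacts d c tc ts L
    module B = LoopFacts d c′ tc′ ts′ L′
    P = Fin (d + d)

  S≡ : ∀ i p → A.S i p ≡ B.S i p
  S≡ = A.M.run-good (λ i s → ∀ p → proj₁ s p ≡ B.S i p) δs _ (λ p → sym (B.S-last p))
    (λ i h p → trans (cong (λ v → v !! _) (η≡ i)) (trans (cong (B.η i !!_) (trans (h _) (cong (λ v → B.S (suc i) (τ d (v !! τ d p))) (η≡ i)))) (sym (B.S-far i p))))

  lb-cong : ∀ {i p q} → A.lb i p ≡ A.lb i q → B.lb i p ≡ B.lb i q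
  lb-cong {i} e = B.State.cyc-l (B.state i) (cyc-cong (S≡ i) (A.State.l-cyc (A.state i) e))

  start′ : ∀ i {p v} → A.vx i p ≡ just v → ∃ λ v′ → B.vx i p ≡ just v′
  start′ i {p} e with A.Crossing.moved (A.crossing i) e
  ... | q , cy , m with B.moved-vx i (subst (λ v → v !! q ≢ q ⊎ v !! τ d q ≢ τ d q) (η≡ i) m)
  ... | u , e′ = u , trans (cong (B.startV i) (B.State.cyc-l (B.state (suc i)) (cyc-cong (S≡ (suc i)) cy))) e′

  same-vertex : ∀ i {p q v} → A.vx i p ≡ just v → A.vx i q ≡ just v → B.vx i p ≡ B.vx i q
  same-vertex i a b = orbit-inv (B.vx i)
    (λ { (here refl) p → trans (cong (B.vx i) (S≡ (suc i) p)) (B.vx-S i p)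
       ; (there (here refl)) p → trans (cong (λ v → B.vx i (v !! p)) (η≡ i)) (B.vx-η i p)
       ; (there (there (here refl))) p → trans (cong (λ v → B.vx i (τ d (v !! τ d p))) (η≡ i)) (B.vx-mirror i p) })
    (A.Crossing.linked (A.crossing i) a b)

module Isomorphism {n : ℕ} (d : ℕ)
  (c : TCover n) (tc : IsTropCover c) (ts : IsTwistedStructure c)
  (c′ : TCover n) (tc′ : IsTropCover c′) (ts′ : IsTwistedStructure c′)
  {σ : Vec (Fin (d + d)) (d + d)} {l : Vec (Arcs.Arc c) (d + d)} {δs : Vec (Vec (Fin (d + d)) (d + d) × Vec (Arcs.Arc c) (d + d)) n}
  {l′ : Vec (Arcs.Arc c′) (d + d)} {δs′ : Vec (Vec (Fin (d + d)) (d + d) × Vec (Arcs.Arc c′) (d + d)) n} {α : Vec (Fin (d + d)) (d + d)}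
  (L : Marking.Loop c d (((σ , l) , δs) , α)) (L′ : Marking.Loop c′ d (((σ , l′) , δs′) , α))
  (η≡ : ∀ i → proj₁ (δs !! i) ≡ proj₁ (δs′ !! i)) where

  private
    module A = LoopFacts d c tc ts L
    module B = LoopFacts d c′ tc′ ts′ L′
    module AB = Compare d c tc ts c′ tc′ ts′ L L′ η≡
    module BA = Compare d c′ tc′ ts′ c tc ts L′ L (sym ∘ η≡)
    P = Fin (d + d)

  fE : Fin A.nE → Fin B.nE
  fE e = proj₁ (B.lb (suc (A.pos (A.src e))) (A.pnt e))

  fV : Fin A.nV → Fin B.nV
  fV v = B.src (fE (proj₁ (A.out-edge v)))

  private
    start-lb : ∀ i {p} e → A.lb (suc i) p ≡ (e , 0) → A.pos (A.src e) ≡ i → B.lb (suc i) p ≡ (fE e , 0) × B.vx i p ≡ just (B.src (fE e))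
    start-lb _ {p} e q refl = go (AB.start′ i {p} (trans (cong (A.startV i) q) (A.startV-yes refl)))
      where
      i : Fin n
      i = A.pos (A.src e)
      same : B.lb (suc i) p ≡ B.lb (suc i) (A.pnt e)
      same = AB.lb-cong {suc i} {p} {A.pnt e} (trans q (sym (A.lb-pnt e)))
      go : (∃ λ u → B.vx i p ≡ just u) → B.lb (suc i) p ≡ (fE e , 0) × B.vx i p ≡ just (B.src (fE e))
      go (u , h) = let (a , b , _) = B.startV-just {i} {B.lb (suc i) p} h in
        trans (cong (proj₁ (B.lb (suc i) p) ,_) a) (cong (λ x → proj₁ x , 0) same) ,
        trans h (cong just (trans (sym b) (cong (B.src ∘ proj₁) same)))

    not-start : ∀ i {p} → A.vx i p ≡ nothing → B.vx i p ≡ nothing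
    not-start i {p} h = go (B.vx i p) refl
      where
      go : (m : Maybe (Fin B.nV)) → B.vx i p ≡ m → m ≡ nothing
      go nothing _ = refl
      go (just u) q = contradiction (trans (sym (proj₂ (BA.start′ i q))) h) λ ()

  f-lb : ∀ i p → B.lb i p ≡ (fE (proj₁ (A.lb i p)) , proj₂ (A.lb i p))
  f-lb = A.trace (λ i p → B.lb i p ≡ f (A.lb i p))
    (λ i p e q r → trans (proj₁ (start-lb i e q r)) (cong f (sym q)))
    pass
    (λ p h → trans (B.lb-glue p) (trans (cong B.glue h) (cong f (sym (A.lb-glue p)))))
    where
    f : A.Arc → B.Arc
    f (e , j) = fE e , j
    pass : ∀ i p → A.vx i p ≡ nothing → B.lb (inject₁ i) p ≡ f (A.lb (inject₁ i) p) → B.lb (suc i) p ≡ f (A.lb (suc i) p)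
    pass i p h k = go (A.step i p) (B.step i p)
      where
      Agree : {X : Set} {V : Set} → (end start : Maybe V) (before after : X) → Set
      Agree end start before after = (∃ λ v → end ≡ just v × start ≡ just v) ⊎ (end ≡ nothing × start ≡ nothing × before ≡ after)
      go : Agree (A.endV i (A.lb (inject₁ i) p)) (A.vx i p) (A.lb (inject₁ i) p) (A.lb (suc i) p) →
        Agree (B.endV i (B.lb (inject₁ i) p)) (B.vx i p) (B.lb (inject₁ i) p) (B.lb (suc i) p) → B.lb (suc i) p ≡ f (A.lb (suc i) p)
      go (inj₁ (_ , _ , b)) _ = contradiction (trans (sym b) h) λ ()
      go (inj₂ _) (inj₁ (_ , _ , b)) = contradiction (trans (sym b) (not-start i h)) λ ()
      go (inj₂ (_ , _ , e)) (inj₂ (_ , _ , e′)) = trans (sym e′) (trans k (cong f e))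

  private
    fE-start : ∀ e → B.lb (suc (A.pos (A.src e))) (A.pnt e) ≡ (fE e , 0) × B.vx (A.pos (A.src e)) (A.pnt e) ≡ just (B.src (fE e))
    fE-start e = start-lb _ e (A.lb-pnt e) refl

  pos-src : ∀ e → B.pos (B.src (fE e)) ≡ A.pos (A.src e)
  pos-src e = proj₂ (proj₂ (B.startV-just {_} {B.lb _ (A.pnt e)} (proj₂ (fE-start e))))

  f-src : ∀ e → B.src (fE e) ≡ fV (A.src e)
  f-src e = go (A.out-edge (A.src e))
    where
    go : (o : ∃ λ e′ → A.src e′ ≡ A.src e) → B.src (fE e) ≡ B.src (fE (proj₁ o))
    go (e′ , q) = just-injective (trans (sym (proj₂ (fE-start e)))
      (trans (AB.same-vertex _ (A.vx-pnt e) vp′) (subst (λ v → B.vx (A.pos v) (A.pnt e′) ≡ just (B.src (fE e′))) q (proj₂ (fE-start e′)))))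
      where
      vp′ : A.vx (A.pos (A.src e)) (A.pnt e′) ≡ just (A.src e)
      vp′ = subst (λ v → A.vx (A.pos v) (A.pnt e′) ≡ just v) q (A.vx-pnt e′)

  f-pos : ∀ v → B.pos (fV v) ≡ A.pos v
  f-pos v = trans (pos-src _) (cong A.pos (proj₂ (A.out-edge v)))

  f-vertex : ∀ i {p v} → A.vx i p ≡ just v → B.vx i p ≡ just (fV v)
  f-vertex i {p} h = let (a , b , r) = A.startV-just {i} {A.lb (suc i) p} h in
    trans (proj₂ (start-lb i _ (cong (proj₁ (A.lb (suc i) p) ,_) a) (trans (cong A.pos b) r))) (cong just (trans (f-src _) (cong fV b)))

  private
    end-lb : ∀ e → A.cross e ≡ B.cross (fE e) × B.tgt (fE e) ≡ fV (A.tgt e)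
    end-lb e = go (A.end-pnt e)
      where
      i : Fin n
      i = A.pos (A.tgt e)
      done : ∀ {p u} → B.lb (inject₁ i) p ≡ (fE e , A.cross e) → B.vx i p ≡ just (fV (A.tgt e)) → B.endV i (B.lb (inject₁ i) p) ≡ just u → B.vx i p ≡ just u →
        A.cross e ≡ B.cross (fE e) × B.tgt (fE e) ≡ fV (A.tgt e)
      done {p} w k a b = let (x , y , _) = B.endV-just {i} {B.lb (inject₁ i) p} a in
        trans (trans (sym (cong proj₂ w)) x) (cong (B.cross ∘ proj₁) w) ,
        trans (cong (B.tgt ∘ proj₁) (sym w)) (trans y (just-injective (trans (sym b) k)))
      at : ∀ {p} → B.lb (inject₁ i) p ≡ (fE e , A.cross e) → B.vx i p ≡ just (fV (A.tgt e)) →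
        (∃ λ v → B.endV i (B.lb (inject₁ i) p) ≡ just v × B.vx i p ≡ just v) ⊎ (B.endV i (B.lb (inject₁ i) p) ≡ nothing × B.vx i p ≡ nothing × B.lb (inject₁ i) p ≡ B.lb (suc i) p) →
        A.cross e ≡ B.cross (fE e) × B.tgt (fE e) ≡ fV (A.tgt e)
      at w k (inj₁ (u , a , b)) = done w k a b
      at w k (inj₂ (_ , b , _)) = contradiction (trans (sym k) b) λ ()
      go : (∃ λ p → A.lb (inject₁ i) p ≡ (e , A.cross e) × A.vx i p ≡ just (A.tgt e)) → A.cross e ≡ B.cross (fE e) × B.tgt (fE e) ≡ fV (A.tgt e)
      go (p , q , h) = at (trans (f-lb _ p) (cong (λ x → fE (proj₁ x) , proj₂ x) q)) (f-vertex _ h) (B.step i p)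

  f-tgt : ∀ e → B.tgt (fE e) ≡ fV (A.tgt e)
  f-tgt e = proj₂ (end-lb e)

  f-wt : ∀ e → B.wt (fE e) ≡ A.wt e
  f-wt e = sym (per-unique
    (subst (λ a → Per (A.S i) (A.pnt e) (A.wA a)) (A.lb-pnt e) (A.State.l-per (A.state i) (A.pnt e)))
    (per-cong (BA.S≡ i) (subst (λ a → Per (B.S i) (A.pnt e) (B.wA a)) (proj₁ (fE-start e)) (B.State.l-per (B.state i) (A.pnt e)))))
    where i = suc (A.pos (A.src e))

  f-wind : ∀ e → B.wind (fE e) ≡ A.wind e
  f-wind e = sym (+-cancelʳ-≡ _ _ _ (trans (proj₁ (end-lb e))
    (cong (B.wind (fE e) +_) (cong₂ (λ a b → [ toℕ a <ᵇ toℕ b ]ᵇ) (trans (cong B.pos (f-tgt e)) (f-pos _)) (pos-src e)))))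

  f-ιE : ∀ e → fE (A.ιE e) ≡ B.ιE (fE e)
  f-ιE e = cong proj₁ (trans (sym (trans (f-lb i (τ d p)) (cong (λ x → fE (proj₁ x) , proj₂ x) (trans (A.State.l-τ (A.state i) p) (cong A.ιA (A.lb-pnt e))))))
    (trans (B.State.l-τ (B.state i) p) (cong B.ιA (proj₁ (fE-start e)))))
    where
    i = suc (A.pos (A.src e))
    p = A.pnt e

  f-ιV : ∀ v → fV (A.ιV v) ≡ B.ιV (fV v)
  f-ιV v = let (e , q) = A.out-edge v in trans (cong (fV ∘ A.ιV) (sym q)) (trans (cong fV (sym (A.src-ι e)))
    (trans (sym (f-src (A.ιE e))) (trans (cong B.src (f-ιE e)) (trans (B.src-ι _) (cong B.ιV (trans (f-src e) (cong fV q)))))))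

module Round {n : ℕ} (d : ℕ)
  (c : TCover n) (tc : IsTropCover c) (ts : IsTwistedStructure c)
  (c′ : TCover n) (tc′ : IsTropCover c′) (ts′ : IsTwistedStructure c′)
  {σ : Vec (Fin (d + d)) (d + d)} {l : Vec (Arcs.Arc c) (d + d)} {δs : Vec (Vec (Fin (d + d)) (d + d) × Vec (Arcs.Arc c) (d + d)) n}
  {l′ : Vec (Arcs.Arc c′) (d + d)} {δs′ : Vec (Vec (Fin (d + d)) (d + d) × Vec (Arcs.Arc c′) (d + d)) n} {α : Vec (Fin (d + d)) (d + d)}
  (L : Marking.Loop c d (((σ , l) , δs) , α)) (L′ : Marking.Loop c′ d (((σ , l′) , δs′) , α))
  (η≡ : ∀ i → proj₁ (δs !! i) ≡ proj₁ (δs′ !! i)) where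

  private
    module A = LoopFacts d c tc ts L
    module I = Isomorphism d c tc ts c′ tc′ ts′ L L′ η≡
    module J = Isomorphism d c′ tc′ ts′ c tc ts L′ L (sym ∘ η≡)

  gfE : ∀ e → J.fE (I.fE e) ≡ e
  gfE e = cong proj₁ (trans (cong (λ a → J.fE (proj₁ a) , proj₂ a) (sym (trans (I.f-lb _ (A.pnt e)) (cong (λ a → I.fE (proj₁ a) , proj₂ a) (A.lb-pnt e)))))
    (trans (sym (J.f-lb (suc (A.pos (A.src e))) (A.pnt e))) (A.lb-pnt e)))

  gfV : ∀ v → J.fV (I.fV v) ≡ v
  gfV v = let (e , q) = A.out-edge v in trans (cong (J.fV ∘ I.fV) (sym q)) (trans (cong J.fV (sym (I.f-src e)))
    (trans (sym (J.f-src (I.fE e))) (trans (cong A.src (gfE e)) q)))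

same-tuple-iso : ∀ {n} d (c : TCover n) (tc : IsTropCover c) (ts : IsTwistedStructure c) (c′ : TCover n) (tc′ : IsTropCover c′) (ts′ : IsTwistedStructure c′)
  {σ l δs l′ δs′ α} (L : Marking.Loop c d (((σ , l) , δs) , α)) (L′ : Marking.Loop c′ d (((σ , l′) , δs′) , α))
  (η≡ : ∀ i → proj₁ (δs !! i) ≡ proj₁ (δs′ !! i)) →
  Σ[ f ∈ Iso c c′ ] ∀ i p → LoopFacts.lb d c′ tc′ ts′ L′ i p ≡ (Iso.fE f (proj₁ (LoopFacts.lb d c tc ts L i p)) , proj₂ (LoopFacts.lb d c tc ts L i p))
same-tuple-iso d c tc ts c′ tc′ ts′ L L′ η≡ = record
  { fV = I.fV ; fE = I.fE ; f-pos = I.f-pos ; f-src = I.f-src ; f-tgt = I.f-tgt ; f-wt = I.f-wt ; f-wind = I.f-wind ; f-ιV = I.f-ιV ; f-ιE = I.f-ιE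
  ; gV = J.fV ; gE = J.fE ; fgV = R′.gfV ; gfV = R.gfV ; fgE = R′.gfE ; gfE = R.gfE } , I.f-lb
  where
  module I = Isomorphism d c tc ts c′ tc′ ts′ L L′ η≡
  module J = Isomorphism d c′ tc′ ts′ c tc ts L′ L (sym ∘ η≡)
  module R = Round d c tc ts c′ tc′ ts′ L L′ η≡
  module R′ = Round d c′ tc′ ts′ c tc ts L′ L (sym ∘ η≡)

module Act {n : ℕ} (d : ℕ) (c c′ : TCover n) (f : Iso c c′) where

  private
    module A = Arcs c
    module B = Arcs c′
    module MA = Marking c d
    module MB = Marking c′ d
    P = Fin (d + d)
  open Iso f

  fA : A.Arc → B.Arc
  fA (e , j) = fE e , j

  private
    fA-inj : ∀ {a b} → fA a ≡ fA b → a ≡ b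
    fA-inj {e , j} {e′ , j′} q = cong₂ _,_ (trans (sym (gfE e)) (trans (cong (gE ∘ proj₁) q) (gfE e′))) (cong proj₂ q)

    ps≡ : ∀ e → B.pos (B.src (fE e)) ≡ A.pos (A.src e)
    ps≡ e = trans (cong B.pos (f-src e)) (f-pos _)

    pt≡ : ∀ e → B.pos (B.tgt (fE e)) ≡ A.pos (A.tgt e)
    pt≡ e = trans (cong B.pos (f-tgt e)) (f-pos _)

    cross≡ : ∀ e → B.cross (fE e) ≡ A.cross e
    cross≡ e = cong₂ _+_ (f-wind e) (cong₂ (λ a b → [ toℕ a <ᵇ toℕ b ]ᵇ) (pt≡ e) (ps≡ e))

    Xs-eq : ∀ i a → B.Xs i (fA a) ≡ A.Xs i a
    Xs-eq i (e , j) rewrite ps≡ e | pt≡ e | f-wind e = refl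

    to : ∀ {i a} → A.Xs i a → B.Xs i (fA a)
    to {i} {a} = subst id (sym (Xs-eq i a))

    from : ∀ {i b} → B.Xs i b → ∃ λ a → A.Xs i a × fA a ≡ b
    from {i} {e , j} x = (gE e , j) , subst id (Xs-eq i (gE e , j)) (subst (B.Xs i) (cong (_, j) (sym (fgE e))) x) , cong (_, j) (fgE e)

    start-f : ∀ i a → B.startV i (fA a) ≡ Data.Maybe.map fV (A.startV i a)
    start-f i (e , j) with (j ≟ℕ 0) ×-dec (A.pos (A.src e) ≟ i)
    ... | yes (refl , q) = trans (B.startV-yes (trans (ps≡ e) q)) (cong just (f-src e))
    ... | no m = B.startV-nothing {a = fE e , j} (λ (p , q) → m (p , trans (sym (ps≡ e)) q))

    end-f : ∀ i a → B.endV i (fA a) ≡ Data.Maybe.map fV (A.endV i a)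
    end-f i (e , j) with (j ≟ℕ A.cross e) ×-dec (A.pos (A.tgt e) ≟ i)
    ... | yes (refl , q) = trans (cong (λ k → B.endV i (fE e , k)) (sym (cross≡ e))) (trans (B.endV-yes (trans (pt≡ e) q)) (cong just (f-tgt e)))
    ... | no m = B.endV-nothing {a = fE e , j} (λ (p , q) → m (trans p (cross≡ e) , trans (sym (pt≡ e)) q))

    state-f : ∀ {i T T′ l l′} → (∀ p → T p ≡ T′ p) → (∀ p → fA (l p) ≡ l′ p) → MA.State (A.Xs i) T l → MB.State (B.Xs i) T′ l′
    state-f {i} {T} {T′} {l} {l′} eT el s = MB.state-cong eT el record
      { twp = record { inj = inj ; tw = tw ; nf = nf }
      ; l∈ = λ p → to (l∈ p)
      ; l-T = λ p → cong fA (l-T p)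
      ; l-τ = λ p → trans (cong fA (l-τ p)) (cong (_, proj₂ (l p)) (f-ιE _))
      ; l-cyc = λ e → l-cyc (fA-inj e)
      ; l-per = λ p → subst (Per T p) (sym (f-wt _)) (l-per p)
      ; l-onto = λ x → let (a , xa , e) = from x ; (p , e′) = l-onto xa in p , trans (cong fA e′) e }
      where open MA.State s

    Agree-f : ∀ (s s′ : A.Arc → Maybe (Fin A.nV)) {a b} (r r′ : B.Arc → Maybe (Fin B.nV)) → (∀ a → r (fA a) ≡ Data.Maybe.map fV (s a)) → (∀ a → r′ (fA a) ≡ Data.Maybe.map fV (s′ a)) →
      MA.Agree s a s′ b → MB.Agree r (fA a) r′ (fA b)
    Agree-f s s′ r r′ h h′ (inj₁ (u , p , q)) = inj₁ (fV u , trans (h _) (cong (Data.Maybe.map fV) p) , trans (h′ _) (cong (Data.Maybe.map fV) q))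
    Agree-f s s′ r r′ h h′ (inj₂ (p , q , e)) = inj₂ (trans (h _) (cong (Data.Maybe.map fV) p) , trans (h′ _) (cong (Data.Maybe.map fV) q) , cong fA e)

    start⁻ : ∀ {i a v} → B.startV i (fA a) ≡ just v → A.startV i a ≡ just (gV v)
    start⁻ {i} {a} e = lem (A.startV i a) (trans (sym (start-f i a)) e)
      where
      lem : ∀ m {v} → Data.Maybe.map fV m ≡ just v → m ≡ just (gV v)
      lem (just u) refl = cong just (sym (gfV u))

    crossing-f : ∀ {i T l l′ η l⁺} → (∀ p → fA (l p) ≡ l′ p) → MA.Crossing (A.Xs (suc i)) (A.Xs (inject₁ i)) (A.startV i) (A.endV i) T l η l⁺ →
      MB.Crossing (B.Xs (suc i)) (B.Xs (inject₁ i)) (B.startV i) (B.endV i) T l′ η (V.map fA l⁺)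
    crossing-f {i} {T} {l} {l′} {η} {l⁺} el C = record
      { adm = adm
      ; far = state-f (λ _ → refl) (λ p → sym (VP.lookup-map p fA l⁺)) far
      ; step = λ p → subst (λ a → MB.Agree (B.endV i) a (B.startV i) (l′ p)) (sym (VP.lookup-map p fA l⁺))
          (subst (MB.Agree (B.endV i) (fA (l⁺ !! p)) (B.startV i)) (el p) (Agree-f (A.endV i) (A.startV i) (B.endV i) (B.startV i) (end-f i) (start-f i) (step p)))
      ; pres = λ p → subst (λ a → MB.Agree (B.startV i) a (B.startV i) (l′ p)) (el _)
          (subst (MB.Agree (B.startV i) (fA (l (η !! p))) (B.startV i)) (el p) (Agree-f (A.startV i) (A.startV i) (B.startV i) (B.startV i) (start-f i) (start-f i) (pres p)))
      ; moved = λ {p} e → moved (start⁻ {i} {l p} (trans (cong (B.startV i) (el p)) e))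
      ; linked = λ {p} {q} e e′ → linked (start⁻ {i} {l p} (trans (cong (B.startV i) (el p)) e)) (start⁻ {i} {l q} (trans (cong (B.startV i) (el q)) e′)) }
      where open MA.Crossing C

  act-start : MA.Start → MB.Start
  act-start (σ , l) = σ , V.map fA l

  act-D : MA.D → MB.D
  act-D (η , l) = η , V.map fA l

  act-S : ∀ {m} (δs : Vec MA.D m) s i → proj₁ (MB.run (V.map act-D δs) (MB.start (act-start s)) i) ≡ proj₁ (MA.run δs (MA.start s) i)
  act-S [] s i = refl
  act-S (δ ∷ δs) s zero = cong (MA.conj (proj₁ δ !!_)) (act-S δs s zero)
  act-S (δ ∷ δs) s (suc i) = act-S δs s i

  act-l : ∀ {m} (δs : Vec MA.D m) s i p → fA (proj₂ (MA.run δs (MA.start s) i) p) ≡ proj₂ (MB.run (V.map act-D δs) (MB.start (act-start s)) i) p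
  act-l [] s i p = sym (VP.lookup-map p fA (proj₂ s))
  act-l (δ ∷ δs) s zero p = sym (VP.lookup-map p fA (proj₂ δ))
  act-l (δ ∷ δs) s (suc i) p = act-l δs s i p

  act-loop : ∀ {s δs α} → MA.Loop ((s , δs) , α) → MB.Loop ((act-start s , V.map act-D δs) , α)
  act-loop {s} {δs} {α} L = record
    { initial = state-f (λ _ → refl) (λ p → sym (VP.lookup-map p fA (proj₂ s))) initial
    ; steps = λ i → subst (λ δ → MB.Val i (MB.run (V.map act-D δs) (MB.start (act-start s)) (suc i)) δ) (sym (VP.lookup-map i act-D δs))
        (subst (λ T → MB.Val i (T , proj₂ (MB.run (V.map act-D δs) (MB.start (act-start s)) (suc i))) (act-D (δs !! i))) (sym (act-S δs s (suc i)))
          (crossing-f (act-l δs s (suc i)) (steps i)))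
    ; α-B = α-B
    ; α-T = λ p → trans (cong (λ T → T (α !! p)) (act-S δs s zero)) (α-T p)
    ; α-l = λ p → trans (sym (act-l δs s zero _)) (trans (cong fA (α-l p)) (cong B.glue (sym (VP.lookup-map p fA (proj₂ s))))) }
    where open MA.Loop L using (initial; steps; α-B; α-T; α-l)

module Marks {n : ℕ} (d : ℕ) (c : TCover n) where

  open Arcs c
  open Marking c d using (Loop; run; run-step; run-last; start)

  Labels : Set
  Labels = Vec Arc (d + d) × Vec (Vec Arc (d + d)) n

  Tuple : Set
  Tuple = Perm d × Vec (Perm d) n × Perm d

  tie : Tuple → Labels → ((Perm d × Vec Arc (d + d)) × Vec (Perm d × Vec Arc (d + d)) n) × Perm d
  tie (σ , ηs , α) (l , ls) = ((σ , l) , V.zip ηs ls) , α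

  Marked : Tuple → Labels → Set
  Marked h m = Loop (tie h m)

  private
    zip-!! : ∀ {A B : Set} {k} (xs : Vec A k) (ys : Vec B k) i → V.zip xs ys !! i ≡ (xs !! i , ys !! i)
    zip-!! (x ∷ xs) (y ∷ ys) zero = refl
    zip-!! (x ∷ xs) (y ∷ ys) (suc i) = zip-!! xs ys i

  tie-η : ∀ (ηs : Vec (Perm d) n) (ls : Vec (Vec Arc (d + d)) n) i → proj₁ (V.zip ηs ls !! i) ≡ ηs !! i
  tie-η ηs ls i = cong proj₁ (zip-!! ηs ls i)

  labels : Tuple → Labels → Fin (suc n) → Fin (d + d) → Arc
  labels (σ , ηs , α) (l , ls) i = proj₂ (run (V.zip ηs ls) (start (σ , l)) i)

  labels-last : ∀ h m p → labels h m (fromℕ n) p ≡ proj₁ m !! p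
  labels-last (σ , ηs , α) (l , ls) p = cong (λ s → proj₂ s p) (run-last (V.zip ηs ls) (start (σ , l)))

  labels-at : ∀ h m i p → labels h m (inject₁ i) p ≡ (proj₂ m !! i) !! p
  labels-at (σ , ηs , α) (l , ls) i p = trans (cong (λ s → proj₂ s p) (run-step (V.zip ηs ls) (start (σ , l)) i)) (cong (λ δ → proj₂ δ !! p) (zip-!! ηs ls i))

  labels-ext : ∀ h m m′ → (∀ i p → labels h m i p ≡ labels h m′ i p) → m ≡ m′
  labels-ext h m m′ e = cong₂ _,_
    (vec-ext λ p → trans (sym (labels-last h m p)) (trans (e (fromℕ n) p) (labels-last h m′ p)))
    (vec-ext λ i → vec-ext λ p → trans (sym (labels-at h m i p)) (trans (e (inject₁ i) p) (labels-at h m′ i p)))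

  tie-l : ∀ (ηs : Vec (Perm d) n) (ls : Vec (Vec Arc (d + d)) n) i → proj₂ (V.zip ηs ls !! i) ≡ ls !! i
  tie-l ηs ls i = cong proj₂ (zip-!! ηs ls i)

act-labels : ∀ {n} d (c c′ : TCover n) → Iso c c′ → Marks.Labels d c → Marks.Labels d c′
act-labels d c c′ f (l , ls) = V.map (Act.fA d c c′ f) l , V.map (V.map (Act.fA d c c′ f)) ls

private
  zip-map : ∀ {A B C : Set} {k} (g : B → C) (xs : Vec A k) (ys : Vec B k) → V.zip xs (V.map g ys) ≡ V.map (λ (x , y) → x , g y) (V.zip xs ys)
  zip-map g [] [] = refl
  zip-map g (x ∷ xs) (y ∷ ys) = cong (_ ∷_) (zip-map g xs ys)

act-marked : ∀ {n} d (c c′ : TCover n) (f : Iso c c′) h m → Marks.Marked d c h m → Marks.Marked d c′ h (act-labels d c c′ f m)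
act-marked d c c′ f (σ , ηs , α) (l , ls) L = subst (λ δs → Marking.Loop c′ d (((σ , V.map (Act.fA d c c′ f) l) , δs) , α))
  (sym (zip-map (V.map (Act.fA d c c′ f)) ηs ls)) (Act.act-loop d c c′ f L)

labels-act : ∀ {n} d (c c′ : TCover n) (f : Iso c c′) h m i p →
  Marks.labels d c′ h (act-labels d c c′ f m) i p ≡ Act.fA d c c′ f (Marks.labels d c h m i p)
labels-act d c c′ f (σ , ηs , α) (l , ls) i p = trans
  (cong (λ δs → proj₂ (Marking.run c′ d δs (Marking.start c′ d (σ , V.map (Act.fA d c c′ f) l)) i) p) (zip-map (V.map (Act.fA d c c′ f)) ηs ls))
  (sym (Act.act-l d c c′ f (V.zip ηs ls) (σ , l) i p))

module Torsor {n : ℕ} (d : ℕ) (c : TCover n) (tc : IsTropCover c) (ts : IsTwistedStructure c) where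

  open TCover c

  private
    iso-of : ∀ f → IsAut c f → Iso c c
    iso-of (fV , fE) (pV , pE , a , b , e , w , wd , iV , iE) = record
      { fV = fV !!_ ; fE = fE !!_ ; f-pos = a ; f-src = b ; f-tgt = e ; f-wt = w ; f-wind = wd ; f-ιV = iV ; f-ιE = iE
      ; gV = inverse (fV !!_) ; gE = inverse (fE !!_)
      ; fgV = inverse-r (pV _ _) ; gfV = inverse-l (pV _ _) ; fgE = inverse-r (pE _ _) ; gfE = inverse-l (pE _ _) }

    act : AutData c → Marks.Labels d c → Marks.Labels d c
    act (fV , fE) (l , ls) = V.map (λ (e , j) → fE !! e , j) l , V.map (V.map (λ (e , j) → fE !! e , j)) ls

    aut-of : (f : Iso c c) → IsAut c (V.tabulate (Iso.fV f) , V.tabulate (Iso.fE f))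
    aut-of f = (λ i j q → trans (sym (gfV i)) (trans (cong gV (trans (sym (lV i)) (trans q (lV j)))) (gfV j))) ,
      (λ i j q → trans (sym (gfE i)) (trans (cong gE (trans (sym (lE i)) (trans q (lE j)))) (gfE j))) ,
      (λ v → trans (cong pos (lV v)) (f-pos v)) ,
      (λ e → trans (cong src (lE e)) (trans (f-src e) (sym (lV _)))) ,
      (λ e → trans (cong tgt (lE e)) (trans (f-tgt e) (sym (lV _)))) ,
      (λ e → trans (cong wt (lE e)) (f-wt e)) ,
      (λ e → trans (cong wind (lE e)) (f-wind e)) ,
      (λ v → trans (lV _) (trans (f-ιV v) (cong ιV (sym (lV v))))) ,
      (λ e → trans (lE _) (trans (f-ιE e) (cong ιE (sym (lE e)))))
      where
      open Iso f
      lV = VP.lookup∘tabulate fV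
      lE = VP.lookup∘tabulate fE

  torsor : ∀ h m₀ → Marks.Marked d c h m₀ → ∀ {fs} → IsListing (IsAut c) fs → Card (Marks.Marked d c h) (length fs)
  torsor h@(σ , ηs , α) m₀ L₀ {fs} lf = card-map (λ f → act f m₀)
    (λ {f} a → act-marked d c c (iso-of f a) h m₀ L₀) inj onto (fs , lf , refl)
    where
    module A = LoopFacts d c tc ts L₀
    inj : ∀ {f g} → IsAut c f → IsAut c g → act f m₀ ≡ act g m₀ → f ≡ g
    inj {fV , fE} {gV , gE} a@(_ , _ , _ , fs , _) b@(_ , _ , _ , gs , _) q = cong₂ _,_ (vec-ext eV) (vec-ext eE)
      where
      eE : ∀ e → fE !! e ≡ gE !! e
      eE e = cong proj₁ (trans (sym (at fV fE a)) (trans (cong (λ m → Marks.labels d c h m (suc (pos (src e))) (A.pnt e)) q) (at gV gE b)))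
        where
        at : ∀ kV kE (k : IsAut c (kV , kE)) → Marks.labels d c h (act (kV , kE) m₀) (suc (pos (src e))) (A.pnt e) ≡ (kE !! e , 0)
        at kV kE k = trans (labels-act d c c (iso-of (kV , kE) k) h m₀ _ (A.pnt e)) (cong (λ (x , j) → kE !! x , j) (A.lb-pnt e))
      eV : ∀ v → fV !! v ≡ gV !! v
      eV v with A.out-edge v
      ... | e , refl = trans (sym (fs e)) (trans (cong src (eE e)) (gs e))
    onto : ∀ {m} → Marks.Marked d c h m → ∃ λ f → IsAut c f × act f m₀ ≡ m
    onto {m} L = build (same-tuple-iso d c tc ts c tc ts L₀ L (λ i → trans (Marks.tie-η d c ηs (proj₂ m₀) i) (sym (Marks.tie-η d c ηs (proj₂ m) i))))
      where
      build : (Σ[ f ∈ Iso c c ] ∀ i p → Marks.labels d c h m i p ≡ (Iso.fE f (proj₁ (Marks.labels d c h m₀ i p)) , proj₂ (Marks.labels d c h m₀ i p))) →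
        ∃ λ f → IsAut c f × act f m₀ ≡ m
      build (f , fl) = φ , aut-of f , Marks.labels-ext d c h (act φ m₀) m (λ i p → trans (labels-act d c c (iso-of φ (aut-of f)) h m₀ i p)
          (trans (cong (_, proj₂ (Marks.labels d c h m₀ i p)) (VP.lookup∘tabulate (Iso.fE f) (proj₁ (Marks.labels d c h m₀ i p)))) (sym (fl i p))))
        where
        φ : AutData c
        φ = V.tabulate (Iso.fV f) , V.tabulate (Iso.fE f)

-- The cover of a tuple: following the points from one branch point to the next

orbit-closed : ∀ {N} {gs : List (Fin N → Fin N)} {D : Fin N → Set} → (∀ {h} → h ∈ gs → Inj h) → (∀ {h} → h ∈ gs → ∀ {z} → D z → D (h z)) →
  ∀ {p q} → Orbit gs p q → D p → D q
orbit-closed inj cl here d = d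
orbit-closed inj cl (fwd h i o) d = cl i (orbit-closed inj cl o d)
orbit-closed {D = D} inj cl (bwd h i o) d = cyc-closed {D = D} (cl i) (orbit-closed inj cl o d) (cyc-sym (inj i) cyc-step)

data LastView : ∀ {m} → Fin (suc m) → Set where
  last : ∀ {m} → LastView (fromℕ m)
  notlast : ∀ {m} (i : Fin m) → LastView (inject₁ i)

last-view : ∀ {m} (i : Fin (suc m)) → LastView i
last-view {zero} zero = last
last-view {suc m} zero = notlast zero
last-view {suc m} (suc i) with last-view i
... | last = last
... | notlast j = notlast (suc j)

levels : ∀ d {k} → Perm d → Vec (Perm d) k → Fin (suc k) → Fin (d + d) → Fin (d + d)
levels d σ [] _ = σ !!_
levels d σ (η ∷ ηs) zero = Twisted.conj (τ d) (Tau.ττ d) (Tau.τ≢ d) (η !!_) (levels d σ ηs zero)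
levels d σ (η ∷ ηs) (suc i) = levels d σ ηs i

levels-far : ∀ d {k} σ (ηs : Vec (Perm d) k) i p → levels d σ ηs (inject₁ i) p ≡ Twisted.conj (τ d) (Tau.ττ d) (Tau.τ≢ d) ((ηs !! i) !!_) (levels d σ ηs (suc i)) p
levels-far d σ (η ∷ ηs) zero p = refl
levels-far d σ (η ∷ ηs) (suc i) p = levels-far d σ ηs i p

levels-last : ∀ d {k} σ (ηs : Vec (Perm d) k) → levels d σ ηs (fromℕ k) ≡ (σ !!_)
levels-last d σ [] = refl
levels-last d σ (η ∷ ηs) = levels-last d σ ηs

record Tuple (d m : ℕ) : Set where
  field
    σ : Perm d
    ηs : Vec (Perm d) (suc m)
    α : Perm d
    adm : ∀ i → ∃[ x ] ∃[ y ] (x ≢ y × y ≢ τ d x × ηs !! i ≡ V.tabulate (sw x y))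
    tσ : Twisted.TwPerm (τ d) (Tau.ττ d) (Tau.τ≢ d) (σ !!_)
    αB : InB d α
    closing : ∀ p → levels d σ ηs zero (α !! p) ≡ α !! (σ !! p)
    transitive : Transitive (Generators.gens d σ ηs α)

module Flow {d m : ℕ} (t : Tuple d m) where

  open Tuple t public
  open Tau d public
  open Twisted (τ d) ττ τ≢ public

  P = Fin (d + d)
  n = suc m

  S : Fin (suc n) → P → P
  S = levels d σ ηs

  X Y : Fin n → P
  X i = proj₁ (adm i)
  Y i = proj₁ (proj₂ (adm i))

  X≢Y : ∀ i → X i ≢ Y i
  X≢Y i = proj₁ (proj₂ (proj₂ (adm i)))

  Y≢τX : ∀ i → Y i ≢ τ d (X i)
  Y≢τX i = proj₁ (proj₂ (proj₂ (proj₂ (adm i))))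

  η : Fin n → P → P
  η i = (ηs !! i) !!_

  η-sw : ∀ i z → η i z ≡ sw (X i) (Y i) z
  η-sw i z = trans (cong (_!! z) (proj₂ (proj₂ (proj₂ (proj₂ (adm i)))))) (VP.lookup∘tabulate _ z)

  η-inv : ∀ i z → η i (η i z) ≡ z
  η-inv i z = trans (cong (η i) (η-sw i z)) (trans (η-sw i _) (transp-inv (X i) (Y i) z))

  ηX : ∀ i → η i (X i) ≡ Y i
  ηX i = trans (η-sw i _) (transp-l _ _)

  ηY : ∀ i → η i (Y i) ≡ X i
  ηY i = trans (η-sw i _) (transp-r _ _)

  mir : Fin n → P → P
  mir i z = τ d (η i (τ d z))

  tS : ∀ i → TwPerm (S i)
  tS = go ηs (η-inv)
    where
    go : ∀ {k} (ηs : Vec (Perm d) k) → (∀ i z → (ηs !! i) !! ((ηs !! i) !! z) ≡ z) → ∀ i → TwPerm (levels d σ ηs i)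
    go [] h _ = tσ
    go (η ∷ ηs) h zero = twPerm-conj {η !!_} (h zero) (go ηs (h ∘ suc) zero)
    go (η ∷ ηs) h (suc i) = go ηs (h ∘ suc) i

  S-inj : ∀ i → Inj (S i)
  S-inj i = TwPerm.inj (tS i)

  S-far : ∀ i p → S (inject₁ i) p ≡ conj (η i) (S (suc i)) p
  S-far = levels-far d σ ηs

  S-sw : ∀ i p → S (inject₁ i) p ≡ conj (sw (X i) (Y i)) (S (suc i)) p
  S-sw i p = trans (S-far i p) (conj-η {T = S (suc i)} (η-sw i) p)

  α-inj : Inj (α !!_)
  α-inj = proj₁ αB _ _

  links : Fin n → List (P → P)
  links i = S (suc i) ∷ η i ∷ mir i ∷ []

  opaque
    cc vc : Fin n → P → P
    cc i = proj₁ (colouring (S (suc i) ∷ []))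
    vc i = proj₁ (colouring (links i))

    vc-inv : ∀ i {h} → h ∈ links i → ∀ p → vc i (h p) ≡ vc i p
    vc-inv i = proj₁ (proj₂ (colouring (links i)))

    vc-link : ∀ i {p q} → vc i p ≡ vc i q → Orbit (links i) p q
    vc-link i = proj₂ (proj₂ (colouring (links i)))

    cc-S : ∀ i p → cc i (S (suc i) p) ≡ cc i p
    cc-S i = proj₁ (proj₂ (colouring (S (suc i) ∷ []))) (here refl)

    cc-cyc : ∀ i {p q} → cc i p ≡ cc i q → Cyc (S (suc i)) p q
    cc-cyc i {p} e = orbit-closed {D = Cyc (S (suc i)) p} (λ { (here refl) → S-inj (suc i) }) (λ { (here refl) c → cyc-trans c cyc-step })
      (proj₂ (proj₂ (colouring (S (suc i) ∷ []))) e) cyc-refl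

  vc-S : ∀ i p → vc i (S (suc i) p) ≡ vc i p
  vc-S i = vc-inv i (here refl)

  vc-η : ∀ i p → vc i (η i p) ≡ vc i p
  vc-η i = vc-inv i (there (here refl))

  vc-mir : ∀ i p → vc i (mir i p) ≡ vc i p
  vc-mir i = vc-inv i (there (there (here refl)))

  vc-far : ∀ i p → vc i (S (inject₁ i) p) ≡ vc i p
  vc-far i p = trans (cong (vc i) (S-far i p)) (trans (vc-η i _) (trans (vc-S i _) (vc-mir i p)))

  cyc-cc : ∀ i {p q} → Cyc (S (suc i)) p q → cc i p ≡ cc i q
  cyc-cc i {p} c = sym (cyc-closed {D = λ z → cc i z ≡ cc i p} (λ h → trans (cc-S i _) h) refl c)

  cyc-vc : ∀ i {p q} → Cyc (S (suc i)) p q → vc i p ≡ vc i q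
  cyc-vc i {p} c = sym (cyc-closed {D = λ z → vc i z ≡ vc i p} (λ h → trans (vc-S i _) h) refl c)

  vc-closed : ∀ i {D : P → Set} → (∀ {z} → D z → D (S (suc i) z)) → (∀ {z} → D z → D (η i z)) → (∀ {z} → D z → D (mir i z)) →
    ∀ {p q} → vc i p ≡ vc i q → D p → D q
  vc-closed i {D} a b c e = orbit-closed {D = D}
    (λ { (here refl) → S-inj (suc i) ; (there (here refl)) → inv⇒inj {f = η i} (η-inv i)
       ; (there (there (here refl))) → inv⇒inj {f = mir i} λ z → trans (cong (τ d ∘ η i) (ττ _)) (trans (cong (τ d) (η-inv i _)) (ττ z)) })
    (λ { (here refl) → a ; (there (here refl)) → b ; (there (there (here refl))) → c }) (vc-link i e)

  Touched : Fin n → P → Set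
  Touched i p = (Cyc (S (suc i)) (X i) p ⊎ Cyc (S (suc i)) (Y i) p) ⊎ (Cyc (S (suc i)) (τ d (X i)) p ⊎ Cyc (S (suc i)) (τ d (Y i)) p)

  touched? : ∀ i p → Dec (Touched i p)
  touched? i p = (cyc-dec (S-inj _) _ p ⊎-dec cyc-dec (S-inj _) _ p) ⊎-dec (cyc-dec (S-inj _) _ p ⊎-dec cyc-dec (S-inj _) _ p)

  touched-S : ∀ i {p} → Touched i p → Touched i (S (suc i) p)
  touched-S i (inj₁ (inj₁ c)) = inj₁ (inj₁ (cyc-trans c cyc-step))
  touched-S i (inj₁ (inj₂ c)) = inj₁ (inj₂ (cyc-trans c cyc-step))
  touched-S i (inj₂ (inj₁ c)) = inj₂ (inj₁ (cyc-trans c cyc-step))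
  touched-S i (inj₂ (inj₂ c)) = inj₂ (inj₂ (cyc-trans c cyc-step))

  touched-τ : ∀ i {p} → Touched i p → Touched i (τ d p)
  touched-τ i (inj₁ (inj₁ c)) = inj₂ (inj₁ (TwPerm.cyc-τ (tS _) c))
  touched-τ i (inj₁ (inj₂ c)) = inj₂ (inj₂ (TwPerm.cyc-τ (tS _) c))
  touched-τ i {p} (inj₂ (inj₁ c)) = inj₁ (inj₁ (subst (λ z → Cyc (S (suc i)) z (τ d p)) (ττ _) (TwPerm.cyc-τ (tS _) c)))
  touched-τ i {p} (inj₂ (inj₂ c)) = inj₁ (inj₂ (subst (λ z → Cyc (S (suc i)) z (τ d p)) (ττ _) (TwPerm.cyc-τ (tS _) c)))

  touched-η : ∀ i {p} → Touched i p → Touched i (η i p)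
  touched-η i {p} h = subst (Touched i) (sym (η-sw i p)) (transp-closed {D = Touched i} (inj₁ (inj₁ cyc-refl)) (inj₁ (inj₂ cyc-refl)) h)

  touched-vc : ∀ i {p q} → vc i p ≡ vc i q → Touched i p → Touched i q
  touched-vc i = vc-closed i {Touched i} (touched-S i) (touched-η i) (λ h → touched-τ i (touched-η i (touched-τ i h)))

  η-fix : ∀ i {p} → ¬ Touched i p → η i p ≡ p
  η-fix i {p} u = trans (η-sw i p) (transp-n (λ { refl → u (inj₁ (inj₁ cyc-refl)) }) (λ { refl → u (inj₁ (inj₂ cyc-refl)) }))

  mir-fix : ∀ i {p} → ¬ Touched i p → mir i p ≡ p
  mir-fix i {p} u = trans (cong (τ d) (η-fix i (λ h → u (subst (Touched i) (ττ p) (touched-τ i h))))) (ττ p)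

  S-same : ∀ i {p} → ¬ Touched i p → S (inject₁ i) p ≡ S (suc i) p
  S-same i {p} u = trans (S-far i p) (trans (cong (η i ∘ S (suc i)) (mir-fix i u)) (η-fix i (u ∘ touched-vc i (vc-S i p))))

  Q = Fin n × P

  F-step : ∀ {i : Fin n} → LastView i → P → Q
  F-step last p = zero , α !! p
  F-step (notlast i) p = suc i , p

  F : Q → Q
  F (i , p) = F-step (last-view i) p

  wrap-step : ∀ {i : Fin n} → LastView i → ℕ
  wrap-step last = 1
  wrap-step (notlast _) = 0

  wrap : Fin n → ℕ
  wrap i = wrap-step (last-view i)

  TQ : Q → Set
  TQ (i , p) = Touched i p

  tQ? : ∀ q → Dec (TQ q)
  tQ? (i , p) = touched? i p

  G τQ : Q → Q
  G (i , p) = i , S (suc i) p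
  τQ (i , p) = i , τ d p

  F-inj : ∀ {q q′} → F q ≡ F q′ → q ≡ q′
  F-inj {i , p} {i′ , p′} e with last-view i | last-view i′
  ... | last | last = cong (fromℕ m ,_) (α-inj (cong proj₂ e))
  ... | last | notlast _ = case cong proj₁ e of λ ()
  ... | notlast _ | last = case cong proj₁ e of λ ()
  ... | notlast j | notlast j′ with e
  ... | refl = refl

  level-inj : ∀ {i i′ p p′} → proj₁ (F (i , p)) ≡ proj₁ (F (i′ , p′)) → i ≡ i′
  level-inj {i} {i′} e with last-view i | last-view i′
  ... | last | last = refl
  ... | notlast j | notlast j′ with e
  ... | refl = refl
  level-inj () | last | notlast _
  level-inj () | notlast _ | last

  F-τ : ∀ q → F (τQ q) ≡ τQ (F q)
  F-τ (i , p) with last-view i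
  ... | last = cong (zero ,_) (proj₂ αB p)
  ... | notlast _ = refl

  F-G⁺ : ∀ q → F (G q) ≡ (proj₁ (F q) , S (inject₁ (proj₁ (F q))) (proj₂ (F q)))
  F-G⁺ (i , p) with last-view i
  ... | last = cong (zero ,_) (trans (cong (λ f → α !! f p) (levels-last d σ ηs)) (sym (closing p)))
  ... | notlast _ = refl

  F-G : ∀ {q} → ¬ TQ (F q) → F (G q) ≡ G (F q)
  F-G {q} u = trans (F-G⁺ q) (cong (proj₁ (F q) ,_) (S-same (proj₁ (F q)) u))

  TQ-G : ∀ {q} → TQ (G q) → TQ q
  TQ-G {i , p} = touched-vc i (vc-S i p)

  itF : ℕ → Q → Q
  itF zero q = q
  itF (suc k) q = F (itF k q)

  itF-suc : ∀ k q → itF k (F q) ≡ itF (suc k) q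
  itF-suc zero q = refl
  itF-suc (suc k) q = cong F (itF-suc k q)

  itF-+ : ∀ j k q → itF (j + k) q ≡ itF j (itF k q)
  itF-+ zero k q = refl
  itF-+ (suc j) k q = cong F (itF-+ j k q)

  private
    F̂ : Fin (n * (d + d)) → Fin (n * (d + d))
    F̂ z = Data.Fin.combine (proj₁ (F (Data.Fin.remQuot {n} (d + d) z))) (proj₂ (F (Data.Fin.remQuot {n} (d + d) z)))

    enc : Q → Fin (n * (d + d))
    enc (i , p) = Data.Fin.combine i p

    enc-F : ∀ q → F̂ (enc q) ≡ enc (F q)
    enc-F (i , p) = cong (λ q → enc (F q)) (F.remQuot-combine i p)

    enc-inj : ∀ {q q′} → enc q ≡ enc q′ → q ≡ q′
    enc-inj {i , p} {i′ , p′} e = let (a , b) = F.combine-injective i p i′ p′ e in cong₂ _,_ a b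

    F̂-inj : Inj F̂
    F̂-inj {x} {y} e = trans (sym (F.combine-remQuot {n} (d + d) x)) (trans (cong enc (F-inj (enc-inj e))) (F.combine-remQuot {n} (d + d) y))

    enc-it : ∀ k q → it F̂ k (enc q) ≡ enc (itF k q)
    enc-it zero q = refl
    enc-it (suc k) q = trans (cong F̂ (enc-it k q)) (enc-F _)

  opaque
    back : ∀ k q → ∃ λ j → itF j (itF k q) ≡ q
    back k q with cyc-sym F̂-inj (k , enc-it k q)
    ... | j , e = j , enc-inj (trans (sym (enc-it j _)) e)

  Free : Q → Set
  Free q = ∀ k → ¬ TQ (itF k q)

  opaque
    free-or : ∀ q → (∃ λ k → TQ (itF k q)) ⊎ Free q
    free-or q with period F̂-inj (enc q)
    ... | K , pK with F.any? {K} (λ r → tQ? (itF (toℕ r) q))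
    ... | yes (r , h) = inj₁ (toℕ r , h)
    ... | no no′ = inj₂ λ k h → let (r , r< , e) = reduce pK k in
            no′ (fromℕ< r< , subst TQ (trans (enc-inj (trans (sym (enc-it k q)) (trans e (enc-it r q)))) (cong (λ s → itF s q) (sym (F.toℕ-fromℕ< r<)))) h)

  F-last : ∀ p → F (fromℕ m , p) ≡ (zero , α !! p)
  F-last p = go (last-view (fromℕ m)) refl
    where
    go : ∀ {j} (v : LastView j) → fromℕ m ≡ j → F-step v p ≡ (zero , α !! p)
    go last e = refl
    go (notlast i′) e = ⊥-elim (F.fromℕ≢inject₁ e)

  F-notlast : ∀ i p → F (inject₁ i , p) ≡ (suc i , p)
  F-notlast i p = go (last-view (inject₁ i)) refl
    where
    go : ∀ {j} (v : LastView j) → inject₁ i ≡ j → F-step v p ≡ (suc i , p)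
    go last e = ⊥-elim (F.fromℕ≢inject₁ (sym e))
    go (notlast i′) e = cong (λ x → suc x , p) (F.inject₁-injective (sym e))

  wrap-last : wrap (fromℕ m) ≡ 1
  wrap-last = go (last-view (fromℕ m)) refl
    where
    go : ∀ {j} (v : LastView j) → fromℕ m ≡ j → wrap-step v ≡ 1
    go last e = refl
    go (notlast i′) e = ⊥-elim (F.fromℕ≢inject₁ e)

  wrap-notlast : ∀ i → wrap (inject₁ i) ≡ 0
  wrap-notlast i = go (last-view (inject₁ i)) refl
    where
    go : ∀ {j} (v : LastView j) → inject₁ i ≡ j → wrap-step v ≡ 0
    go last e = ⊥-elim (F.fromℕ≢inject₁ (sym e))
    go (notlast i′) e = refl

  wrap-level : ∀ i p → (wrap i ≡ 1 × proj₁ (F (i , p)) ≡ zero) ⊎ (wrap i ≡ 0 × toℕ (proj₁ (F (i , p))) ≡ suc (toℕ i))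
  wrap-level i p with last-view i
  ... | last = inj₁ (refl , refl)
  ... | notlast j = inj₂ (refl , cong suc (sym (F.toℕ-inject₁ j)))

  private
    free-F : ∀ {q} → Free q → Free (F q)
    free-F f k h = f (suc k) (subst TQ (itF-suc k _) h)

    free-it : ∀ {q} k → Free q → Free (itF k q)
    free-it zero f = f
    free-it (suc k) f = free-F (free-it k f)

    free-back : ∀ {q} k → Free (itF k q) → Free q
    free-back {q} k f = let (j , e) = back k q in subst Free e (free-it j f)

    free-G : ∀ {q} → Free q → Free (G q)
    free-G {q} f k h = f k (TQ-G (subst TQ (go k) h))
      where
      go : ∀ k → itF k (G q) ≡ G (itF k q)
      go zero = refl
      go (suc k) = trans (cong F (go k)) (F-G (f (suc k)))

    -- within one turn around the circle the point does not change
    climb : ∀ (i : Fin n) p → ∃ λ k → itF k (zero , p) ≡ (i , p)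
    climb i p = rise _ i ≤-refl
      where
      rise : ∀ b i → toℕ i ≤ b → ∃ λ k → itF k (zero , p) ≡ (i , p)
      rise b zero _ = 0 , refl
      rise (suc b) (suc i) (s≤s l) = let (k , e) = rise b (inject₁ i) (≤-trans (≤-reflexive (F.toℕ-inject₁ i)) l) in
        suc k , trans (cong F e) (F-notlast i p)

    free-level : ∀ i i′ p → Free (i , p) → Free (i′ , p)
    free-level i i′ p f = let (k , e) = climb i p ; (k′ , e′) = climb i′ p in
      subst Free e′ (free-it k′ (free-back k (subst Free (sym e) f)))

    not-free : ∀ q → ¬ Free q
    not-free (i , p) f = orbit-closed {D = λ p → Free (zero , p)} gen-inj gen-closed (transitive p (X zero)) (free-level i zero p f) 0 (inj₁ (inj₁ cyc-refl))
      where
      open Generators d σ ηs α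
      gen-inj : ∀ {h} → h ∈ gens → Inj h
      gen-inj = gens-elim Inj (TwPerm.inj tσ) α-inj (λ i → inv⇒inj {f = η i} (η-inv i))
        (λ i → inv⇒inj {f = mir i} λ z → trans (cong (τ d ∘ η i) (ττ _)) (trans (cong (τ d) (η-inv i _)) (ττ z)))
      gen-closed : ∀ {h} → h ∈ gens → ∀ {z} → Free (zero , z) → Free (zero , h z)
      gen-closed = gens-elim (λ h → ∀ {z} → Free (zero , z) → Free (zero , h z))
        (λ {z} f → free-level (fromℕ m) zero _ (subst (λ g → Free (fromℕ m , g z)) (levels-last d σ ηs) (free-G (free-level zero (fromℕ m) z f))))
        (λ {z} f → subst Free (F-last z) (free-F (free-level zero (fromℕ m) z f)))
        (λ i {z} f → subst (λ y → Free (zero , y)) (sym (η-fix i (free-level zero i z f 0))) f)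
        (λ i {z} f → subst (λ y → Free (zero , y)) (sym (mir-fix i (free-level zero i z f 0))) f)

  opaque
    reach : ∀ q → ∃ λ k → TQ (itF k q)
    reach q = [ id , (λ f → ⊥-elim (not-free q f)) ]′ (free-or q)

<ᵇ≤ : ∀ {m n c} → (m < n → 1 ≤ c) → [ m <ᵇ n ]ᵇ ≤ c
<ᵇ≤ {m} {n} h with m <ᵇ n in q
... | false = z≤n
... | true = h (<ᵇ⇒< m n (subst Data.Bool.T (sym q) tt))

record Enumeration {B : Set} (P : B → Set) : Set where
  field
    size : ℕ
    at : Fin size → B
    at∈ : ∀ i → P (at i)
    idx : ∀ {b} → P b → Fin size
    at-idx : ∀ {b} (p : P b) → at (idx p) ≡ b
    at-inj : ∀ {i j} → at i ≡ at j → i ≡ j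

opaque
  enumerate-pairs : ∀ {m n} {P : Fin m × Fin n → Set} → (∀ b → Dec (P b)) → Enumeration P
  enumerate-pairs {m} {n} {P} P? = record { size = length xs ; at = proj₁ e ; at∈ = proj₁ (proj₂ e)
      ; idx = λ p → proj₁ (proj₁ (proj₂ (proj₂ e)) p) ; at-idx = λ p → proj₂ (proj₁ (proj₂ (proj₂ e)) p) ; at-inj = proj₂ (proj₂ (proj₂ e)) }
    where
    all : Card {Fin m × Fin n} (λ _ → ⊤ × ⊤) (m * n)
    all = card-Σ (card-Fin m) (λ _ → card-Fin n)
    xs : List (Fin m × Fin n)
    xs = filter P? (proj₁ all)
    l : IsListing P xs
    l = let (u , h) = filter-listing P? (proj₁ (proj₂ all)) in u , λ x → mk⇔ (proj₂ ∘ Equivalence.to (h x)) (λ p → Equivalence.from (h x) ((tt , tt) , p))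
    e : Σ[ at ∈ (Fin (length xs) → Fin m × Fin n) ] (∀ i → P (at i)) × (∀ {b} → P b → ∃ λ i → at i ≡ b) × (∀ {i j} → at i ≡ at j → i ≡ j)
    e = enumerate (xs , l , refl)

module Trace {d m : ℕ} (t : Tuple d m) where

  open Flow t

  K = Fin n × P

  edgeOf vertOf : Q → K
  edgeOf (i , p) = i , cc i p
  vertOf (i , p) = i , vc i p

  -- q lies on the edge e, which has crossed the cut j times since its source.
  data Lab : Q → K → ℕ → Set where
    start : ∀ {q} → TQ q → Lab q (edgeOf q) 0
    pass : ∀ {q q′ e j} → F q ≡ q′ → ¬ TQ q′ → Lab q e j → Lab q′ e (wrap (proj₁ q) + j)

  -- the edge through q ends at t after crossing the cut c more times.
  data End : Q → Q → ℕ → Set where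
    end : ∀ {q t} → F q ≡ t → TQ t → End q t (wrap (proj₁ q))
    pass : ∀ {q q′ t c} → F q ≡ q′ → ¬ TQ q′ → End q′ t c → End q t (wrap (proj₁ q) + c)

  lab-det : ∀ {q e j e′ j′} → Lab q e j → Lab q e′ j′ → (e , j) ≡ (e′ , j′)
  lab-det (start _) (start _) = refl
  lab-det (start h) (pass _ u _) = ⊥-elim (u h)
  lab-det (pass _ u _) (start h) = ⊥-elim (u h)
  lab-det (pass x _ l) (pass x′ _ l′) with F-inj (trans x (sym x′))
  ... | refl with lab-det l l′
  ... | refl = refl

  end-det : ∀ {q t c t′ c′} → End q t c → End q t′ c′ → (t , c) ≡ (t′ , c′)
  end-det (end refl _) (end refl _) = refl
  end-det (end refl h) (pass refl u _) = ⊥-elim (u h)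
  end-det (pass refl u _) (end refl h) = ⊥-elim (u h)
  end-det {q} (pass refl _ l) (pass refl _ l′) = cong (λ tc → proj₁ tc , wrap (proj₁ q) + proj₂ tc) (end-det l l′)

  opaque
    lab-total : ∀ q → Σ[ ej ∈ K × ℕ ] Lab q (proj₁ ej) (proj₂ ej)
    lab-total q with reach q
    ... | k , h with back k q
    ... | j , e = subst (λ x → Σ[ ej ∈ K × ℕ ] Lab x (proj₁ ej) (proj₂ ej)) e (go j)
      where
      go : ∀ j → Σ[ ej ∈ K × ℕ ] Lab (itF j (itF k q)) (proj₁ ej) (proj₂ ej)
      go zero = _ , start h
      go (suc j) with tQ? (itF (suc j) (itF k q))
      ... | yes h′ = _ , start h′
      ... | no u = _ , pass refl u (proj₂ (go j))

    end-total : ∀ q → Σ[ tc ∈ Q × ℕ ] End q (proj₁ tc) (proj₂ tc)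
    end-total q with reach (F q)
    ... | k , h = go k q h
      where
      go : ∀ k q → TQ (itF k (F q)) → Σ[ tc ∈ Q × ℕ ] End q (proj₁ tc) (proj₂ tc)
      go zero q h = _ , end refl h
      go (suc k) q h with tQ? (F q)
      ... | yes h′ = _ , end refl h′
      ... | no u = _ , pass refl u (proj₂ (go k (F q) (subst TQ (sym (itF-suc k (F q))) h)))

  lb : Q → K × ℕ
  lb q = proj₁ (lab-total q)

  lab : ∀ q → Lab q (proj₁ (lb q)) (proj₂ (lb q))
  lab q = proj₂ (lab-total q)

  tq : Q → Q
  tq q = proj₁ (proj₁ (end-total q))

  crs : Q → ℕ
  crs q = proj₂ (proj₁ (end-total q))

  ends : ∀ q → End q (tq q) (crs q)
  ends q = proj₂ (end-total q)

  vt : Q → K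
  vt q = vertOf (tq q)

  crs-end : ∀ {q} → TQ (F q) → tq q ≡ F q × crs q ≡ wrap (proj₁ q)
  crs-end h = let e = end-det (ends _) (end refl h) in cong proj₁ e , cong proj₂ e

  crs-pass : ∀ {q} → ¬ TQ (F q) → tq q ≡ tq (F q) × crs q ≡ wrap (proj₁ q) + crs (F q)
  crs-pass u = let e = end-det (ends _) (pass refl u (ends _)) in cong proj₁ e , cong proj₂ e

  TQ-τ : ∀ {q} → TQ (τQ q) → TQ q
  TQ-τ {i , p} h = subst (Touched i) (ττ p) (touched-τ i h)

  end-TQ : ∀ {q t c} → End q t c → TQ t
  end-TQ (end _ h) = h
  end-TQ (pass _ _ l) = end-TQ l

  end-τ : ∀ {q t c} → End q t c → End (τQ q) (τQ t) c
  end-τ {q} (end refl h) = end (F-τ q) (touched-τ _ h)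
  end-τ {q} (pass refl u l) = pass (F-τ q) (u ∘ TQ-τ) (end-τ l)

  tq-τ : ∀ q → tq (τQ q) ≡ τQ (tq q)
  tq-τ q = cong proj₁ (end-det (ends (τQ q)) (end-τ (ends q)))

  crs-τ : ∀ q → crs (τQ q) ≡ crs q
  crs-τ q = cong proj₂ (end-det (ends (τQ q)) (end-τ (ends q)))

  end-G : ∀ {q t c} → End q t c → ∃ λ t′ → End (G q) t′ c × vertOf t′ ≡ vertOf t
  end-G {q} (end refl h) = _ , end (F-G⁺ q) (touched-vc (proj₁ (F q)) (sym (vc-far (proj₁ (F q)) (proj₂ (F q)))) h) ,
    cong (proj₁ (F q) ,_) (vc-far (proj₁ (F q)) _)
  end-G {q} (pass refl u l) with end-G l
  ... | t′ , l′ , e = t′ , pass (F-G u) (u ∘ TQ-G) l′ , e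

  private
    crs-G : ∀ q → crs (G q) ≡ crs q × vt (G q) ≡ vt q
    crs-G q with end-G (ends q)
    ... | t′ , l , e with end-det (ends (G q)) l
    ... | e′ = cong proj₂ e′ , trans (cong (vertOf ∘ proj₁) e′) e

  crs-cyc : ∀ {i p p′} → Cyc (S (suc i)) p p′ → crs (i , p) ≡ crs (i , p′) × vt (i , p) ≡ vt (i , p′)
  crs-cyc {i} {p} c = cyc-closed {D = λ z → crs (i , p) ≡ crs (i , z) × vt (i , p) ≡ vt (i , z)}
    (λ (a , b) → trans a (sym (proj₁ (crs-G _))) , trans b (sym (proj₂ (crs-G _)))) (refl , refl) c

  edge-cyc : ∀ {q q′} → edgeOf q ≡ edgeOf q′ → ∃ λ i → ∃ λ p → ∃ λ p′ → q ≡ (i , p) × q′ ≡ (i , p′) × Cyc (S (suc i)) p p′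
  edge-cyc {i , p} {i′ , p′} e with cong proj₁ e
  ... | refl = i , p , p′ , refl , refl , cc-cyc i (cong proj₂ e)

  cross-split : ∀ {q e j} → Lab q e j → ∀ {q₀} → edgeOf q₀ ≡ e → crs q₀ ≡ j + crs q × vt q₀ ≡ vt q
  cross-split (start h) x with edge-cyc x
  ... | i , p , p′ , refl , refl , c = crs-cyc c
  cross-split (pass {q} {j = j} refl u l) x with cross-split l x | crs-pass {q} u
  ... | a , b | a′ , b′ = trans a (trans (cong (j +_) b′) (trans (sym (+-assoc j _ _)) (cong (_+ crs (F q)) (+-comm j (wrap (proj₁ q)))))) ,
    trans b (cong vertOf a′)

  lab-strict : ∀ {q e j} → ¬ TQ q → Lab q e j → 1 ≤ j ⊎ toℕ (proj₁ e) < toℕ (proj₁ q)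
  lab-low : ∀ {q e j} → Lab q e j → 1 ≤ j ⊎ toℕ (proj₁ e) ≤ toℕ (proj₁ q)
  lab-low {q} (start h) = inj₂ ≤-refl
  lab-low {q} (pass x u l) = [ inj₁ , inj₂ ∘ <⇒≤ ]′ (lab-strict u (pass x u l))
  lab-strict u (start h) = ⊥-elim (u h)
  lab-strict {q′} {e} u (pass {q} refl _ l) with wrap-level (proj₁ q) (proj₂ q)
  ... | inj₁ (a , b) = inj₁ (≤-trans (≤-reflexive (sym a)) (m≤m+n _ _))
  ... | inj₂ (a , b) with lab-low l
  ... | inj₁ k = inj₁ (≤-trans k (m≤n+m _ _))
  ... | inj₂ k = inj₂ (subst (toℕ (proj₁ e) <_) (sym b) (s≤s k))

  end-high : ∀ {q t c} → End q t c → 1 ≤ c ⊎ toℕ (proj₁ q) < toℕ (proj₁ t)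
  end-high {q} (end refl h) with wrap-level (proj₁ q) (proj₂ q)
  ... | inj₁ (a , b) = inj₁ (≤-reflexive (sym a))
  ... | inj₂ (a , b) = inj₂ (subst (toℕ (proj₁ q) <_) (sym b) ≤-refl)
  end-high {q} (pass refl u l) with wrap-level (proj₁ q) (proj₂ q)
  ... | inj₁ (a , b) = inj₁ (≤-trans (≤-reflexive (sym a)) (m≤m+n _ _))
  ... | inj₂ (a , b) with end-high l
  ... | inj₁ k = inj₁ (≤-trans k (m≤n+m _ _))
  ... | inj₂ k = inj₂ (<-trans (subst (toℕ (proj₁ q) <_) (sym b) ≤-refl) k)

  lab-G : ∀ {q e j} → Lab q e j → Lab (G q) e j
  lab-G {i , p} (start h) = subst (λ k → Lab (i , S (suc i) p) (i , k) 0) (cc-S i p) (start (touched-S i h))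
  lab-G (pass {q} refl u l) = pass (F-G u) (u ∘ TQ-G) (lab-G l)

  lab-τ : ∀ {q e j} → Lab q e j → ∀ {q₀} → edgeOf q₀ ≡ e → Lab (τQ q) (edgeOf (τQ q₀)) j
  lab-τ (start h) x with edge-cyc x
  ... | i , p , p′ , refl , refl , c = subst (λ k → Lab _ (i , k) 0) (sym (cyc-cc i (TwPerm.cyc-τ (tS (suc i)) c))) (start (touched-τ i h))
  lab-τ (pass {q} refl u l) x = pass (F-τ q) (u ∘ TQ-τ) (lab-τ l x)

  private
    F-it : ∀ {i p i′ p′} → F (i , p) ≡ (i′ , p′) → ¬ Touched i′ p′ → ∀ k →
      F (i , it (S (suc i)) k p) ≡ (i′ , it (S (suc i′)) k p′) × ¬ Touched i′ (it (S (suc i′)) k p′)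
    F-it e u zero = e , u
    F-it {i} {p} {i′} e u (suc k) with F-it {i} {p} e u k
    ... | e′ , u′ = trans (F-G (λ h → u′ (subst TQ e′ h))) (cong G e′) , u′ ∘ touched-vc i′ (vc-S i′ _)

  lab-cyc : ∀ {i p p′ e j e′ j′} → Lab (i , p) e j → Lab (i , p′) e′ j′ → e ≡ e′ → j ≡ j′ → Cyc (S (suc i)) p p′
  lab-cyc {i} (start h) (start h′) x _ = cc-cyc i (cong proj₂ x)
  lab-cyc {i} (start h) l@(pass _ u _) x y with lab-strict u l
  ... | inj₁ k = ⊥-elim (<⇒≢ k y)
  ... | inj₂ k = ⊥-elim (<⇒≢ k (cong (toℕ ∘ proj₁) (sym x)))
  lab-cyc {i} l@(pass _ u _) (start h) x y with lab-strict u l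
  ... | inj₁ k = ⊥-elim (<⇒≢ k (sym y))
  ... | inj₂ k = ⊥-elim (<⇒≢ k (cong (toℕ ∘ proj₁) x))
  lab-cyc {i} {p} {p′} (pass {i₁ , p₁} a u l) (pass {i₂ , p₂} b u′ l′) x y with level-inj {i₁} {i₂} {p₁} {p₂} (trans (cong proj₁ a) (sym (cong proj₁ b)))
  ... | refl with lab-cyc l l′ x (+-cancelˡ-≡ (wrap i₁) _ _ y)
  ... | k , refl = k , cong proj₂ (trans (sym (proj₁ (F-it {i₁} {p₁} a u k))) b)

  lab-per : ∀ {i p e j} → Lab (i , p) e j → ∀ {i₀ p₀} → edgeOf (i₀ , p₀) ≡ e → ∀ {w} → Per (S (suc i₀)) p₀ w → Per (S (suc i)) p w
  lab-per (start h) x pw with edge-cyc x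
  ... | i , p , p′ , refl , refl , c = per-cyc (S-inj _) c pw
  lab-per {i} {p} (pass {i₁ , p₁} a u l) x {w} pw with lab-per l x pw
  ... | b , c , min = b , cong proj₂ (trans (sym (proj₁ (F-it {i₁} {p₁} a u w))) (trans (cong (λ z → F (i₁ , z)) c) a)) ,
    λ k r s e → min k r s (cong proj₂ (F-inj (trans (proj₁ (F-it {i₁} {p₁} a u k)) (trans (cong (i ,_) e) (sym a)))))

  EK VK : K → Set
  EK (i , κ) = ∃ λ p → Touched i p × cc i p ≡ κ
  VK (i , κ) = ∃ λ p → Touched i p × vc i p ≡ κ

  lab-EK : ∀ {q e j} → Lab q e j → EK e
  lab-EK {i , p} (start h) = p , h , refl
  lab-EK (pass _ _ l) = lab-EK l

  opaque
    enumE : Enumeration EK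
    enumE = enumerate-pairs (λ (i , κ) → F.any? (λ p → touched? i p ×-dec (cc i p ≟ κ)))

    enumV : Enumeration VK
    enumV = enumerate-pairs (λ (i , κ) → F.any? (λ p → touched? i p ×-dec (vc i p ≟ κ)))

  module E = Enumeration enumE
  module V′ = Enumeration enumV

  qE : Fin E.size → Q
  qE e = proj₁ (E.at e) , proj₁ (E.at∈ e)

  tE : ∀ e → TQ (qE e)
  tE e = proj₁ (proj₂ (E.at∈ e))

  edge-qE : ∀ e → edgeOf (qE e) ≡ E.at e
  edge-qE e = cong (proj₁ (E.at e) ,_) (proj₂ (proj₂ (E.at∈ e)))

  qV : Fin V′.size → Q
  qV v = proj₁ (V′.at v) , proj₁ (V′.at∈ v)

  tV : ∀ v → TQ (qV v)
  tV v = proj₁ (proj₂ (V′.at∈ v))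

  vert-qV : ∀ v → vertOf (qV v) ≡ V′.at v
  vert-qV v = cong (proj₁ (V′.at v) ,_) (proj₂ (proj₂ (V′.at∈ v)))

  eIdx : ∀ q → TQ q → Fin E.size
  eIdx (i , p) h = E.idx {i , cc i p} (p , h , refl)

  at-eIdx : ∀ q h → E.at (eIdx q h) ≡ edgeOf q
  at-eIdx (i , p) h = E.at-idx (p , h , refl)

  vIdx : ∀ q → TQ q → Fin V′.size
  vIdx (i , p) h = V′.idx {i , vc i p} (p , h , refl)

  at-vIdx : ∀ q h → V′.at (vIdx q h) ≡ vertOf q
  at-vIdx (i , p) h = V′.at-idx (p , h , refl)

  vIdx-≡ : ∀ {q q′ h h′} → vertOf q ≡ vertOf q′ → vIdx q h ≡ vIdx q′ h′
  vIdx-≡ {q} {q′} {h} {h′} e = V′.at-inj (trans (at-vIdx q h) (trans e (sym (at-vIdx q′ h′))))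

  cover : TCover n
  cover = record
    { nV = V′.size ; nE = E.size
    ; pos = λ v → proj₁ (V′.at v)
    ; src = λ e → vIdx (qE e) (tE e)
    ; tgt = λ e → vIdx (tq (qE e)) (end-TQ (ends (qE e)))
    ; wt = λ e → proj₁ (period (S-inj (suc (proj₁ (qE e)))) (proj₂ (qE e)))
    ; wind = λ e → crs (qE e) ∸ [ toℕ (proj₁ (vt (qE e))) <ᵇ toℕ (proj₁ (E.at e)) ]ᵇ
    ; ιV = λ v → vIdx (τQ (qV v)) (touched-τ _ (tV v))
    ; ιE = λ e → eIdx (τQ (qE e)) (touched-τ _ (tE e)) }

module CoverLoop {d m : ℕ} (t : Tuple d m) where

  open Flow t
  open Trace t
  open Arcs cover
  module Mk = Marking cover d
  open Mk using (State; Crossing; Agree)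

  at-src : ∀ e → V′.at (src e) ≡ vertOf (qE e)
  at-src e = at-vIdx _ _

  at-tgt : ∀ e → V′.at (tgt e) ≡ vt (qE e)
  at-tgt e = at-vIdx _ _

  pos-src : ∀ e → pos (src e) ≡ proj₁ (E.at e)
  pos-src e = cong proj₁ (at-src e)

  pos-tgt : ∀ e → pos (tgt e) ≡ proj₁ (vt (qE e))
  pos-tgt e = cong proj₁ (at-tgt e)

  private
    b : Fin nE → ℕ
    b e = [ toℕ (proj₁ (vt (qE e))) <ᵇ toℕ (proj₁ (E.at e)) ]ᵇ

    b≤ : ∀ e → b e ≤ crs (qE e)
    b≤ e = <ᵇ≤ (λ l → [ id , (λ h → ⊥-elim (<-asym h l)) ]′ (end-high (ends (qE e))))

    b≡ : ∀ e → [ pt e <ᵇ ps e ]ᵇ ≡ b e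
    b≡ e = cong₂ (λ x y → [ toℕ x <ᵇ toℕ y ]ᵇ) (pos-tgt e) (pos-src e)

  cross≡ : ∀ e → cross e ≡ crs (qE e)
  cross≡ e = trans (cong (crs (qE e) ∸ b e +_) (b≡ e)) (m∸n+n≡m (b≤ e))

  positive : ∀ e → pos (src e) ≡ pos (tgt e) → 1 ≤ wind e
  positive e q = [ (λ h → subst (1 ≤_) (sym (cong (crs (qE e) ∸_) (<ᵇ-0 (λ l → <⇒≢ l (cong toℕ (sym r)))))) h) ,
      (λ h → ⊥-elim (<⇒≢ h (cong toℕ r))) ]′ (end-high (ends (qE e)))
    where
    r : proj₁ (E.at e) ≡ proj₁ (vt (qE e))
    r = trans (sym (pos-src e)) (trans q (pos-tgt e))

  Λ : Q → Arc
  Λ q = E.idx (lab-EK (lab q)) , proj₂ (lb q)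

  at-Λ : ∀ q → E.at (proj₁ (Λ q)) ≡ proj₁ (lb q)
  at-Λ q = E.at-idx (lab-EK (lab q))

  Λ-≡ : ∀ {q e j e′} → Lab q e j → E.at e′ ≡ e → Λ q ≡ (e′ , j)
  Λ-≡ {q} l r = let x = lab-det (lab q) l in cong₂ _,_ (E.at-inj (trans (at-Λ q) (trans (cong proj₁ x) (sym r)))) (cong proj₂ x)

  Λ-Lab : ∀ q → Lab q (E.at (proj₁ (Λ q))) (proj₂ (Λ q))
  Λ-Lab q = subst (λ e → Lab q e (proj₂ (lb q))) (sym (at-Λ q)) (lab q)

  edge-Λ : ∀ q → edgeOf (qE (proj₁ (Λ q))) ≡ E.at (proj₁ (Λ q))
  edge-Λ q = edge-qE _

  cross-Λ : ∀ q → cross (proj₁ (Λ q)) ≡ proj₂ (Λ q) + crs q × V′.at (tgt (proj₁ (Λ q))) ≡ vt q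
  cross-Λ q = let (x , y) = cross-split (Λ-Lab q) (edge-Λ q) in trans (cross≡ _) x , trans (at-tgt _) y

  Xs-Λ : ∀ i p → Xs (suc i) (Λ (i , p))
  Xs-Λ i p = low , high (end-high (ends (i , p)))
    where
    a = Λ (i , p)
    low : 1 ≤ proj₂ a ⊎ ps (proj₁ a) < suc (toℕ i)
    low with lab-low (Λ-Lab (i , p))
    ... | inj₁ h = inj₁ h
    ... | inj₂ h = inj₂ (s≤s (subst (λ k → toℕ k ≤ toℕ i) (sym (pos-src (proj₁ a))) h))
    high : 1 ≤ crs (i , p) ⊎ toℕ i < toℕ (proj₁ (tq (i , p))) → proj₂ a < cross (proj₁ a) ⊎ (proj₂ a ≡ cross (proj₁ a) × suc (toℕ i) ≤ pt (proj₁ a))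
    high h with crs (i , p) ≟ℕ 0 | cross-Λ (i , p)
    ... | no c | x , _ = inj₁ (subst (proj₂ a <_) (sym x) (m<m+n _ (n≢0⇒n>0 c)))
    ... | yes c | x , y = inj₂ (trans (sym (+-identityʳ _)) (trans (cong (proj₂ a +_) (sym c)) (sym x)) ,
            [ (λ k → ⊥-elim (<⇒≢ k (sym c))) , subst (λ k → suc (toℕ i) ≤ toℕ k) (sym (cong proj₁ y)) ]′ h)

  start-touched : ∀ i p (h : Touched i p) → startV i (Λ (i , p)) ≡ just (vIdx (i , p) h)
  start-touched i p h = trans (cong (startV i) (Λ-≡ (start h) (at-eIdx (i , p) h)))
      (trans (startV-yes (cong proj₁ at≡)) (cong just (V′.at-inj (trans at≡ (sym (at-vIdx (i , p) h))))))
    where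
    at≡ : V′.at (src (eIdx (i , p) h)) ≡ vertOf (i , p)
    at≡ with edge-cyc (trans (edge-qE (eIdx (i , p) h)) (at-eIdx (i , p) h)) | at-src (eIdx (i , p) h)
    ... | _ , p₁ , _ , x , refl , c | r = trans r (trans (cong vertOf x) (cong (i ,_) (cyc-vc i c)))

  start-untouched : ∀ i p → ¬ Touched i p → startV i (Λ (i , p)) ≡ nothing
  start-untouched i p u = startV-nothing {i} {Λ (i , p)} λ (x , y) → case lab-strict u (Λ-Lab (i , p)) of λ
    { (inj₁ h) → <⇒≢ h (sym x) ; (inj₂ h) → <⇒≢ h (cong toℕ (trans (sym (pos-src _)) y)) }

  touched-start : ∀ i p {v} → startV i (Λ (i , p)) ≡ just v → Touched i p
  touched-start i p s = case touched? i p of λ { (yes h) → h ; (no u) → case trans (sym s) (start-untouched i p u) of λ () }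

  onto : ∀ i {a} → Xs (suc i) a → ∃ λ p → Λ (i , p) ≡ a
  onto i {e , j} x = level j (ground j) _ i ≤-refl x
    where
    Goal : ℕ → Fin n → Set
    Goal j i = Xs (suc i) (e , j) → ∃ λ p → Λ (i , p) ≡ (e , j)
    step′ : ∀ {i q j′} j → Λ q ≡ (e , j′) → wrap (proj₁ q) + j′ ≡ j → proj₁ (F q) ≡ i → endV i (e , j) ≡ nothing → ∃ λ p → Λ (i , p) ≡ (e , j)
    step′ {i} {q} {j′} j lq w refl no-end = proj₂ (F q) , Λ-≡ (subst (Lab (F q) (E.at e)) w (pass refl u (subst (λ a → Lab q (E.at (proj₁ a)) (proj₂ a)) lq (Λ-Lab q)))) refl
      where
      u : ¬ TQ (F q)
      u h with cross-Λ q | crs-end h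
      ... | x , y | tqF , cF = case trans (sym no-end) (subst (λ k → endV i (e , k) ≡ just (tgt e)) cr (endV-yes ps≡)) of λ ()
        where
        cr : cross e ≡ j
        cr = trans (cong (cross ∘ proj₁) (sym lq)) (trans x (trans (cong₂ _+_ (cong proj₂ lq) cF) (trans (+-comm j′ _) w)))
        ps≡ : pos (tgt e) ≡ i
        ps≡ = trans (cong (pos ∘ tgt ∘ proj₁) (sym lq)) (trans (cong proj₁ y) (cong proj₁ tqF))
    level : ∀ j → (endV zero (e , j) ≡ nothing → Xs zero (e , j) → ∃ λ p → Λ (zero , p) ≡ (e , j)) → ∀ k i → toℕ i ≤ k → Goal j i
    level j g k i l x with (j ≟ℕ 0) ×-dec (pos (src e) ≟ i)
    ... | yes (refl , refl) = subst (λ k → ∃ λ p → Λ (k , p) ≡ (e , 0)) (sym (pos-src e)) (proj₂ (qE e) , Λ-≡ (start (tE e)) (sym (edge-qE e)))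
    level j g k zero l x | no ns = let (y , z) = pass→ {zero} {e , j} x (startV-nothing {zero} {e , j} ns) in g z y
    level j g (suc k) (suc i) (s≤s l) x | no ns with pass→ {suc i} {e , j} x (startV-nothing {suc i} {e , j} ns)
    ... | y , z with level j g k (inject₁ i) (≤-trans (≤-reflexive (F.toℕ-inject₁ i)) l) y
    ... | p , r = step′ j r (cong (_+ j) (wrap-notlast i)) (cong proj₁ (F-notlast i p)) z
    ground : ∀ j → endV zero (e , j) ≡ nothing → Xs zero (e , j) → ∃ λ p → Λ (zero , p) ≡ (e , j)
    ground zero z y = case proj₁ (zero→ {e , zero} y) of λ ()
    ground (suc j) z y with level j (ground j) n (fromℕ m) (≤-trans (≤-reflexive (F.toℕ-fromℕ m)) (n≤1+n m)) (→last {e , j} (proj₂ (zero→ {e , suc j} y)))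
    ... | p , r = step′ (suc j) r (cong (_+ j) wrap-last) (cong proj₁ (F-last p)) z

  state-suc : ∀ i → State (Xs (suc i)) (S (suc i)) (λ p → Λ (i , p))
  state-suc i = record
    { twp = tS (suc i)
    ; l∈ = Xs-Λ i
    ; l-T = λ p → Λ-≡ (lab-G (Λ-Lab (i , p))) refl
    ; l-τ = λ p → Λ-≡ (lab-τ (Λ-Lab (i , p)) (edge-Λ (i , p))) (at-eIdx _ _)
    ; l-cyc = λ {p} {q} r → lab-cyc (Λ-Lab (i , p)) (Λ-Lab (i , q)) (cong (E.at ∘ proj₁) r) (cong proj₂ r)
    ; l-per = λ p → lab-per (Λ-Lab (i , p)) (edge-Λ (i , p)) (proj₂ (period (S-inj _) _))
    ; l-onto = onto i }

  private
    α⁻ : P → P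
    α⁻ = inverse (α !!_)

    αr : ∀ p → α !! α⁻ p ≡ p
    αr = inverse-r α-inj

    S₀ : ∀ p → S zero p ≡ α !! S (fromℕ n) (α⁻ p)
    S₀ p = trans (cong (S zero) (sym (αr p))) (trans (closing (α⁻ p)) (cong (λ f → α !! f (α⁻ p)) (sym (levels-last d σ ηs))))

    it₀ : ∀ k p → it (S zero) k p ≡ α !! it (S (fromℕ n)) k (α⁻ p)
    it₀ zero p = sym (αr p)
    it₀ (suc k) p = trans (cong (S zero) (it₀ k p)) (trans (S₀ _) (cong (λ x → α !! S (fromℕ n) x) (inverse-l α-inj _)))

    α⁻τ : ∀ p → α⁻ (τ d p) ≡ τ d (α⁻ p)
    α⁻τ p = α-inj (trans (αr _) (sym (trans (proj₂ αB _) (cong (τ d) (αr p)))))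

  lam : Fin (suc n) → P → Arc
  lam zero p = glue (Λ (fromℕ m , α⁻ p))
  lam (suc i) p = Λ (i , p)

  state : ∀ i → State (Xs i) (S i) (lam i)
  state (suc i) = state-suc i
  state zero = record
    { twp = tS zero
    ; l∈ = λ p → →zero {glue (Λ (fromℕ m , α⁻ p))} (s≤s z≤n) (last→ {Λ (fromℕ m , α⁻ p)} (l∈ (α⁻ p)))
    ; l-T = λ p → cong glue (trans (cong (λ x → Λ (fromℕ m , x)) (trans (cong α⁻ (S₀ p)) (inverse-l α-inj _))) (l-T (α⁻ p)))
    ; l-τ = λ p → cong glue (trans (cong (λ x → Λ (fromℕ m , x)) (α⁻τ p)) (l-τ (α⁻ p)))
    ; l-cyc = λ {p} {q} r → let (k , x) = l-cyc (cong₂ _,_ (cong proj₁ r) (suc-injective (cong proj₂ r))) in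
        k , trans (it₀ k p) (trans (cong (α !!_) x) (αr q))
    ; l-per = λ p → let (x , y , z) = l-per (α⁻ p) in x , trans (it₀ (wt (proj₁ (Λ (fromℕ m , α⁻ p)))) p) (trans (cong (α !!_) y) (αr p)) ,
        λ k r s q → z k r s (α-inj (trans (sym (it₀ k p)) (trans q (sym (αr p)))))
    ; l-onto = λ {a} xa → let (p , r) = l-onto (→last {unglue a} (pr a xa)) in α !! p ,
        trans (cong (λ x → glue (Λ (fromℕ m , x))) (inverse-l α-inj p)) (trans (cong glue r) (glue-unglue xa)) }
    where
    open State (state-suc (fromℕ m))
    pr : ∀ a → Xs zero a → proj₂ (unglue a) < cross (proj₁ a)
    pr (e , j) x = let (y , z) = zero→ {e , j} x in ≤-trans (≤-reflexive (m+[n∸m]≡n y)) z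

  private
    pred-label : ∀ i p → ∃ λ q → F q ≡ (i , p) × lam (inject₁ i) p ≡ (proj₁ (Λ q) , wrap (proj₁ q) + proj₂ (Λ q))
    pred-label zero p = (fromℕ m , α⁻ p) , trans (F-last _) (cong (zero ,_) (αr p)) , cong (λ k → proj₁ (Λ (fromℕ m , α⁻ p)) , k + proj₂ (Λ (fromℕ m , α⁻ p))) (sym wrap-last)
    pred-label (suc i) p = (inject₁ i , p) , F-notlast i p , cong (λ k → proj₁ (Λ (inject₁ i , p)) , k + proj₂ (Λ (inject₁ i , p))) (sym (wrap-notlast i))

  end-touched : ∀ i p (h : Touched i p) → endV i (lam (inject₁ i) p) ≡ just (vIdx (i , p) h)
  end-touched i p h with pred-label i p
  ... | q , refl , x with cross-Λ q | crs-end {q} h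
  ... | y , z | a , c = trans (cong (endV i) (trans x (cong (proj₁ (Λ q) ,_) (trans (+-comm _ (proj₂ (Λ q))) (trans (cong (proj₂ (Λ q) +_) (sym c)) (sym y))))))
      (trans (endV-yes (trans (cong proj₁ z) (cong proj₁ a))) (cong just (V′.at-inj (trans z (trans (cong vertOf a) (sym (at-vIdx _ h)))))))

  lam-untouched : ∀ i p → ¬ Touched i p → lam (inject₁ i) p ≡ lam (suc i) p
  lam-untouched i p u with pred-label i p
  ... | q , refl , x = trans x (sym (Λ-≡ (pass refl u (Λ-Lab q)) refl))

  step : ∀ i p → Agree (endV i) (lam (inject₁ i) p) (startV i) (lam (suc i) p)
  step i p with touched? i p
  ... | yes h = inj₁ (vIdx (i , p) h , end-touched i p h , start-touched i p h)
  ... | no u = inj₂ (trans (cong (endV i) (lam-untouched i p u)) (proj₂ (pass→ {i} {lam (suc i) p} (Xs-Λ i p) (start-untouched i p u))) ,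
          start-untouched i p u , lam-untouched i p u)

  pres : ∀ i p → Agree (startV i) (lam (suc i) (η i p)) (startV i) (lam (suc i) p)
  pres i p with touched? i p
  ... | yes h = inj₁ (vIdx (i , p) h , trans (start-touched i _ (touched-η i h)) (cong just (vIdx-≡ (cong (i ,_) (vc-η i p)))) , start-touched i p h)
  ... | no u = inj₂ (trans (cong (startV i ∘ lam (suc i)) (η-fix i u)) (start-untouched i p u) , start-untouched i p u , cong (lam (suc i)) (η-fix i u))

  moved : ∀ i {p v} → startV i (lam (suc i) p) ≡ just v → ∃ λ q → Cyc (S (suc i)) p q × (η i q ≢ q ⊎ η i (τ d q) ≢ τ d q)
  moved i {p} s with touched-start i p s
  ... | inj₁ (inj₁ c) = X i , cyc-sym (S-inj _) c , inj₁ (λ q → X≢Y i (trans (sym q) (ηX i)))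
  ... | inj₁ (inj₂ c) = Y i , cyc-sym (S-inj _) c , inj₁ (λ q → X≢Y i (trans (sym (ηY i)) q))
  ... | inj₂ (inj₁ c) = τ d (X i) , cyc-sym (S-inj _) c , inj₂ (λ q → X≢Y i (trans (sym (ττ _)) (trans (sym q) (trans (cong (η i) (ττ _)) (ηX i)))))
  ... | inj₂ (inj₂ c) = τ d (Y i) , cyc-sym (S-inj _) c , inj₂ (λ q → X≢Y i (trans (sym (ηY i)) (trans (cong (η i) (sym (ττ _))) (trans q (ττ _)))))

  linked : ∀ i {p q v} → startV i (lam (suc i) p) ≡ just v → startV i (lam (suc i) q) ≡ just v → Orbit (links i) p q
  linked i {p} {q} a c = vc-link i (cong proj₂ (trans (sym (at-vIdx (i , p) h)) (trans (cong V′.at eq) (at-vIdx (i , q) h′))))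
    where
    h = touched-start i p a
    h′ = touched-start i q c
    eq : vIdx (i , p) h ≡ vIdx (i , q) h′
    eq = just-injective (trans (sym (start-touched i p h)) (trans a (trans (sym c) (start-touched i q h′))))

  marking : Marks.Labels d cover
  marking = V.tabulate (lam (fromℕ n)) , V.tabulate (λ i → V.tabulate (lam (inject₁ i)))

  marking-labels : ∀ i p → Marks.labels d cover (σ , ηs , α) marking i p ≡ lam i p
  marking-labels i p with last-view i
  ... | last = trans (Marks.labels-last d cover (σ , ηs , α) marking p) (VP.lookup∘tabulate _ p)
  ... | notlast j = trans (Marks.labels-at d cover (σ , ηs , α) marking j p)
          (trans (cong (_!! p) (VP.lookup∘tabulate (λ i → V.tabulate (lam (inject₁ i))) j)) (VP.lookup∘tabulate _ p))

  private
    δs = V.zip ηs (proj₂ marking)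

    run-S : ∀ {k} (ηs : Vec (Perm d) k) ls l i → proj₁ (Mk.run (V.zip ηs ls) (Mk.start (σ , l)) i) ≡ levels d σ ηs i
    run-S [] [] l i = refl
    run-S (η ∷ ηs) (x ∷ ls) l zero = cong (conj (η !!_)) (run-S ηs ls l zero)
    run-S (η ∷ ηs) (x ∷ ls) l (suc i) = run-S ηs ls l i

  marked : Marks.Marked d cover (σ , ηs , α) marking
  marked = record
    { initial = Mk.state-cong (λ p → cong (λ f → f p) (levels-last d σ ηs)) (λ p → sym (VP.lookup∘tabulate _ p)) (state (fromℕ n))
    ; steps = steps
    ; α-B = αB
    ; α-T = λ p → trans (cong (λ f → f (α !! p)) (run-S ηs (proj₂ marking) (proj₁ marking) zero)) (closing p)
    ; α-l = λ p → trans (marking-labels zero (α !! p)) (cong glue (trans (cong (λ x → Λ (fromℕ m , x)) (inverse-l α-inj p)) (sym (VP.lookup∘tabulate _ p)))) }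
    where
    ml : ∀ i p → Marks.labels d cover (σ , ηs , α) marking i p ≡ lam i p
    ml = marking-labels
    lab′ : ∀ i → P → Arc
    lab′ = Marks.labels d cover (σ , ηs , α) marking
    farl : ∀ i p → (proj₂ marking !! i) !! p ≡ lam (inject₁ i) p
    farl i p = trans (cong (_!! p) (VP.lookup∘tabulate (λ i → V.tabulate (lam (inject₁ i))) i)) (VP.lookup∘tabulate _ p)
    core : ∀ i → Mk.Crossing (Xs (suc i)) (Xs (inject₁ i)) (startV i) (endV i) (S (suc i)) (lab′ (suc i)) (ηs !! i) (proj₂ marking !! i)
    core i = record
      { adm = adm i
      ; far = Mk.state-cong (S-far i) (λ p → sym (farl i p)) (state (inject₁ i))
      ; step = λ p → subst (λ a → Agree (endV i) a (startV i) (lab′ (suc i) p)) (sym (farl i p))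
          (subst (Agree (endV i) (lam (inject₁ i) p) (startV i)) (sym (ml (suc i) p)) (step i p))
      ; pres = λ p → subst (λ a → Agree (startV i) a (startV i) (lab′ (suc i) p)) (sym (ml (suc i) _))
          (subst (Agree (startV i) (lam (suc i) (η i p)) (startV i)) (sym (ml (suc i) p)) (pres i p))
      ; moved = λ {p} s → moved i (trans (cong (startV i) (sym (ml (suc i) p))) s)
      ; linked = λ {p} {q} s s′ → linked i (trans (cong (startV i) (sym (ml (suc i) p))) s) (trans (cong (startV i) (sym (ml (suc i) q))) s′) }
    steps : ∀ i → Mk.Val i (Mk.run δs (Mk.start (σ , proj₁ marking)) (suc i)) (δs !! i)
    steps i = subst (λ T → Mk.Crossing (Xs (suc i)) (Xs (inject₁ i)) (startV i) (endV i) T (lab′ (suc i)) (proj₁ (δs !! i)) (proj₂ (δs !! i)))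
      (sym (run-S ηs (proj₂ marking) (proj₁ marking) (suc i)))
      (subst (λ x → Mk.Crossing (Xs (suc i)) (Xs (inject₁ i)) (startV i) (endV i) (S (suc i)) (lab′ (suc i)) x (proj₂ (δs !! i))) (sym (Marks.tie-η d cover ηs (proj₂ marking) i))
        (subst (λ x → Mk.Crossing (Xs (suc i)) (Xs (inject₁ i)) (startV i) (endV i) (S (suc i)) (lab′ (suc i)) (ηs !! i) x) (sym (Marks.tie-l d cover ηs (proj₂ marking) i)) (core i)))

sumFin-+ : ∀ {n} (f g : Fin n → ℕ) → sumFin (λ i → f i + g i) ≡ sumFin f + sumFin g
sumFin-+ {zero} f g = refl
sumFin-+ {suc n} f g = trans (cong (f zero + g zero +_) (sumFin-+ (f ∘ suc) (g ∘ suc))) (r (f zero) (g zero) _ _)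
  where
  r : ∀ a b c d → a + b + (c + d) ≡ a + c + (b + d)
  r = solve-∀

sumFin-const : ∀ n k → sumFin {n} (λ _ → k) ≡ n * k
sumFin-const zero k = refl
sumFin-const (suc n) k = cong (k +_) (sumFin-const n k)

sumFin-group : ∀ {m n} (p : Fin m → Fin n) (f : Fin m → ℕ) →
  sumFin (λ i → sumFin (λ x → if does (p x ≟ i) then f x else 0)) ≡ sumFin f
sumFin-group {zero} {n} p f = trans (sumFin-const n 0) (*-zeroʳ n)
sumFin-group {suc m} p f = trans (sumFin-+ (λ i → if does (p zero ≟ i) then f zero else 0) _) (cong₂ _+_
  (trans (sumFin-list (λ i → p zero ≟ i) (λ _ → f zero) {p zero ∷ []} ([] ∷ [] , λ x → mk⇔ (λ { (here e) → sym e ; (there ()) }) (λ e → here (sym e)))) (+-identityʳ _))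
  (sumFin-group (p ∘ suc) (f ∘ suc)))

count-if : ∀ {n} {P : Fin n → Set} (P? : ∀ x → Dec (P x)) → sumFin (λ e → [ does (P? e) ]ᵇ) ≡ sumFin (λ e → if does (P? e) then 1 else 0)
count-if P? = sumFin-cong λ e → lem (does (P? e))
  where
  lem : ∀ b → [ b ]ᵇ ≡ (if b then 1 else 0)
  lem true  = refl
  lem false = refl

-- the genus, by counting half-edges
genus-of-structure : ∀ {n} (c : TCover n) → IsTwistedStructure c → HasGenus c (suc n)
genus-of-structure {n} c (fib , _) = trans (+-comm nE 1) (trans (cong suc (m+m-injective (trans (sym handshake) vertices))) (sym (+-suc nV n)))
  where
  open TCover c
  ends : (h : Fin nE → Fin nV) → sumFin (λ v → sumFin (λ e → [ does (h e ≟ v) ]ᵇ)) ≡ nE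
  ends h = trans (sumFin-cong (λ v → count-if (λ e → h e ≟ v))) (trans (sumFin-group h (λ _ → 1)) (trans (sumFin-const nE 1) (*-identityʳ nE)))
  handshake : sumFin (val c) ≡ nE + nE
  handshake = trans (sumFin-+ (λ v → sumFin (λ e → [ does (src e ≟ v) ]ᵇ)) _) (cong₂ _+_ (ends src) (ends tgt))
  over : (Fin nV → ℕ) → Fin n → ℕ
  over f i = sumFin (λ v → if does (pos v ≟ i) then f v else 0)
  local : ∀ i → over (val c) i ≡ (over (λ _ → 1) i + 1) + (over (λ _ → 1) i + 1)
  local i with fib i
  ... | inj₁ (v , p , v4 , all) = trans (sumFin-list (λ v → pos v ≟ i) (val c) l) (trans (cong (_+ 0) v4)
          (cong (λ k → (k + 1) + (k + 1)) (sym (sumFin-list (λ v → pos v ≟ i) (λ _ → 1) l))))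
    where l = list₁ p (λ {u} → all u)
  ... | inj₂ (v , w , ne , p , q , v3 , w3 , all) = trans (sumFin-list (λ v → pos v ≟ i) (val c) l) (trans (cong₂ (λ a b → a + (b + 0)) v3 w3)
          (cong (λ k → (k + 1) + (k + 1)) (sym (sumFin-list (λ v → pos v ≟ i) (λ _ → 1) l))))
    where l = list₂ ne p q (λ {u} → all u)
  vertices : sumFin (val c) ≡ (nV + n) + (nV + n)
  vertices = trans (sym (sumFin-group pos (val c))) (trans (sumFin-cong local)
    (trans (sumFin-+ (λ i → over (λ _ → 1) i + 1) _) (cong₂ _+_ total total)))
    where
    total : sumFin (λ i → over (λ _ → 1) i + 1) ≡ nV + n
    total = trans (sumFin-+ (over (λ _ → 1)) (λ _ → 1)) (cong₂ _+_
      (trans (sumFin-group pos (λ _ → 1)) (trans (sumFin-const nV 1) (*-identityʳ nV))) (trans (sumFin-const n 1) (*-identityʳ n)))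

-- the degree, by counting the points on the arcs over the cut
degree-of-state : ∀ {n} d (c : TCover n) {T l} → Marking.State c d (Arcs.Xs c (fromℕ n)) T l → twiceDeg c ≡ 2 * d
degree-of-state {n} d c {T} {l} st = trans (sumFin-cong (λ e → *-comm (wt e) (cross e)))
  (trans (sym (card-≡ points arcs))
  (cong (d +_) (sym (+-identityʳ d))))
  where
  open Arcs c
  open Marking.State c d st
  Pt : Fin nE × (ℕ × Fin (d + d)) → Set
  Pt (e , j , p) = ⊤ × (j < cross e × l p ≡ (e , j))
  points : Card Pt (d + d)
  points = card-map (λ p → proj₁ (l p) , proj₂ (l p) , p) (λ {p} _ → tt , last→ (l∈ p) , refl) (λ _ _ q → cong (proj₂ ∘ proj₂) q)
    (λ { {e , j , p} (_ , _ , q) → p , tt , cong (λ a → proj₁ a , proj₂ a , p) q }) (card-Fin (d + d))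
  label : ∀ {a} → Xs (fromℕ n) a → Card (λ p → l p ≡ a) (wA a)
  label xa with l-onto xa
  ... | p , refl = card-⇔ (λ c → sym (cyc-l c)) (λ e → l-cyc (sym e)) (card-cyc inj (l-per p))
  arcs : Card Pt (sumFin (λ e → if true then cross e * wt e else 0))
  arcs = card-subst (sym (sumFin-list (λ _ → yes tt) (λ e → cross e * wt e) (proj₁ (proj₂ (card-Fin nE)))))
    (Σ-list (λ e → cross e * wt e) (allFin nE) (proj₁ (proj₂ (card-Fin nE))) (λ {e} _ → card-Σ (card-< (cross e)) (λ {j} j< → label {e , j} (→last j<))))

module ShapeLemmas {n} (c : TCover n) where

  open TCover c

  module _ (h : Fin nE → Fin nV) {v : Fin nV} where

    count-one : One h v → sumFin (λ e → [ does (h e ≟ v) ]ᵇ) ≡ 1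
    count-one (e , p , all) = sumFin-count (λ e → h e ≟ v) (list₁ p all)

    count-two : Two h v → sumFin (λ e → [ does (h e ≟ v) ]ᵇ) ≡ 2
    count-two (e , f , p , q , ne , all) = sumFin-count (λ e → h e ≟ v) (list₂ ne p q all)

    weight-one : (o : One h v) → sumFin (λ e → if does (h e ≟ v) then wt e else 0) ≡ wt (proj₁ o)
    weight-one (e , p , all) = trans (sumFin-list (λ e → h e ≟ v) wt (list₁ p all)) (+-identityʳ _)

    weight-two : (o : Two h v) → sumFin (λ e → if does (h e ≟ v) then wt e else 0) ≡ wt (proj₁ o) + wt (proj₁ (proj₂ o))
    weight-two (e , f , p , q , ne , all) = trans (sumFin-list (λ e → h e ≟ v) wt (list₂ ne p q all)) (cong (wt e +_) (+-identityʳ _))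

  data VShape (v : Fin nV) : Set where
    s₁₂ : ιV v ≢ v → (o : One src v) (t : Two tgt v) → wt (proj₁ o) ≡ wt (proj₁ t) + wt (proj₁ (proj₂ t)) → VShape v
    s₂₁ : ιV v ≢ v → (o : Two src v) (t : One tgt v) → wt (proj₁ t) ≡ wt (proj₁ o) + wt (proj₁ (proj₂ o)) → VShape v
    s₂₂ : ιV v ≡ v → (o : Two src v) (t : Two tgt v) → ∀ ω → wt (proj₁ o) ≡ ω → wt (proj₁ (proj₂ o)) ≡ ω → wt (proj₁ t) ≡ ω → wt (proj₁ (proj₂ t)) ≡ ω → VShape v

  shape-balanced : ∀ {v} → VShape v → inW c v ≡ outW c v
  shape-balanced (s₁₂ _ o t e) = trans (weight-two tgt t) (trans (sym e) (sym (weight-one src o)))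
  shape-balanced (s₂₁ _ o t e) = trans (weight-one tgt t) (trans e (sym (weight-two src o)))
  shape-balanced (s₂₂ _ o t ω a b a′ b′) = trans (weight-two tgt t) (trans (cong₂ _+_ (trans a′ (sym a)) (trans b′ (sym b))) (sym (weight-two src o)))

  shape-val : ∀ {v} → VShape v → (ιV v ≢ v × val c v ≡ 3) ⊎ (ιV v ≡ v × val c v ≡ 4)
  shape-val (s₁₂ n o t e) = inj₁ (n , cong₂ _+_ (count-one src o) (count-two tgt t))
  shape-val (s₂₁ n o t e) = inj₁ (n , cong₂ _+_ (count-two src o) (count-one tgt t))
  shape-val (s₂₂ f o t _ _ _ _ _) = inj₂ (f , cong₂ _+_ (count-two src o) (count-two tgt t))

  shape-four : ∀ {v} → VShape v → val c v ≡ 4 → ∀ e e′ → Adj c v e → Adj c v e′ → wt e ≡ wt e′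
  shape-four (s₁₂ n o t e) v4 _ _ _ _ = case trans (sym v4) (cong₂ _+_ (count-one src o) (count-two tgt t)) of λ ()
  shape-four (s₂₁ n o t e) v4 _ _ _ _ = case trans (sym v4) (cong₂ _+_ (count-two src o) (count-one tgt t)) of λ ()
  shape-four {v} (s₂₂ f (o₁ , o₂ , _ , _ , _ , oa) (t₁ , t₂ , _ , _ , _ , ta) ω a b a′ b′) _ e e′ x y = trans (w x) (sym (w y))
    where
    w : ∀ {e} → Adj c v e → wt e ≡ ω
    w (inj₁ s) = [ (λ { refl → a }) , (λ { refl → b }) ]′ (oa s)
    w (inj₂ s) = [ (λ { refl → a′ }) , (λ { refl → b′ }) ]′ (ta s)

  module Flip (ιVιV : ∀ v → ιV (ιV v) ≡ v) (ιEιE : ∀ e → ιE (ιE e) ≡ e) (wt-ι : ∀ e → wt (ιE e) ≡ wt e)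
    (src-ι : ∀ e → src (ιE e) ≡ ιV (src e)) (tgt-ι : ∀ e → tgt (ιE e) ≡ ιV (tgt e)) where

    module _ (h : Fin nE → Fin nV) (h-ι : ∀ e → h (ιE e) ≡ ιV (h e)) {v : Fin nV} where

      private
        back : ∀ {e} → h e ≡ ιV v → h (ιE e) ≡ v
        back p = trans (h-ι _) (trans (cong ιV p) (ιVιV v))

      flip-one : One h v → One h (ιV v)
      flip-one (e , p , all) = ιE e , trans (h-ι e) (cong ιV p) , λ q → trans (sym (ιEιE _)) (cong ιE (all (back q)))

      flip-two : Two h v → Two h (ιV v)
      flip-two (e₁ , e₂ , p₁ , p₂ , ne , all) = ιE e₁ , ιE e₂ , trans (h-ι e₁) (cong ιV p₁) , trans (h-ι e₂) (cong ιV p₂) ,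
        (λ q → ne (trans (sym (ιEιE e₁)) (trans (cong ιE q) (ιEιE e₂)))) ,
        λ q → [ (λ r → inj₁ (trans (sym (ιEιE _)) (cong ιE r))) , (λ r → inj₂ (trans (sym (ιEιE _)) (cong ιE r))) ]′ (all (back q))

    flip-shape : ∀ {v} → VShape v → VShape (ιV v)
    flip-shape {v} (s₁₂ n o t e) = s₁₂ (λ q → n (trans (sym q) (ιVιV v))) (flip-one src src-ι o) (flip-two tgt tgt-ι t)
      (trans (wt-ι _) (trans e (sym (cong₂ _+_ (wt-ι _) (wt-ι _)))))
    flip-shape {v} (s₂₁ n o t e) = s₂₁ (λ q → n (trans (sym q) (ιVιV v))) (flip-two src src-ι o) (flip-one tgt tgt-ι t)
      (trans (wt-ι _) (trans e (sym (cong₂ _+_ (wt-ι _) (wt-ι _)))))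
    flip-shape {v} s@(s₂₂ f _ _ _ _ _ _ _) = subst VShape (sym f) s

module Structure {d m : ℕ} (t : Tuple d m) where

  open Flow t
  open Trace t
  open CoverLoop t
  open Arcs cover
  open Positive positive
  open ShapeLemmas cover
  open Mk using (State)

  tc-wt : ∀ e → 1 ≤ wt e
  tc-wt e = proj₁ (proj₂ (period (S-inj (suc (proj₁ (qE e)))) (proj₂ (qE e))))

  vc-τ : ∀ i {p q} → vc i p ≡ vc i q → vc i (τ d p) ≡ vc i (τ d q)
  vc-τ i {p} e = vc-closed i {D = λ z → vc i (τ d p) ≡ vc i (τ d z)}
    (λ {z} h → trans h (trans (cong (vc i) (sym (TwPerm.tw₁ (tS (suc i)) z))) (vc-S i _)))
    (λ {z} h → trans h (trans (sym (vc-mir i (τ d z))) (cong (vc i ∘ τ d ∘ η i) (ττ z))))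
    (λ {z} h → trans h (trans (sym (vc-η i (τ d z))) (cong (vc i) (sym (ττ _))))) e refl

  vert-τ : ∀ {q q′} → vertOf q ≡ vertOf q′ → vertOf (τQ q) ≡ vertOf (τQ q′)
  vert-τ {i , p} {i′ , p′} e with cong proj₁ e
  ... | refl = cong (i ,_) (vc-τ i (cong proj₂ e))

  edge-τ : ∀ {q q′} → edgeOf q ≡ edgeOf q′ → edgeOf (τQ q) ≡ edgeOf (τQ q′)
  edge-τ e with edge-cyc e
  ... | i , p , p′ , refl , refl , c = cong (i ,_) (cyc-cc i (TwPerm.cyc-τ (tS (suc i)) c))

  edge-vert : ∀ {q q′} → edgeOf q ≡ edgeOf q′ → vertOf q ≡ vertOf q′
  edge-vert e with edge-cyc e
  ... | i , p , p′ , refl , refl , c = cong (i ,_) (cyc-vc i c)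

  edge-crs : ∀ {q q′} → edgeOf q ≡ edgeOf q′ → crs q ≡ crs q′ × vt q ≡ vt q′
  edge-crs e with edge-cyc e
  ... | i , p , p′ , refl , refl , c = crs-cyc c

  at-ιV : ∀ v {q} → vertOf q ≡ V′.at v → V′.at (ιV v) ≡ vertOf (τQ q)
  at-ιV v e = trans (at-vIdx _ _) (vert-τ (trans (vert-qV v) (sym e)))

  at-ιE : ∀ e → E.at (ιE e) ≡ edgeOf (τQ (qE e))
  at-ιE e = at-eIdx _ _

  qE-ι : ∀ e → edgeOf (qE (ιE e)) ≡ edgeOf (τQ (qE e))
  qE-ι e = trans (edge-qE (ιE e)) (at-ιE e)

  ττQ : ∀ q → τQ (τQ q) ≡ q
  ττQ (i , p) = cong (i ,_) (ττ p)

  ιVιV : ∀ v → ιV (ιV v) ≡ v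
  ιVιV v = V′.at-inj (trans (at-ιV (ιV v) {τQ (qV v)} (sym (at-ιV v (vert-qV v)))) (trans (cong vertOf (ττQ (qV v))) (vert-qV v)))

  ιEιE : ∀ e → ιE (ιE e) ≡ e
  ιEιE e = E.at-inj (trans (at-ιE (ιE e)) (trans (edge-τ (qE-ι e)) (trans (cong edgeOf (ττQ (qE e))) (edge-qE e))))

  pos-ι : ∀ v → pos (ιV v) ≡ pos v
  pos-ι v = cong proj₁ (at-ιV v (vert-qV v))

  src-ι : ∀ e → src (ιE e) ≡ ιV (src e)
  src-ι e = V′.at-inj (trans (at-src (ιE e)) (trans (edge-vert (qE-ι e)) (sym (at-ιV (src e) (sym (at-src e))))))

  vt-ι : ∀ e → vt (qE (ιE e)) ≡ vertOf (τQ (tq (qE e)))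
  vt-ι e = trans (proj₂ (edge-crs (qE-ι e))) (cong vertOf (tq-τ (qE e)))

  tgt-ι : ∀ e → tgt (ιE e) ≡ ιV (tgt e)
  tgt-ι e = V′.at-inj (trans (at-tgt (ιE e)) (trans (vt-ι e) (sym (at-ιV (tgt e) (sym (at-tgt e))))))

  per-wt : ∀ e → Per (S (suc (proj₁ (qE e)))) (proj₂ (qE e)) (wt e)
  per-wt e = proj₂ (period (S-inj (suc (proj₁ (qE e)))) (proj₂ (qE e)))

  edge-per : ∀ {i p i′ p′ w} → edgeOf (i , p) ≡ edgeOf (i′ , p′) → Per (S (suc i)) p w → Per (S (suc i′)) p′ w
  edge-per e pw with edge-cyc e
  ... | i , p , p′ , refl , refl , c = per-cyc (S-inj _) c pw

  wt-ι : ∀ e → wt (ιE e) ≡ wt e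
  wt-ι e = per-unique (edge-per (qE-ι e) (per-wt (ιE e))) (TwPerm.per-τ (tS (suc (proj₁ (qE e)))) (per-wt e))

  wind-ι : ∀ e → wind (ιE e) ≡ wind e
  wind-ι e = cong₂ _∸_ (trans (proj₁ (edge-crs (qE-ι e))) (crs-τ (qE e)))
    (cong₂ (λ x y → [ toℕ x <ᵇ toℕ y ]ᵇ) (cong proj₁ (vt-ι e)) (cong proj₁ (at-ιE e)))

  ιE≢ : ∀ e → ιE e ≢ e
  ιE≢ e q = TwPerm.no-self (tS (suc (proj₁ (qE e)))) (cc-cyc (proj₁ (qE e)) (cong proj₂ k))
    where
    k : edgeOf (qE e) ≡ edgeOf (τQ (qE e))
    k = trans (edge-qE e) (trans (cong E.at (sym q)) (at-ιE e))

  module _ (i : Fin n) where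

    vX : Fin nV
    vX = vIdx (i , X i) (inj₁ (inj₁ cyc-refl))

    at-vX : V′.at vX ≡ (i , vc i (X i))
    at-vX = at-vIdx _ _

    pos-vX : pos vX ≡ i
    pos-vX = cong proj₁ at-vX

    at-ιvX : V′.at (ιV vX) ≡ (i , vc i (τ d (X i)))
    at-ιvX = at-ιV vX {i , X i} (sym at-vX)

    private
      near : Fin (suc n)
      near = suc i
      far : Fin (suc n)
      far = inject₁ i

      lamE : Fin (suc n) → P → Fin nE
      lamE k p = proj₁ (lam k p)

      per-lam : ∀ k p {w} → Per (S k) p w → wt (lamE k p) ≡ w
      per-lam k p pw = per-unique (State.l-per (state k) p) pw

      src-of : ∀ p (h : Touched i p) → lam near p ≡ (lamE near p , 0) × V′.at (src (lamE near p)) ≡ (i , vc i p)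
      src-of p h = let (a , b , _) = startV-just {i} {lam near p} (start-touched i p h) in
        cong (lamE near p ,_) a , trans (cong V′.at b) (at-vIdx _ h)

      tgt-of : ∀ p (h : Touched i p) → lam far p ≡ (lamE far p , cross (lamE far p)) × V′.at (tgt (lamE far p)) ≡ (i , vc i p)
      tgt-of p h = let (a , b , _) = endV-just {i} {lam far p} (end-touched i p h) in
        cong (lamE far p ,_) a , trans (cong V′.at b) (at-vIdx _ h)

      src-pt : ∀ {e κ} → V′.at (src e) ≡ (i , κ) → ∃ λ p → vc i p ≡ κ × lam near p ≡ (e , 0)
      src-pt {e} {κ} q = go (qE e) refl (trans (sym (at-src e)) q)
        where
        go : ∀ x → qE e ≡ x → vertOf x ≡ (i , κ) → ∃ λ p → vc i p ≡ κ × lam near p ≡ (e , 0)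
        go (_ , p) r refl = p , refl , Λ-≡ (start (subst TQ r (tE e))) (trans (sym (edge-qE e)) (cong edgeOf r))

      tgt-pt : ∀ {e κ} → V′.at (tgt e) ≡ (i , κ) → ∃ λ p → vc i p ≡ κ × lam far p ≡ (e , cross e)
      tgt-pt {e} {κ} q = go (State.l-onto (state far) (end-arc pe))
        where
        pe : pos (tgt e) ≡ i
        pe = cong proj₁ q
        go : (∃ λ p → lam far p ≡ (e , cross e)) → ∃ λ p → vc i p ≡ κ × lam far p ≡ (e , cross e)
        go (p , r) = p , k (step i p) , r
          where
          k : Mk.Agree (endV i) (lam far p) (startV i) (lam near p) → vc i p ≡ κ
          k (inj₂ (x , _ , _)) = case trans (sym x) (trans (cong (endV i) r) (endV-yes pe)) of λ ()
          k (inj₁ (u , x , y)) = let h = touched-start i p y in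
            cong proj₂ (trans (sym (at-vIdx (i , p) h)) (trans (cong V′.at (just-injective (trans (sym (start-touched i p h))
              (trans y (trans (sym x) (trans (cong (endV i) r) (endV-yes pe))))))) q))

      lam-cyc : ∀ k {p q} → Cyc (S k) p q → lamE k p ≡ lamE k q
      lam-cyc k c = cong proj₁ (State.cyc-l (state k) c)

    module AtVertex {v : Fin nV} {x : P} (tx : Touched i x) (av : V′.at v ≡ (i , vc i x)) where

      private
        on : ∀ {p} → vc i p ≡ vc i x → Touched i p
        on e = touched-vc i (sym e) tx

        src-v : ∀ {p} → vc i p ≡ vc i x → src (lamE near p) ≡ v
        src-v {p} e = V′.at-inj (trans (proj₂ (src-of p (on e))) (trans (cong (i ,_) e) (sym av)))

        tgt-v : ∀ {p} → vc i p ≡ vc i x → tgt (lamE far p) ≡ v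
        tgt-v {p} e = V′.at-inj (trans (proj₂ (tgt-of p (on e))) (trans (cong (i ,_) e) (sym av)))

      one-out : (∀ {p} → vc i p ≡ vc i x → Cyc (S near) x p) → Σ[ o ∈ One src v ] proj₁ o ≡ lamE near x
      one-out all = (lamE near x , src-v refl , λ {e} q → let (p , k , r) = src-pt (trans (cong V′.at q) av) in
        trans (sym (cong proj₁ r)) (sym (lam-cyc near (all k)))) , refl

      one-in : (∀ {p} → vc i p ≡ vc i x → Cyc (S far) x p) → Σ[ o ∈ One tgt v ] proj₁ o ≡ lamE far x
      one-in all = (lamE far x , tgt-v refl , λ {e} q → let (p , k , r) = tgt-pt (trans (cong V′.at q) av) in
        trans (sym (cong proj₁ r)) (sym (lam-cyc far (all k)))) , refl

      two-out : ∀ {y} → vc i y ≡ vc i x → ¬ Cyc (S near) x y → (∀ {p} → vc i p ≡ vc i x → Cyc (S near) x p ⊎ Cyc (S near) y p) →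
        Σ[ o ∈ Two src v ] proj₁ o ≡ lamE near x × proj₁ (proj₂ o) ≡ lamE near y
      two-out {y} e nc all = (lamE near x , lamE near y , src-v refl , src-v e ,
        (λ q → nc (State.l-cyc (state near) (trans (proj₁ (src-of x tx)) (trans (cong (_, 0) q) (sym (proj₁ (src-of y (on e)))))))) ,
        λ {e} q → let (p , k , r) = src-pt (trans (cong V′.at q) av) in
          [ (λ c → inj₁ (trans (sym (cong proj₁ r)) (sym (lam-cyc near c)))) , (λ c → inj₂ (trans (sym (cong proj₁ r)) (sym (lam-cyc near c)))) ]′ (all k)) , refl , refl

      two-in : ∀ {y} → vc i y ≡ vc i x → ¬ Cyc (S far) x y → (∀ {p} → vc i p ≡ vc i x → Cyc (S far) x p ⊎ Cyc (S far) y p) →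
        Σ[ o ∈ Two tgt v ] proj₁ o ≡ lamE far x × proj₁ (proj₂ o) ≡ lamE far y
      two-in {y} e nc all = (lamE far x , lamE far y , tgt-v refl , tgt-v e ,
        (λ q → nc (State.l-cyc (state far) (trans (proj₁ (tgt-of x tx)) (trans (cong (λ f → f , cross f) q) (sym (proj₁ (tgt-of y (on e)))))))) ,
        λ {e} q → let (p , k , r) = tgt-pt (trans (cong V′.at q) av) in
          [ (λ c → inj₁ (trans (sym (cong proj₁ r)) (sym (lam-cyc far c)))) , (λ c → inj₂ (trans (sym (cong proj₁ r)) (sym (lam-cyc far c)))) ]′ (all k)) , refl , refl

    private
      x = X i
      y = Y i
      T = S near
      tT = tS near
      tx : Touched i x
      tx = inj₁ (inj₁ cyc-refl)
      open TwPerm tT using (no-self; cyc-τ; cyc-τ₁; inj)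

      vcY : vc i y ≡ vc i x
      vcY = trans (cong (vc i) (sym (ηX i))) (vc-η i x)

      toFar : ∀ {p q} → Cyc (conj (sw x y) T) p q → Cyc (S far) p q
      toFar = cyc-cong (λ p → sym (S-sw i p))

      fromFar : ∀ {p q} → Cyc (S far) p q → Cyc (conj (sw x y) T) p q
      fromFar = cyc-cong (S-sw i)

      perFar : ∀ {p w} → Per (conj (sw x y) T) p w → Per (S far) p w
      perFar = per-cong (λ p → sym (S-sw i p))

      mir-stays : ∀ {D : P → Set} → (¬ D (τ d x)) → (¬ D (τ d y)) → ∀ {z} → D z → D (mir i z)
      mir-stays {D} nx ny {z} h = subst D (sym (trans (cong (τ d) (trans (η-sw i _) (transp-n
        (λ q → nx (subst D (trans (sym (ττ z)) (cong (τ d) q)) h)) (λ q → ny (subst D (trans (sym (ττ z)) (cong (τ d) q)) h))))) (ττ z))) h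

      η-stays : ∀ {D : P → Set} → D x → D y → ∀ {z} → D z → D (η i z)
      η-stays {D} a b {z} h = subst D (sym (η-sw i z)) (transp-closed {D = D} a b h)

      not-fixed : vc i (τ d x) ≢ vc i x → ιV vX ≢ vX
      not-fixed ne q = ne (cong proj₂ (trans (sym at-ιvX) (trans (cong V′.at q) at-vX)))

      module A = AtVertex tx at-vX

      case-one : Cyc T x y → VShape vX
      case-one c = s₁₂ (not-fixed (λ e → no-self (inD (e)))) (proj₁ o) (proj₁ ti) weights
        where
        module R = CutResult (near-one tT (X≢Y i) (Y≢τX i) c)
        inD : ∀ {p} → vc i p ≡ vc i x → Cyc T x p
        inD e = vc-closed i {Cyc T x} (λ h → cyc-trans h cyc-step) (η-stays {Cyc T x} cyc-refl c)
          (mir-stays {Cyc T x} no-self (λ h → no-self (cyc-trans (cyc-sym inj c) h))) (sym e) cyc-refl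
        o = A.one-out inD
        ti = A.two-in vcY (R.cut-ncyc ∘ fromFar) (λ e → [ inj₁ ∘ toFar , inj₂ ∘ toFar ]′ (R.cut-cover (inD e)))
        weights : wt (proj₁ (proj₁ o)) ≡ wt (proj₁ (proj₁ ti)) + wt (proj₁ (proj₂ (proj₁ ti)))
        weights = trans (per-lam near x R.px) (trans (sym (m+[n∸m]≡n (<⇒≤ R.a<m))) (sym (cong₂ _+_ (per-lam far x (perFar R.cut-perˡ)) (per-lam far y (perFar R.cut-perʳ)))))

      case-two : ¬ Cyc T x y → ¬ Cyc T x (τ d y) → VShape vX
      case-two n nτ = s₂₁ (not-fixed (λ e → no-τx (inD e))) (proj₁ o) (proj₁ ti) weights
        where
        module R = JoinResult (near-two tT (X≢Y i) (Y≢τX i) n nτ)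
        D : P → Set
        D z = Cyc T x z ⊎ Cyc T y z
        no-τx : ¬ D (τ d x)
        no-τx = [ no-self , (λ h → nτ (cyc-sym inj (cyc-τ₁ h))) ]′
        inD : ∀ {p} → vc i p ≡ vc i x → D p
        inD e = vc-closed i {D} [ (λ h → inj₁ (cyc-trans h cyc-step)) , (λ h → inj₂ (cyc-trans h cyc-step)) ]′
          (η-stays {D} (inj₁ cyc-refl) (inj₂ cyc-refl)) (mir-stays {D} no-τx [ nτ , no-self ]′) (sym e) (inj₁ cyc-refl)
        o = A.two-out vcY n inD
        ti = A.one-in (λ e → toFar (R.join-cover (inD e)))
        px = proj₂ (period inj x)
        py = proj₂ (period inj y)
        weights : wt (proj₁ (proj₁ ti)) ≡ wt (proj₁ (proj₁ o)) + wt (proj₁ (proj₂ (proj₁ o)))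
        weights = trans (per-lam far x (perFar (R.join-per px py))) (trans (+-comm (proj₁ (period inj y)) _) (sym (cong₂ _+_ (per-lam near x px) (per-lam near y py))))

      case-mirror : Cyc T x (τ d y) → VShape vX
      case-mirror c = s₂₂ (V′.at-inj (trans at-ιvX (trans (cong (i ,_) vcτ) (sym at-vX)))) (proj₁ o) (proj₁ ti) w
          (per-lam near x px) (per-lam near (τ d x) (TwPerm.per-τ tT px)) (per-lam far x pf) (per-lam far (τ d x) (TwPerm.per-τ (tS far) pf))
        where
        module R = MirrorResult (near-mirror tT (X≢Y i) (Y≢τX i) c)
        D : P → Set
        D z = Cyc T x z ⊎ Cyc T (τ d x) z
        yτ : Cyc T (τ d x) y
        yτ = cyc-τ₁ c
        vcτ : vc i (τ d x) ≡ vc i x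
        vcτ = trans (cyc-vc i yτ) vcY
        Dτ : ∀ {z} → D z → D (τ d z)
        Dτ (inj₁ h) = inj₂ (cyc-τ h)
        Dτ {z} (inj₂ h) = inj₁ (subst (λ u → Cyc T u (τ d z)) (ττ x) (cyc-τ h))
        Dη : ∀ {z} → D z → D (η i z)
        Dη = η-stays {D} (inj₁ cyc-refl) (inj₂ yτ)
        inD : ∀ {p} → vc i p ≡ vc i x → D p
        inD e = vc-closed i {D} [ (λ h → inj₁ (cyc-trans h cyc-step)) , (λ h → inj₂ (cyc-trans h cyc-step)) ]′ Dη (λ h → Dτ (Dη (Dτ h))) (sym e) (inj₁ cyc-refl)
        o = A.two-out vcτ no-self inD
        ti = A.two-in vcτ (TwPerm.no-self (tS far)) (λ e → [ inj₁ ∘ toFar , inj₂ ∘ toFar ]′ (R.mirror-cover (inD e)))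
        w = proj₁ (period inj x)
        px = proj₂ (period inj x)
        pf : Per (S far) x w
        pf = perFar (R.mirror-per px)

    shape-vX : VShape vX
    shape-vX with cyc-dec inj x y | cyc-dec inj x (τ d y)
    ... | yes c | _ = case-one c
    ... | no n | no nτ = case-two n nτ
    ... | no n | yes c = case-mirror c

    only-vX : ∀ v → pos v ≡ i → v ≡ vX ⊎ v ≡ ιV vX
    only-vX v q = go (qV v) refl
      where
      go : ∀ z → qV v ≡ z → v ≡ vX ⊎ v ≡ ιV vX
      go (i′ , p) r with trans (sym (cong proj₁ r)) q
      ... | refl = k (subst TQ r (tV v))
        where
        av : V′.at v ≡ (i , vc i p)
        av = trans (sym (vert-qV v)) (cong vertOf r)
        k : Touched i p → v ≡ vX ⊎ v ≡ ιV vX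
        k (inj₁ (inj₁ h)) = inj₁ (V′.at-inj (trans av (trans (cong (i ,_) (sym (cyc-vc i h))) (sym at-vX))))
        k (inj₁ (inj₂ h)) = inj₁ (V′.at-inj (trans av (trans (cong (i ,_) (trans (sym (cyc-vc i h)) vcY)) (sym at-vX))))
        k (inj₂ (inj₁ h)) = inj₂ (V′.at-inj (trans av (trans (cong (i ,_) (sym (cyc-vc i h))) (sym at-ιvX))))
        k (inj₂ (inj₂ h)) = inj₂ (V′.at-inj (trans av (trans (cong (i ,_) (trans (sym (cyc-vc i h)) (vc-τ i vcY))) (sym at-ιvX))))

  private
    module Fl = Flip ιVιV ιEιE wt-ι src-ι tgt-ι

  vshape : ∀ v → VShape v
  vshape v with only-vX (pos v) v refl
  ... | inj₁ q = subst VShape (sym q) (shape-vX (pos v))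
  ... | inj₂ q = subst VShape (sym q) (Fl.flip-shape (shape-vX (pos v)))

  tropCover : IsTropCover cover
  tropCover = tc-wt , positive , λ v → shape-balanced (vshape v)

  twisted : IsTwistedStructure cover
  twisted = fib , (λ v → shape-four (vshape v)) , ιVιV , ιEιE , pos-ι , src-ι , tgt-ι , wt-ι , wind-ι , ιE≢ , fixed
    where
    val-of : ∀ v → (ιV v ≢ v × val cover v ≡ 3) ⊎ (ιV v ≡ v × val cover v ≡ 4)
    val-of v = shape-val (vshape v)
    fixed : ∀ v → (ιV v ≡ v) ⇔ (val cover v ≡ 4)
    fixed v with val-of v
    ... | inj₁ (a , b) = mk⇔ (λ q → ⊥-elim (a q)) (λ q → case trans (sym b) q of λ ())
    ... | inj₂ (a , b) = mk⇔ (λ _ → b) (λ _ → a)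
    fib : ∀ i → (∃[ v ] (pos v ≡ i × val cover v ≡ 4 × (∀ w → pos w ≡ i → w ≡ v)))
      ⊎ (∃[ v ] ∃[ w ] (v ≢ w × pos v ≡ i × pos w ≡ i × val cover v ≡ 3 × val cover w ≡ 3 × (∀ u → pos u ≡ i → (u ≡ v) ⊎ (u ≡ w))))
    fib i with val-of (vX i) | val-of (ιV (vX i))
    ... | inj₂ (a , b) | _ = inj₁ (vX i , pos-vX i , b , λ w q → [ id , (λ r → trans r a) ]′ (only-vX i w q))
    ... | inj₁ (a , b) | inj₁ (_ , b′) = inj₂ (vX i , ιV (vX i) , a ∘ sym , pos-vX i , trans (pos-ι _) (pos-vX i) , b , b′ , only-vX i)
    ... | inj₁ (a , b) | inj₂ (a′ , _) = ⊥-elim (a (sym (trans (sym (ιVιV _)) a′)))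

  isCover : IsTwistedTropCover cover d (suc n)
  isCover = tropCover , twisted , degree-of-state d cover (state (fromℕ n)) ,
    LoopFacts.transitive⇒connected d cover tropCover twisted marked (subst (λ e → Transitive (Generators.gens d σ e α)) (sym (VP.map-proj₁-zip ηs (proj₂ marking))) transitive) ,
    genus-of-structure cover twisted

-- Fractions

import Data.Rational.Unnormalised as ℚᵘ
import Data.Rational.Unnormalised.Properties as ℚᵘP
import Data.Rational.Properties as ℚP
import Data.Rational as ℚ
import Data.Integer as ℤ
import Data.Integer.Properties as ℤP
import Data.Integer.Tactic.RingSolver as ℤSolver

frac-≡ : ∀ a b a′ b′ → a * suc b′ ≡ a′ * suc b → frac a (suc b) ≡ frac a′ (suc b′)
frac-≡ a b a′ b′ e = ℚP.fromℚᵘ-cong {ℚᵘ.mkℚᵘ (ℤ.+ a) b} {ℚᵘ.mkℚᵘ (ℤ.+ a′) b′}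
  (ℚᵘ.*≡* (trans (sym (ℤP.pos-* a (suc b′))) (trans (cong ℤ.+_ e) (ℤP.pos-* a′ (suc b)))))

frac-cross : ∀ {a b a′ b′} → 1 ≤ b → 1 ≤ b′ → a * b′ ≡ a′ * b → frac a b ≡ frac a′ b′
frac-cross {a} {suc b} {a′} {suc b′} _ _ e = frac-≡ a b a′ b′ e

frac-+ : ∀ a b c → frac a (suc c) ℚ.+ frac b (suc c) ≡ frac (a + b) (suc c)
frac-+ a b c = ℚP.toℚᵘ-injective (ℚᵘP.≃-trans (ℚP.toℚᵘ-homo-+ (frac a (suc c)) (frac b (suc c)))
  (ℚᵘP.≃-trans (ℚᵘP.+-cong (ℚP.toℚᵘ-fromℚᵘ x) (ℚP.toℚᵘ-fromℚᵘ y)) (ℚᵘP.≃-trans same (ℚᵘP.≃-sym (ℚP.toℚᵘ-fromℚᵘ z)))))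
  where
  x = ℚᵘ.mkℚᵘ (ℤ.+ a) c
  y = ℚᵘ.mkℚᵘ (ℤ.+ b) c
  z = ℚᵘ.mkℚᵘ (ℤ.+ (a + b)) c
  ring : ∀ x y z → (x ℤ.* z ℤ.+ y ℤ.* z) ℤ.* z ≡ (x ℤ.+ y) ℤ.* (z ℤ.* z)
  ring = ℤSolver.solve-∀
  same : x ℚᵘ.+ y ℚᵘ.≃ z
  same = ℚᵘ.*≡* (trans (ring (ℤ.+ a) (ℤ.+ b) (ℤ.+ suc c)) (cong₂ ℤ._*_ (sym (ℤP.pos-+ a b)) (sym (ℤP.pos-* (suc c) (suc c)))))

sumℚ-frac : ∀ {A : Set} (f : A → ℚ.ℚ) {c} → 1 ≤ c → (xs : List A) (a : Fin (length xs) → ℕ) → (∀ k → f (L.lookup xs k) ≡ frac (a k) c) →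
  sumℚ (map f xs) ≡ frac (sumFin a) c
sumℚ-frac f {suc c} _ [] a h = frac-≡ 0 0 0 c refl
sumℚ-frac f {suc c} 1≤c (x ∷ xs) a h = trans (cong₂ ℚ._+_ (h zero) (sumℚ-frac f 1≤c xs (a ∘ suc) (h ∘ suc))) (frac-+ (a zero) _ c)

tuple-of : ∀ d {m} h → HurCond d (suc (suc m)) h → Σ[ t ∈ Tuple d m ] (Tuple.σ t , Tuple.ηs t , Tuple.α t) ≡ h
tuple-of d {m} (σ , ηs , α) (adm , ((σ-inj , tw) , ns) , αB , eq , tr) = record
  { σ = σ ; ηs = ηs ; α = α
  ; adm = λ i → let (x , y , a , b , e) = adm i in x , y , a , b , trans e (VP.tabulate-cong (λ z → sym (sw-≡ x y z)))
  ; tσ = record { inj = σ-inj _ _ ; tw = tw ; nf = nf }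
  ; αB = αB
  ; closing = λ p → trans (levels-zero ηs _) (eq p)
  ; transitive = tr } , refl
  where
  open Tau d
  levels-zero : ∀ {k} (ηs : Vec (Perm d) k) p → levels d σ ηs zero p ≡ applyL d ηs (σ !! applyR d ηs p)
  levels-zero [] p = refl
  levels-zero (η ∷ ηs) p = cong (η !!_) (levels-zero ηs _)
  nf : ∀ z → σ !! z ≢ τ d z
  nf z e = ns z λ j s → cyc⇒same (closure (same⇒cyc s))
    where
    inj : Inj (σ !!_)
    inj = σ-inj _ _
    -- σ z = τ z makes the cycle of z self-symmetric, since σ (τ (σ j)) = τ j.
    closure : ∀ {j} → Cyc (σ !!_) z j → Cyc (σ !!_) z (τ d j)
    closure = cyc-closed {D = λ j → Cyc (σ !!_) z (τ d j)}
      (λ {j} c → cyc-trans c (cyc-sym inj (1 , trans (sym (ττ _)) (cong (τ d) (tw j))))) (1 , e)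

iso⇒equiv : ∀ {n} {c c′ : TCover n} → Iso c c′ → Equiv c c′
iso⇒equiv f = mk↔ₛ′ fV gV fgV gfV , mk↔ₛ′ fE gE fgE gfE , f-pos , f-src , f-tgt , f-wt , f-wind , f-ιV , f-ιE
  where open Iso f

equiv⇒iso : ∀ {n} {c c′ : TCover n} → Equiv c c′ → Iso c c′
equiv⇒iso (φ , ψ , a , b , e , w , x , y , z) = record
  { fV = Inverse.to φ ; fE = Inverse.to ψ ; f-pos = a ; f-src = b ; f-tgt = e ; f-wt = w ; f-wind = x ; f-ιV = y ; f-ιE = z
  ; gV = Inverse.from φ ; gE = Inverse.from ψ
  ; fgV = Inverse.strictlyInverseˡ φ ; gfV = Inverse.strictlyInverseʳ φ ; fgE = Inverse.strictlyInverseˡ ψ ; gfE = Inverse.strictlyInverseʳ ψ }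

identity-aut : ∀ {n} (c : TCover n) → IsAut c (V.allFin _ , V.allFin _)
identity-aut c = perm , perm , (λ v → cong pos (l v)) , (λ e → trans (cong src (l e)) (sym (l _))) , (λ e → trans (cong tgt (l e)) (sym (l _))) ,
  (λ e → cong wt (l e)) , (λ e → cong wind (l e)) , (λ v → trans (l _) (cong ιV (sym (l v)))) , (λ e → trans (l _) (cong ιE (sym (l e))))
  where
  open TCover c
  l : ∀ {k} (i : Fin k) → V.allFin k !! i ≡ i
  l = VP.lookup-allFin
  perm : ∀ {k} → IsPerm (V.allFin k)
  perm i j e = trans (sym (l i)) (trans e (l j))

module _ {m : ℕ} (d : ℕ) (c : TCover (suc m)) (ok : IsTwistedTropCover c d (suc (suc m))) where

  private
    Arc = Arcs.Arc c
    Pr = Perm d × Vec Arc (d + d)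

    zip-maps : ∀ {k} (δs : Vec Pr k) → V.zip (V.map proj₁ δs) (V.map proj₂ δs) ≡ δs
    zip-maps [] = refl
    zip-maps (δ ∷ δs) = cong (δ ∷_) (zip-maps δs)

    untie : ((Perm d × Vec Arc (d + d)) × Vec Pr (suc m)) × Perm d → HurTuple d (suc (suc m)) × Marks.Labels d c
    untie (((σ , l) , δs) , α) = (σ , V.map proj₁ δs , α) , l , V.map proj₂ δs

    tie-untie : ∀ z → Marks.tie d c (proj₁ (untie z)) (proj₂ (untie z)) ≡ z
    tie-untie (((σ , l) , δs) , α) = cong (λ δs → ((σ , l) , δs) , α) (zip-maps δs)

    untie-tie : ∀ h μ → untie (Marks.tie d c h μ) ≡ (h , μ)
    untie-tie (σ , ηs , α) (l , ls) = cong₂ (λ x y → (σ , x , α) , l , y) (VP.map-proj₁-zip ηs ls) (VP.map-proj₂-zip ηs ls)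

  card-pairs : 1 ≤ d → Card (λ (hm : HurTuple d (suc (suc m)) × Marks.Labels d c) → Marks.Marked d c (proj₁ hm) (proj₂ hm))
    (dfact d * (2 ^ suc m * (vertexFactor c * edgeFactor c)))
  card-pairs 1≤d = card-map untie
    (λ {z} L → subst (Marking.Loop c d) (sym (tie-untie z)) L)
    (λ {z} {z′} _ _ e → trans (sym (tie-untie z)) (trans (cong (λ x → Marks.tie d c (proj₁ x) (proj₂ x)) e) (tie-untie z′)))
    (λ {hm} L → Marks.tie d c (proj₁ hm) (proj₂ hm) , L , untie-tie (proj₁ hm) (proj₂ hm))
    (MarkedCount.card-marked c ok 1≤d)

  marked⇒hurwitz : ∀ {h μ} → Marks.Marked d c h μ → HurCond d (suc (suc m)) h
  marked⇒hurwitz {σ , ηs , α} {l , ls} L = subst (λ x → HurCond d (suc (suc m)) (σ , x , α)) (VP.map-proj₁-zip ηs ls)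
    (LoopFacts.hurwitz d c (proj₁ ok) (proj₁ (proj₂ ok)) L (proj₁ (proj₂ (proj₂ (proj₂ ok)))))

opaque
  marked-by-cover : ∀ d {m} h → HurCond d (suc (suc m)) h →
    ∃ λ c → IsTwistedTropCover c d (suc (suc m)) × ∃ λ (μ : Marks.Labels d c) → Marks.Marked d c h μ
  marked-by-cover d h hc with tuple-of d h hc
  ... | t , refl = Trace.cover t , Structure.isCover t , CoverLoop.marking t , CoverLoop.marked t

dfact-pos : ∀ d → 1 ≤ dfact d
dfact-pos d = *-mono-≤ (m^n>0 2 d) (1≤n! d)

module Assembly {d m : ℕ} (1≤d : 1 ≤ d) (H : List (HurTuple d (suc (suc m)))) (lH : IsListing (HurCond d (suc (suc m))) H)
  (Ls : List (TropEntry (suc m))) (rep : IsRepSystem d (suc (suc m)) Ls) where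

  private
    Hur = HurTuple d (suc (suc m))
    I = Fin (length Ls)

    cov : I → TCover (suc m)
    cov k = proj₁ (L.lookup Ls k)

    auts : ∀ k → List (AutData (cov k))
    auts k = proj₂ (L.lookup Ls k)

    ok : ∀ k → IsTwistedTropCover (cov k) d (suc (suc m))
    ok = proj₁ rep

    Has : I → Hur → Set
    Has k h = ∃ λ μ → Marks.Marked d (cov k) h μ

    has : ∀ h → HurCond d (suc (suc m)) h → ∃ λ k → Has k h
    has h hc = let (c , ok-c , μ , L) = marked-by-cover d h hc ; (k , eq) = proj₂ (proj₂ (proj₂ rep)) c ok-c in
      k , act-labels d c (cov k) (equiv⇒iso eq) μ , act-marked d c (cov k) (equiv⇒iso eq) h μ L

    has-unique : ∀ {k l h} → Has k h → Has l h → k ≡ l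
    has-unique {k} {l} {σ , ηs , α} (μ , L) (μ′ , L′) = case k ≟ l of λ
      { (yes e) → e ; (no n) → ⊥-elim (proj₁ (proj₂ (proj₂ rep)) k l n (iso⇒equiv (proj₁ iso))) }
      where
      iso = same-tuple-iso d (cov k) (proj₁ (ok k)) (proj₁ (proj₂ (ok k))) (cov l) (proj₁ (ok l)) (proj₁ (proj₂ (ok l))) L L′
            (λ i → trans (Marks.tie-η d (cov k) ηs (proj₂ μ) i) (sym (Marks.tie-η d (cov l) ηs (proj₂ μ′) i)))

    has⇒hurwitz : ∀ {k h} → Has k h → HurCond d (suc (suc m)) h
    has⇒hurwitz {k} {h} (μ , L) = marked⇒hurwitz d (cov k) (ok k) {h} {μ} L

    _≟H_ : DecidableEquality Hur
    _≟H_ = ×-≡-dec (VP.≡-dec _≟_) (×-≡-dec (VP.≡-dec (VP.≡-dec _≟_)) (VP.≡-dec _≟_))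

    open import Data.List.Membership.DecPropositional _≟H_ using () renaming (_∈?_ to _∈?H_)

    has? : ∀ k h → Dec (Has k h)
    has? k h with h ∈?H H
    ... | no n = no (λ x → n (⇒∈ lH (has⇒hurwitz {k} {h} x)))
    ... | yes h∈ with has h (∈⇒ lH h∈)
    ... | k′ , x with k′ ≟ k
    ... | yes refl = yes x
    ... | no n = no (λ y → n (has-unique {k′} {k} {h} x y))

    a : I → ℕ
    a k = length (filter (has? k) H)

    card-has : ∀ k → Card (Has k) (a k)
    card-has k = card-⇔ proj₂ (λ {h} x → has⇒hurwitz {k} {h} x , x) (filter (has? k) H , filter-listing (has? k) lH , refl)

    total : length H ≡ sumFin a
    total = trans (card-unique lH (card-map {P = λ (kh : I × Hur) → ⊤ × Has (proj₁ kh) (proj₂ kh)} proj₂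
        (λ {kh} (_ , x) → has⇒hurwitz {proj₁ kh} {proj₂ kh} x)
        (λ { {k , h} {l , .h} (_ , x) (_ , y) refl → cong (_, h) (has-unique {k} {l} {h} x y) })
        (λ {h} hc → let (k , x) = has h hc in (k , h) , (tt , x) , refl)
        (Σ-list {Q = Has} a (allFin (length Ls)) (proj₁ (proj₂ (card-Fin _))) (λ {k} _ → card-has k))))
      (sym (sumFin-list (λ _ → yes tt) a (proj₁ (proj₂ (card-Fin _)))))

    balance : ∀ k → a k * length (auts k) ≡ dfact d * (2 ^ suc m * (vertexFactor (cov k) * edgeFactor (cov k)))
    balance k = card-≡ (card-⇔ {P = λ (hm : Hur × Marks.Labels d (cov k)) → Has k (proj₁ hm) × Marks.Marked d (cov k) (proj₁ hm) (proj₂ hm)}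
        proj₂ (λ {hm} L → (proj₂ hm , L) , L)
        (card-Σ (card-has k) (λ {h} (μ , L) → Torsor.torsor d (cov k) (proj₁ (ok k)) (proj₁ (proj₂ (ok k))) h μ L (proj₁ (proj₂ rep) k))))
      (card-pairs d (cov k) (ok k) 1≤d)

    nonempty : ∀ {B : Set} {x : B} {xs : List B} → x ∈ xs → 1 ≤ length xs
    nonempty {xs = _ ∷ xs} _ = s≤s z≤n

    weight : ∀ k → entryWeight (suc (suc m)) (L.lookup Ls k) ≡ frac (a k) (dfact d)
    weight k = frac-cross (nonempty (⇒∈ (proj₁ (proj₂ rep) k) {V.allFin _ , V.allFin _} (identity-aut (cov k)))) (dfact-pos d)
      (trans (*-comm (2 ^ suc m * vertexFactor (cov k) * edgeFactor (cov k)) (dfact d))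
        (trans (cong (dfact d *_) (*-assoc (2 ^ suc m) (vertexFactor (cov k)) (edgeFactor (cov k)))) (sym (balance k))))

  conclusion : tropTwistedHurwitz (suc (suc m)) Ls ≡ twistedHurwitz d (suc (suc m)) H
  conclusion = trans (sumℚ-frac (entryWeight (suc (suc m))) (dfact-pos d) Ls a weight) (cong (λ k → frac k (dfact d)) (sym total))

mainTheorem2 : ∀ (d g : ℕ) → 1 ≤ d → 2 ≤ g →
    (H : List (HurTuple d g)) → IsListing (HurCond d g) H →
    (L : List (TropEntry (g ∸ 1))) → IsRepSystem d g L →
    tropTwistedHurwitz g L ≡ twistedHurwitz d g H
mainTheorem2 d (suc zero) 1≤d (s≤s ())
mainTheorem2 d (suc (suc m)) 1≤d _ H lH Ls rep = Assembly.conclusion 1≤d H lH Ls rep
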